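{- For every $\varepsilon>0$ there exists a constant $C_\varepsilon$, depending only on $\varepsilon$, such that for infinitely many positive integers $n$ there exists an $n\times n$ Boolean matrix $M$ with $$R(M)\le C_\varepsilon\qquad\text{and}\qquad \gamma_2(M)\ \ge\ n^{\frac12-\varepsilon}.$$
   Context: $\gamma_2$-norm: for $M\in\mathbb{C}^{m\times n}$, $\gamma_2(M)=\min_{M=UV}\|U\|_{\mathrm{row}}\|V\|_{\mathrm{col}}$, where the minimum is over all factorizations $M=UV$ into complex matrices, $\|U\|_{\mathrm{row}}$ is the maximum $\ell_2$-norm of a row of $U$, and $\|V\|_{\mathrm{col}}$ is the maximum $\ell_2$-norm of a column of $V$. Randomized communication cost: for a Boolean (i.e. $\{0,1\}$-valued) matrix $M$, $R(M)$ is the public-coin randomized communication complexity of $M$. That is, Alice receives a row index $x$, Bob receives a column index $y$, they share an infinite string of random bits, and $R(M)$ is the minimum, over all two-party protocols that for every input $(x,y)$ output $M(x,y)$ correctly with probability at least $2/3$, of the worst-case number of bits communicated. -}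

module Defs where

open import Algebra.Bundles using (CommutativeRing)
open import Data.Bool.Base using (Bool; true; false; if_then_else_)
open import Data.Empty using (⊥-elim)
open import Data.Fin.Base using (Fin)
open import Data.Integer.Base as ℤ using (ℤ; +_; -[1+_])
import Data.Integer.Properties as ℤ
import Data.Integer.Solver as ℤ-Solver
open import Data.List.Base using (List; []; _∷_; applyUpTo)
open import Data.Nat.Base as ℕ using (ℕ; zero; suc; z≤n; s≤s)
import Data.Nat.Properties as ℕ
import Data.Nat.Solver as ℕ-Solver
open import Data.Product.Base using (∃; _×_; _,_; proj₁; proj₂)
open import Data.Rational.Base
open import Data.Rational.Properties
import Data.Rational.Unnormalised.Base as ℚᵘ
import Data.Rational.Unnormalised.Properties as ℚᵘ
open import Data.Rational.Solver using (module +-*-Solver)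
open import Data.Sum.Base using (_⊎_; inj₁; inj₂)
open import Data.Vec.Functional as Vector using (Vector)
open import Function.Base using (_∘_)
open import Relation.Binary.PropositionalEquality
  using (_≡_; refl; sym; trans; cong; cong₂; subst; subst₂; module ≡-Reasoning)
open import Relation.Nullary using (¬_; Dec; yes; no)

open import Algebra.Definitions.RawSemiring +-*-rawSemiring using (_^_)
open import Algebra.Properties.CommutativeSemiring.Exp
  (CommutativeRing.commutativeSemiring +-*-commutativeRing)
  using (^-homo-*; ^-assocʳ; ^-distrib-*)

open +-*-Solver using (solve; _:+_; _:*_; _:-_; :-_; _:=_; con)
open ℤ-Solver.+-*-Solver using ()
  renaming (solve to solveℤ; _:+_ to _:+ᶻ_; _:*_ to _:*ᶻ_; :-_ to :-ᶻ_; _:=_ to _:=ᶻ_)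
open ℕ-Solver.+-*-Solver using ()
  renaming (solve to solveℕ; _:*_ to _:*ⁿ_; _:=_ to _:=ⁿ_)

p-q≤r⇒p≤q+r : ∀ {p q r} → p - q ≤ r → p ≤ q + r
p-q≤r⇒p≤q+r {p} {q} {r} h =
  subst (_≤ q + r) (solve 2 (λ p q → q :+ (p :- q) := p) refl p q) (+-monoʳ-≤ q h)

p≤q+r⇒p-q≤r : ∀ {p q r} → p ≤ q + r → p - q ≤ r
p≤q+r⇒p-q≤r {p} {q} {r} h =
  subst (p - q ≤_) (solve 2 (λ q r → (q :+ r) :- q := r) refl q r) (+-monoˡ-≤ (- q) h)

p≤∣p∣ : ∀ p → p ≤ ∣ p ∣
p≤∣p∣ p with ≤-total 0ℚ p
... | inj₁ 0≤p = ≤-reflexive (sym (0≤p⇒∣p∣≡p 0≤p))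
... | inj₂ p≤0 = ≤-trans p≤0 (0≤∣p∣ p)

∣p-q∣-comm : ∀ p q → ∣ p - q ∣ ≡ ∣ q - p ∣
∣p-q∣-comm p q = trans
  (cong ∣_∣ (solve 2 (λ p q → p :- q := :- (q :- p)) refl p q)) (∣-p∣≡∣p∣ (q - p))

∣p-q∣≤r⇒p≤q+r : ∀ {p q r} → ∣ p - q ∣ ≤ r → p ≤ q + r
∣p-q∣≤r⇒p≤q+r {p} {q} h = p-q≤r⇒p≤q+r (≤-trans (p≤∣p∣ (p - q)) h)

∣p-q∣≤r : ∀ {p q r} → p ≤ q + r → q ≤ p + r → ∣ p - q ∣ ≤ r
∣p-q∣≤r {p} {q} {r} h k with ∣p∣≡p∨∣p∣≡-p (p - q)
... | inj₁ eq = subst (_≤ r) (sym eq) (p≤q+r⇒p-q≤r h)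
... | inj₂ eq = subst (_≤ r)
  (sym (trans eq (solve 2 (λ p q → :- (p :- q) := q :- p) refl p q))) (p≤q+r⇒p-q≤r k)

opaque
  half : ℚ → ℚ
  half δ = ½ * δ

  half+half : ∀ δ → half δ + half δ ≡ δ
  half+half δ = trans (sym (*-distribʳ-+ δ ½ ½)) (*-identityˡ δ)

  0<half : ∀ {δ} → 0ℚ < δ → 0ℚ < half δ
  0<half {δ} 0<δ = subst (_< half δ) (*-zeroʳ ½) (*-monoʳ-<-pos ½ 0<δ)

0≤p+q : ∀ {p q} → 0ℚ ≤ p → 0ℚ ≤ q → 0ℚ ≤ p + q
0≤p+q {p} {q} h k = subst (_≤ p + q) (+-identityˡ 0ℚ) (+-mono-≤ {0ℚ} {p} {0ℚ} {q} h k)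

0≤p*q : ∀ {p q} → 0ℚ ≤ p → 0ℚ ≤ q → 0ℚ ≤ p * q
0≤p*q {p} {q} h k = subst (_≤ p * q) (*-zeroʳ p)
  (*-monoˡ-≤-nonNeg p {{nonNegative h}} k)

*-mono-≤ : ∀ {p q r s} → 0ℚ ≤ p → p ≤ q → 0ℚ ≤ r → r ≤ s → p * r ≤ q * s
*-mono-≤ {p} {q} {r} {s} 0≤p p≤q 0≤r r≤s = ≤-trans
  (*-monoʳ-≤-nonNeg r {{nonNegative 0≤r}} p≤q)
  (*-monoˡ-≤-nonNeg q {{nonNegative (≤-trans 0≤p p≤q)}} r≤s)

p≤p+q : ∀ p {q} → 0ℚ ≤ q → p ≤ p + q
p≤p+q p {q} 0≤q = subst (_≤ p + q) (+-identityʳ p) (+-monoʳ-≤ p {0ℚ} {q} 0≤q)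

0≤1 : 0ℚ ≤ 1ℚ
0≤1 = nonNegative⁻¹ 1ℚ

0<1 : 0ℚ < 1ℚ
0<1 = positive⁻¹ 1ℚ

-- Fractions m / (k + 1); opaque to keep the type checker from
-- normalising gcds.

opaque
  frac : ℕ → ℕ → ℚ
  frac m k = + m / suc k

  frac-def : ∀ m k → frac m k ≡ + m / suc k
  frac-def m k = refl

  frac-toℚᵘ : ∀ m k → toℚᵘ (frac m k) ℚᵘ.≃ ℚᵘ.mkℚᵘ (+ m) k
  frac-toℚᵘ m k = toℚᵘ-fromℚᵘ (ℚᵘ.mkℚᵘ (+ m) k)

  0≤frac : ∀ m k → 0ℚ ≤ frac m k
  0≤frac m k = nonNegative⁻¹ (+ m / suc k) {{normalize-nonNeg m (suc k)}}

  0<frac : ∀ m k → 0ℚ < frac (suc m) k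
  0<frac m k = positive⁻¹ (+ suc m / suc k) {{normalize-pos (suc m) (suc k)}}

fromℕ : ℕ → ℚ
fromℕ n = frac n 0

1/suc : ℕ → ℚ
1/suc k = frac 1 k

frac≡* : ∀ m k → frac m k ≡ fromℕ m * 1/suc k
frac≡* m k = toℚᵘ-injective (ℚᵘ.≃-trans (frac-toℚᵘ m k)
  (ℚᵘ.≃-sym (ℚᵘ.≃-trans (toℚᵘ-homo-* (fromℕ m) (1/suc k))
    (ℚᵘ.≃-trans (ℚᵘ.*-cong (frac-toℚᵘ m 0) (frac-toℚᵘ 1 k))
      (ℚᵘ.*≡* (cong₂ ℤ._*_ (ℤ.*-identityʳ (+ m)) (cong (λ i → + suc i) (sym (ℕ.+-identityʳ k)))))))))

fromℕ-+ : ∀ m n → fromℕ (m ℕ.+ n) ≡ fromℕ m + fromℕ n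
fromℕ-+ m n = toℚᵘ-injective (ℚᵘ.≃-trans (frac-toℚᵘ (m ℕ.+ n) 0)
  (ℚᵘ.≃-sym (ℚᵘ.≃-trans (toℚᵘ-homo-+ (fromℕ m) (fromℕ n))
    (ℚᵘ.≃-trans (ℚᵘ.+-cong (frac-toℚᵘ m 0) (frac-toℚᵘ n 0))
      (ℚᵘ.*≡* (cong (ℤ._* + 1) (cong₂ ℤ._+_ (ℤ.*-identityʳ (+ m)) (ℤ.*-identityʳ (+ n)))))))))

fromℕ-1 : fromℕ 1 ≡ 1ℚ
fromℕ-1 = frac-def 1 0

suc*1/suc : ∀ k → fromℕ (suc k) * 1/suc k ≡ 1ℚ
suc*1/suc k = trans (sym (frac≡* (suc k) k)) (toℚᵘ-injective
  (ℚᵘ.≃-trans (frac-toℚᵘ (suc k) k) (ℚᵘ.*≡* (ℤ.*-comm (+ suc k) (+ 1)))))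

fromℕ-mono-≤ : ∀ {m n} → m ℕ.≤ n → fromℕ m ≤ fromℕ n
fromℕ-mono-≤ {m} {n} m≤n = subst (fromℕ m ≤_)
  (trans (sym (fromℕ-+ m (n ℕ.∸ m))) (cong fromℕ (ℕ.m+[n∸m]≡n m≤n)))
  (p≤p+q (fromℕ m) (0≤frac (n ℕ.∸ m) 0))

frac-suc : ∀ m k → frac (suc m) k ≡ frac m k + 1/suc k
frac-suc m k = trans (frac≡* (suc m) k)
  (trans (cong (_* 1/suc k) (trans (cong fromℕ (ℕ.+-comm 1 m)) (fromℕ-+ m 1)))
    (trans (*-distribʳ-+ (1/suc k) (fromℕ m) (fromℕ 1))
      (cong₂ _+_ (sym (frac≡* m k)) (sym (frac≡* 1 k)))))

ceil : ℚ → ℕ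
ceil p = ℤ.∣ ↥ p ∣

p≤ceil : ∀ p → p ≤ fromℕ (ceil p)
p≤ceil p@(mkℚ (+ n) d _) = toℚᵘ-cancel-≤
  (ℚᵘ.≤-respʳ-≃ (ℚᵘ.≃-sym (frac-toℚᵘ n 0))
    (ℚᵘ.*≤* (ℤ.*-monoˡ-≤-nonNeg (+ n) (ℤ.+≤+ (s≤s (z≤n {d}))))))
p≤ceil p@(mkℚ -[1+ n ] d _) = ≤-trans (<⇒≤ (negative⁻¹ p)) (0≤frac (suc n) 0)

opaque
  archimedean : ∀ B {δ} → 0ℚ < δ → ∃ λ K → B * 1/suc K ≤ δ
  archimedean B {δ} 0<δ = K , (begin
    B * ι                   ≡⟨ cong (_* ι) B≡ ⟨
    (B ÷ δ) * δ * ι         ≤⟨ *-monoʳ-≤-nonNeg ι {{nonNegative (0≤frac 1 K)}}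
                                (*-monoʳ-≤-nonNeg δ {{nonNegative (<⇒≤ 0<δ)}} B÷δ≤) ⟩
    fromℕ (suc K) * δ * ι   ≡⟨ solve 3 (λ a b c → a :* b :* c := (a :* c) :* b) refl (fromℕ (suc K)) δ ι ⟩
    fromℕ (suc K) * ι * δ   ≡⟨ cong (_* δ) (suc*1/suc K) ⟩
    1ℚ * δ                  ≡⟨ *-identityˡ δ ⟩
    δ                       ∎)
    where
    open ≤-Reasoning
    instance
      δ≢0 : NonZero δ
      δ≢0 = >-nonZero 0<δ
    K : ℕ
    K = ceil (B ÷ δ)
    ι : ℚ
    ι = 1/suc K
    B≡ : (B ÷ δ) * δ ≡ B
    B≡ = trans (*-assoc B (1/ δ) δ) (trans (cong (B *_) (*-inverseˡ δ)) (*-identityʳ B))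
    B÷δ≤ : B ÷ δ ≤ fromℕ (suc K)
    B÷δ≤ = ≤-trans (p≤ceil (B ÷ δ)) (fromℕ-mono-≤ (ℕ.n≤1+n K))

1/-antimono : ∀ {m n} → m ℕ.≤ n → 1/suc n ≤ 1/suc m
1/-antimono {m} {n} m≤n = begin
  ιn                          ≡⟨ *-identityˡ ιn ⟨
  1ℚ * ιn                     ≡⟨ cong (_* ιn) (suc*1/suc m) ⟨
  fromℕ (suc m) * ιm * ιn     ≤⟨ *-monoʳ-≤-nonNeg ιn {{nonNegative (0≤frac 1 n)}}
                                  (*-monoʳ-≤-nonNeg ιm {{nonNegative (0≤frac 1 m)}}
                                    (fromℕ-mono-≤ (s≤s m≤n))) ⟩
  fromℕ (suc n) * ιm * ιn     ≡⟨ solve 3 (λ a b c → a :* b :* c := (a :* c) :* b) refl (fromℕ (suc n)) ιm ιn ⟩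
  fromℕ (suc n) * ιn * ιm     ≡⟨ cong (_* ιm) (suc*1/suc n) ⟩
  1ℚ * ιm                     ≡⟨ *-identityˡ ιm ⟩
  ιm                          ∎
  where
  open ≤-Reasoning
  ιm ιn : ℚ
  ιm = 1/suc m
  ιn = 1/suc n

opaque
  eventually-1/≤ : ∀ {δ} → 0ℚ < δ → ∃ λ N → ∀ n → N ℕ.≤ n → 1/suc n ≤ δ
  eventually-1/≤ {δ} 0<δ with archimedean 1ℚ 0<δ
  ... | N , h = N , λ n N≤n →
    ≤-trans (1/-antimono N≤n) (subst (_≤ δ) (*-identityˡ (1/suc N)) h)

0≤^ : ∀ {p} q → 0ℚ ≤ p → 0ℚ ≤ p ^ q
0≤^ zero    0≤p = 0≤1
0≤^ (suc q) 0≤p = 0≤p*q 0≤p (0≤^ q 0≤p)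

0<^ : ∀ {p} q → 0ℚ < p → 0ℚ < p ^ q
0<^ zero        0<p = 0<1
0<^ {p} (suc q) 0<p = positive⁻¹ (p * p ^ q)
  {{pos*pos⇒pos p {{positive 0<p}} (p ^ q) {{positive (0<^ q 0<p)}}}}

^-mono-≤ : ∀ {p r} q → 0ℚ ≤ p → p ≤ r → p ^ q ≤ r ^ q
^-mono-≤ zero    0≤p p≤r = ≤-refl
^-mono-≤ (suc q) 0≤p p≤r = *-mono-≤ 0≤p p≤r (0≤^ q 0≤p) (^-mono-≤ q 0≤p p≤r)

^-mono-< : ∀ {p r} q .{{_ : ℕ.NonZero q}} → 0ℚ ≤ p → p < r → p ^ q < r ^ q
^-mono-< {p} {r} (suc q) 0≤p p<r = ≤-<-trans
  (*-monoˡ-≤-nonNeg p {{nonNegative 0≤p}} (^-mono-≤ q 0≤p (<⇒≤ p<r)))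
  (*-monoˡ-<-pos (r ^ q) {{positive (0<^ q (≤-<-trans 0≤p p<r))}} p<r)

^-cancel-≤ : ∀ {p r} q .{{_ : ℕ.NonZero q}} → 0ℚ ≤ r → p ^ q ≤ r ^ q → p ≤ r
^-cancel-≤ q 0≤r h = ≮⇒≥ λ r<p → <-irrefl refl (<-≤-trans (^-mono-< q 0≤r r<p) h)

1≤^ : ∀ {p} q → 1ℚ ≤ p → 1ℚ ≤ p ^ q
1≤^ zero    1≤p = ≤-refl
1≤^ (suc q) 1≤p = *-mono-≤ 0≤1 1≤p 0≤1 (1≤^ q 1≤p)

p≤p^q : ∀ {p} q .{{_ : ℕ.NonZero q}} → 1ℚ ≤ p → p ≤ p ^ q
p≤p^q {p} (suc q) 1≤p = subst (_≤ p ^ suc q) (*-identityʳ p)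
  (*-monoˡ-≤-nonNeg p {{nonNegative (≤-trans 0≤1 1≤p)}} (1≤^ q 1≤p))

^-monoʳ-≤ : ∀ {p m n} → 1ℚ ≤ p → m ℕ.≤ n → p ^ m ≤ p ^ n
^-monoʳ-≤ {n = n} 1≤p z≤n       = 1≤^ n 1≤p
^-monoʳ-≤ {p}     1≤p (s≤s m≤n) =
  *-monoˡ-≤-nonNeg p {{nonNegative (≤-trans 0≤1 1≤p)}} (^-monoʳ-≤ 1≤p m≤n)

1^ : ∀ q → 1ℚ ^ q ≡ 1ℚ
1^ zero    = refl
1^ (suc q) = trans (*-identityˡ (1ℚ ^ q)) (1^ q)

bernoulli : ∀ {x} n → 0ℚ ≤ x → 1ℚ + fromℕ n * x ≤ (1ℚ + x) ^ n
bernoulli {x} zero 0≤x = ≤-reflexive (trans (cong (λ y → 1ℚ + y) (trans (cong (_* x) (frac-def 0 0)) (*-zeroˡ x))) (+-identityʳ 1ℚ))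
bernoulli {x} (suc n) 0≤x = begin
  1ℚ + fromℕ (suc n) * x                       ≡⟨ cong (λ y → 1ℚ + y * x) (trans (fromℕ-+ 1 n) (cong (_+ N) fromℕ-1)) ⟩
  1ℚ + (1ℚ + N) * x                            ≤⟨ p≤p+q _ (0≤p*q (0≤p*q (0≤frac n 0) 0≤x) 0≤x) ⟩
  1ℚ + (1ℚ + N) * x + N * x * x                ≡⟨ solve 2 (λ N x → con 1ℚ :+ (con 1ℚ :+ N) :* x :+ N :* x :* x
                                                   := (con 1ℚ :+ x) :* (con 1ℚ :+ N :* x)) refl N x ⟩
  (1ℚ + x) * (1ℚ + N * x)                      ≤⟨ *-monoˡ-≤-nonNeg (1ℚ + x) {{nonNegative (0≤p+q 0≤1 0≤x)}} (bernoulli n 0≤x) ⟩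
  (1ℚ + x) ^ suc n                             ∎
  where
  open ≤-Reasoning
  N : ℚ
  N = fromℕ n

CauchySeq : (ℕ → ℚ) → Set
CauchySeq s = ∀ δ → 0ℚ < δ →
  ∃ λ N → ∀ m n → N ℕ.≤ m → N ℕ.≤ n → ∣ s m - s n ∣ ≤ δ

record ℝ : Set where
  constructor mkℝ
  field
    approx : ℕ → ℚ
    cauchy : CauchySeq approx

open ℝ public

infix 4 _≤ʳ_ _<ʳ_ _≈ʳ_

_≤ʳ_ : ℝ → ℝ → Set
x ≤ʳ y = ∀ δ → 0ℚ < δ → ∃ λ N → ∀ n → N ℕ.≤ n → approx x n ≤ approx y n + δ

_<ʳ_ : ℝ → ℝ → Set
x <ʳ y = ∃ λ δ → 0ℚ < δ × ∃ λ N → ∀ n → N ℕ.≤ n → approx x n + δ ≤ approx y n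

_≈ʳ_ : ℝ → ℝ → Set
x ≈ʳ y = x ≤ʳ y × y ≤ʳ x

opaque
  cauchy-bound : ∀ x δ → 0ℚ < δ →
    ∃ λ N → ∀ m n → N ℕ.≤ m → N ℕ.≤ n → approx x m ≤ approx x n + δ
  cauchy-bound x δ 0<δ with cauchy x δ 0<δ
  ... | N , h = N , λ m n N≤m N≤n → ∣p-q∣≤r⇒p≤q+r (h m n N≤m N≤n)

opaque
  cauchy-intro : ∀ {s} →
    (∀ δ → 0ℚ < δ → ∃ λ N → ∀ m n → N ℕ.≤ m → N ℕ.≤ n → s m ≤ s n + δ) → CauchySeq s
  cauchy-intro h δ 0<δ with h δ 0<δ
  ... | N , k = N , λ m n N≤m N≤n → ∣p-q∣≤r (k m n N≤m N≤n) (k n m N≤n N≤m)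

opaque
  eventually-bounded : ∀ x → ∃ λ B → ∃ λ N → ∀ n → N ℕ.≤ n → ∣ approx x n ∣ ≤ B
  eventually-bounded x with cauchy x 1ℚ 0<1
  ... | N , h = ∣ x_N ∣ + 1ℚ , N , λ n N≤n → begin
    ∣ approx x n ∣                ≡⟨ cong ∣_∣ (solve 2 (λ a b → a := b :+ (a :- b)) refl (approx x n) x_N) ⟩
    ∣ x_N + (approx x n - x_N) ∣  ≤⟨ ∣p+q∣≤∣p∣+∣q∣ x_N _ ⟩
    ∣ x_N ∣ + ∣ approx x n - x_N ∣ ≤⟨ +-monoʳ-≤ ∣ x_N ∣ (h n N N≤n ℕ.≤-refl) ⟩
    ∣ x_N ∣ + 1ℚ                  ∎
    where
    open ≤-Reasoning
    x_N : ℚ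
    x_N = approx x N

fromℚ : ℚ → ℝ
fromℚ p = mkℝ (λ _ → p) (cauchy-intro λ δ 0<δ → 0 , λ _ _ _ _ → p≤p+q p (<⇒≤ 0<δ))

0ʳ 1ʳ : ℝ
0ʳ = fromℚ 0ℚ
1ʳ = fromℚ 1ℚ

infixl 6 _+ʳ_ _-ʳ_ _⊔ʳ_
infixl 7 _*ʳ_
infix  8 -ʳ_

≤⊔ˡ : ∀ {a b N} → a ℕ.⊔ b ℕ.≤ N → a ℕ.≤ N
≤⊔ˡ {a} {b} = ℕ.m⊔n≤o⇒m≤o a b

≤⊔ʳ : ∀ {a b N} → a ℕ.⊔ b ℕ.≤ N → b ℕ.≤ N
≤⊔ʳ {a} {b} = ℕ.m⊔n≤o⇒n≤o a b

opaque
  +-cauchy : ∀ x y → CauchySeq (λ n → approx x n + approx y n)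
  +-cauchy x y = cauchy-intro λ δ 0<δ →
    let (N₁ , h₁) = cauchy-bound x (half δ) (0<half 0<δ)
        (N₂ , h₂) = cauchy-bound y (half δ) (0<half 0<δ)
    in N₁ ℕ.⊔ N₂ , λ m n N≤m N≤n → subst (approx x m + approx y m ≤_)
         (trans (solve 3 (λ a b h → (a :+ h) :+ (b :+ h) := (a :+ b) :+ (h :+ h)) refl
                  (approx x n) (approx y n) (half δ))
                (cong (λ e → approx x n + approx y n + e) (half+half δ)))
         (+-mono-≤ (h₁ m n (≤⊔ˡ N≤m) (≤⊔ˡ N≤n)) (h₂ m n (≤⊔ʳ {N₁} N≤m) (≤⊔ʳ {N₁} N≤n)))

_+ʳ_ : ℝ → ℝ → ℝ
x +ʳ y = mkℝ (λ n → approx x n + approx y n) (+-cauchy x y)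

opaque
  neg-cauchy : ∀ x → CauchySeq (λ n → - approx x n)
  neg-cauchy x = cauchy-intro λ δ 0<δ →
    let (N , h) = cauchy-bound x δ 0<δ
    in N , λ m n N≤m N≤n → subst₂ _≤_
         (solve 3 (λ a b d → b :+ (:- b :- a) := :- a) refl (approx x m) (approx x n) δ)
         (solve 3 (λ a b d → (a :+ d) :+ (:- b :- a) := :- b :+ d) refl (approx x m) (approx x n) δ)
         (+-monoˡ-≤ (- approx x n - approx x m) (h n m N≤n N≤m))

-ʳ_ : ℝ → ℝ
-ʳ x = mkℝ (λ n → - approx x n) (neg-cauchy x)

_-ʳ_ : ℝ → ℝ → ℝ
x -ʳ y = x +ʳ (-ʳ y)

opaque
  ⊔-cauchy : ∀ x y → CauchySeq (λ n → approx x n ⊔ approx y n)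
  ⊔-cauchy x y = cauchy-intro λ δ 0<δ →
    let (N₁ , h₁) = cauchy-bound x δ 0<δ
        (N₂ , h₂) = cauchy-bound y δ 0<δ
    in N₁ ℕ.⊔ N₂ , λ m n N≤m N≤n → ⊔-lub
         (≤-trans (h₁ m n (≤⊔ˡ N≤m) (≤⊔ˡ N≤n)) (+-monoˡ-≤ δ (p≤p⊔q (approx x n) (approx y n))))
         (≤-trans (h₂ m n (≤⊔ʳ {N₁} N≤m) (≤⊔ʳ {N₁} N≤n)) (+-monoˡ-≤ δ (p≤q⊔p (approx x n) (approx y n))))

_⊔ʳ_ : ℝ → ℝ → ℝ
x ⊔ʳ y = mkℝ (λ n → approx x n ⊔ approx y n) (⊔-cauchy x y)

opaque
  *-cauchy : ∀ x y → CauchySeq (λ n → approx x n * approx y n)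
  *-cauchy x y δ 0<δ
    with eventually-bounded x | eventually-bounded y
  ... | B₁ , M₁ , b₁ | B₂ , M₂ , b₂
    with archimedean B₁ (0<half 0<δ) | archimedean B₂ (0<half 0<δ)
  ... | K₁ , k₁ | K₂ , k₂
    with cauchy x (1/suc K₂) (0<frac 0 K₂) | cauchy y (1/suc K₁) (0<frac 0 K₁)
  ... | N₁ , h₁ | N₂ , h₂ = (M₁ ℕ.⊔ M₂) ℕ.⊔ (N₁ ℕ.⊔ N₂) , λ m n N≤m N≤n →
    let M≤n  = ≤⊔ˡ {M₁ ℕ.⊔ M₂} N≤n
        M≤m  = ≤⊔ˡ {M₁ ℕ.⊔ M₂} N≤m
        N′≤m = ≤⊔ʳ {M₁ ℕ.⊔ M₂} N≤m
        N′≤n = ≤⊔ʳ {M₁ ℕ.⊔ M₂} N≤n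
        a = approx x m
        b = approx x n
        c = approx y m
        d = approx y n
    in begin
      ∣ a * c - b * d ∣
        ≡⟨ cong ∣_∣ (solve 4 (λ a b c d → a :* c :- b :* d := c :* (a :- b) :+ b :* (c :- d)) refl a b c d) ⟩
      ∣ c * (a - b) + b * (c - d) ∣
        ≤⟨ ∣p+q∣≤∣p∣+∣q∣ (c * (a - b)) (b * (c - d)) ⟩
      ∣ c * (a - b) ∣ + ∣ b * (c - d) ∣
        ≡⟨ cong₂ _+_ (∣p*q∣≡∣p∣*∣q∣ c (a - b)) (∣p*q∣≡∣p∣*∣q∣ b (c - d)) ⟩
      ∣ c ∣ * ∣ a - b ∣ + ∣ b ∣ * ∣ c - d ∣
        ≤⟨ +-mono-≤
             (*-mono-≤ (0≤∣p∣ c) (b₂ m (≤⊔ʳ {M₁} M≤m)) (0≤∣p∣ (a - b)) (h₁ m n (≤⊔ˡ N′≤m) (≤⊔ˡ N′≤n)))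
             (*-mono-≤ (0≤∣p∣ b) (b₁ n (≤⊔ˡ M≤n)) (0≤∣p∣ (c - d)) (h₂ m n (≤⊔ʳ {N₁} N′≤m) (≤⊔ʳ {N₁} N′≤n))) ⟩
      B₂ * 1/suc K₂ + B₁ * 1/suc K₁
        ≤⟨ +-mono-≤ k₂ k₁ ⟩
      half δ + half δ
        ≡⟨ half+half δ ⟩
      δ ∎
    where open ≤-Reasoning

_*ʳ_ : ℝ → ℝ → ℝ
x *ʳ y = mkℝ (λ n → approx x n * approx y n) (*-cauchy x y)

largest : {P : ℕ → Set} → (∀ m → Dec (P m)) → ℕ → ℕ
largest P? zero = zero
largest P? (suc b) with P? (suc b)
... | yes _ = suc b
... | no  _ = largest P? b

-- For r ≥ 0 and q ≥ 1, root q r k is the largest multiple of 1 / (k + 1)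
-- whose q-th power is at most r; for r < 0 it is 0.  The search bound
-- exceeds r, hence also the root.
root : ℕ → ℚ → ℕ → ℚ
root q r k = frac (largest (λ m → frac m k ^ q ≤? r) (suc (ceil r) ℕ.* suc k)) k

frac-cancel : ∀ a k → frac (a ℕ.* suc k) k ≡ fromℕ a
frac-cancel a k = toℚᵘ-injective (ℚᵘ.≃-trans (frac-toℚᵘ (a ℕ.* suc k) k)
  (ℚᵘ.≃-trans (ℚᵘ.*≡* (trans (ℤ.*-identityʳ (+ (a ℕ.* suc k))) (ℤ.pos-* a (suc k))))
    (ℚᵘ.≃-sym (frac-toℚᵘ a 0))))

p<suc-ceil : ∀ p → p < fromℕ (suc (ceil p))
p<suc-ceil p = ≤-<-trans (p≤ceil p)
  (subst₂ _<_ (+-identityˡ (fromℕ (ceil p)))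
    (trans (cong (_+ fromℕ (ceil p)) (sym fromℕ-1)) (sym (fromℕ-+ 1 (ceil p))))
    (+-monoˡ-< (fromℕ (ceil p)) 0<1))

frac-zero : ∀ k → frac 0 k ≡ 0ℚ
frac-zero k = trans (frac-def 0 k) (0/n≡0 (suc k))

fromℕ-0 : fromℕ 0 ≡ 0ℚ
fromℕ-0 = frac-zero 0

1≤fromℕ-suc : ∀ n → 1ℚ ≤ fromℕ (suc n)
1≤fromℕ-suc n = subst (_≤ fromℕ (suc n)) fromℕ-1 (fromℕ-mono-≤ (s≤s z≤n))

opaque
  root-bound : ∀ q .{{_ : ℕ.NonZero q}} r k → ¬ (frac (suc (ceil r) ℕ.* suc k) k ^ q ≤ r)
  root-bound q r k h = <-irrefl refl (<-≤-trans (p<suc-ceil r)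
    (≤-trans (p≤p^q q (1≤fromℕ-suc (ceil r)))
      (subst (λ p → p ^ q ≤ r) (frac-cancel (suc (ceil r)) k) h)))

  0≤root : ∀ q r k → 0ℚ ≤ root q r k
  0≤root q r k = 0≤frac (largest (λ m → frac m k ^ q ≤? r) (suc (ceil r) ℕ.* suc k)) k

  root-lower : ∀ q .{{_ : ℕ.NonZero q}} r k → root q r k ≡ 0ℚ ⊎ root q r k ^ q ≤ r
  root-lower q r k = go (suc (ceil r) ℕ.* suc k)
    where
    P? : ∀ m → Dec (frac m k ^ q ≤ r)
    P? m = frac m k ^ q ≤? r
    go : ∀ b → frac (largest P? b) k ≡ 0ℚ ⊎ frac (largest P? b) k ^ q ≤ r
    go zero = inj₁ (frac-zero k)
    go (suc b) with P? (suc b)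
    ... | yes h = inj₂ h
    ... | no  _ = go b

  root-upper : ∀ q .{{_ : ℕ.NonZero q}} r k → r < (root q r k + 1/suc k) ^ q
  root-upper q r k = subst (λ p → r < p ^ q) (frac-suc (largest P? b) k)
    (≰⇒> (go b (root-bound q r k)))
    where
    P? : ∀ m → Dec (frac m k ^ q ≤ r)
    P? m = frac m k ^ q ≤? r
    b : ℕ
    b = suc (ceil r) ℕ.* suc k
    go : ∀ b → ¬ (frac b k ^ q ≤ r) → ¬ (frac (suc (largest P? b)) k ^ q ≤ r)
    go zero    ¬Pb h = ¬Pb (≤-trans (^-mono-≤ q (0≤frac 0 k)
      (subst (frac 0 k ≤_) (sym (frac-suc 0 k)) (p≤p+q (frac 0 k) (0≤frac 1 k)))) h)
    go (suc b) ¬Pb h with P? (suc b) | P? b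
    ... | yes Pb | _ = ¬Pb Pb
    ... | no  _  | no ¬Pb′ = go b ¬Pb′ h
    ... | no  _  | yes Pb′ = ¬Pb (subst (λ m → frac (suc m) k ^ q ≤ r) (top b Pb′) h)
      where
      top : ∀ b → frac b k ^ q ≤ r → largest P? b ≡ b
      top zero    _ = refl
      top (suc b) h with P? (suc b)
      ... | yes _  = refl
      ... | no ¬Pb = ⊥-elim (¬Pb h)

opaque
  √-cauchy : ∀ x → CauchySeq (λ n → root 2 (approx x n) n)
  √-cauchy x = cauchy-intro λ δ 0<δ →
    let h = half δ
        0<h = 0<half 0<δ
        (N₁ , h₁) = cauchy-bound x (h * h) (subst (0ℚ <_) (cong (h *_) (*-identityʳ h)) (0<^ 2 0<h))
        (N₂ , h₂) = eventually-1/≤ 0<h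
    in N₁ ℕ.⊔ N₂ , λ m n N≤m N≤n →
      step x δ m n 0<δ (h₁ m n (≤⊔ˡ N≤m) (≤⊔ˡ N≤n)) (h₂ n (≤⊔ʳ {N₁} N≤n))
    where
    open ≤-Reasoning
    step : ∀ x δ m n → 0ℚ < δ → approx x m ≤ approx x n + half δ * half δ → 1/suc n ≤ half δ →
      root 2 (approx x m) m ≤ root 2 (approx x n) n + δ
    step x δ m n 0<δ a≤b ι≤h with root-lower 2 (approx x m) m
    ... | inj₁ eq = subst (_≤ root 2 (approx x n) n + δ) (sym eq) (0≤p+q (0≤root 2 (approx x n) n) (<⇒≤ 0<δ))
    ... | inj₂ s²≤a = ^-cancel-≤ 2 (0≤p+q 0≤t (<⇒≤ 0<δ)) (begin
      s ^ 2                           ≤⟨ s²≤a ⟩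
      approx x m                      ≤⟨ a≤b ⟩
      approx x n + h * h              ≤⟨ +-monoˡ-≤ (h * h) (<⇒≤ (root-upper 2 (approx x n) n)) ⟩
      (t + 1/suc n) ^ 2 + h * h       ≤⟨ +-monoˡ-≤ (h * h) (^-mono-≤ 2 (0≤p+q 0≤t (0≤frac 1 n)) (+-monoʳ-≤ t ι≤h)) ⟩
      (t + h) ^ 2 + h * h             ≤⟨ p≤p+q _ (0≤p+q (0≤p*q 0≤t (0≤h)) (0≤p+q (0≤p*q 0≤t 0≤h) (0≤p*q (0≤h) 0≤h+h))) ⟩
      (t + h) ^ 2 + h * h + (t * h + (t * h + h * (h + h)))
        ≡⟨ solve 2 (λ t h → (t :+ h) :* ((t :+ h) :* con 1ℚ) :+ h :* h :+ (t :* h :+ (t :* h :+ h :* (h :+ h)))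
             := (t :+ (h :+ h)) :* ((t :+ (h :+ h)) :* con 1ℚ)) refl t h ⟩
      (t + (h + h)) ^ 2               ≡⟨ cong (λ d → (t + d) ^ 2) (half+half δ) ⟩
      (t + δ) ^ 2                     ∎)
      where
      s t h : ℚ
      s = root 2 (approx x m) m
      t = root 2 (approx x n) n
      h = half δ
      0≤t : 0ℚ ≤ t
      0≤t = 0≤root 2 (approx x n) n
      0≤h : 0ℚ ≤ h
      0≤h = <⇒≤ (0<half 0<δ)
      0≤h+h : 0ℚ ≤ h + h
      0≤h+h = 0≤p+q 0≤h 0≤h

infix 8 √_

-- √ x = 0 for x < 0.
√_ : ℝ → ℝ
√ x = mkℝ (λ n → root 2 (approx x n) n) (√-cauchy x)

infixr 8 _^ᶻ_

_^ᶻ_ : (n : ℕ) .{{_ : ℕ.NonZero n}} → ℤ → ℚ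
n ^ᶻ (+ k)    = (+ n / 1) ^ k
n ^ᶻ -[1+ k ] = (+ 1 / n) ^ suc k

opaque
  ^ᶻ-shift : ∀ n .{{_ : ℕ.NonZero n}} p k m → p ℤ.+ + k ≡ + m →
    n ^ᶻ p * fromℕ n ^ k ≡ fromℕ n ^ m
  ^ᶻ-shift n (+ j) k m eq = trans (cong (λ c → c ^ j * fromℕ n ^ k) (sym (frac-def n 0)))
    (trans (sym (^-homo-* (fromℕ n) j k)) (cong (fromℕ n ^_) (ℤ.+-injective eq)))
  ^ᶻ-shift (suc n) -[1+ j ] k m eq = begin
    (+ 1 / suc n) ^ suc j * c ^ k            ≡⟨ cong (λ d → d ^ suc j * c ^ k) (sym (frac-def 1 n)) ⟩
    1/suc n ^ suc j * c ^ k                  ≡⟨ cong (λ e → 1/suc n ^ suc j * c ^ e) k≡ ⟩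
    1/suc n ^ suc j * c ^ (suc j ℕ.+ m)      ≡⟨ cong (1/suc n ^ suc j *_) (^-homo-* c (suc j) m) ⟩
    1/suc n ^ suc j * (c ^ suc j * c ^ m)    ≡⟨ sym (*-assoc (1/suc n ^ suc j) (c ^ suc j) (c ^ m)) ⟩
    1/suc n ^ suc j * c ^ suc j * c ^ m      ≡⟨ cong (_* c ^ m) (sym (^-distrib-* (1/suc n) c (suc j))) ⟩
    (1/suc n * c) ^ suc j * c ^ m            ≡⟨ cong (λ d → d ^ suc j * c ^ m) (trans (*-comm (1/suc n) c) (suc*1/suc n)) ⟩
    1ℚ ^ suc j * c ^ m                       ≡⟨ cong (_* c ^ m) (1^ (suc j)) ⟩
    1ℚ * c ^ m                               ≡⟨ *-identityˡ (c ^ m) ⟩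
    c ^ m                                    ∎
    where
    open ≡-Reasoning
    c : ℚ
    c = fromℕ (suc n)
    k≡ : k ≡ suc j ℕ.+ m
    k≡ = ℤ.+-injective (trans
      (solveℤ 2 (λ a b → b :=ᶻ :-ᶻ a :+ᶻ (a :+ᶻ b)) refl -[1+ j ] (+ k))
      (cong (λ i → + suc j ℤ.+ i) eq))

  shift-exists : ∀ i j → ℤ.∣ i ∣ ℕ.≤ j → ∃ λ m → i ℤ.+ + j ≡ + m
  shift-exists (+ a)    j _   = a ℕ.+ j , refl
  shift-exists -[1+ a ] j a<j = j ℕ.∸ suc a , ℤ.⊖-≥ a<j

  cross-≤ : ∀ a b K → a ≤ b + 1/suc K →
    ↥ a ℤ.* (↧ b ℤ.* + suc K) ℤ.≤ (↥ b ℤ.* + suc K ℤ.+ ↧ b) ℤ.* ↧ a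
  cross-≤ a@record{} b@record{} K h = subst (λ i → ↥ a ℤ.* (↧ b ℤ.* + suc K) ℤ.≤ (↥ b ℤ.* + suc K ℤ.+ i) ℤ.* ↧ a)
    (ℤ.*-identityˡ (↧ b))
    (ℚᵘ.drop-*≤* (ℚᵘ.≤-respʳ-≃
      (ℚᵘ.≃-trans (toℚᵘ-homo-+ b (1/suc K)) (ℚᵘ.+-cong (ℚᵘ.≃-refl {toℚᵘ b}) (frac-toℚᵘ 1 K)))
      (toℚᵘ-mono-≤ h)))

  exponent-≤ : ∀ pa pb qa qb K k ma mb →
    pa ℤ.* (+ qb ℤ.* + K) ℤ.≤ (pb ℤ.* + K ℤ.+ + qb) ℤ.* + qa →
    pa ℤ.+ + (k ℕ.* qa) ≡ + ma → pb ℤ.+ + (k ℕ.* qb) ≡ + mb →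
    ma ℕ.* (qb ℕ.* K) ℕ.≤ mb ℕ.* (qa ℕ.* K) ℕ.+ qa ℕ.* qb
  exponent-≤ pa pb qa qb K k ma mb h eqa eqb = ℤ.drop‿+≤+ (subst₂ ℤ._≤_ lhs rhs (ℤ.+-monoˡ-≤ shift h))
    where
    shift : ℤ
    shift = + k ℤ.* + qa ℤ.* (+ qb ℤ.* + K)
    lhs : pa ℤ.* (+ qb ℤ.* + K) ℤ.+ shift ≡ + (ma ℕ.* (qb ℕ.* K))
    lhs = trans (solveℤ 4 (λ p k q r → p :*ᶻ r :+ᶻ k :*ᶻ q :*ᶻ r :=ᶻ (p :+ᶻ k :*ᶻ q) :*ᶻ r) refl
                   pa (+ k) (+ qa) (+ qb ℤ.* + K))
          (trans (cong₂ ℤ._*_ (trans (cong (λ i → pa ℤ.+ i) (sym (ℤ.pos-* k qa))) eqa) (sym (ℤ.pos-* qb K)))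
            (sym (ℤ.pos-* ma (qb ℕ.* K))))
    rhs : (pb ℤ.* + K ℤ.+ + qb) ℤ.* + qa ℤ.+ shift ≡ + (mb ℕ.* (qa ℕ.* K) ℕ.+ qa ℕ.* qb)
    rhs = trans (solveℤ 5 (λ p k qa qb K → (p :*ᶻ K :+ᶻ qb) :*ᶻ qa :+ᶻ k :*ᶻ qa :*ᶻ (qb :*ᶻ K)
                   :=ᶻ (p :+ᶻ k :*ᶻ qb) :*ᶻ (qa :*ᶻ K) :+ᶻ qa :*ᶻ qb) refl pb (+ k) (+ qa) (+ qb) (+ K))
          (trans (cong₂ ℤ._+_
            (trans (cong₂ ℤ._*_ (trans (cong (λ i → pb ℤ.+ i) (sym (ℤ.pos-* k qb))) eqb) (sym (ℤ.pos-* qa K)))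
              (sym (ℤ.pos-* mb (qa ℕ.* K))))
            (sym (ℤ.pos-* qa qb)))
            (sym (ℤ.pos-+ (mb ℕ.* (qa ℕ.* K)) (qa ℕ.* qb))))

powApprox : (n : ℕ) .{{_ : ℕ.NonZero n}} → ℚ → ℕ → ℚ
powApprox n a k = root (↧ₙ a) (n ^ᶻ (↥ a)) k

opaque
  0≤powApprox : ∀ n .{{_ : ℕ.NonZero n}} a k → 0ℚ ≤ powApprox n a k
  0≤powApprox n a k = 0≤root (↧ₙ a) (n ^ᶻ (↥ a)) k

  fromℕ≤[1+] : ∀ n K → fromℕ n ≤ (1ℚ + fromℕ n * 1/suc K) ^ suc K
  fromℕ≤[1+] n K = begin
    c                                   ≡⟨ *-identityˡ c ⟨
    1ℚ * c                              ≡⟨ cong (_* c) (suc*1/suc K) ⟨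
    fromℕ (suc K) * ι * c               ≡⟨ solve 3 (λ a b c → a :* b :* c := a :* (c :* b)) refl (fromℕ (suc K)) ι c ⟩
    fromℕ (suc K) * (c * ι)             ≤⟨ subst (fromℕ (suc K) * (c * ι) ≤_)
                                             (+-comm (fromℕ (suc K) * (c * ι)) 1ℚ) (p≤p+q (fromℕ (suc K) * (c * ι)) 0≤1) ⟩
    1ℚ + fromℕ (suc K) * (c * ι)        ≤⟨ bernoulli (suc K) (0≤p*q (0≤frac n 0) (0≤frac 1 K)) ⟩
    (1ℚ + c * ι) ^ suc K                ∎
    where
    open ≤-Reasoning
    c ι : ℚ
    c = fromℕ n
    ι = 1/suc K

  powApprox-≤ : ∀ n .{{_ : ℕ.NonZero n}} a b K m l → a ≤ b + 1/suc K →
    powApprox n a m ≤ (powApprox n b l + 1/suc l) * (1ℚ + fromℕ n * 1/suc K)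
  powApprox-≤ n@(suc n-1) a b K m l a≤b with root-lower (↧ₙ a) (n ^ᶻ (↥ a)) m
  ... | inj₁ eq = subst (_≤ (powApprox n b l + 1/suc l) * (1ℚ + fromℕ n * 1/suc K)) (sym eq)
    (0≤p*q (0≤p+q (0≤powApprox n b l) (0≤frac 1 l)) (0≤p+q 0≤1 (0≤p*q (0≤frac n 0) (0≤frac 1 K))))
  ... | inj₂ s^qa≤ = *-cancelʳ-≤-pos (c ^ k) {{positive 0<c^k}} (subst (s * c ^ k ≤_)
      (solve 3 (λ u g v → u :* g :* v := u :* v :* g) refl u (c ^ k) v)
      (^-cancel-≤ Q {{ℕ.m*n≢0 qa (qb ℕ.* suc K) {{_}} {{ℕ.m*n≢0 qb (suc K)}}}} (0≤p*q 0≤uc^k 0≤v) main))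
    where
    open ≤-Reasoning
    qa qb k Q : ℕ
    qa = ↧ₙ a
    qb = ↧ₙ b
    k = ℤ.∣ ↥ a ∣ ℕ.+ ℤ.∣ ↥ b ∣
    Q = qa ℕ.* (qb ℕ.* suc K)
    s t u v c : ℚ
    s = powApprox n a m
    t = powApprox n b l
    u = t + 1/suc l
    c = fromℕ n
    v = 1ℚ + c * 1/suc K
    0<c^k : 0ℚ < c ^ k
    0<c^k = 0<^ k (0<frac n-1 0)
    0≤c^ : ∀ j → 0ℚ ≤ c ^ j
    0≤c^ j = 0≤^ j (0≤frac n 0)
    0≤s : 0ℚ ≤ s
    0≤s = 0≤powApprox n a m
    0≤uc^k : 0ℚ ≤ u * c ^ k
    0≤uc^k = 0≤p*q (0≤p+q (0≤powApprox n b l) (0≤frac 1 l)) (0≤c^ k)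
    0≤v : 0ℚ ≤ v
    0≤v = 0≤p+q 0≤1 (0≤p*q (0≤frac n 0) (0≤frac 1 K))
    ma-spec : ∃ λ ma → ↥ a ℤ.+ + (k ℕ.* qa) ≡ + ma
    ma-spec = shift-exists (↥ a) (k ℕ.* qa) (ℕ.≤-trans (ℕ.m≤m+n ℤ.∣ ↥ a ∣ ℤ.∣ ↥ b ∣) (ℕ.m≤m*n k qa))
    mb-spec : ∃ λ mb → ↥ b ℤ.+ + (k ℕ.* qb) ≡ + mb
    mb-spec = shift-exists (↥ b) (k ℕ.* qb) (ℕ.≤-trans (ℕ.m≤n+m ℤ.∣ ↥ b ∣ ℤ.∣ ↥ a ∣) (ℕ.m≤m*n k qb))
    ma mb : ℕ
    ma = proj₁ ma-spec
    mb = proj₁ mb-spec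
    split : ∀ w q → (w * c ^ k) ^ q ≡ w ^ q * c ^ (k ℕ.* q)
    split w q = trans (^-distrib-* w (c ^ k) q) (cong (w ^ q *_) (^-assocʳ c k q))
    lower : (s * c ^ k) ^ qa ≤ c ^ ma
    lower = begin
      (s * c ^ k) ^ qa                   ≡⟨ split s qa ⟩
      s ^ qa * c ^ (k ℕ.* qa)            ≤⟨ *-monoʳ-≤-nonNeg (c ^ (k ℕ.* qa)) {{nonNegative (0≤c^ (k ℕ.* qa))}} s^qa≤ ⟩
      n ^ᶻ (↥ a) * c ^ (k ℕ.* qa)        ≡⟨ ^ᶻ-shift n (↥ a) (k ℕ.* qa) ma (proj₂ ma-spec) ⟩
      c ^ ma                             ∎
    upper : c ^ mb ≤ (u * c ^ k) ^ qb
    upper = begin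
      c ^ mb                             ≡⟨ ^ᶻ-shift n (↥ b) (k ℕ.* qb) mb (proj₂ mb-spec) ⟨
      n ^ᶻ (↥ b) * c ^ (k ℕ.* qb)        ≤⟨ *-monoʳ-≤-nonNeg (c ^ (k ℕ.* qb)) {{nonNegative (0≤c^ (k ℕ.* qb))}}
                                              (<⇒≤ (root-upper qb (n ^ᶻ (↥ b)) l)) ⟩
      u ^ qb * c ^ (k ℕ.* qb)            ≡⟨ split u qb ⟨
      (u * c ^ k) ^ qb                   ∎
    Q≡₁ : qb ℕ.* (qa ℕ.* suc K) ≡ Q
    Q≡₁ = solveℕ 3 (λ x y z → y :*ⁿ (x :*ⁿ z) :=ⁿ x :*ⁿ (y :*ⁿ z)) refl qa qb (suc K)
    Q≡₂ : suc K ℕ.* (qa ℕ.* qb) ≡ Q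
    Q≡₂ = solveℕ 3 (λ x y z → z :*ⁿ (x :*ⁿ y) :=ⁿ x :*ⁿ (y :*ⁿ z)) refl qa qb (suc K)
    main : (s * c ^ k) ^ Q ≤ (u * c ^ k * v) ^ Q
    main = begin
      (s * c ^ k) ^ Q
        ≡⟨ ^-assocʳ (s * c ^ k) qa (qb ℕ.* suc K) ⟨
      ((s * c ^ k) ^ qa) ^ (qb ℕ.* suc K)
        ≤⟨ ^-mono-≤ (qb ℕ.* suc K) (0≤^ qa (0≤p*q 0≤s (0≤c^ k))) lower ⟩
      (c ^ ma) ^ (qb ℕ.* suc K)
        ≡⟨ ^-assocʳ c ma (qb ℕ.* suc K) ⟩
      c ^ (ma ℕ.* (qb ℕ.* suc K))
        ≤⟨ ^-monoʳ-≤ (1≤fromℕ-suc n-1)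
             (exponent-≤ (↥ a) (↥ b) qa qb (suc K) k ma mb (cross-≤ a b K a≤b) (proj₂ ma-spec) (proj₂ mb-spec)) ⟩
      c ^ (mb ℕ.* (qa ℕ.* suc K) ℕ.+ qa ℕ.* qb)
        ≡⟨ ^-homo-* c (mb ℕ.* (qa ℕ.* suc K)) (qa ℕ.* qb) ⟩
      c ^ (mb ℕ.* (qa ℕ.* suc K)) * c ^ (qa ℕ.* qb)
        ≡⟨ cong (_* c ^ (qa ℕ.* qb)) (^-assocʳ c mb (qa ℕ.* suc K)) ⟨
      (c ^ mb) ^ (qa ℕ.* suc K) * c ^ (qa ℕ.* qb)
        ≤⟨ *-mono-≤ (0≤^ (qa ℕ.* suc K) (0≤c^ mb)) (^-mono-≤ (qa ℕ.* suc K) (0≤c^ mb) upper)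
             (0≤c^ (qa ℕ.* qb)) (^-mono-≤ (qa ℕ.* qb) (0≤frac n 0) (fromℕ≤[1+] n K)) ⟩
      ((u * c ^ k) ^ qb) ^ (qa ℕ.* suc K) * (v ^ suc K) ^ (qa ℕ.* qb)
        ≡⟨ cong₂ _*_ (trans (^-assocʳ (u * c ^ k) qb (qa ℕ.* suc K)) (cong ((u * c ^ k) ^_) Q≡₁))
             (trans (^-assocʳ v (suc K) (qa ℕ.* qb)) (cong (v ^_) Q≡₂)) ⟩
      (u * c ^ k) ^ Q * v ^ Q
        ≡⟨ ^-distrib-* (u * c ^ k) v Q ⟨
      (u * c ^ k * v) ^ Q ∎

  pow-bounded : ∀ n .{{_ : ℕ.NonZero n}} x →
    ∃ λ B → ∃ λ N → ∀ l → N ℕ.≤ l → powApprox n (approx x l) l ≤ B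
  pow-bounded n x =
    let (N , h) = cauchy-bound x (1/suc 0) (0<frac 0 0)
    in (powApprox n (approx x N) N + 1/suc N) * (1ℚ + fromℕ n * 1/suc 0) , N ,
       λ l N≤l → powApprox-≤ n (approx x l) (approx x N) 0 l N (h l N N≤l ℕ.≤-refl)

  pow-cauchy : ∀ n .{{_ : ℕ.NonZero n}} x → CauchySeq (λ k → powApprox n (approx x k) k)
  pow-cauchy n x = cauchy-intro λ δ 0<δ →
    let (B , N₁ , bnd) = pow-bounded n x
        (K , h)        = archimedean ((B + 1/suc 0) * fromℕ n) (0<half 0<δ)
        (N₂ , h₂)      = cauchy-bound x (1/suc K) (0<frac 0 K)
        (N₃ , h₃)      = eventually-1/≤ (0<half 0<δ)
    in N₁ ℕ.⊔ (N₂ ℕ.⊔ N₃) , λ m l N≤m N≤l →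
      let N′≤m = ≤⊔ʳ {N₁} N≤m
          N′≤l = ≤⊔ʳ {N₁} N≤l
      in step δ B K m l (bnd l (≤⊔ˡ N≤l)) h (h₃ l (≤⊔ʳ {N₂} N′≤l))
           (h₂ m l (≤⊔ˡ N′≤m) (≤⊔ˡ N′≤l))
    where
    open ≤-Reasoning
    step : ∀ δ B K m l → powApprox n (approx x l) l ≤ B →
      (B + 1/suc 0) * fromℕ n * 1/suc K ≤ half δ → 1/suc l ≤ half δ →
      approx x m ≤ approx x l + 1/suc K →
      powApprox n (approx x m) m ≤ powApprox n (approx x l) l + δ
    step δ B K m l t≤B hK hl xm≤xl = begin
      powApprox n (approx x m) m       ≤⟨ powApprox-≤ n (approx x m) (approx x l) K m l xm≤xl ⟩
      (t + ιl) * (1ℚ + c * ιK)         ≡⟨ solve 4 (λ t i c k → (t :+ i) :* (con 1ℚ :+ c :* k)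
                                            := t :+ (i :+ (t :+ i) :* (c :* k))) refl t ιl c ιK ⟩
      t + (ιl + (t + ιl) * (c * ιK))   ≤⟨ +-monoʳ-≤ t (+-mono-≤ hl (*-monoʳ-≤-nonNeg (c * ιK)
                                            {{nonNegative (0≤p*q (0≤frac n 0) (0≤frac 1 K))}}
                                            (+-mono-≤ t≤B (1/-antimono {0} {l} z≤n)))) ⟩
      t + (half δ + (B + 1/suc 0) * (c * ιK)) ≡⟨ cong (λ e → t + (half δ + e)) (*-assoc (B + 1/suc 0) c ιK) ⟨
      t + (half δ + (B + 1/suc 0) * c * ιK)   ≤⟨ +-monoʳ-≤ t (+-monoʳ-≤ (half δ) hK) ⟩
      t + (half δ + half δ)            ≡⟨ cong (λ e → t + e) (half+half δ) ⟩
      t + δ                            ∎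
      where
      t ιl c ιK : ℚ
      t = powApprox n (approx x l) l
      ιl = 1/suc l
      c = fromℕ n
      ιK = 1/suc K

infixr 9 _^ʳ_

-- n ^ x as the limit of the powers of n to the rationals approximating x.
_^ʳ_ : (n : ℕ) .{{_ : ℕ.NonZero n}} → ℝ → ℝ
n ^ʳ x = mkℝ (λ k → powApprox n (approx x k) k) (pow-cauchy n x)

record ℂ : Set where
  constructor _+i_
  field
    re im : ℝ

open ℂ public

infix  4 _≈ᶜ_
infixl 6 _+ᶜ_
infixl 7 _*ᶜ_

_≈ᶜ_ : ℂ → ℂ → Set
z ≈ᶜ w = re z ≈ʳ re w × im z ≈ʳ im w

0ᶜ 1ᶜ : ℂ
0ᶜ = 0ʳ +i 0ʳ
1ᶜ = 1ʳ +i 0ʳ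

_+ᶜ_ : ℂ → ℂ → ℂ
z +ᶜ w = (re z +ʳ re w) +i (im z +ʳ im w)

_*ᶜ_ : ℂ → ℂ → ℂ
z *ᶜ w = (re z *ʳ re w -ʳ im z *ʳ im w) +i (re z *ʳ im w +ʳ im z *ʳ re w)

∣_∣² : ℂ → ℝ
∣ z ∣² = re z *ʳ re z +ʳ im z *ʳ im z

Matrix : Set → ℕ → ℕ → Set
Matrix A m n = Vector (Vector A n) m

infixl 7 _·_

_·_ : ∀ {m k n} → Matrix ℂ m k → Matrix ℂ k n → Matrix ℂ m n
(U · V) i j = Vector.foldr _+ᶜ_ 0ᶜ (λ l → U i l *ᶜ V l j)

‖_‖₂ : ∀ {n} → Vector ℂ n → ℝ
‖ v ‖₂ = √ Vector.foldr _+ʳ_ 0ʳ (λ i → ∣ v i ∣²)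

-- Starting the maximum at 0 is harmless, the norms being nonnegative.
‖_‖row : ∀ {m n} → Matrix ℂ m n → ℝ
‖ U ‖row = Vector.foldr _⊔ʳ_ 0ʳ (λ i → ‖ U i ‖₂)

‖_‖col : ∀ {m n} → Matrix ℂ m n → ℝ
‖ V ‖col = Vector.foldr _⊔ʳ_ 0ʳ (λ j → ‖ (λ i → V i j) ‖₂)

-- γ₂ M is a minimum over factorizations M = U V of arbitrary inner
-- dimension; t ≤ γ₂ M says that t is a lower bound for the minimized values.
infix 4 _≤γ₂_

_≤γ₂_ : ∀ {m n} → ℝ → Matrix ℂ m n → Set
_≤γ₂_ {m} {n} t M = ∀ k (U : Matrix ℂ m k) (V : Matrix ℂ k n) →
  (∀ i j → M i j ≈ᶜ (U · V) i j) → t ≤ʳ ‖ U ‖row *ʳ ‖ V ‖col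

toℂ : ∀ {m n} → Matrix Bool m n → Matrix ℂ m n
toℂ M i j = if M i j then 1ᶜ else 0ᶜ

-- Deterministic two-party protocols: at an inner node the named player
-- sends one bit, which selects the subtree.
data Protocol (X Y : Set) : Set where
  output : Bool → Protocol X Y
  alice  : (X → Bool) → (Bool → Protocol X Y) → Protocol X Y
  bob    : (Y → Bool) → (Bool → Protocol X Y) → Protocol X Y

module _ {X Y : Set} where

  run : Protocol X Y → X → Y → Bool
  run (output b)  x y = b
  run (alice f π) x y = run (π (f x)) x y
  run (bob g π)   x y = run (π (g y)) x y

  bits : Protocol X Y → X → Y → ℕ
  bits (output b)  x y = 0
  bits (alice f π) x y = suc (bits (π (f x)) x y)
  bits (bob g π)   x y = suc (bits (π (g y)) x y)

Coins : Set
Coins = ℕ → Bool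

-- T : List Bool → Bool stands for the closed set of all coin sequences
-- whose finite prefixes all satisfy T; every closed set has this form.
infix 4 _∈closed_

_∈closed_ : Coins → (List Bool → Bool) → Set
r ∈closed T = ∀ k → T (applyUpTo r k) ≡ true

-- The number of words of length k all of whose prefixes satisfy T.
count : (List Bool → Bool) → ℕ → ℕ
count T zero    = if T [] then 1 else 0
count T (suc k) =
  if T [] then count (T ∘ (false ∷_)) k ℕ.+ count (T ∘ (true ∷_)) k else 0

-- The uniform measure of the closed set of T is the infimum over k of
-- the nonincreasing sequence density T k.
density : (List Bool → Bool) → ℕ → ℝ
density T k = fromℚ (_/_ (+ count T k) (2 ℕ.^ k) {{ℕ.m^n≢0 2 k}})

-- E is measurable with probability p for independent uniform coins:
-- by regularity, this means that closed subsets of E and of its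
-- complement have measure arbitrarily close to p and to 1 - p.
HasProbability : (Coins → Set) → ℝ → Set
HasProbability E p = ∀ δ → 0ʳ <ʳ δ →
  ∃ λ (K : List Bool → Bool) → ∃ λ (L : List Bool → Bool) →
    (∀ r → r ∈closed K → E r) ×
    (∀ r → r ∈closed L → ¬ E r) ×
    (∀ k → p -ʳ δ ≤ʳ density K k) ×
    (∀ k → 1ʳ -ʳ p -ʳ δ ≤ʳ density L k)

-- R M ≤ᴿ c: some public-coin protocol for M always communicates at most
-- c bits.  The shared coins select a deterministic protocol.
infix 4 R_≤ᴿ_

R_≤ᴿ_ : ∀ {m n} → Matrix Bool m n → ℕ → Set
R_≤ᴿ_ {m} {n} M c = ∃ λ (π : Coins → Protocol (Fin m) (Fin n)) →
  (∀ r x y → bits (π r) x y ℕ.≤ c) ×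
  (∀ x y → ∃ λ p → fromℚ (+ 2 / 3) ≤ʳ p × HasProbability (λ r → run (π r) x y ≡ M x y) p)

module Submission where

-- Let A₀ be the homogeneous coordinate ring of the projective line over F₄,
-- with X₀ = p + q, and adjoin Xᵢ₊₁ with Xᵢ₊₁³ = (Xᵢ + p)³ + p³.  This is the
-- tame tower of Garcia and Stichtenoth: it is totally ramified over p = q,
-- splits completely over p = 0, and its functions whose poles lie on the
-- fibre q = 0 and have total order a fixed multiple of 3ⁿ form a space V of
-- dimension proportional to the number 3ⁿ of split points.  A product of
-- two functions of V has O(3ⁿ) zeros, so their jets of a fixed order at the
-- split points form a code of constant rate and alphabet whose square has
-- constant relative distance.
--
-- Rows and columns of the matrix are vectors x, y ∈ Vᵈ, and the entry is 1
-- if Σⱼ xⱼ yⱼ = 0.  To decide this, Alice sends the jets of her d functions at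
-- a random split point; a nonzero Σⱼ xⱼ yⱼ vanishes at few of them.  Since V
-- has no zero divisors, some F₂-linear functional λ makes the signs of
-- λ(Σⱼ xⱼ yⱼ) a Hadamard matrix H.  The ones of M form an n^(-O(1/d))
-- fraction of the entries and all lie where H = 1, and Lindsey's lemma,
-- ⟨M , H⟩ ≤ n^(3/2) γ₂(M), gives γ₂(M) ≥ n^(1/2 - O(1/d)).

-- The curves are never normalised and no genus is computed. The n-th ring is free of rank 3ⁿ over
-- A₀. Its basis monomials in X₁, ..., Xₙ have average degree n, so that degree M offers only 3ⁿ (M
-- - n + 1) dimensions. Order T along the fibre q = 0 naively costs 3ⁿ T more conditions, and for
-- bounded M - T and large n nothing would be left. The obstacle is to win back the term n 3ⁿ. On
-- the places where Xₖ is the first of the Xᵢ to leave the value 1, a weighted filtration saves at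
-- least 3ⁿ - 3ᵏ - 3ⁿ⁻ᵏ of the bit conditions. There are two such families for each k, and their
-- savings sum to 2 n 3ⁿ bits up to O(3ⁿ).
--
-- Zeros are counted by taking norms down to the projective line, where they can be read off the
-- coefficients of a form. That only 0 has norm 0 comes from the totally ramified place, over which
-- every floor of the tower gives a discrete valuation ring.

open import Data.Bool.Base using (Bool; true; false; _xor_; _∧_; not; if_then_else_)
import Data.Bool.Properties as Bool
open import Data.Fin.Base using (Fin; zero; suc)
open import Data.Nat.Base as ℕ using (ℕ; zero; suc; z≤n; s≤s)
import Data.Nat.Properties as ℕ
open import Data.Product.Base using (Σ; ∃; _×_; _,_; proj₁; proj₂; map₁)
open import Data.Sum.Base as Sum using (_⊎_; inj₁; inj₂)
open import Data.Vec.Base as Vec using (Vec; []; _∷_)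
import Data.Vec.Properties as Vec
open import Function.Base using (_∘_)
open import Level using (0ℓ)
open import Relation.Binary.PropositionalEquality as ≡ using (_≡_; _≢_; cong; cong₂; subst)
open import Relation.Nullary using (¬_; Dec; yes; no; does; contradiction)

-- The field of four elements and algebras over it.

module FieldOfFour where
  open import Algebra.Bundles using (CommutativeRing; RawRing)
  open import Algebra.Solver.Ring.AlmostCommutativeRing using (_-Raw-AlmostCommutative⟶_; fromCommutativeRing)
  import Algebra.Solver.Ring
  open import Data.Maybe.Base using (Maybe; just; nothing)
  open import Data.Unit.Base using (tt)
  open ≡ using (refl; sym; trans; module ≡-Reasoning)
  open import Relation.Nullary.Decidable using (toWitness)

  data F₄ : Set where
    0₄ 1₄ ω ω² : F₄

  infixl 6 _+₄_
  infixl 7 _*₄_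

  _+₄_ _*₄_ : F₄ → F₄ → F₄
  0₄ +₄ b  = b
  1₄ +₄ 0₄ = 1₄
  1₄ +₄ 1₄ = 0₄
  1₄ +₄ ω  = ω²
  1₄ +₄ ω² = ω
  ω  +₄ 0₄ = ω
  ω  +₄ 1₄ = ω²
  ω  +₄ ω  = 0₄
  ω  +₄ ω² = 1₄
  ω² +₄ 0₄ = ω²
  ω² +₄ 1₄ = ω
  ω² +₄ ω  = 1₄
  ω² +₄ ω² = 0₄
  0₄ *₄ b  = 0₄
  1₄ *₄ b  = b
  ω  *₄ 0₄ = 0₄
  ω  *₄ 1₄ = ω
  ω  *₄ ω  = ω²
  ω  *₄ ω² = 1₄
  ω² *₄ 0₄ = 0₄
  ω² *₄ 1₄ = ω²
  ω² *₄ ω  = 1₄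
  ω² *₄ ω² = ω

  lo hi : F₄ → Bool
  lo 0₄ = false
  lo 1₄ = true
  lo ω  = false
  lo ω² = true
  hi 0₄ = false
  hi 1₄ = false
  hi ω  = true
  hi ω² = true

  fromBits : Bool → Bool → F₄
  fromBits false false = 0₄
  fromBits true  false = 1₄
  fromBits false true  = ω
  fromBits true  true  = ω²

  fromBits-lo-hi : ∀ a → fromBits (lo a) (hi a) ≡ a
  fromBits-lo-hi 0₄ = refl
  fromBits-lo-hi 1₄ = refl
  fromBits-lo-hi ω  = refl
  fromBits-lo-hi ω² = refl

  lo-hi-injective : ∀ {a b} → lo a ≡ lo b → hi a ≡ hi b → a ≡ b
  lo-hi-injective {a} {b} p q = trans (sym (fromBits-lo-hi a)) (trans (cong₂ fromBits p q) (fromBits-lo-hi b))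

  _≟₄_ : (a b : F₄) → Dec (a ≡ b)
  a ≟₄ b with lo a Bool.≟ lo b | hi a Bool.≟ hi b
  ... | yes p | yes q = yes (lo-hi-injective p q)
  ... | no ¬p | _     = no λ eq → ¬p (cong lo eq)
  ... | _     | no ¬q = no λ eq → ¬q (cong hi eq)

  -- Deciding by cases lets an identity in several variables be proved by evaluating all its
  -- instances.
  all₄? : {P : F₄ → Set} → (∀ a → Dec (P a)) → Dec (∀ a → P a)
  all₄? P? with P? 0₄ | P? 1₄ | P? ω | P? ω²
  ... | yes p | yes q | yes r | yes s = yes λ where
    0₄ → p
    1₄ → q
    ω  → r
    ω² → s
  ... | no ¬p | _ | _ | _ = no λ f → ¬p (f 0₄)
  ... | _ | no ¬p | _ | _ = no λ f → ¬p (f 1₄)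
  ... | _ | _ | no ¬p | _ = no λ f → ¬p (f ω)
  ... | _ | _ | _ | no ¬p = no λ f → ¬p (f ω²)

  +₄-assoc : ∀ a b c → (a +₄ b) +₄ c ≡ a +₄ (b +₄ c)
  +₄-assoc = toWitness {a? = all₄? λ a → all₄? λ b → all₄? λ c → ((a +₄ b) +₄ c) ≟₄ (a +₄ (b +₄ c))} tt

  +₄-comm : ∀ a b → a +₄ b ≡ b +₄ a
  +₄-comm = toWitness {a? = all₄? λ a → all₄? λ b → (a +₄ b) ≟₄ (b +₄ a)} tt

  +₄-self : ∀ a → a +₄ a ≡ 0₄
  +₄-self = toWitness {a? = all₄? λ a → (a +₄ a) ≟₄ 0₄} tt

  lo-+ : ∀ a b → lo (a +₄ b) ≡ lo a xor lo b
  lo-+ = toWitness {a? = all₄? λ a → all₄? λ b → lo (a +₄ b) Bool.≟ (lo a xor lo b)} tt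

  hi-+ : ∀ a b → hi (a +₄ b) ≡ hi a xor hi b
  hi-+ = toWitness {a? = all₄? λ a → all₄? λ b → hi (a +₄ b) Bool.≟ (hi a xor hi b)} tt

  +₄-identityʳ : ∀ a → a +₄ 0₄ ≡ a
  +₄-identityʳ = toWitness {a? = all₄? λ a → (a +₄ 0₄) ≟₄ a} tt

  *₄-assoc : ∀ a b c → (a *₄ b) *₄ c ≡ a *₄ (b *₄ c)
  *₄-assoc = toWitness {a? = all₄? λ a → all₄? λ b → all₄? λ c → ((a *₄ b) *₄ c) ≟₄ (a *₄ (b *₄ c))} tt

  *₄-comm : ∀ a b → a *₄ b ≡ b *₄ a
  *₄-comm = toWitness {a? = all₄? λ a → all₄? λ b → (a *₄ b) ≟₄ (b *₄ a)} tt

  *₄-distribˡ : ∀ a b c → a *₄ (b +₄ c) ≡ a *₄ b +₄ a *₄ c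
  *₄-distribˡ = toWitness {a? = all₄? λ a → all₄? λ b → all₄? λ c → (a *₄ (b +₄ c)) ≟₄ (a *₄ b +₄ a *₄ c)} tt

  *₄-identityˡ : ∀ a → 1₄ *₄ a ≡ a
  *₄-identityˡ = toWitness {a? = all₄? λ a → (1₄ *₄ a) ≟₄ a} tt

  *₄-zeroˡ : ∀ a → 0₄ *₄ a ≡ 0₄
  *₄-zeroˡ = toWitness {a? = all₄? λ a → (0₄ *₄ a) ≟₄ 0₄} tt

  *₄-zeroʳ : ∀ a → a *₄ 0₄ ≡ 0₄
  *₄-zeroʳ = toWitness {a? = all₄? λ a → (a *₄ 0₄) ≟₄ 0₄} tt

  -- The unit group has order 3. Hence a² inverts a, and wherever p vanishes the value of h is 1.
  cube₄ : ∀ a → a ≢ 0₄ → a *₄ a *₄ a ≡ 1₄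
  cube₄ 0₄ a≢0 = contradiction refl a≢0
  cube₄ 1₄ _ = refl
  cube₄ ω  _ = refl
  cube₄ ω² _ = refl

  *₄-integral : ∀ a b → a ≢ 0₄ → a *₄ b ≡ 0₄ → b ≡ 0₄
  *₄-integral a b a≢0 ab≡0 = begin
    b                    ≡⟨ *₄-identityˡ b ⟨
    1₄ *₄ b              ≡⟨ cong (_*₄ b) (cube₄ a a≢0) ⟨
    a *₄ a *₄ a *₄ b     ≡⟨ *₄-assoc (a *₄ a) a b ⟩
    a *₄ a *₄ (a *₄ b)   ≡⟨ cong (a *₄ a *₄_) ab≡0 ⟩
    a *₄ a *₄ 0₄         ≡⟨ *₄-zeroʳ (a *₄ a) ⟩
    0₄                   ∎
    where open ≡-Reasoning

  cube₄-zero : ∀ a → a *₄ a *₄ a ≡ 0₄ → a ≡ 0₄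
  cube₄-zero a a³≡0 with a ≟₄ 0₄
  ... | yes a≡0 = a≡0
  ... | no  a≢0 = contradiction (trans (sym (cube₄ a a≢0)) a³≡0) λ ()

  F₄-rawRing : RawRing 0ℓ 0ℓ
  F₄-rawRing = record { _≈_ = _≡_ ; _+_ = _+₄_ ; _*_ = _*₄_ ; -_ = λ a → a ; 0# = 0₄ ; 1# = 1₄ }

  -- Zero and one are written `κ 0₄` and `κ 1₄` in most of what follows, because these are the
  -- values of the constants of the solver.
  record F₄-Algebra : Set₁ where
    field
      commutativeRing : CommutativeRing 0ℓ 0ℓ
    open CommutativeRing commutativeRing public
    field
      κ   : F₄ → Carrier
      κ-+ : ∀ a b → κ (a +₄ b) ≈ κ a + κ b
      κ-* : ∀ a b → κ (a *₄ b) ≈ κ a * κ b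
      κ-0 : κ 0₄ ≈ 0#
      κ-1 : κ 1₄ ≈ 1#

    κ-cong : ∀ {a b} → a ≡ b → κ a ≈ κ b
    κ-cong a≡b = reflexive (cong κ a≡b)

    open import Algebra.Properties.AbelianGroup +-abelianGroup using (inverseˡ-unique)

    κ-neg : ∀ a → κ a ≈ - κ a
    κ-neg a = inverseˡ-unique (κ a) (κ a)
      (CommutativeRing.trans commutativeRing (CommutativeRing.sym commutativeRing (κ-+ a a))
        (CommutativeRing.trans commutativeRing (κ-cong (+₄-self a)) κ-0))

  -- With coefficients in F₄ normalisation knows that 1 + 1 = 0 and 1 + ω + ω² = 0, so identities of
  -- characteristic 2 and factorisations over the cube roots of unity are solved automatically.
  module AlgebraSolver (K : F₄-Algebra) where
    open F₄-Algebra K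
    morphism : F₄-rawRing -Raw-AlmostCommutative⟶ fromCommutativeRing commutativeRing
    morphism = record
      { ⟦_⟧ = κ ; +-homo = κ-+ ; *-homo = κ-* ; -‿homo = κ-neg ; 0-homo = κ-0 ; 1-homo = κ-1 }

    coeff? : ∀ a b → Maybe (κ a ≈ κ b)
    coeff? a b with a ≟₄ b
    ... | yes a≡b = just (κ-cong a≡b)
    ... | no  _   = nothing

    open Algebra.Solver.Ring F₄-rawRing (fromCommutativeRing commutativeRing) morphism coeff? public
      using (solve; con; _:+_; _:*_; _:=_)

-- Power series over the field of four elements: orders, fixed points, cube roots.

module PowerSeriesRing where
  open FieldOfFour
  open import Algebra.Structures using (IsCommutativeRing)
  open ≡ using (refl; sym; trans; module ≡-Reasoning)

  interchange₄ : ∀ a b c d → (a +₄ b) +₄ (c +₄ d) ≡ (a +₄ c) +₄ (b +₄ d)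
  interchange₄ a b c d = begin
    (a +₄ b) +₄ (c +₄ d)  ≡⟨ +₄-assoc a b (c +₄ d) ⟩
    a +₄ (b +₄ (c +₄ d))  ≡⟨ cong (a +₄_) (+₄-assoc b c d) ⟨
    a +₄ ((b +₄ c) +₄ d)  ≡⟨ cong (λ x → a +₄ (x +₄ d)) (+₄-comm b c) ⟩
    a +₄ ((c +₄ b) +₄ d)  ≡⟨ cong (a +₄_) (+₄-assoc c b d) ⟩
    a +₄ (c +₄ (b +₄ d))  ≡⟨ +₄-assoc a c (b +₄ d) ⟨
    (a +₄ c) +₄ (b +₄ d)  ∎
    where open ≡-Reasoning

  PowerSeries : Set
  PowerSeries = ℕ → F₄

  infix  4 _≈ₚ_
  infixl 6 _+ₚ_
  infixl 7 _*ₚ_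

  _≈ₚ_ : PowerSeries → PowerSeries → Set
  f ≈ₚ g = ∀ n → f n ≡ g n

  opaque
    _+ₚ_ _*ₚ_ : PowerSeries → PowerSeries → PowerSeries
    (f +ₚ g) n = f n +₄ g n
    (f *ₚ g) zero    = f 0 *₄ g 0
    (f *ₚ g) (suc n) = f 0 *₄ g (suc n) +₄ (f ∘ suc *ₚ g) n

  constₚ : F₄ → PowerSeries
  constₚ a zero    = a
  constₚ a (suc n) = 0₄

  t : PowerSeries
  t 1 = 1₄
  t _ = 0₄

  opaque
    unfolding _*ₚ_

    +ₚ-at : ∀ f g n → (f +ₚ g) n ≡ f n +₄ g n
    +ₚ-at f g n = refl

    *ₚ-0 : ∀ f g → (f *ₚ g) 0 ≡ f 0 *₄ g 0
    *ₚ-0 f g = refl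

    *ₚ-cong : ∀ {f f′ g g′} → f ≈ₚ f′ → g ≈ₚ g′ → f *ₚ g ≈ₚ f′ *ₚ g′
    *ₚ-cong p q zero    = cong₂ _*₄_ (p 0) (q 0)
    *ₚ-cong p q (suc n) = cong₂ _+₄_ (cong₂ _*₄_ (p 0) (q (suc n))) (*ₚ-cong (p ∘ suc) q n)

    -- The product is defined by splitting off the constant term of the left factor; commutativity
    -- needs the same recursion on the right factor.
    *ₚ-suc : ∀ f g n → (f *ₚ g) (suc n) ≡ (f *ₚ (g ∘ suc)) n +₄ f (suc n) *₄ g 0
    *ₚ-suc f g zero    = refl
    *ₚ-suc f g (suc n) = trans (cong (f 0 *₄ g (2 ℕ.+ n) +₄_) (*ₚ-suc (f ∘ suc) g n))
      (sym (+₄-assoc (f 0 *₄ g (2 ℕ.+ n)) _ _))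

    *ₚ-comm : ∀ f g → f *ₚ g ≈ₚ g *ₚ f
    *ₚ-comm f g zero    = *₄-comm (f 0) (g 0)
    *ₚ-comm f g (suc n) = begin
      f 0 *₄ g (suc n) +₄ (f ∘ suc *ₚ g) n  ≡⟨ +₄-comm (f 0 *₄ g (suc n)) _ ⟩
      (f ∘ suc *ₚ g) n +₄ f 0 *₄ g (suc n)  ≡⟨ cong₂ _+₄_ (*ₚ-comm (f ∘ suc) g n) (*₄-comm (f 0) _) ⟩
      (g *ₚ f ∘ suc) n +₄ g (suc n) *₄ f 0  ≡⟨ *ₚ-suc g f n ⟨
      (g *ₚ f) (suc n)                      ∎
      where open ≡-Reasoning

    *ₚ-distribʳ : ∀ h f g → (f +ₚ g) *ₚ h ≈ₚ f *ₚ h +ₚ g *ₚ h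
    *ₚ-distribʳ h f g n = trans (*ₚ-comm (f +ₚ g) h n)
      (trans (distribˡ h f g n) (cong₂ _+₄_ (*ₚ-comm h f n) (*ₚ-comm h g n)))
      where
      distribˡ : ∀ f g h → f *ₚ (g +ₚ h) ≈ₚ f *ₚ g +ₚ f *ₚ h
      distribˡ f g h zero    = *₄-distribˡ (f 0) (g 0) (h 0)
      distribˡ f g h (suc n) = trans
        (cong₂ _+₄_ (*₄-distribˡ (f 0) (g (suc n)) (h (suc n))) (distribˡ (f ∘ suc) g h n))
        (interchange₄ (f 0 *₄ g (suc n)) _ _ _)

    scale-*ₚ : ∀ a f g → (λ n → a *₄ f n) *ₚ g ≈ₚ λ n → a *₄ (f *ₚ g) n
    scale-*ₚ a f g zero    = *₄-assoc a (f 0) (g 0)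
    scale-*ₚ a f g (suc n) = trans (cong₂ _+₄_ (*₄-assoc a (f 0) (g (suc n))) (scale-*ₚ a (f ∘ suc) g n))
      (sym (*₄-distribˡ a _ _))

    *ₚ-assoc : ∀ f g h → (f *ₚ g) *ₚ h ≈ₚ f *ₚ (g *ₚ h)
    *ₚ-assoc f g h zero    = *₄-assoc (f 0) (g 0) (h 0)
    *ₚ-assoc f g h (suc n) = begin
      f 0 *₄ g 0 *₄ h (suc n) +₄ ((λ m → f 0 *₄ g (suc m)) +ₚ (f ∘ suc *ₚ g) ) *ₚh
        ≡⟨ cong₂ _+₄_ (*₄-assoc (f 0) (g 0) (h (suc n)))
             (trans (*ₚ-distribʳ h (λ m → f 0 *₄ g (suc m)) (f ∘ suc *ₚ g) n)
               (cong₂ _+₄_ (scale-*ₚ (f 0) (g ∘ suc) h n) (*ₚ-assoc (f ∘ suc) g h n))) ⟩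
      f 0 *₄ (g 0 *₄ h (suc n)) +₄ (f 0 *₄ (g ∘ suc *ₚ h) n +₄ (f ∘ suc *ₚ (g *ₚ h)) n)
        ≡⟨ +₄-assoc (f 0 *₄ (g 0 *₄ h (suc n))) _ _ ⟨
      f 0 *₄ (g 0 *₄ h (suc n)) +₄ f 0 *₄ (g ∘ suc *ₚ h) n +₄ (f ∘ suc *ₚ (g *ₚ h)) n
        ≡⟨ cong (_+₄ (f ∘ suc *ₚ (g *ₚ h)) n) (*₄-distribˡ (f 0) _ _) ⟨
      (f *ₚ (g *ₚ h)) (suc n) ∎
      where
      open ≡-Reasoning
      _*ₚh : PowerSeries → F₄
      k *ₚh = (k *ₚ h) n

    zero-*ₚ : ∀ {f} g → f ≈ₚ (λ _ → 0₄) → f *ₚ g ≈ₚ λ _ → 0₄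
    zero-*ₚ {f} g f≈0 zero    = trans (cong (_*₄ g 0) (f≈0 0)) (*₄-zeroˡ (g 0))
    zero-*ₚ {f} g f≈0 (suc n) = trans
      (cong₂ _+₄_ (trans (cong (_*₄ g (suc n)) (f≈0 0)) (*₄-zeroˡ (g (suc n)))) (zero-*ₚ g (f≈0 ∘ suc) n)) refl

    const-*ₚ : ∀ a g → constₚ a *ₚ g ≈ₚ λ n → a *₄ g n
    const-*ₚ a g zero    = refl
    const-*ₚ a g (suc n) = trans (cong (a *₄ g (suc n) +₄_) (zero-*ₚ g (λ _ → refl) n)) (+₄-identityʳ _)

    *ₚ-identityˡ : ∀ f → constₚ 1₄ *ₚ f ≈ₚ f
    *ₚ-identityˡ f n = trans (const-*ₚ 1₄ f n) (*₄-identityˡ (f n))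

    isCommutativeRingₚ : IsCommutativeRing _≈ₚ_ _+ₚ_ _*ₚ_ (λ f → f) (λ _ → 0₄) (constₚ 1₄)
    isCommutativeRingₚ = record
      { isRing = record
        { +-isAbelianGroup = record
          { isGroup = record
            { isMonoid = record
              { isSemigroup = record
                { isMagma = record
                  { isEquivalence = record
                    { refl = λ _ → refl ; sym = λ p n → sym (p n) ; trans = λ p q n → trans (p n) (q n) }
                  ; ∙-cong = λ p q n → cong₂ _+₄_ (p n) (q n) }
                ; assoc = λ f g h n → +₄-assoc (f n) (g n) (h n) }
              ; identity = (λ f n → refl) , (λ f n → +₄-identityʳ (f n)) }
            ; inverse = (λ f n → +₄-self (f n)) , (λ f n → +₄-self (f n))
            ; ⁻¹-cong = λ p → p }
          ; comm = λ f g n → +₄-comm (f n) (g n) }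
        ; *-cong = *ₚ-cong
        ; *-assoc = *ₚ-assoc
        ; *-identity = *ₚ-identityˡ , (λ f n → trans (*ₚ-comm f (constₚ 1₄) n) (*ₚ-identityˡ f n))
        ; distrib = (λ h f g n → trans (*ₚ-comm h (f +ₚ g) n) (trans (*ₚ-distribʳ h f g n)
                      (cong₂ _+₄_ (*ₚ-comm f h n) (*ₚ-comm g h n)))) , *ₚ-distribʳ }
      ; *-comm = *ₚ-comm }

    κₚ-+ : ∀ a b → constₚ (a +₄ b) ≈ₚ constₚ a +ₚ constₚ b
    κₚ-+ a b zero    = refl
    κₚ-+ a b (suc n) = refl

    κₚ-* : ∀ a b → constₚ (a *₄ b) ≈ₚ constₚ a *ₚ constₚ b
    κₚ-* a b zero    = refl
    κₚ-* a b (suc n) = sym (trans (const-*ₚ a (constₚ b) (suc n)) (*₄-zeroʳ a))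

  PS : F₄-Algebra
  PS = record
    { commutativeRing = record { isCommutativeRing = isCommutativeRingₚ }
    ; κ   = constₚ
    ; κ-+ = κₚ-+
    ; κ-* = κₚ-*
    ; κ-0 = λ where
        zero    → refl
        (suc n) → refl
    ; κ-1 = λ _ → refl
    }

  -- The k-th power of t divides f. Orders occur only as lower bounds, which finitely many
  -- coefficients decide.
  Div : ℕ → PowerSeries → Set
  Div k f = ∀ i → i ℕ.< k → f i ≡ 0₄

  Div-resp : ∀ {k f g} → f ≈ₚ g → Div k f → Div k g
  Div-resp f≈g d i i<k = trans (sym (f≈g i)) (d i i<k)

  Div-mono : ∀ {j k f} → j ℕ.≤ k → Div k f → Div j f
  Div-mono j≤k d i i<j = d i (ℕ.<-≤-trans i<j j≤k)

  opaque
    unfolding _*ₚ_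

    Div-+ : ∀ {k f g} → Div k f → Div k g → Div k (f +ₚ g)
    Div-+ d e i i<k = cong₂ _+₄_ (d i i<k) (e i i<k)

    Div-*ʳ : ∀ {k} f {g} → Div k g → Div k (f *ₚ g)
    Div-*ʳ f d zero    i<k = trans (cong (f 0 *₄_) (d 0 i<k)) (*₄-zeroʳ (f 0))
    Div-*ʳ f {g} d (suc i) i<k = cong₂ _+₄_
      (trans (cong (f 0 *₄_) (d (suc i) i<k)) (*₄-zeroʳ (f 0)))
      (Div-*ʳ (f ∘ suc) d i (ℕ.<-trans (ℕ.n<1+n i) i<k))

    Div-suc : ∀ {k f} → f 0 ≡ 0₄ → Div k (f ∘ suc) → Div (suc k) f
    Div-suc p d zero    _         = p
    Div-suc p d (suc i) (s≤s i<k) = d i i<k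

    Div-* : ∀ j k {f g} → Div j f → Div k g → Div (j ℕ.+ k) (f *ₚ g)
    Div-* zero    k {f} d e = Div-*ʳ f e
    Div-* (suc j) k {f} {g} d e = Div-suc
      (trans (cong (_*₄ g 0) f0≡0) (*₄-zeroˡ (g 0)))
      (Div-resp (λ n → sym (cong (λ a → a *₄ g (suc n) +₄ (f ∘ suc *ₚ g) n) f0≡0 ⟨ trans ⟩
                            cong (_+₄ (f ∘ suc *ₚ g) n) (*₄-zeroˡ (g (suc n)))))
        (Div-* j k (λ i i<j → d (suc i) (s≤s i<j)) e))
      where
      open import Function.Base using (_⟨_⟩_)
      f0≡0 : f 0 ≡ 0₄
      f0≡0 = d 0 (s≤s z≤n)

    *ₚ-tail : ∀ {f} g → f 0 ≡ 0₄ → ∀ n → (f *ₚ g) (suc n) ≡ (f ∘ suc *ₚ g) n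
    *ₚ-tail {f} g f0≡0 n = trans (cong (λ a → a *₄ g (suc n) +₄ (f ∘ suc *ₚ g) n) f0≡0)
      (cong (_+₄ (f ∘ suc *ₚ g) n) (*₄-zeroˡ (g (suc n))))

    -- A series with nonzero constant term is a unit and contributes nothing to the order; the
    -- lowest coefficients of f vanish one after the other because F₄ has no zero divisors.
    Div-cancel : ∀ k {f g} → g 0 ≢ 0₄ → Div k (f *ₚ g) → Div k f
    Div-cancel zero    g0≢0 d i ()
    Div-cancel (suc k) {f} {g} g0≢0 d = Div-suc f0≡0
      (Div-cancel k g0≢0 λ i i<k → trans (sym (*ₚ-tail {f} g f0≡0 i)) (d (suc i) (s≤s i<k)))
      where
      f0≡0 : f 0 ≡ 0₄
      f0≡0 = *₄-integral (g 0) (f 0) g0≢0 (trans (*₄-comm (g 0) (f 0)) (d 0 (s≤s z≤n)))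

    -- One factor vanishing from degree m on makes the case distinction decidable.
    *ₚ-integral : ∀ m {f g} → (∀ i → m ℕ.≤ i → f i ≡ 0₄) → f *ₚ g ≈ₚ (λ _ → 0₄) →
      (f ≈ₚ λ _ → 0₄) ⊎ (g ≈ₚ λ _ → 0₄)
    *ₚ-integral zero    bound _ = inj₁ λ n → bound n z≤n
    *ₚ-integral (suc m) {f} {g} bound fg≈0 with f 0 ≟₄ 0₄
    ... | no f0≢0  = inj₂ λ n → Div-cancel (suc n) {g} {f} f0≢0
      (λ i _ → trans (*ₚ-comm g f i) (fg≈0 i)) n (ℕ.n<1+n n)
    ... | yes f0≡0 with *ₚ-integral m {f ∘ suc} {g} (λ i m≤i → bound (suc i) (s≤s m≤i))
                          (λ n → trans (sym (*ₚ-tail {f} g f0≡0 n)) (fg≈0 (suc n)))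
    ...   | inj₂ g≈0 = inj₂ g≈0
    ...   | inj₁ h   = inj₁ λ where
      zero    → f0≡0
      (suc n) → h n

  Causal : (PowerSeries → PowerSeries) → Set
  Causal Q = ∀ n {f g} → (∀ i → i ℕ.≤ n → f i ≡ g i) → Q f n ≡ Q g n

  opaque
    unfolding _*ₚ_

    *ₚ-causal : ∀ n {f f′ g g′} → (∀ i → i ℕ.≤ n → f i ≡ f′ i) → (∀ i → i ℕ.≤ n → g i ≡ g′ i) →
      (f *ₚ g) n ≡ (f′ *ₚ g′) n
    *ₚ-causal zero    p q = cong₂ _*₄_ (p 0 z≤n) (q 0 z≤n)
    *ₚ-causal (suc n) p q = cong₂ _+₄_ (cong₂ _*₄_ (p 0 z≤n) (q (suc n) ℕ.≤-refl))
      (*ₚ-causal n (λ i i≤n → p (suc i) (s≤s i≤n)) (λ i i≤n → q i (ℕ.m≤n⇒m≤1+n i≤n)))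

  -- The solution of f = a + t Q(f). As Q is causal, the k-th iterate is correct up to coefficient
  -- k, so the solution is the diagonal of the iterates.
  module Fixpoint (a : F₄) (Q : PowerSeries → PowerSeries) (causal : Causal Q) where

    step : PowerSeries → PowerSeries
    step f zero    = a
    step f (suc n) = Q f n

    iterate : ℕ → PowerSeries
    iterate zero    = λ _ → a
    iterate (suc k) = step (iterate k)

    iterate-stable : ∀ k i → i ℕ.≤ k → iterate k i ≡ iterate (suc k) i
    iterate-stable zero    zero    _         = refl
    iterate-stable (suc k) zero    _         = refl
    iterate-stable (suc k) (suc i) (s≤s i≤k) =
      causal i λ j j≤i → iterate-stable k j (ℕ.≤-trans j≤i i≤k)

    fixpoint : PowerSeries
    fixpoint n = iterate n n

    fixpoint≡iterate : ∀ k i → i ℕ.≤ k → fixpoint i ≡ iterate k i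
    fixpoint≡iterate zero    zero z≤n = refl
    fixpoint≡iterate (suc k) i i≤k with ℕ.m≤n⇒m<n∨m≡n i≤k
    ... | inj₁ (s≤s i≤k′) = trans (fixpoint≡iterate k i i≤k′) (iterate-stable k i i≤k′)
    ... | inj₂ refl = refl

    fixpoint-suc : ∀ n → fixpoint (suc n) ≡ Q fixpoint n
    fixpoint-suc n = causal n λ i i≤n → sym (fixpoint≡iterate n i i≤n)

  open AlgebraSolver PS

  shift : PowerSeries → PowerSeries
  shift f zero    = 0₄
  shift f (suc n) = f n

  opaque
    unfolding _*ₚ_

    t*≈shift : ∀ f → t *ₚ f ≈ₚ shift f
    t*≈shift f zero    = *₄-zeroˡ (f 0)
    t*≈shift f (suc n) = trans (*ₚ-tail {t} f refl n) (trans (*ₚ-cong {g = f} tail-t (λ _ → refl) n) (*ₚ-identityˡ f n))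
      where
      tail-t : t ∘ suc ≈ₚ constₚ 1₄
      tail-t zero    = refl
      tail-t (suc n) = refl

    shift-decompose : ∀ f → f ≈ₚ constₚ (f 0) +ₚ shift (f ∘ suc)
    shift-decompose f zero    = sym (+₄-identityʳ (f 0))
    shift-decompose f (suc n) = refl

    +ₚ-cong : ∀ {f f′ g g′} → f ≈ₚ f′ → g ≈ₚ g′ → f +ₚ g ≈ₚ f′ +ₚ g′
    +ₚ-cong p q n = cong₂ _+₄_ (p n) (q n)

  -- w with constant coefficient 1 and w³ = f: writing w = 1 + t ψ and
  -- f = 1 + t s, the equation becomes ψ = s + t (ψ² + t ψ³).
  module CubeRoot (f : PowerSeries) (f0≡1 : f 0 ≡ 1₄) where
    opaque
      unfolding _*ₚ_

      Q : PowerSeries → PowerSeries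
      Q ψ = (λ n → f (2 ℕ.+ n)) +ₚ ψ *ₚ ψ *ₚ (constₚ 1₄ +ₚ t *ₚ ψ)

      Q-causal : Causal Q
      Q-causal n p = cong (f (2 ℕ.+ n) +₄_)
        (*ₚ-causal n (λ i i≤n → *ₚ-causal i (λ j j≤i → p j (ℕ.≤-trans j≤i i≤n)) (λ j j≤i → p j (ℕ.≤-trans j≤i i≤n)))
          (λ i i≤n → cong (constₚ 1₄ i +₄_)
            (*ₚ-causal i {t} (λ _ _ → refl) (λ j j≤i → p j (ℕ.≤-trans j≤i i≤n)))))

      ψ : PowerSeries
      ψ = Fixpoint.fixpoint (f 1) Q Q-causal

      ψ-eq : ψ ≈ₚ f ∘ suc +ₚ t *ₚ (ψ *ₚ ψ *ₚ (constₚ 1₄ +ₚ t *ₚ ψ))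
      ψ-eq zero    = sym (trans (cong (f 1 +₄_) (*₄-zeroˡ ((ψ *ₚ ψ *ₚ (constₚ 1₄ +ₚ t *ₚ ψ)) 0))) (+₄-identityʳ (f 1)))
      ψ-eq (suc n) = trans (Fixpoint.fixpoint-suc (f 1) Q Q-causal n) (cong (f (2 ℕ.+ n) +₄_) (sym (t*≈shift (ψ *ₚ ψ *ₚ (constₚ 1₄ +ₚ t *ₚ ψ)) (suc n))))

      cbrt : PowerSeries
      cbrt = constₚ 1₄ +ₚ t *ₚ ψ

      cbrt-0 : cbrt 0 ≡ 1₄
      cbrt-0 = cong (1₄ +₄_) (*₄-zeroˡ (ψ 0))

      cbrt³ : cbrt *ₚ cbrt *ₚ cbrt ≈ₚ f
      cbrt³ n = begin
        (cbrt *ₚ cbrt *ₚ cbrt) n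
          ≡⟨ solve 2 (λ t ψ → (con 1₄ :+ t :* ψ) :* (con 1₄ :+ t :* ψ) :* (con 1₄ :+ t :* ψ)
               := con 1₄ :+ t :* (ψ :+ t :* (ψ :* ψ :* (con 1₄ :+ t :* ψ)))) (λ _ → refl) t ψ n ⟩
        (constₚ 1₄ +ₚ t *ₚ (ψ +ₚ R)) n
          ≡⟨ cong (constₚ 1₄ n +₄_) (*ₚ-cong {t} (λ _ → refl) (+ₚ-cong {g = R} ψ-eq (λ _ → refl)) n) ⟩
        (constₚ 1₄ +ₚ t *ₚ (f ∘ suc +ₚ R +ₚ R)) n
          ≡⟨ solve 3 (λ t s r → con 1₄ :+ t :* (s :+ r :+ r) := con 1₄ :+ t :* s) (λ _ → refl) t (f ∘ suc) R n ⟩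
        (constₚ 1₄ +ₚ t *ₚ (f ∘ suc)) n
          ≡⟨ cong₂ _+₄_ (cong (λ a → constₚ a n) (sym f0≡1)) (t*≈shift (f ∘ suc) n) ⟩
        (constₚ (f 0) +ₚ shift (f ∘ suc)) n
          ≡⟨ shift-decompose f n ⟨
        f n ∎
        where
        open ≡-Reasoning
        R : PowerSeries
        R = t *ₚ (ψ *ₚ ψ *ₚ (constₚ 1₄ +ₚ t *ₚ ψ))

  opaque
    unfolding _*ₚ_

    -- Writing f = 1 + t s, the inverse is the fixed point ψ = 1 + t s ψ, as signs do not matter.
    inverseₚ : ∀ f → f 0 ≡ 1₄ → ∃ λ g → f *ₚ g ≈ₚ constₚ 1₄
    inverseₚ f f0≡1 = ψ , λ n → begin
      (f *ₚ ψ) n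
        ≡⟨ *ₚ-cong {f} {g = ψ} f≈ (λ _ → refl) n ⟩
      ((constₚ 1₄ +ₚ t *ₚ f ∘ suc) *ₚ ψ) n
        ≡⟨ solve 3 (λ t s ψ → (con 1₄ :+ t :* s) :* ψ := ψ :+ t :* (s :* ψ)) (λ _ → refl) t (f ∘ suc) ψ n ⟩
      (ψ +ₚ t *ₚ (f ∘ suc *ₚ ψ)) n
        ≡⟨ cong (_+₄ (t *ₚ (f ∘ suc *ₚ ψ)) n) (ψ-eq n) ⟩
      (constₚ 1₄ +ₚ t *ₚ (f ∘ suc *ₚ ψ) +ₚ t *ₚ (f ∘ suc *ₚ ψ)) n
        ≡⟨ solve 1 (λ r → con 1₄ :+ r :+ r := con 1₄) (λ _ → refl) (t *ₚ (f ∘ suc *ₚ ψ)) n ⟩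
      constₚ 1₄ n ∎
      where
      open ≡-Reasoning
      Q : PowerSeries → PowerSeries
      Q ψ = f ∘ suc *ₚ ψ
      Q-causal : Causal Q
      Q-causal n p = *ₚ-causal n {f ∘ suc} (λ _ _ → refl) p
      open Fixpoint 1₄ Q Q-causal
      ψ : PowerSeries
      ψ = fixpoint
      ψ-eq : ψ ≈ₚ constₚ 1₄ +ₚ t *ₚ (f ∘ suc *ₚ ψ)
      ψ-eq zero    = sym (cong (1₄ +₄_) (*₄-zeroˡ ((f ∘ suc *ₚ ψ) 0)))
      ψ-eq (suc n) = trans (fixpoint-suc n) (sym (t*≈shift (f ∘ suc *ₚ ψ) (suc n)))
      f≈ : f ≈ₚ constₚ 1₄ +ₚ t *ₚ f ∘ suc
      f≈ n = trans (shift-decompose f n) (cong₂ _+₄_ (cong (λ a → constₚ a n) f0≡1) (sym (t*≈shift (f ∘ suc) n)))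

-- Adjoining a cube root, and the norm of the extension.

module CubicExtension where
  open FieldOfFour

  -- K[y] / (y³ - h) on the basis 1, y, y². This is a ring for every h; that the tower has no zero
  -- divisors will be seen at a place.
  module Cubic (K : F₄-Algebra) (h : F₄-Algebra.Carrier K) where
    open F₄-Algebra K
    open AlgebraSolver K

    Triple : Set
    Triple = Carrier × Carrier × Carrier

    infix  4 _≈³_
    infixl 6 _+³_
    infixl 7 _*³_

    _≈³_ : Triple → Triple → Set
    (f₀ , f₁ , f₂) ≈³ (g₀ , g₁ , g₂) = f₀ ≈ g₀ × f₁ ≈ g₁ × f₂ ≈ g₂

    _+³_ _*³_ : Triple → Triple → Triple
    (f₀ , f₁ , f₂) +³ (g₀ , g₁ , g₂) = f₀ + g₀ , f₁ + g₁ , f₂ + g₂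
    (f₀ , f₁ , f₂) *³ (g₀ , g₁ , g₂) =
      f₀ * g₀ + h * (f₁ * g₂ + f₂ * g₁) , f₀ * g₁ + f₁ * g₀ + h * (f₂ * g₂) , f₀ * g₂ + f₁ * g₁ + f₂ * g₀

    κ³ : F₄ → Triple
    κ³ a = κ a , κ 0₄ , κ 0₄

    ↑_ : Carrier → Triple
    ↑ f = f , κ 0₄ , κ 0₄

    y : Triple
    y = κ 0₄ , κ 1₄ , κ 0₄

    *³-assoc : ∀ a b c → (a *³ b) *³ c ≈³ a *³ (b *³ c)
    *³-assoc (a₀ , a₁ , a₂) (b₀ , b₁ , b₂) (c₀ , c₁ , c₂) =
        solve 10 (λ h a₀ a₁ a₂ b₀ b₁ b₂ c₀ c₁ c₂ →
            (a₀ :* b₀ :+ h :* (a₁ :* b₂ :+ a₂ :* b₁)) :* c₀ :+ h :* ((a₀ :* b₁ :+ a₁ :* b₀ :+ h :* (a₂ :* b₂)) :* c₂ :+ (a₀ :* b₂ :+ a₁ :* b₁ :+ a₂ :* b₀) :* c₁)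
            := a₀ :* (b₀ :* c₀ :+ h :* (b₁ :* c₂ :+ b₂ :* c₁)) :+ h :* (a₁ :* (b₀ :* c₂ :+ b₁ :* c₁ :+ b₂ :* c₀) :+ a₂ :* (b₀ :* c₁ :+ b₁ :* c₀ :+ h :* (b₂ :* c₂))))
          refl h a₀ a₁ a₂ b₀ b₁ b₂ c₀ c₁ c₂
      , solve 10 (λ h a₀ a₁ a₂ b₀ b₁ b₂ c₀ c₁ c₂ →
            (a₀ :* b₀ :+ h :* (a₁ :* b₂ :+ a₂ :* b₁)) :* c₁ :+ (a₀ :* b₁ :+ a₁ :* b₀ :+ h :* (a₂ :* b₂)) :* c₀ :+ h :* ((a₀ :* b₂ :+ a₁ :* b₁ :+ a₂ :* b₀) :* c₂)
            := a₀ :* (b₀ :* c₁ :+ b₁ :* c₀ :+ h :* (b₂ :* c₂)) :+ a₁ :* (b₀ :* c₀ :+ h :* (b₁ :* c₂ :+ b₂ :* c₁)) :+ h :* (a₂ :* (b₀ :* c₂ :+ b₁ :* c₁ :+ b₂ :* c₀)))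
          refl h a₀ a₁ a₂ b₀ b₁ b₂ c₀ c₁ c₂
      , solve 10 (λ h a₀ a₁ a₂ b₀ b₁ b₂ c₀ c₁ c₂ →
            (a₀ :* b₀ :+ h :* (a₁ :* b₂ :+ a₂ :* b₁)) :* c₂ :+ (a₀ :* b₁ :+ a₁ :* b₀ :+ h :* (a₂ :* b₂)) :* c₁ :+ (a₀ :* b₂ :+ a₁ :* b₁ :+ a₂ :* b₀) :* c₀
            := a₀ :* (b₀ :* c₂ :+ b₁ :* c₁ :+ b₂ :* c₀) :+ a₁ :* (b₀ :* c₁ :+ b₁ :* c₀ :+ h :* (b₂ :* c₂)) :+ a₂ :* (b₀ :* c₀ :+ h :* (b₁ :* c₂ :+ b₂ :* c₁)))
          refl h a₀ a₁ a₂ b₀ b₁ b₂ c₀ c₁ c₂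

    *³-comm : ∀ a b → a *³ b ≈³ b *³ a
    *³-comm (a₀ , a₁ , a₂) (b₀ , b₁ , b₂) =
        solve 7 (λ h a₀ a₁ a₂ b₀ b₁ b₂ → a₀ :* b₀ :+ h :* (a₁ :* b₂ :+ a₂ :* b₁) := b₀ :* a₀ :+ h :* (b₁ :* a₂ :+ b₂ :* a₁))
          refl h a₀ a₁ a₂ b₀ b₁ b₂
      , solve 7 (λ h a₀ a₁ a₂ b₀ b₁ b₂ → a₀ :* b₁ :+ a₁ :* b₀ :+ h :* (a₂ :* b₂) := b₀ :* a₁ :+ b₁ :* a₀ :+ h :* (b₂ :* a₂))
          refl h a₀ a₁ a₂ b₀ b₁ b₂
      , solve 6 (λ a₀ a₁ a₂ b₀ b₁ b₂ → a₀ :* b₂ :+ a₁ :* b₁ :+ a₂ :* b₀ := b₀ :* a₂ :+ b₁ :* a₁ :+ b₂ :* a₀)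
          refl a₀ a₁ a₂ b₀ b₁ b₂

    *³-distribˡ : ∀ a b c → a *³ (b +³ c) ≈³ a *³ b +³ a *³ c
    *³-distribˡ (a₀ , a₁ , a₂) (b₀ , b₁ , b₂) (c₀ , c₁ , c₂) =
        solve 10 (λ h a₀ a₁ a₂ b₀ b₁ b₂ c₀ c₁ c₂ →
            a₀ :* (b₀ :+ c₀) :+ h :* (a₁ :* (b₂ :+ c₂) :+ a₂ :* (b₁ :+ c₁))
            := a₀ :* b₀ :+ h :* (a₁ :* b₂ :+ a₂ :* b₁) :+ (a₀ :* c₀ :+ h :* (a₁ :* c₂ :+ a₂ :* c₁)))
          refl h a₀ a₁ a₂ b₀ b₁ b₂ c₀ c₁ c₂
      , solve 10 (λ h a₀ a₁ a₂ b₀ b₁ b₂ c₀ c₁ c₂ →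
            a₀ :* (b₁ :+ c₁) :+ a₁ :* (b₀ :+ c₀) :+ h :* (a₂ :* (b₂ :+ c₂))
            := a₀ :* b₁ :+ a₁ :* b₀ :+ h :* (a₂ :* b₂) :+ (a₀ :* c₁ :+ a₁ :* c₀ :+ h :* (a₂ :* c₂)))
          refl h a₀ a₁ a₂ b₀ b₁ b₂ c₀ c₁ c₂
      , solve 9 (λ a₀ a₁ a₂ b₀ b₁ b₂ c₀ c₁ c₂ →
            a₀ :* (b₂ :+ c₂) :+ a₁ :* (b₁ :+ c₁) :+ a₂ :* (b₀ :+ c₀)
            := a₀ :* b₂ :+ a₁ :* b₁ :+ a₂ :* b₀ :+ (a₀ :* c₂ :+ a₁ :* c₁ :+ a₂ :* c₀))
          refl a₀ a₁ a₂ b₀ b₁ b₂ c₀ c₁ c₂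

    scale-*³ : ∀ f g → ↑ f *³ g ≈³ (f * proj₁ g , f * proj₁ (proj₂ g) , f * proj₂ (proj₂ g))
    scale-*³ f (g₀ , g₁ , g₂) =
        solve 5 (λ f g₀ g₁ g₂ h → f :* g₀ :+ h :* (con 0₄ :* g₂ :+ con 0₄ :* g₁) := f :* g₀) refl f g₀ g₁ g₂ h
      , solve 5 (λ f g₀ g₁ g₂ h → f :* g₁ :+ con 0₄ :* g₀ :+ h :* (con 0₄ :* g₂) := f :* g₁) refl f g₀ g₁ g₂ h
      , solve 4 (λ f g₀ g₁ g₂ → f :* g₂ :+ con 0₄ :* g₁ :+ con 0₄ :* g₀ := f :* g₂) refl f g₀ g₁ g₂

    y-* : ∀ g → y *³ g ≈³ (h * proj₂ (proj₂ g) , proj₁ g , proj₁ (proj₂ g))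
    y-* (g₀ , g₁ , g₂) =
        solve 4 (λ g₀ g₁ g₂ h → con 0₄ :* g₀ :+ h :* (con 1₄ :* g₂ :+ con 0₄ :* g₁) := h :* g₂) refl g₀ g₁ g₂ h
      , solve 4 (λ g₀ g₁ g₂ h → con 0₄ :* g₁ :+ con 1₄ :* g₀ :+ h :* (con 0₄ :* g₂) := g₀) refl g₀ g₁ g₂ h
      , solve 3 (λ g₀ g₁ g₂ → con 0₄ :* g₂ :+ con 1₄ :* g₁ :+ con 0₄ :* g₀ := g₁) refl g₀ g₁ g₂

    *³-identityˡ : ∀ a → κ³ 1₄ *³ a ≈³ a
    *³-identityˡ (a₀ , a₁ , a₂) = let (p , q , r) = scale-*³ (κ 1₄) (a₀ , a₁ , a₂) in
      trans p (1* a₀) , trans q (1* a₁) , trans r (1* a₂)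
      where
      1* : ∀ a → κ 1₄ * a ≈ a
      1* a = trans (*-congʳ κ-1) (*-identityˡ a)

    ≈³-sym : ∀ {a b} → a ≈³ b → b ≈³ a
    ≈³-sym (p , q , r) = sym p , sym q , sym r

    ≈³-trans : ∀ {a b c} → a ≈³ b → b ≈³ c → a ≈³ c
    ≈³-trans (p , q , r) (p′ , q′ , r′) = trans p p′ , trans q q′ , trans r r′

    +³-cong : ∀ {a b c d} → a ≈³ b → c ≈³ d → a +³ c ≈³ b +³ d
    +³-cong (p , q , r) (p′ , q′ , r′) = +-cong p p′ , +-cong q q′ , +-cong r r′

    *³-cong : ∀ {a b c d} → a ≈³ b → c ≈³ d → a *³ c ≈³ b *³ d
    *³-cong (p , q , r) (p′ , q′ , r′) =
        +-cong (*-cong p p′) (*-congˡ (+-cong (*-cong q r′) (*-cong r q′)))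
      , +-cong (+-cong (*-cong p q′) (*-cong q p′)) (*-congˡ (*-cong r r′))
      , +-cong (+-cong (*-cong p r′) (*-cong q q′)) (*-cong r p′)

    κ0+ : ∀ a → κ 0₄ + a ≈ a
    κ0+ a = trans (+-congʳ κ-0) (+-identityˡ a)

    a+a : ∀ a → a + a ≈ κ 0₄
    a+a = solve 1 (λ a → a :+ a := con 0₄) refl

    algebra : F₄-Algebra
    algebra = record
      { commutativeRing = record
        { _≈_ = _≈³_ ; _+_ = _+³_ ; _*_ = _*³_ ; -_ = λ a → a ; 0# = κ³ 0₄ ; 1# = κ³ 1₄
        ; isCommutativeRing = record
          { isRing = record
            { +-isAbelianGroup = record
              { isGroup = record
                { isMonoid = record
                  { isSemigroup = record
                    { isMagma = record
                      { isEquivalence = record { refl = refl , refl , refl ; sym = ≈³-sym ; trans = ≈³-trans }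
                      ; ∙-cong = +³-cong }
                    ; assoc = λ _ _ _ → +-assoc _ _ _ , +-assoc _ _ _ , +-assoc _ _ _ }
                  ; identity = (λ _ → κ0+ _ , κ0+ _ , κ0+ _)
                             , (λ _ → trans (+-comm _ _) (κ0+ _) , trans (+-comm _ _) (κ0+ _) , trans (+-comm _ _) (κ0+ _)) }
                ; inverse = (λ _ → a+a _ , a+a _ , a+a _) , (λ _ → a+a _ , a+a _ , a+a _)
                ; ⁻¹-cong = λ p → p }
              ; comm = λ _ _ → +-comm _ _ , +-comm _ _ , +-comm _ _ }
            ; *-cong = *³-cong
            ; *-assoc = *³-assoc
            ; *-identity = *³-identityˡ , (λ a → ≈³-trans (*³-comm a (κ³ 1₄)) (*³-identityˡ a))
            ; distrib = *³-distribˡ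
                      , (λ a b c → ≈³-trans (*³-comm (b +³ c) a) (≈³-trans (*³-distribˡ a b c) (+³-cong (*³-comm a b) (*³-comm a c)))) }
          ; *-comm = *³-comm } }
      ; κ   = κ³
      ; κ-+ = λ a b → κ-+ a b , sym (κ0+ _) , sym (κ0+ _)
      ; κ-* = λ a b → ≈³-sym (≈³-trans (scale-*³ (κ a) (κ³ b))
                        (sym (κ-* a b) , *κ0 (κ a) , *κ0 (κ a)))
      ; κ-0 = refl , refl , refl
      ; κ-1 = refl , refl , refl
      }
      where
      *κ0 : ∀ a → a * κ 0₄ ≈ κ 0₄
      *κ0 = solve 1 (λ a → a :* con 0₄ := con 0₄) refl

    -- The product of f₀ + f₁ y + f₂ y² over the conjugates y, ω y, ω² y. The coefficient -3 of the
    -- mixed term is 1 in characteristic 2.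
    norm : Triple → Carrier
    norm (f₀ , f₁ , f₂) = f₀ * f₀ * f₀ + h * (f₁ * f₁ * f₁) + h * h * (f₂ * f₂ * f₂) + h * (f₀ * f₁ * f₂)

    norm-cong : ∀ {f g} → f ≈³ g → norm f ≈ norm g
    norm-cong (p , q , r) = +-cong (+-cong (+-cong (*-cong (*-cong p p) p)
      (*-congˡ (*-cong (*-cong q q) q))) (*-congˡ (*-cong (*-cong r r) r))) (*-congˡ (*-cong (*-cong p q) r))

    -- Multiplicativity for the factor y, which has norm h; it serves to cancel y from an element of
    -- norm zero.
    norm-y : ∀ f → norm (y *³ f) ≈ h * norm f
    norm-y f@(f₀ , f₁ , f₂) = trans (norm-cong (y-* f))
      (solve 4 (λ h f₀ f₁ f₂ →
          (h :* f₂) :* (h :* f₂) :* (h :* f₂) :+ h :* (f₀ :* f₀ :* f₀) :+ h :* h :* (f₁ :* f₁ :* f₁) :+ h :* ((h :* f₂) :* f₀ :* f₁)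
          := h :* (f₀ :* f₀ :* f₀ :+ h :* (f₁ :* f₁ :* f₁) :+ h :* h :* (f₂ :* f₂ :* f₂) :+ h :* (f₀ :* f₁ :* f₂)))
        refl h f₀ f₁ f₂)

-- Floors of the tower and local expansions.

module Evaluation where
  open FieldOfFour
  open PowerSeriesRing
  open CubicExtension

  -- X is the newest generator. In characteristic 2, `h` equals (X + p)³ + p³, the cube of the next
  -- one.
  record Stage : Set₁ where
    field algebra : F₄-Algebra
    open F₄-Algebra algebra public
    field p X : Carrier
    h : Carrier
    h = X * X * X + p * (X * X) + p * p * X

  next : Stage → Stage
  next S = record { algebra = Cubic.algebra S.algebra S.h ; p = Cubic.↑_ S.algebra S.h S.p ; X = Cubic.y S.algebra S.h }
    where module S = Stage S

  -- To be read as the local expansion at an F₄-rational place where t, a parameter on the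
  -- projective line, is still a local parameter.
  record Eval (K : F₄-Algebra) : Set where
    open F₄-Algebra K
    field
      ⟦_⟧    : Carrier → PowerSeries
      ⟦⟧-cong : ∀ {f g} → f ≈ g → ⟦ f ⟧ ≈ₚ ⟦ g ⟧
      ⟦⟧-+    : ∀ f g → ⟦ f + g ⟧ ≈ₚ ⟦ f ⟧ +ₚ ⟦ g ⟧
      ⟦⟧-*    : ∀ f g → ⟦ f * g ⟧ ≈ₚ ⟦ f ⟧ *ₚ ⟦ g ⟧
      ⟦⟧-κ    : ∀ a → ⟦ κ a ⟧ ≈ₚ constₚ a

  module _ {K : F₄-Algebra} (E : Eval K) (h : F₄-Algebra.Carrier K) where
    open F₄-Algebra K
    open Eval E
    open Cubic K h
    private module P = F₄-Algebra PS
    open AlgebraSolver PS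

    module _ (ρ : PowerSeries) (ρ³≈h : ρ *ₚ ρ *ₚ ρ ≈ₚ ⟦ h ⟧) where

      evalRoot : Triple → PowerSeries
      evalRoot (f₀ , f₁ , f₂) = ⟦ f₀ ⟧ +ₚ ρ *ₚ ⟦ f₁ ⟧ +ₚ ρ *ₚ ρ *ₚ ⟦ f₂ ⟧

      private
        *₁ : ∀ f₀ f₁ f₂ g₀ g₁ g₂ → ⟦ f₀ * g₀ + h * (f₁ * g₂ + f₂ * g₁) ⟧ ≈ₚ ⟦ f₀ ⟧ *ₚ ⟦ g₀ ⟧ +ₚ ρ *ₚ ρ *ₚ ρ *ₚ (⟦ f₁ ⟧ *ₚ ⟦ g₂ ⟧ +ₚ ⟦ f₂ ⟧ *ₚ ⟦ g₁ ⟧)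
        *₁ f₀ f₁ f₂ g₀ g₁ g₂ = P.trans (⟦⟧-+ _ _) (P.+-cong (⟦⟧-* f₀ g₀) (P.trans (⟦⟧-* _ _) (P.*-cong (P.sym ρ³≈h)
          (P.trans (⟦⟧-+ _ _) (P.+-cong (⟦⟧-* f₁ g₂) (⟦⟧-* f₂ g₁))))))

      extend : Eval algebra
      extend = record
        { ⟦_⟧ = evalRoot
        ; ⟦⟧-cong = λ (p , q , r) → P.+-cong (P.+-cong (⟦⟧-cong p) (P.*-congˡ {ρ} (⟦⟧-cong q))) (P.*-congˡ {ρ *ₚ ρ} (⟦⟧-cong r))
        ; ⟦⟧-+ = λ (f₀ , f₁ , f₂) (g₀ , g₁ , g₂) → P.trans
            (P.+-cong (P.+-cong (⟦⟧-+ f₀ g₀) (P.*-congˡ {ρ} (⟦⟧-+ f₁ g₁))) (P.*-congˡ {ρ *ₚ ρ} (⟦⟧-+ f₂ g₂)))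
            (solve 7 (λ ρ a b c d e f → (a :+ d) :+ ρ :* (b :+ e) :+ ρ :* ρ :* (c :+ f)
                := (a :+ ρ :* b :+ ρ :* ρ :* c) :+ (d :+ ρ :* e :+ ρ :* ρ :* f)) P.refl ρ ⟦ f₀ ⟧ ⟦ f₁ ⟧ ⟦ f₂ ⟧ ⟦ g₀ ⟧ ⟦ g₁ ⟧ ⟦ g₂ ⟧)
        ; ⟦⟧-* = λ (f₀ , f₁ , f₂) (g₀ , g₁ , g₂) → P.trans
            (P.+-cong (P.+-cong (*₁ f₀ f₁ f₂ g₀ g₁ g₂)
              (P.*-congˡ {ρ} (P.trans (⟦⟧-+ _ _) (P.+-cong (P.trans (⟦⟧-+ _ _) (P.+-cong (⟦⟧-* f₀ g₁) (⟦⟧-* f₁ g₀)))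
                (P.trans (⟦⟧-* _ _) (P.*-cong (P.sym ρ³≈h) (⟦⟧-* f₂ g₂)))))))
              (P.*-congˡ {ρ *ₚ ρ} (P.trans (⟦⟧-+ _ _) (P.+-cong (P.trans (⟦⟧-+ _ _) (P.+-cong (⟦⟧-* f₀ g₂) (⟦⟧-* f₁ g₁))) (⟦⟧-* f₂ g₀)))))
            (solve 7 (λ ρ a b c d e f → (a :* d :+ ρ :* ρ :* ρ :* (b :* f :+ c :* e)) :+ ρ :* (a :* e :+ b :* d :+ ρ :* ρ :* ρ :* (c :* f)) :+ ρ :* ρ :* (a :* f :+ b :* e :+ c :* d)
                := (a :+ ρ :* b :+ ρ :* ρ :* c) :* (d :+ ρ :* e :+ ρ :* ρ :* f)) P.refl ρ ⟦ f₀ ⟧ ⟦ f₁ ⟧ ⟦ f₂ ⟧ ⟦ g₀ ⟧ ⟦ g₁ ⟧ ⟦ g₂ ⟧)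
        ; ⟦⟧-κ = λ a → P.trans (P.+-cong (P.+-cong (⟦⟧-κ a) (P.*-congˡ {ρ} (⟦⟧-κ 0₄))) (P.*-congˡ {ρ *ₚ ρ} (⟦⟧-κ 0₄)))
            (solve 2 (λ a ρ → a :+ ρ :* con 0₄ :+ ρ :* ρ :* con 0₄ := a) P.refl (constₚ a) ρ)
        }

      eval-↑ : ∀ f → evalRoot (↑ f) ≈ₚ ⟦ f ⟧
      eval-↑ f = P.trans (P.+-cong (P.+-congˡ {⟦ f ⟧} (P.*-congˡ {ρ} (⟦⟧-κ 0₄))) (P.*-congˡ {ρ *ₚ ρ} (⟦⟧-κ 0₄)))
        (solve 2 (λ a ρ → a :+ ρ :* con 0₄ :+ ρ :* ρ :* con 0₄ := a) P.refl ⟦ f ⟧ ρ)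

      eval-y : evalRoot y ≈ₚ ρ
      eval-y = P.trans (P.+-cong (P.+-cong (⟦⟧-κ 0₄) (P.*-congˡ {ρ} (⟦⟧-κ 1₄))) (P.*-congˡ {ρ *ₚ ρ} (⟦⟧-κ 0₄)))
        (solve 1 (λ ρ → con 0₄ :+ ρ :* con 1₄ :+ ρ :* ρ :* con 0₄ := ρ) P.refl ρ)

    rotate : ∀ ζ ρ → ζ *₄ ζ *₄ ζ ≡ 1₄ → ρ *ₚ ρ *ₚ ρ ≈ₚ ⟦ h ⟧ → (constₚ ζ *ₚ ρ) *ₚ (constₚ ζ *ₚ ρ) *ₚ (constₚ ζ *ₚ ρ) ≈ₚ ⟦ h ⟧
    rotate ζ ρ ζ³≡1 ρ³≈h = P.trans
      (solve 2 (λ z r → (z :* r) :* (z :* r) :* (z :* r) := (z :* z :* z) :* (r :* r :* r)) P.refl (constₚ ζ) ρ)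
      (P.trans (P.*-cong ζ³≈1 ρ³≈h) (P.*-identityˡ ⟦ h ⟧))
      where
      ζ³≈1 : constₚ ζ *ₚ constₚ ζ *ₚ constₚ ζ ≈ₚ constₚ 1₄
      ζ³≈1 = P.trans (P.*-congʳ {constₚ ζ} (P.sym (P.κ-* ζ ζ))) (P.trans (P.sym (P.κ-* (ζ *₄ ζ) ζ)) (P.κ-cong ζ³≡1))

    module _ (ρ : PowerSeries) (ρ³≈h : ρ *ₚ ρ *ₚ ρ ≈ₚ ⟦ h ⟧) where

      conjugate : ∀ ζ → ζ *₄ ζ *₄ ζ ≡ 1₄ → Eval algebra
      conjugate ζ ζ³≡1 = extend (constₚ ζ *ₚ ρ) (rotate ζ ρ ζ³≡1 ρ³≈h)

      -- Once h is replaced by ρ³ the norm form factors over F₄. Thus the orders of f at the three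
      -- points above a point add up to a lower bound for the order of its norm.
      eval-norm : ∀ f → ⟦ norm f ⟧ ≈ₚ evalRoot (constₚ 1₄ *ₚ ρ) (rotate 1₄ ρ ≡.refl ρ³≈h) f
        *ₚ evalRoot (constₚ ω *ₚ ρ) (rotate ω ρ ≡.refl ρ³≈h) f *ₚ evalRoot (constₚ ω² *ₚ ρ) (rotate ω² ρ ≡.refl ρ³≈h) f
      eval-norm (f₀ , f₁ , f₂) = P.trans
        (P.trans (⟦⟧-+ _ _) (P.+-cong (P.trans (⟦⟧-+ _ _) (P.+-cong (P.trans (⟦⟧-+ _ _) (P.+-cong (cube f₀)
          (P.trans (⟦⟧-* _ _) (P.*-cong h≈ (cube f₁)))))
          (P.trans (⟦⟧-* _ _) (P.*-cong (P.trans (⟦⟧-* h h) (P.*-cong h≈ h≈)) (cube f₂)))))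
          (P.trans (⟦⟧-* _ _) (P.*-cong h≈ (P.trans (⟦⟧-* _ _) (P.*-congʳ {⟦ f₂ ⟧} (⟦⟧-* f₀ f₁)))))))
        (solve 4 (λ ρ a b c → let r = ρ :* ρ :* ρ in
            a :* a :* a :+ r :* (b :* b :* b) :+ r :* r :* (c :* c :* c) :+ r :* (a :* b :* c)
            := (a :+ (con 1₄ :* ρ) :* b :+ (con 1₄ :* ρ) :* (con 1₄ :* ρ) :* c)
               :* (a :+ (con ω :* ρ) :* b :+ (con ω :* ρ) :* (con ω :* ρ) :* c)
               :* (a :+ (con ω² :* ρ) :* b :+ (con ω² :* ρ) :* (con ω² :* ρ) :* c))
          P.refl ρ ⟦ f₀ ⟧ ⟦ f₁ ⟧ ⟦ f₂ ⟧)
        where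
        h≈ : ⟦ h ⟧ ≈ₚ ρ *ₚ ρ *ₚ ρ
        h≈ = P.sym ρ³≈h
        cube : ∀ f → ⟦ f * f * f ⟧ ≈ₚ ⟦ f ⟧ *ₚ ⟦ f ⟧ *ₚ ⟦ f ⟧
        cube f = P.trans (⟦⟧-* (f * f) f) (P.*-congʳ {⟦ f ⟧} (⟦⟧-* f f))

-- Places over p = 0 and over q = 0.

module Places where
  open FieldOfFour
  open PowerSeriesRing
  open CubicExtension
  open Evaluation
  open import Data.List.Base as List using (List; []; _∷_; length)
  open import Data.List.Relation.Unary.All as All using (All; _∷_)
  open import Data.Nat.Solver using (module +-*-Solver)
  open import Data.Unit.Base using (tt)
  open import Relation.Nullary.Decidable using (toWitness)

  private module P = F₄-Algebra PS

  -- A point of the fibre p = 0, which splits completely.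
  record SplitPoint (S : Stage) : Set where
    open Stage S
    field
      eval : Eval algebra
    open Eval eval public
    field
      p-const : ⟦ p ⟧ 0 ≡ 0₄
      X-const : ⟦ X ⟧ 0 ≢ 0₄

  opaque
    unfolding _*ₚ_

    h-at-0 : ∀ x p → (x *ₚ x *ₚ x +ₚ p *ₚ (x *ₚ x) +ₚ p *ₚ p *ₚ x) 0 ≡
      x 0 *₄ x 0 *₄ x 0 +₄ p 0 *₄ (x 0 *₄ x 0) +₄ p 0 *₄ p 0 *₄ x 0
    h-at-0 x p = ≡.refl

    cubic-at-0 : ∀ x → (x *ₚ x *ₚ x +ₚ x *ₚ x +ₚ x) 0 ≡ x 0 *₄ x 0 *₄ x 0 +₄ x 0 *₄ x 0 +₄ x 0
    cubic-at-0 x = ≡.refl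

    quadratic-at-0 : ∀ x → (x *ₚ x +ₚ x +ₚ constₚ 1₄) 0 ≡ x 0 *₄ x 0 +₄ x 0 +₄ 1₄
    quadratic-at-0 x = ≡.refl

  module _ {S : Stage} where
    open Stage S

    ⟦h⟧ : (E : Eval algebra) → let open Eval E in
      ⟦ h ⟧ ≈ₚ ⟦ X ⟧ *ₚ ⟦ X ⟧ *ₚ ⟦ X ⟧ +ₚ ⟦ p ⟧ *ₚ (⟦ X ⟧ *ₚ ⟦ X ⟧) +ₚ ⟦ p ⟧ *ₚ ⟦ p ⟧ *ₚ ⟦ X ⟧
    ⟦h⟧ E = P.trans (⟦⟧-+ _ _) (P.+-cong (P.trans (⟦⟧-+ _ _) (P.+-cong
        (P.trans (⟦⟧-* _ _) (P.*-congʳ {⟦ X ⟧} (⟦⟧-* X X)))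
        (P.trans (⟦⟧-* _ _) (P.*-congˡ {⟦ p ⟧} (⟦⟧-* X X)))))
        (P.trans (⟦⟧-* _ _) (P.*-congʳ {⟦ X ⟧} (⟦⟧-* p p))))
      where open Eval E

  module _ {S : Stage} (z : SplitPoint S) where
    open Stage S
    open SplitPoint z

    -- Where p vanishes, h reduces to X³, and the cube of a unit of F₄ is 1. Hence h has three cube
    -- roots with coefficients in F₄, and each point has three points above it.
    split-h-const : ⟦ h ⟧ 0 ≡ 1₄
    split-h-const = ≡.trans (⟦h⟧ {S} eval 0) (≡.trans
      (h-at-0 ⟦ X ⟧ ⟦ p ⟧) (≡.trans (cong (λ a → ⟦ X ⟧ 0 *₄ ⟦ X ⟧ 0 *₄ ⟦ X ⟧ 0 +₄ a *₄ (⟦ X ⟧ 0 *₄ ⟦ X ⟧ 0) +₄ a *₄ a *₄ ⟦ X ⟧ 0) p-const)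
      (≡.trans (vanish (⟦ X ⟧ 0)) (cube₄ (⟦ X ⟧ 0) X-const))))
      where
      vanish : ∀ x → x *₄ x *₄ x +₄ 0₄ *₄ (x *₄ x) +₄ 0₄ *₄ 0₄ *₄ x ≡ x *₄ x *₄ x
      vanish = toWitness {a? = all₄? λ x → (x *₄ x *₄ x +₄ 0₄ *₄ (x *₄ x) +₄ 0₄ *₄ 0₄ *₄ x) ≟₄ (x *₄ x *₄ x)} tt

    open CubeRoot ⟦ h ⟧ split-h-const

    splitAbove : ∀ ζ → ζ *₄ ζ *₄ ζ ≡ 1₄ → ζ ≢ 0₄ → SplitPoint (next S)
    splitAbove ζ ζ³≡1 ζ≢0 = record
      { eval = E
      ; p-const = ≡.trans (eval-↑ {algebra} eval h _ ρ³ p 0) p-const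
      ; X-const = λ eq → ζ≢0 (≡.trans (≡.sym (≡.trans (eval-y {algebra} eval h _ ρ³ 0)
          (≡.trans (*ₚ-0 (constₚ ζ) cbrt) (≡.trans (cong (ζ *₄_) cbrt-0) (≡.trans (*₄-comm ζ 1₄) (*₄-identityˡ ζ)))))) eq)
      }
      where
      ρ³ : (constₚ ζ *ₚ cbrt) *ₚ (constₚ ζ *ₚ cbrt) *ₚ (constₚ ζ *ₚ cbrt) ≈ₚ ⟦ h ⟧
      ρ³ = rotate {algebra} eval h ζ cbrt ζ³≡1 cbrt³
      E = conjugate {algebra} eval h cbrt cbrt³ ζ ζ³≡1

    split-norm : let open Cubic algebra h in ∀ f → ⟦ norm f ⟧ ≈ₚ
      SplitPoint.⟦_⟧ (splitAbove 1₄ ≡.refl λ ()) f *ₚ SplitPoint.⟦_⟧ (splitAbove ω ≡.refl λ ()) f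
        *ₚ SplitPoint.⟦_⟧ (splitAbove ω² ≡.refl λ ()) f
    split-norm = eval-norm {algebra} eval h cbrt cbrt³

  -- The place p = 1, X₀ = ... = Xₙ = 1 of the bad fibre, with X + p of order m.
  record UnitPlace (S : Stage) (m : ℕ) : Set where
    open Stage S
    field
      eval : Eval algebra
    open Eval eval public
    field
      p≈1     : ⟦ p ⟧ ≈ₚ constₚ 1₄
      X-const : ⟦ X ⟧ 0 ≡ 1₄
      X+1-div : Div m (⟦ X ⟧ +ₚ constₚ 1₄)

  -- Linear over F₂ only, because vectors of bits will index rows and columns.
  record Functional (K : F₄-Algebra) : Set where
    open F₄-Algebra K
    field
      fn       : Carrier → Bool
      fn-cong  : ∀ {f g} → f ≈ g → fn f ≡ fn g
      additive : ∀ f g → fn (f + g) ≡ fn f xor fn g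

  Vanish : ∀ {K} → List (Functional K) → F₄-Algebra.Carrier K → Set
  Vanish ℓs f = All (λ ℓ → Functional.fn ℓ f ≡ false) ℓs

  coefficientTests : ∀ {K} → Eval K → ℕ → List (Functional K)
  coefficientTests E zero    = []
  coefficientTests E (suc a) =
      record { fn = λ f → lo (⟦ f ⟧ a) ; fn-cong = λ p → cong lo (⟦⟧-cong p a)
             ; additive = λ f g → ≡.trans (cong lo (≡.trans (⟦⟧-+ f g a) (+ₚ-at ⟦ f ⟧ ⟦ g ⟧ a))) (lo-+ (⟦ f ⟧ a) (⟦ g ⟧ a)) }
    ∷ record { fn = λ f → hi (⟦ f ⟧ a) ; fn-cong = λ p → cong hi (⟦⟧-cong p a)
             ; additive = λ f g → ≡.trans (cong hi (≡.trans (⟦⟧-+ f g a) (+ₚ-at ⟦ f ⟧ ⟦ g ⟧ a))) (hi-+ (⟦ f ⟧ a) (⟦ g ⟧ a)) }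
    ∷ coefficientTests E a
    where open Eval E

  coefficientTests-sound : ∀ {K} (E : Eval K) a {f} → Vanish (coefficientTests E a) f → Div a (Eval.⟦_⟧ E f)
  coefficientTests-sound E (suc a) (u ∷ v ∷ vs) i (s≤s i≤a) with ℕ.m≤n⇒m<n∨m≡n i≤a
  ... | inj₁ i<a    = coefficientTests-sound E a vs i i<a
  ... | inj₂ ≡.refl = lo-hi-injective u v

  length-coefficientTests : ∀ {K} (E : Eval K) a → length (coefficientTests E a) ≡ 2 ℕ.* a
  length-coefficientTests E zero    = ≡.refl
  length-coefficientTests E (suc a) = ≡.trans (cong (2 ℕ.+_) (length-coefficientTests E a))
    (solve 1 (λ a → con 2 :+ con 2 :* a := con 2 :* (con 1 :+ a)) ≡.refl a)
    where open +-*-Solver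

  -- Vanishing to order a along a set of places, as a multiplicative filtration. The linear
  -- conditions `tests a` imply membership in `Fil a`, so their number bounds its codimension.
  record Filtration (S : Stage) : Set₁ where
    open Stage S
    field
      Fil      : ℕ → Carrier → Set
      Fil-resp : ∀ {a f g} → f ≈ g → Fil a f → Fil a g
      Fil-mono : ∀ {a b f} → a ℕ.≤ b → Fil b f → Fil a f
      Fil-zero : ∀ a → Fil a (κ 0₄)
      Fil-0    : ∀ f → Fil 0 f
      Fil-+    : ∀ {a f g} → Fil a f → Fil a g → Fil a (f + g)
      Fil-*    : ∀ a b {f g} → Fil a f → Fil b g → Fil (a ℕ.+ b) (f * g)
      tests    : ℕ → List (Functional algebra)
      sound    : ∀ a {f} → Vanish (tests a) f → Fil a f

  evalFiltration : ∀ {S} → Eval (Stage.algebra S) → Filtration S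
  evalFiltration E = record
    { Fil = λ a f → Div a ⟦ f ⟧
    ; Fil-resp = λ f≈g → Div-resp (⟦⟧-cong f≈g)
    ; Fil-mono = λ a≤b → Div-mono a≤b
    ; Fil-zero = λ a i _ → ≡.trans (⟦⟧-κ 0₄ i) (P.κ-0 i)
    ; Fil-0 = λ _ _ ()
    ; Fil-+ = λ {a} {f} {g} d e → Div-resp (P.sym (⟦⟧-+ f g)) (Div-+ d e)
    ; Fil-* = λ a b {f} {g} d e → Div-resp (P.sym (⟦⟧-* f g)) (Div-* a b d e)
    ; tests = coefficientTests E
    ; sound = coefficientTests-sound E
    }
    where open Eval E

  module _ {S : Stage} {m : ℕ} (u : UnitPlace S m) where
    open Stage S
    open UnitPlace u
    open AlgebraSolver PS
    private
      x : PowerSeries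
      x = ⟦ X ⟧

    unit-h : ⟦ h ⟧ ≈ₚ x *ₚ x *ₚ x +ₚ x *ₚ x +ₚ x
    unit-h = P.trans (⟦h⟧ {S} eval) (P.trans
      (P.+-cong (P.+-congˡ {x *ₚ x *ₚ x} (P.*-congʳ {x *ₚ x} p≈1)) (P.*-congʳ {x} (P.*-cong p≈1 p≈1)))
      (solve 1 (λ x → x :* x :* x :+ con 1₄ :* (x :* x) :+ con 1₄ :* con 1₄ :* x := x :* x :* x :+ x :* x :+ x) P.refl x))

    unit-h-const : ⟦ h ⟧ 0 ≡ 1₄
    unit-h-const = ≡.trans (unit-h 0) (≡.trans (cubic-at-0 x) (cong (λ a → a *₄ a *₄ a +₄ a *₄ a +₄ a) X-const))

    open CubeRoot ⟦ h ⟧ unit-h-const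

    -- h + 1 = (x + 1)³ and w³ + 1 = (w + 1) (w² + w + 1), where w² + w + 1 is
    -- a unit for a cube root w of h with constant term 1.
    private
      quadratic-const : (cbrt *ₚ cbrt +ₚ cbrt +ₚ constₚ 1₄) 0 ≢ 0₄
      quadratic-const eq = contradiction
        (≡.trans (≡.sym (≡.trans (quadratic-at-0 cbrt) (cong (λ a → a *₄ a +₄ a +₄ 1₄) cbrt-0))) eq) λ ()

      factor₁ : (cbrt +ₚ constₚ 1₄) *ₚ (cbrt *ₚ cbrt +ₚ cbrt +ₚ constₚ 1₄) ≈ₚ cbrt *ₚ cbrt *ₚ cbrt +ₚ constₚ 1₄
      factor₁ = solve 1 (λ w → (w :+ con 1₄) :* (w :* w :+ w :+ con 1₄) := w :* w :* w :+ con 1₄) P.refl cbrt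

      factor₂ : cbrt *ₚ cbrt *ₚ cbrt +ₚ constₚ 1₄ ≈ₚ x *ₚ x *ₚ x +ₚ x *ₚ x +ₚ x +ₚ constₚ 1₄
      factor₂ = P.+-congʳ {constₚ 1₄} (P.trans cbrt³ unit-h)

      factor₃ : x *ₚ x *ₚ x +ₚ x *ₚ x +ₚ x +ₚ constₚ 1₄ ≈ₚ (x +ₚ constₚ 1₄) *ₚ (x +ₚ constₚ 1₄) *ₚ (x +ₚ constₚ 1₄)
      factor₃ = solve 1 (λ x → x :* x :* x :+ x :* x :+ x :+ con 1₄ := (x :+ con 1₄) :* (x :+ con 1₄) :* (x :+ con 1₄)) P.refl x

      cube-div : Div (m ℕ.+ m ℕ.+ m) ((cbrt +ₚ constₚ 1₄) *ₚ (cbrt *ₚ cbrt +ₚ cbrt +ₚ constₚ 1₄))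
      cube-div = Div-resp (P.sym (P.trans factor₁ (P.trans factor₂ factor₃)))
        (Div-* (m ℕ.+ m) m (Div-* m m X+1-div X+1-div) X+1-div)

    triple : m ℕ.+ m ℕ.+ m ≡ 3 ℕ.* m
    triple = ≡.trans (ℕ.+-assoc m m m) (cong (λ k → m ℕ.+ (m ℕ.+ k)) (≡.sym (ℕ.+-identityʳ m)))

    cbrt+1-div : Div (3 ℕ.* m) (cbrt +ₚ constₚ 1₄)
    cbrt+1-div = subst (λ k → Div k (cbrt +ₚ constₚ 1₄)) triple
      (Div-cancel (m ℕ.+ m ℕ.+ m) {cbrt +ₚ constₚ 1₄} {cbrt *ₚ cbrt +ₚ cbrt +ₚ constₚ 1₄} quadratic-const cube-div)

    private
      E : ∀ ζ → ζ *₄ ζ *₄ ζ ≡ 1₄ → Eval (Stage.algebra (next S))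
      E ζ ζ³≡1 = conjugate {algebra} eval h cbrt cbrt³ ζ ζ³≡1

      E-y : ∀ ζ ζ³≡1 → Eval.⟦_⟧ (E ζ ζ³≡1) (Stage.X (next S)) ≈ₚ constₚ ζ *ₚ cbrt
      E-y ζ ζ³≡1 = eval-y {algebra} eval h (constₚ ζ *ₚ cbrt) (rotate {algebra} eval h ζ cbrt ζ³≡1 cbrt³)

      E-p : ∀ ζ ζ³≡1 → Eval.⟦_⟧ (E ζ ζ³≡1) (Stage.p (next S)) ≈ₚ constₚ 1₄
      E-p ζ ζ³≡1 = P.trans (eval-↑ {algebra} eval h (constₚ ζ *ₚ cbrt) (rotate {algebra} eval h ζ cbrt ζ³≡1 cbrt³) p) p≈1

      y≈ : Eval.⟦_⟧ (E 1₄ ≡.refl) (Stage.X (next S)) ≈ₚ cbrt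
      y≈ = P.trans (E-y 1₄ ≡.refl) (P.*-identityˡ cbrt)

      y+1-div : Div (3 ℕ.* m) (Eval.⟦_⟧ (E 1₄ ≡.refl) (Stage.X (next S)) +ₚ constₚ 1₄)
      y+1-div = Div-resp (P.+-congʳ {constₚ 1₄} {cbrt} (P.sym y≈)) cbrt+1-div

    unitAbove : UnitPlace (next S) (3 ℕ.* m)
    unitAbove = record
      { eval = E 1₄ ≡.refl
      ; p≈1 = E-p 1₄ ≡.refl
      ; X-const = ≡.trans (y≈ 0) cbrt-0
      ; X+1-div = y+1-div
      }

    -- For ζ = ω and ζ = ω² these are the two places over the unit place at which X leaves the value
    -- 1.
    twisted : ∀ ζ → ζ *₄ ζ *₄ ζ ≡ 1₄ → Filtration (next S)
    twisted ζ ζ³≡1 = evalFiltration (E ζ ζ³≡1)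

    unit-norm : let open Cubic algebra h in ∀ f → ⟦ norm f ⟧ ≈ₚ UnitPlace.⟦_⟧ unitAbove f
      *ₚ Eval.⟦_⟧ (E ω ≡.refl) f *ₚ Eval.⟦_⟧ (E ω² ≡.refl) f
    unit-norm = eval-norm {algebra} eval h cbrt cbrt³

    -- Above the unit place lie the next unit place and two twisted places, each of which
    -- contributes T to the order of the norm.
    unit-cond-norm : ∀ T f → Div T (UnitPlace.⟦_⟧ unitAbove f) →
      Div T (Eval.⟦_⟧ (E ω ≡.refl) f) → Div T (Eval.⟦_⟧ (E ω² ≡.refl) f) → Div (3 ℕ.* T) ⟦ Cubic.norm algebra h f ⟧
    unit-cond-norm T f d₁ d₂ d₃ = subst (λ k → Div k ⟦ Cubic.norm algebra h f ⟧)
      (≡.trans (ℕ.+-assoc T T T) (cong (λ k → T ℕ.+ (T ℕ.+ k)) (≡.sym (ℕ.+-identityʳ T))))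
      (Div-resp (P.sym (unit-norm f)) (Div-* (T ℕ.+ T) T (Div-* T T d₁ d₂) d₃))

    -- With X = ζ w, the factor X + ζ of h = X (X² + X + 1) is ζ (w + 1) for ζ ≠ 1.
    twisted-h : ∀ ζ (ζ³≡1 : ζ *₄ ζ *₄ ζ ≡ 1₄) → ζ *₄ ζ +₄ ζ ≡ 1₄ → Filtration.Fil (twisted ζ ζ³≡1) (3 ℕ.* m) (Stage.h (next S))
    twisted-h ζ ζ³≡1 ζ²+ζ≡1 = Div-resp (P.sym h≈) (Div-*ʳ (constₚ ζ *ₚ ζw *ₚ (ζw +ₚ constₚ ζ +ₚ constₚ 1₄)) cbrt+1-div)
      where
      module E′ = Eval (E ζ ζ³≡1)
      ζw : PowerSeries
      ζw = constₚ ζ *ₚ cbrt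
      one≈ : constₚ 1₄ ≈ₚ constₚ ζ *ₚ constₚ ζ +ₚ constₚ ζ
      one≈ = P.trans (P.κ-cong (≡.sym ζ²+ζ≡1)) (P.trans (P.κ-+ (ζ *₄ ζ) ζ) (P.+-congʳ {constₚ ζ} (P.κ-* ζ ζ)))
      y≈′ : E′.⟦ Stage.X (next S) ⟧ ≈ₚ ζw
      y≈′ = E-y ζ ζ³≡1
      p≈ : E′.⟦ Stage.p (next S) ⟧ ≈ₚ constₚ 1₄
      p≈ = E-p ζ ζ³≡1
      h≈₁ : E′.⟦ Stage.h (next S) ⟧ ≈ₚ ζw *ₚ ζw *ₚ ζw +ₚ constₚ 1₄ *ₚ (ζw *ₚ ζw) +ₚ constₚ 1₄ *ₚ (constₚ ζ *ₚ constₚ ζ +ₚ constₚ ζ) *ₚ ζw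
      h≈₁ = P.trans (⟦h⟧ {next S} (E ζ ζ³≡1))
        (P.+-cong (P.+-cong (P.*-cong (P.*-cong y≈′ y≈′) y≈′) (P.*-cong p≈ (P.*-cong y≈′ y≈′))) (P.*-cong (P.*-cong p≈ (P.trans p≈ one≈)) y≈′))
      h≈₂ : ζw *ₚ ζw *ₚ ζw +ₚ constₚ 1₄ *ₚ (ζw *ₚ ζw) +ₚ constₚ 1₄ *ₚ (constₚ ζ *ₚ constₚ ζ +ₚ constₚ ζ) *ₚ ζw
        ≈ₚ constₚ ζ *ₚ ζw *ₚ (ζw +ₚ constₚ ζ +ₚ constₚ 1₄) *ₚ (cbrt +ₚ constₚ 1₄)
      h≈₂ = solve 2 (λ z w → let q = z :* w in q :* q :* q :+ con 1₄ :* (q :* q) :+ con 1₄ :* (z :* z :+ z) :* q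
          := z :* q :* (q :+ z :+ con 1₄) :* (w :+ con 1₄)) P.refl (constₚ ζ) cbrt
      h≈ : E′.⟦ Stage.h (next S) ⟧ ≈ₚ constₚ ζ *ₚ ζw *ₚ (ζw +ₚ constₚ ζ +ₚ constₚ 1₄) *ₚ (cbrt +ₚ constₚ 1₄)
      h≈ = P.trans h≈₁ h≈₂

-- Filtrations above a place where h vanishes.

module WeightedFiltration where
  open FieldOfFour
  open CubicExtension
  open Evaluation
  open Places
  open import Data.List.Base as List using (_++_; map)
  import Data.List.Relation.Unary.All.Properties as All
  open import Data.Nat.Base using (_∸_)
  open import Data.Nat.Solver using (module +-*-Solver)

  module _ {K : F₄-Algebra} {h : F₄-Algebra.Carrier K} where
    open Cubic K h
    open Functional

    component₀ component₁ component₂ : Functional K → Functional algebra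
    component₀ ℓ = record { fn = λ f → fn ℓ (proj₁ f) ; fn-cong = λ p → fn-cong ℓ (proj₁ p) ; additive = λ f g → additive ℓ (proj₁ f) (proj₁ g) }
    component₁ ℓ = record { fn = λ f → fn ℓ (proj₁ (proj₂ f)) ; fn-cong = λ p → fn-cong ℓ (proj₁ (proj₂ p))
                          ; additive = λ f g → additive ℓ (proj₁ (proj₂ f)) (proj₁ (proj₂ g)) }
    component₂ ℓ = record { fn = λ f → fn ℓ (proj₂ (proj₂ f)) ; fn-cong = λ p → fn-cong ℓ (proj₂ (proj₂ p))
                          ; additive = λ f g → additive ℓ (proj₂ (proj₂ f)) (proj₂ (proj₂ g)) }

  ∸-lower₁ : ∀ a w → a ℕ.≤ w ℕ.+ (a ∸ w)
  ∸-lower₁ a w = ℕ.m≤n+m∸n a w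

  ∸-lower₂ : ∀ a w → a ℕ.≤ w ℕ.+ (w ℕ.+ (a ∸ w ∸ w))
  ∸-lower₂ a w = ℕ.≤-trans (∸-lower₁ a w) (ℕ.+-monoʳ-≤ w (∸-lower₁ (a ∸ w) w))

  open +-*-Solver using (solve; _:+_; _:*_; _:=_; con)

  -- The weighted filtration a ↦ { f : fᵢ ∈ Fil (a - i w) } of the cubic
  -- extension is multiplicative as soon as h ∈ Fil (3 w).
  module Above {S : Stage} (F : Filtration S) (w : ℕ) (h∈ : Filtration.Fil F (3 ℕ.* w) (Stage.h S)) where
    open Stage S
    open Filtration F
    open Cubic algebra h using (Triple; norm)

    Fil′ : ℕ → Triple → Set
    Fil′ a (f₀ , f₁ , f₂) = Fil a f₀ × Fil (a ∸ w) f₁ × Fil (a ∸ w ∸ w) f₂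

    private
      raise : ∀ {a b f} → b ℕ.≤ a → Fil a f → Fil b f
      raise = Fil-mono

      bound : ∀ {m n k} → m ℕ.≤ n → n ≡ k → m ℕ.≤ k
      bound m≤n ≡.refl = m≤n

      below₁ : ∀ {m n} → m ℕ.≤ w ℕ.+ n → m ∸ w ℕ.≤ n
      below₁ {m} = ℕ.m≤n+o⇒m∸n≤o m w

      below₂ : ∀ {m n} → m ℕ.≤ w ℕ.+ (w ℕ.+ n) → m ∸ w ∸ w ℕ.≤ n
      below₂ h = below₁ (below₁ h)

    module _ (a b : ℕ) where
      private
        a₁ = a ∸ w
        a₂ = a ∸ w ∸ w
        b₁ = b ∸ w
        b₂ = b ∸ w ∸ w
        A₁ = ∸-lower₁ a w
        A₂ = ∸-lower₂ a w
        B₁ = ∸-lower₁ b w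
        B₂ = ∸-lower₂ b w

      -- A product whose exponent of y reaches 3 or 4 is reduced at the price of a factor h, and the
      -- weight 3 w of h makes up exactly for the three lost powers of y.
      Fil′-* : ∀ {f g} → Fil′ a f → Fil′ b g → Fil′ (a ℕ.+ b) (Cubic._*³_ algebra h f g)
      Fil′-* (f₀ , f₁ , f₂) (g₀ , g₁ , g₂) =
          Fil-+ (Fil-* a b f₀ g₀) (Fil-resp (sym (distribˡ h _ _)) (Fil-+
            (raise (bound (ℕ.+-mono-≤ A₁ B₂) (solve 3 (λ w a b → (w :+ a) :+ (w :+ (w :+ b)) := con 3 :* w :+ (a :+ b)) ≡.refl w a₁ b₂))
              (Fil-* (3 ℕ.* w) (a₁ ℕ.+ b₂) h∈ (Fil-* a₁ b₂ f₁ g₂)))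
            (raise (bound (ℕ.+-mono-≤ A₂ B₁) (solve 3 (λ w a b → (w :+ (w :+ a)) :+ (w :+ b) := con 3 :* w :+ (a :+ b)) ≡.refl w a₂ b₁))
              (Fil-* (3 ℕ.* w) (a₂ ℕ.+ b₁) h∈ (Fil-* a₂ b₁ f₂ g₁)))))
        , Fil-+ (Fil-+
            (raise (below₁ (bound (ℕ.+-monoʳ-≤ a B₁) (solve 3 (λ w a b → a :+ (w :+ b) := w :+ (a :+ b)) ≡.refl w a b₁)))
              (Fil-* a b₁ f₀ g₁))
            (raise (below₁ (bound (ℕ.+-monoˡ-≤ b A₁) (solve 3 (λ w a b → (w :+ a) :+ b := w :+ (a :+ b)) ≡.refl w a₁ b)))
              (Fil-* a₁ b f₁ g₀)))
            (raise (below₁ (bound (ℕ.+-mono-≤ A₂ B₂) (solve 3 (λ w a b → (w :+ (w :+ a)) :+ (w :+ (w :+ b)) := w :+ (con 3 :* w :+ (a :+ b))) ≡.refl w a₂ b₂)))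
              (Fil-* (3 ℕ.* w) (a₂ ℕ.+ b₂) h∈ (Fil-* a₂ b₂ f₂ g₂)))
        , Fil-+ (Fil-+
            (raise (below₂ (bound (ℕ.+-monoʳ-≤ a B₂) (solve 3 (λ w a b → a :+ (w :+ (w :+ b)) := w :+ (w :+ (a :+ b))) ≡.refl w a b₂)))
              (Fil-* a b₂ f₀ g₂))
            (raise (below₂ (bound (ℕ.+-mono-≤ A₁ B₁) (solve 3 (λ w a b → (w :+ a) :+ (w :+ b) := w :+ (w :+ (a :+ b))) ≡.refl w a₁ b₁)))
              (Fil-* a₁ b₁ f₁ g₁)))
            (raise (below₂ (bound (ℕ.+-monoˡ-≤ b A₂) (solve 3 (λ w a b → (w :+ (w :+ a)) :+ b := w :+ (w :+ (a :+ b))) ≡.refl w a₂ b)))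
              (Fil-* a₂ b f₂ g₀))

    -- With weight w for y and 3 w for h all monomials of the norm have weight at least 3 a;
    -- truncation of a - i w at 0 can only raise a weight.
    Fil-norm : ∀ a {f} → Fil′ a f → Fil (3 ℕ.* a) (norm f)
    Fil-norm a {f₀ , f₁ , f₂} (d₀ , d₁ , d₂) = Fil-+ (Fil-+ (Fil-+
        (raise (ℕ.≤-reflexive (solve 1 (λ a → con 3 :* a := a :+ a :+ a) ≡.refl a)) (cube a d₀))
        (raise (bound (ℕ.*-monoʳ-≤ 3 (∸-lower₁ a w)) (solve 2 (λ w a → con 3 :* (w :+ a) := con 3 :* w :+ (a :+ a :+ a)) ≡.refl w a₁))
          (Fil-* (3 ℕ.* w) (a₁ ℕ.+ a₁ ℕ.+ a₁) h∈ (cube a₁ d₁))))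
        (raise (bound (ℕ.*-monoʳ-≤ 3 (∸-lower₂ a w)) (solve 2 (λ w a → con 3 :* (w :+ (w :+ a)) := con 3 :* w :+ con 3 :* w :+ (a :+ a :+ a)) ≡.refl w a₂))
          (Fil-* (3 ℕ.* w ℕ.+ 3 ℕ.* w) (a₂ ℕ.+ a₂ ℕ.+ a₂) (Fil-* (3 ℕ.* w) (3 ℕ.* w) h∈ h∈) (cube a₂ d₂))))
        (raise (bound (ℕ.≤-trans (ℕ.≤-reflexive (solve 1 (λ a → con 3 :* a := a :+ a :+ a) ≡.refl a)) (ℕ.+-mono-≤ (ℕ.+-monoʳ-≤ a (∸-lower₁ a w)) (∸-lower₂ a w))) (solve 4 (λ w a a₁ a₂ → a :+ (w :+ a₁) :+ (w :+ (w :+ a₂)) := con 3 :* w :+ (a :+ a₁ :+ a₂)) ≡.refl w a a₁ a₂))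
          (Fil-* (3 ℕ.* w) (a ℕ.+ a₁ ℕ.+ a₂) h∈ (Fil-* (a ℕ.+ a₁) a₂ (Fil-* a a₁ d₀ d₁) d₂)))
      where
      a₁ = a ∸ w
      a₂ = a ∸ w ∸ w
      cube : ∀ b {f} → Fil b f → Fil (b ℕ.+ b ℕ.+ b) (f * f * f)
      cube b d = Fil-* (b ℕ.+ b) b (Fil-* b b d d) d

    above : Filtration (next S)
    above = record
      { Fil = Fil′
      ; Fil-resp = λ (p , q , r) (d₀ , d₁ , d₂) → Fil-resp p d₀ , Fil-resp q d₁ , Fil-resp r d₂
      ; Fil-mono = λ a≤b (d₀ , d₁ , d₂) → raise a≤b d₀ , raise (ℕ.∸-monoˡ-≤ w a≤b) d₁ , raise (ℕ.∸-monoˡ-≤ w (ℕ.∸-monoˡ-≤ w a≤b)) d₂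
      ; Fil-zero = λ a → Fil-zero a , Fil-zero (a ∸ w) , Fil-zero (a ∸ w ∸ w)
      ; Fil-0 = λ (f₀ , f₁ , f₂) → Fil-0 f₀ , raise (ℕ.m∸n≤m 0 w) (Fil-0 f₁) , raise (ℕ.≤-trans (ℕ.m∸n≤m (0 ∸ w) w) (ℕ.m∸n≤m 0 w)) (Fil-0 f₂)
      ; Fil-+ = λ (d₀ , d₁ , d₂) (e₀ , e₁ , e₂) → Fil-+ d₀ e₀ , Fil-+ d₁ e₁ , Fil-+ d₂ e₂
      ; Fil-* = Fil′-*
      ; tests = λ a → map (component₀ {algebra} {h}) (tests a) ++ (map (component₁ {algebra} {h}) (tests (a ∸ w)) ++ map (component₂ {algebra} {h}) (tests (a ∸ w ∸ w)))
      ; sound = λ a vs →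
          let vs₀ , vs₁₂ = All.++⁻ (map (component₀ {algebra} {h}) (tests a)) vs
              vs₁ , vs₂ = All.++⁻ (map (component₁ {algebra} {h}) (tests (a ∸ w))) vs₁₂
          in sound a (All.map⁻ {f = component₀ {algebra} {h}} vs₀) , sound (a ∸ w) (All.map⁻ {f = component₁ {algebra} {h}} vs₁) , sound (a ∸ w ∸ w) (All.map⁻ {f = component₂ {algebra} {h}} vs₂)
      }

    private module S′ = Stage (next S)
    private module F′ = Filtration above

    X∈ : F′.Fil w S′.X
    X∈ = Fil-zero w , raise (ℕ.≤-reflexive (ℕ.n∸n≡0 w)) (Fil-0 (κ 1₄)) , Fil-zero (w ∸ w ∸ w)

    -- Each `h` is divisible by X, so the new one inherits the order w of the new X: the bound drops
    -- from 3 w to w.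
    h∈′ : F′.Fil w S′.h
    h∈′ = F′.Fil-+ {w} {S′.X S′.* S′.X S′.* S′.X S′.+ S′.p S′.* (S′.X S′.* S′.X)} (F′.Fil-+ {w} {S′.X S′.* S′.X S′.* S′.X}
        (F′.Fil-* 0 w {S′.X S′.* S′.X} (F′.Fil-0 (S′.X S′.* S′.X)) X∈)
        (F′.Fil-* 0 w {S′.p} (F′.Fil-0 S′.p) (F′.Fil-* 0 w {S′.X} (F′.Fil-0 S′.X) X∈)))
        (F′.Fil-* 0 w {S′.p S′.* S′.p} (F′.Fil-0 (S′.p S′.* S′.p)) X∈)

-- The totally ramified place, and why only zero has norm zero.

module Ramification where
  open FieldOfFour
  open PowerSeriesRing
  open CubicExtension
  open Evaluation
  open import Data.Unit.Base using (⊤; tt)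

  private module P = F₄-Algebra PS

  record AlgHom (K L : F₄-Algebra) : Set where
    private
      module K = F₄-Algebra K
      module L = F₄-Algebra L
    field
      ⟦_⟧    : K.Carrier → L.Carrier
      ⟦⟧-cong : ∀ {f g} → f K.≈ g → ⟦ f ⟧ L.≈ ⟦ g ⟧
      ⟦⟧-+    : ∀ f g → ⟦ f K.+ g ⟧ L.≈ ⟦ f ⟧ L.+ ⟦ g ⟧
      ⟦⟧-*    : ∀ f g → ⟦ f K.* g ⟧ L.≈ ⟦ f ⟧ L.* ⟦ g ⟧
      ⟦⟧-κ    : ∀ a → ⟦ K.κ a ⟧ L.≈ L.κ a

  record StageHom (S T : Stage) : Set where
    private
      module S = Stage S
      module T = Stage T
    field
      hom : AlgHom S.algebra T.algebra
    open AlgHom hom public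
    field
      ⟦p⟧ : ⟦ S.p ⟧ T.≈ T.p
      ⟦X⟧ : ⟦ S.X ⟧ T.≈ T.X

    ⟦h⟧ : ⟦ S.h ⟧ T.≈ T.h
    ⟦h⟧ = T.trans (⟦⟧-+ _ _) (T.+-cong (T.trans (⟦⟧-+ _ _) (T.+-cong
        (T.trans (⟦⟧-* _ _) (T.*-cong XX ⟦X⟧))
        (T.trans (⟦⟧-* _ _) (T.*-cong ⟦p⟧ XX))))
        (T.trans (⟦⟧-* _ _) (T.*-cong (T.trans (⟦⟧-* _ _) (T.*-cong ⟦p⟧ ⟦p⟧)) ⟦X⟧)))
      where
      XX : ⟦ S.X S.* S.X ⟧ T.≈ T.X T.* T.X
      XX = T.trans (⟦⟧-* _ _) (T.*-cong ⟦X⟧ ⟦X⟧)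

  module _ {S T : Stage} (φ : StageHom S T) where
    private
      module S = Stage S
      module T = Stage T
      module CS = Cubic S.algebra S.h
      module CT = Cubic T.algebra T.h
    open StageHom φ

    map³ : CS.Triple → CT.Triple
    map³ (f₀ , f₁ , f₂) = ⟦ f₀ ⟧ , ⟦ f₁ ⟧ , ⟦ f₂ ⟧

    private
      *h : ∀ f g → ⟦ f ⟧ T.≈ g → ⟦ S.h S.* f ⟧ T.≈ T.h T.* g
      *h f g p = T.trans (⟦⟧-* S.h f) (T.*-cong ⟦h⟧ p)

      *+* : ∀ f g f′ g′ → ⟦ f S.* g S.+ f′ S.* g′ ⟧ T.≈ ⟦ f ⟧ T.* ⟦ g ⟧ T.+ ⟦ f′ ⟧ T.* ⟦ g′ ⟧
      *+* f g f′ g′ = T.trans (⟦⟧-+ _ _) (T.+-cong (⟦⟧-* f g) (⟦⟧-* f′ g′))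

      cube : ∀ f → ⟦ f S.* f S.* f ⟧ T.≈ ⟦ f ⟧ T.* ⟦ f ⟧ T.* ⟦ f ⟧
      cube f = T.trans (⟦⟧-* _ _) (T.*-congʳ (⟦⟧-* f f))

    next-hom : StageHom (next S) (next T)
    next-hom = record
      { hom = record
        { ⟦_⟧ = map³
        ; ⟦⟧-cong = λ (p , q , r) → ⟦⟧-cong p , ⟦⟧-cong q , ⟦⟧-cong r
        ; ⟦⟧-+ = λ (f₀ , f₁ , f₂) (g₀ , g₁ , g₂) → ⟦⟧-+ f₀ g₀ , ⟦⟧-+ f₁ g₁ , ⟦⟧-+ f₂ g₂
        ; ⟦⟧-* = λ (f₀ , f₁ , f₂) (g₀ , g₁ , g₂) →
              T.trans (⟦⟧-+ _ _) (T.+-cong (⟦⟧-* f₀ g₀) (*h _ _ (*+* f₁ g₂ f₂ g₁)))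
            , T.trans (⟦⟧-+ _ _) (T.+-cong (*+* f₀ g₁ f₁ g₀) (*h _ _ (⟦⟧-* f₂ g₂)))
            , T.trans (⟦⟧-+ _ _) (T.+-cong (*+* f₀ g₂ f₁ g₁) (⟦⟧-* f₂ g₀))
        ; ⟦⟧-κ = λ a → ⟦⟧-κ a , ⟦⟧-κ 0₄ , ⟦⟧-κ 0₄
        }
      ; ⟦p⟧ = ⟦p⟧ , ⟦⟧-κ 0₄ , ⟦⟧-κ 0₄
      ; ⟦X⟧ = ⟦⟧-κ 0₄ , ⟦⟧-κ 1₄ , ⟦⟧-κ 0₄
      }

    hom-norm : ∀ f → ⟦ CS.norm f ⟧ T.≈ CT.norm (map³ f)
    hom-norm (f₀ , f₁ , f₂) = T.trans (⟦⟧-+ _ _) (T.+-cong (T.trans (⟦⟧-+ _ _) (T.+-cong (T.trans (⟦⟧-+ _ _)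
      (T.+-cong (cube f₀) (*h _ _ (cube f₁)))) (T.trans (⟦⟧-* _ _) (T.*-cong (*h S.h _ ⟦h⟧) (cube f₂)))))
      (*h _ _ (T.trans (⟦⟧-* _ _) (T.*-congʳ (⟦⟧-* f₀ f₁)))))

  -- Membership in the k-th power of the ideal generated by X.
  Deep : (S : Stage) → ℕ → Stage.Carrier S → Set
  Deep S zero    f = ⊤
  Deep S (suc k) f = ∃ λ g → f ≈ X * g × Deep S k g
    where open Stage S

  -- X generates the maximal ideal of a discrete valuation ring with residue field F₄.
  record Ramified (S : Stage) : Set where
    open Stage S
    field
      res      : Carrier → F₄
      res-cong : ∀ {f g} → f ≈ g → res f ≡ res g
      res-+    : ∀ f g → res (f + g) ≡ res f +₄ res g
      res-*    : ∀ f g → res (f * g) ≡ res f *₄ res g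
      res-κ    : ∀ a → res (κ a) ≡ a
      res-X    : res X ≡ 0₄
      X-cancel : ∀ f → X * f ≈ κ 0₄ → f ≈ κ 0₄
      divide   : ∀ f → res f ≡ 0₄ → ∃ λ g → f ≈ X * g

    field
      separated : ∀ f → (∀ k → Deep S k f) → f ≈ κ 0₄
      -- Since h / X = X² + p X + p² is a unit, y³ = h is an Eisenstein equation. The inverse of X +
      -- p is carried along because at the next floor the product of the two units is y³ + p³ = (X +
      -- p)³, so both are units again.
      u⁻¹ v⁻¹   : Carrier
      u-inverse : (X + p) * u⁻¹ ≈ κ 1₄
      v-inverse : (X * X + p * X + p * p) * v⁻¹ ≈ κ 1₄

    Deep-* : ∀ k a {f g} → g ≈ a * f → Deep S k f → Deep S k g
    Deep-* zero    a eq _ = tt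
    Deep-* (suc k) a {f} {g} eq (f′ , f≈Xf′ , d) = a * f′ ,
      trans eq (trans (*-congˡ f≈Xf′) (solve 3 (λ a x f → a :* (x :* f) := x :* (a :* f)) refl a X f′)) ,
      Deep-* k a refl d
      where open AlgebraSolver algebra

  module _ (K : F₄-Algebra) where
    open F₄-Algebra K
    open AlgebraSolver K

    sum-of-cubesˡ : ∀ y p u → (y + p) * ((y * y + p * y + p * p) * u) ≈ (y * y * y + p * p * p) * u
    sum-of-cubesˡ = solve 3 (λ y p u → (y :+ p) :* ((y :* y :+ p :* y :+ p :* p) :* u) := (y :* y :* y :+ p :* p :* p) :* u) refl

    sum-of-cubesʳ : ∀ y p u → (y * y + p * y + p * p) * ((y + p) * u) ≈ (y * y * y + p * p * p) * u
    sum-of-cubesʳ = solve 3 (λ y p u → (y :* y :+ p :* y :+ p :* p) :* ((y :+ p) :* u) := (y :* y :* y :+ p :* p :* p) :* u) refl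

    cube-right : ∀ y → y * y * y ≈ y * (y * (y * κ 1₄))
    cube-right = solve 1 (λ y → y :* y :* y := y :* (y :* (y :* con 1₄))) refl

  module NextRamified {S : Stage} (R : Ramified S) where
    open Stage S
    open Ramified R
    open Cubic algebra h using (Triple; norm; norm-cong; norm-y; y; y-*; ↑_; scale-*³; κ³)
    private
      module S′ = Stage (next S)
      module K = AlgebraSolver algebra

      v : Carrier
      v = X * X + p * X + p * p

      h≈ : h ≈ X * v
      h≈ = K.solve 2 (λ x p → x :* x :* x :+ p :* (x :* x) :+ p :* p :* x := x :* (x :* x :+ p :* x :+ p :* p)) refl X p
        where open K

      res-h : res h ≡ 0₄
      res-h = ≡.trans (res-cong h≈) (≡.trans (res-* X v) (≡.trans (cong (_*₄ res v) res-X) (*₄-zeroˡ (res v))))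

      v-cancel : ∀ f → v * f ≈ κ 0₄ → f ≈ κ 0₄
      v-cancel f vf≈0 = trans (sym (trans (*-congʳ (trans v-inverse κ-1)) (*-identityˡ f)))
        (trans (K.solve 3 (λ v w f → v :* w :* f := w :* (v :* f)) refl v v⁻¹ f)
          (trans (*-congˡ vf≈0) (K.solve 1 (λ w → w :* con 0₄ := con 0₄) refl v⁻¹)))
        where open K

      h-cancel : ∀ f → h * f ≈ κ 0₄ → f ≈ κ 0₄
      h-cancel f hf≈0 = v-cancel f (X-cancel (v * f) (trans (sym (*-assoc X v f)) (trans (*-congʳ (sym h≈)) hf≈0)))

      res′ : Triple → F₄
      res′ (f₀ , _ , _) = res f₀

      -- All terms but f₀³ contain h, whose residue is 0.
      res-norm : ∀ f → res (norm f) ≡ res′ f *₄ res′ f *₄ res′ f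
      res-norm f@(f₀ , f₁ , f₂) = ≡.trans
        (res-cong (K.solve 4 (λ h f₀ f₁ f₂ → let open K in
            f₀ :* f₀ :* f₀ :+ h :* (f₁ :* f₁ :* f₁) :+ h :* h :* (f₂ :* f₂ :* f₂) :+ h :* (f₀ :* f₁ :* f₂)
            := f₀ :* f₀ :* f₀ :+ h :* (f₁ :* f₁ :* f₁ :+ h :* (f₂ :* f₂ :* f₂) :+ f₀ :* f₁ :* f₂)) refl h f₀ f₁ f₂))
        (≡.trans (res-+ _ _) (≡.trans (cong₂ _+₄_ (≡.trans (res-* (f₀ * f₀) f₀) (cong (_*₄ res f₀) (res-* f₀ f₀)))
          (≡.trans (res-* h _) (≡.trans (cong (_*₄ res (f₁ * f₁ * f₁ + h * (f₂ * f₂ * f₂) + f₀ * f₁ * f₂)) res-h)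
            (*₄-zeroˡ (res (f₁ * f₁ * f₁ + h * (f₂ * f₂ * f₂) + f₀ * f₁ * f₂)))))) (+₄-identityʳ _)))

      -- If f₀ = X g, then f₀ = h v⁻¹ g because h = X v, and multiplication by y brings the last
      -- component to the front with a factor h.
      divide′ : ∀ f → res′ f ≡ 0₄ → ∃ λ g → f S′.≈ S′.X S′.* g
      divide′ (f₀ , f₁ , f₂) res≡0 with divide f₀ res≡0
      ... | g , f₀≈Xg = (f₁ , f₂ , v⁻¹ * g) , S′.sym (S′.trans (y-* (f₁ , f₂ , v⁻¹ * g))
        (trans (*-congʳ h≈) (trans (K.solve 4 (λ x v w g → x :* v :* (w :* g) := x :* ((v :* w) :* g)) refl X v v⁻¹ g)
          (trans (*-congˡ (trans (*-congʳ (trans v-inverse κ-1)) (*-identityˡ g))) (sym f₀≈Xg))) , refl , refl))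
        where open K

      X-cancel′ : ∀ f → S′.X S′.* f S′.≈ κ³ 0₄ → f S′.≈ κ³ 0₄
      X-cancel′ f yf≈0 = let (p , q , r) = S′.trans (S′.sym (y-* f)) yf≈0 in q , r , h-cancel _ p

      y³-* : ∀ f → y S′.* (y S′.* (y S′.* f)) S′.≈ (h * proj₁ f , h * proj₁ (proj₂ f) , h * proj₂ (proj₂ f))
      y³-* f = let (p₁ , q₁ , r₁) = y-* f
                   (p₂ , q₂ , r₂) = y-* (y S′.* f)
                   (p₃ , q₃ , r₃) = y-* (y S′.* (y S′.* f))
               in trans p₃ (*-congˡ (trans r₂ q₁)) , trans q₃ (trans p₂ (*-congˡ r₁)) , trans r₃ (trans q₂ p₁)

      -- Multiplication by y³ is multiplication by h = X v in every component, so every three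
      -- factors y yield one factor X.
      Deep-components : ∀ k f → Deep (next S) (k ℕ.+ (k ℕ.+ k)) f → Deep S k (proj₁ f) × Deep S k (proj₁ (proj₂ f)) × Deep S k (proj₂ (proj₂ f))
      Deep-components zero    f _ = tt , tt , tt
      Deep-components (suc k) f d with ≡.subst (λ j → Deep (next S) j f) (cong suc (≡.trans (ℕ.+-suc k (k ℕ.+ suc k))
                                         (cong suc (≡.trans (cong (k ℕ.+_) (ℕ.+-suc k k)) (ℕ.+-suc k (k ℕ.+ k)))))) d
      ... | g₁ , f≈ , g₂ , g₁≈ , g₃ , g₂≈ , d₃ with Deep-components k g₃ d₃
      ...   | d₀ , d₁ , d₂ = let (p , q , r) = f≈yyyg in
        (v * proj₁ g₃ , trans p (hX _) , Deep-* k v refl d₀) ,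
        (v * proj₁ (proj₂ g₃) , trans q (hX _) , Deep-* k v refl d₁) ,
        (v * proj₂ (proj₂ g₃) , trans r (hX _) , Deep-* k v refl d₂)
        where
        hX : ∀ g → h * g ≈ X * (v * g)
        hX g = trans (*-congʳ h≈) (*-assoc X v g)
        f≈yyyg : f S′.≈ (h * proj₁ g₃ , h * proj₁ (proj₂ g₃) , h * proj₂ (proj₂ g₃))
        f≈yyyg = S′.trans (S′.trans f≈ (S′.*-congˡ {y} (S′.trans g₁≈ (S′.*-congˡ {y} g₂≈)))) (y³-* g₃)

      separated′ : ∀ f → (∀ k → Deep (next S) k f) → f S′.≈ κ³ 0₄
      separated′ f deep = separated _ (λ k → proj₁ (Deep-components k f (deep _)))
        , separated _ (λ k → proj₁ (proj₂ (Deep-components k f (deep _))))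
        , separated _ (λ k → proj₂ (proj₂ (Deep-components k f (deep _))))

      u³ : (X + p) * (X + p) * (X + p) * (u⁻¹ * u⁻¹ * u⁻¹) ≈ κ 1₄
      u³ = trans (K.solve 2 (λ u w → u :* u :* u :* (w :* w :* w) := (u :* w) :* (u :* w) :* (u :* w)) refl (X + p) u⁻¹)
        (trans (*-cong (*-cong u-inverse u-inverse) u-inverse) (K.solve 0 (con 1₄ :* con 1₄ :* con 1₄ := con 1₄) refl))
        where open K

      -- y³ + p³ = h + p³ = (X + p)³
      y³+p³ : (y S′.* y S′.* y S′.+ S′.p S′.* S′.p S′.* S′.p) S′.* ↑ (u⁻¹ * u⁻¹ * u⁻¹) S′.≈ κ³ 1₄
      y³+p³ = S′.trans (S′.*-congʳ {↑ (u⁻¹ * u⁻¹ * u⁻¹)} {y S′.* y S′.* y S′.+ S′.p S′.* S′.p S′.* S′.p} {↑ ((X + p) * (X + p) * (X + p))}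
          (S′.trans (S′.+-cong {y S′.* y S′.* y} {↑ h} {S′.p S′.* S′.p S′.* S′.p} {↑ (p * p * p)} y³≈ p³≈)
            (K.solve 2 (λ x p → (x :* x :* x :+ p :* (x :* x) :+ p :* p :* x) :+ p :* p :* p := (x :+ p) :* (x :+ p) :* (x :+ p)) refl X p
            , 0+0 , 0+0)))
        (S′.trans (↑-* _ _) (u³ , refl , refl))
        where
        open K
        0+0 : κ 0₄ + κ 0₄ ≈ κ 0₄
        0+0 = K.solve 0 (con 0₄ :+ con 0₄ := con 0₄) refl
        ↑-* : ∀ f g → ↑ f S′.* ↑ g S′.≈ ↑ (f * g)
        ↑-* f g = S′.trans (scale-*³ f (↑ g)) (refl , *0 f , *0 f)
          where
          *0 : ∀ f → f * κ 0₄ ≈ κ 0₄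
          *0 f = K.solve 1 (λ f → f :* con 0₄ := con 0₄) refl f
        p³≈ : S′.p S′.* S′.p S′.* S′.p S′.≈ ↑ (p * p * p)
        p³≈ = S′.trans (S′.*-congʳ {S′.p} {S′.p S′.* S′.p} {↑ (p * p)} (↑-* p p)) (↑-* (p * p) p)
        y³≈ : y S′.* y S′.* y S′.≈ ↑ h
        y³≈ = S′.trans (cube-right S′.algebra y)
          (S′.trans (y³-* (κ³ 1₄)) (K.solve 1 (λ h → h :* con 1₄ := h) refl h , *0 h , *0 h))
          where
          *0 : ∀ f → f * κ 0₄ ≈ κ 0₄
          *0 f = K.solve 1 (λ f → f :* con 0₄ := con 0₄) refl f

      U : Triple
      U = ↑ (u⁻¹ * u⁻¹ * u⁻¹)

      u-inverse′ : (y S′.+ S′.p) S′.* ((y S′.* y S′.+ S′.p S′.* y S′.+ S′.p S′.* S′.p) S′.* U) S′.≈ κ³ 1₄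
      u-inverse′ = S′.trans (sum-of-cubesˡ S′.algebra y S′.p U) y³+p³

      v-inverse′ : (y S′.* y S′.+ S′.p S′.* y S′.+ S′.p S′.* S′.p) S′.* ((y S′.+ S′.p) S′.* U) S′.≈ κ³ 1₄
      v-inverse′ = S′.trans (sum-of-cubesʳ S′.algebra y S′.p U) y³+p³

      res-*′ : ∀ f g → res′ (Cubic._*³_ algebra h f g) ≡ res′ f *₄ res′ g
      res-*′ (f₀ , f₁ , f₂) (g₀ , g₁ , g₂) = ≡.trans (res-+ _ _) (≡.trans (cong₂ _+₄_ (res-* f₀ g₀)
        (≡.trans (res-* h _) (≡.trans (cong (_*₄ res (f₁ * g₂ + f₂ * g₁)) res-h) (*₄-zeroˡ (res (f₁ * g₂ + f₂ * g₁)))))) (+₄-identityʳ _))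

    nextRamified : Ramified (next S)
    nextRamified = record
      { res = res′
      ; res-cong = λ (p , _) → res-cong p
      ; res-+ = λ (f₀ , _) (g₀ , _) → res-+ f₀ g₀
      ; res-* = res-*′
      ; res-κ = res-κ
      ; res-X = res-κ 0₄
      ; X-cancel = X-cancel′
      ; divide = divide′
      ; separated = separated′
      ; u⁻¹ = (y S′.* y S′.+ S′.p S′.* y S′.+ S′.p S′.* S′.p) S′.* U
      ; v⁻¹ = (y S′.+ S′.p) S′.* U
      ; u-inverse = u-inverse′
      ; v-inverse = v-inverse′
      }

    norm-divide : ∀ f g → f S′.≈ S′.X S′.* g → norm f ≈ κ 0₄ → norm g ≈ κ 0₄
    norm-divide f g f≈yg norm≈0 = h-cancel (norm g)
      (trans (sym (norm-y g)) (trans (sym (norm-cong {f} {Cubic._*³_ algebra h y g} f≈yg)) norm≈0))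

    norm-deep : ∀ k f → norm f ≈ κ 0₄ → Deep (next S) k f
    norm-deep zero    f _ = tt
    norm-deep (suc k) f norm≈0 =
      let (g , f≈yg) = divide′ f (cube₄-zero (res′ f) (≡.trans (≡.sym (res-norm f)) (≡.trans (res-cong norm≈0) (res-κ 0₄))))
      in g , f≈yg , norm-deep k g (norm-divide f g f≈yg norm≈0)

    -- The residue of the norm is a cube of the residue, so an element of norm zero is y times
    -- another element of norm zero. It is then divisible by every power of y, hence zero. No
    -- valuation is computed, as equality of power series cannot be decided.
    norm-zero : ∀ f → norm f ≈ κ 0₄ → f S′.≈ κ³ 0₄
    norm-zero f norm≈0 = separated′ f (λ k → norm-deep k f norm≈0)

-- Binary forms and gradings.

module HomogeneousForms where
  open FieldOfFour
  open PowerSeriesRing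
  open CubicExtension
  open Evaluation
  import Algebra.Construct.DirectProduct as DirectProduct
  open import Data.Nat.Solver using (module +-*-Solver)

  private module P = F₄-Algebra PS

  _⊗_ : F₄-Algebra → F₄-Algebra → F₄-Algebra
  K ⊗ L = record
    { commutativeRing = DirectProduct.commutativeRing K.commutativeRing L.commutativeRing
    ; κ = λ a → K.κ a , L.κ a
    ; κ-+ = λ a b → K.κ-+ a b , L.κ-+ a b
    ; κ-* = λ a b → K.κ-* a b , L.κ-* a b
    ; κ-0 = K.κ-0 , L.κ-0
    ; κ-1 = K.κ-1 , L.κ-1
    }
    where
    module K = F₄-Algebra K
    module L = F₄-Algebra L

  module Forms (K : F₄-Algebra) (p q : F₄-Algebra.Carrier K) where
    open F₄-Algebra K
    open AlgebraSolver K

    q^ : ℕ → Carrier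
    q^ zero    = κ 1₄
    q^ (suc k) = q * q^ k

    -- Horner's scheme for the sum of the cᵢ pⁱ q^(m - i).
    form : ∀ {m} → Vec F₄ (suc m) → Carrier
    form {zero}  (c ∷ []) = κ c
    form {suc m} (c ∷ cs) = κ c * q^ (suc m) + p * form cs

    IsForm : ℕ → Carrier → Set
    IsForm m f = ∃ λ (c : Vec F₄ (suc m)) → f ≈ form c

    form-+ : ∀ {m} (c d : Vec F₄ (suc m)) → form c + form d ≈ form (Vec.zipWith _+₄_ c d)
    form-+ {zero}  (c ∷ []) (d ∷ []) = sym (κ-+ c d)
    form-+ {suc m} (c ∷ cs) (d ∷ ds) = trans
      (solve 6 (λ c d Q p f g → (c :* Q :+ p :* f) :+ (d :* Q :+ p :* g) := (c :+ d) :* Q :+ p :* (f :+ g)) refl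
        (κ c) (κ d) (q^ (suc m)) p (form cs) (form ds))
      (+-cong (*-congʳ (sym (κ-+ c d))) (*-congˡ (form-+ cs ds)))

    form-scale : ∀ {m} a (c : Vec F₄ (suc m)) → κ a * form c ≈ form (Vec.map (a *₄_) c)
    form-scale {zero}  a (c ∷ []) = sym (κ-* a c)
    form-scale {suc m} a (c ∷ cs) = trans
      (solve 5 (λ a c Q p f → a :* (c :* Q :+ p :* f) := (a :* c) :* Q :+ p :* (a :* f)) refl (κ a) (κ c) (q^ (suc m)) p (form cs))
      (+-cong (*-congʳ (sym (κ-* a c))) (*-congˡ (form-scale a cs)))

    form-zeros : ∀ m → form (Vec.replicate (suc m) 0₄) ≈ κ 0₄
    form-zeros zero    = refl
    form-zeros (suc m) = trans (+-congˡ (*-congˡ (form-zeros m)))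
      (solve 2 (λ Q p → con 0₄ :* Q :+ p :* con 0₄ := con 0₄) refl (q^ (suc m)) p)

    -- A factor q leaves the powers of p in place and adds a zero coefficient for the new highest
    -- one.
    snoc0 : ∀ {m} → Vec F₄ (suc m) → Vec F₄ (suc (suc m))
    snoc0 {zero}  (c ∷ []) = c ∷ 0₄ ∷ []
    snoc0 {suc m} (c ∷ cs) = c ∷ snoc0 cs

    form-snoc0 : ∀ {m} (c : Vec F₄ (suc m)) → q * form c ≈ form (snoc0 c)
    form-snoc0 {zero}  (c ∷ []) = solve 3 (λ q c p → q :* c := c :* (q :* con 1₄) :+ p :* con 0₄) refl q (κ c) p
    form-snoc0 {suc m} (c ∷ cs) = trans
      (solve 5 (λ q c Q p f → q :* (c :* Q :+ p :* f) := c :* (q :* Q) :+ p :* (q :* f)) refl q (κ c) (q^ (suc m)) p (form cs))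
      (+-congˡ (*-congˡ (form-snoc0 cs)))

    IsForm-resp : ∀ {m f g} → f ≈ g → IsForm m f → IsForm m g
    IsForm-resp f≈g (c , eq) = c , trans (sym f≈g) eq

    IsForm-zero : ∀ m → IsForm m (κ 0₄)
    IsForm-zero m = Vec.replicate (suc m) 0₄ , sym (form-zeros m)

    IsForm-+ : ∀ {m f g} → IsForm m f → IsForm m g → IsForm m (f + g)
    IsForm-+ (c , p) (d , q) = Vec.zipWith _+₄_ c d , trans (+-cong p q) (form-+ c d)

    IsForm-p : ∀ {m f} → IsForm m f → IsForm (suc m) (p * f)
    IsForm-p {m} {f} (c , eq) = 0₄ ∷ c ,
      trans (*-congˡ eq) (solve 3 (λ p f Q → p :* f := con 0₄ :* Q :+ p :* f) refl p (form c) (q^ (suc m)))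

    IsForm-q : ∀ {m f} → IsForm m f → IsForm (suc m) (q * f)
    IsForm-q (c , eq) = snoc0 c , trans (*-congˡ eq) (form-snoc0 c)

    IsForm-κ : ∀ {m f} a → IsForm m f → IsForm m (κ a * f)
    IsForm-κ a (c , eq) = Vec.map (a *₄_) c , trans (*-congˡ eq) (form-scale a c)

    IsForm-q^ : ∀ {m f} k → IsForm m f → IsForm (k ℕ.+ m) (q^ k * f)
    IsForm-q^ {m} {f} zero    hf = IsForm-κ 1₄ hf
    IsForm-q^ {m} {f} (suc k) hf = IsForm-resp (sym (*-assoc q (q^ k) f)) (IsForm-q (IsForm-q^ k hf))

    IsForm-* : ∀ {m m′ f g} → IsForm m f → IsForm m′ g → IsForm (m ℕ.+ m′) (f * g)
    IsForm-* {m} {m′} {f} {g} (c , eq) hg = IsForm-resp (*-congʳ (sym eq)) (go c)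
      where
      go : ∀ {m} (c : Vec F₄ (suc m)) → IsForm (m ℕ.+ m′) (form c * g)
      go {zero}  (c ∷ []) = IsForm-κ c hg
      go {suc m} (c ∷ cs) = IsForm-resp
        (solve 5 (λ c Q p f g → c :* (Q :* g) :+ p :* (f :* g) := (c :* Q :+ p :* f) :* g) refl (κ c) (q^ (suc m)) p (form cs) g)
        (IsForm-+ (IsForm-κ c (IsForm-q^ (suc m) hg)) (IsForm-p (go cs)))

  -- Hom m f: f is homogeneous of degree m + d.
  record Graded (S : Stage) (d : ℕ) : Set₁ where
    open Stage S
    field
      Hom      : ℕ → Carrier → Set
      Hom-resp : ∀ {m f g} → f ≈ g → Hom m f → Hom m g
      Hom-zero : ∀ m → Hom m (κ 0₄)
      Hom-+    : ∀ {m f g} → Hom m f → Hom m g → Hom m (f + g)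
      Hom-p    : ∀ {m f} → Hom m f → Hom (suc m) (p * f)
      Hom-X    : ∀ {m f} → Hom m f → Hom (suc m) (X * f)
      Hom-*    : ∀ {m m′ f g} → Hom m f → Hom m′ g → Hom (m ℕ.+ m′ ℕ.+ d) (f * g)

  module _ (S : Stage) where
    open Stage S
    open AlgebraSolver algebra

    h-expand : ∀ f → X * (X * (X * f)) + p * (X * (X * f)) + p * (p * (X * f)) ≈ h * f
    h-expand = solve 3 (λ x p f → x :* (x :* (x :* f)) :+ p :* (x :* (x :* f)) :+ p :* (p :* (x :* f))
      := (x :* x :* x :+ p :* (x :* x) :+ p :* p :* x) :* f) refl X p

  open +-*-Solver using (solve; _:+_; _:*_; _:=_; con)

  module NextGraded {S : Stage} {d : ℕ} (G : Graded S d) where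
    open Stage S
    open Graded G
    open Cubic algebra h using (Triple; norm; scale-*³; y-*)
    private
      module S′ = Stage (next S)

      at : ∀ {m m′ f} → m ≡ m′ → Hom m f → Hom m′ f
      at ≡.refl hf = hf

      Hom-h : ∀ {m f} → Hom m f → Hom (3 ℕ.+ m) (h * f)
      Hom-h {m} {f} hf = Hom-resp (h-expand S f)
        (Hom-+ (Hom-+ (Hom-X (Hom-X (Hom-X hf))) (Hom-p (Hom-X (Hom-X hf)))) (Hom-p (Hom-p (Hom-X hf))))

    -- The generator y has degree 1, so the coefficient of yⁱ must have degree i less than the
    -- element. Starting the index 2 above the previous offset avoids negative degrees.
    Hom′ : ℕ → Triple → Set
    Hom′ m (f₀ , f₁ , f₂) = Hom (2 ℕ.+ m) f₀ × Hom (1 ℕ.+ m) f₁ × Hom m f₂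

    Hom′-* : ∀ {m m′ f g} → Hom′ m f → Hom′ m′ g → Hom′ (m ℕ.+ m′ ℕ.+ (2 ℕ.+ d)) (Cubic._*³_ algebra h f g)
    Hom′-* {m} {m′} (f₀ , f₁ , f₂) (g₀ , g₁ , g₂) =
        Hom-+ (at (solve 3 (λ m m′ d → (con 2 :+ m) :+ (con 2 :+ m′) :+ d := con 2 :+ (m :+ m′ :+ (con 2 :+ d))) ≡.refl m m′ d) (Hom-* f₀ g₀))
              (at (solve 3 (λ m m′ d → con 3 :+ (con 1 :+ m :+ m′ :+ d) := con 2 :+ (m :+ m′ :+ (con 2 :+ d))) ≡.refl m m′ d)
                (Hom-h (Hom-+ (Hom-* f₁ g₂) (at (solve 3 (λ m m′ d → m :+ (con 1 :+ m′) :+ d := con 1 :+ m :+ m′ :+ d) ≡.refl m m′ d) (Hom-* f₂ g₁)))))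
      , Hom-+ (Hom-+ (at (solve 3 (λ m m′ d → (con 2 :+ m) :+ (con 1 :+ m′) :+ d := con 1 :+ (m :+ m′ :+ (con 2 :+ d))) ≡.refl m m′ d) (Hom-* f₀ g₁))
                     (at (solve 3 (λ m m′ d → (con 1 :+ m) :+ (con 2 :+ m′) :+ d := con 1 :+ (m :+ m′ :+ (con 2 :+ d))) ≡.refl m m′ d) (Hom-* f₁ g₀)))
              (at (solve 3 (λ m m′ d → con 3 :+ (m :+ m′ :+ d) := con 1 :+ (m :+ m′ :+ (con 2 :+ d))) ≡.refl m m′ d) (Hom-h (Hom-* f₂ g₂)))
      , Hom-+ (Hom-+ (at (solve 3 (λ m m′ d → (con 2 :+ m) :+ m′ :+ d := m :+ m′ :+ (con 2 :+ d)) ≡.refl m m′ d) (Hom-* f₀ g₂))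
                     (at (solve 3 (λ m m′ d → (con 1 :+ m) :+ (con 1 :+ m′) :+ d := m :+ m′ :+ (con 2 :+ d)) ≡.refl m m′ d) (Hom-* f₁ g₁)))
              (at (solve 3 (λ m m′ d → m :+ (con 2 :+ m′) :+ d := m :+ m′ :+ (con 2 :+ d)) ≡.refl m m′ d) (Hom-* f₂ g₀))

    Hom-norm : ∀ {m f} → Hom′ m f → Hom (6 ℕ.+ 3 ℕ.* m ℕ.+ 2 ℕ.* d) (norm f)
    Hom-norm {m} (f₀ , f₁ , f₂) = Hom-+ (Hom-+ (Hom-+
        (at (solve 2 (λ m d → (con 2 :+ m) :+ (con 2 :+ m) :+ d :+ (con 2 :+ m) :+ d := con 6 :+ con 3 :* m :+ con 2 :* d) ≡.refl m d)
          (Hom-* (Hom-* f₀ f₀) f₀))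
        (at (solve 2 (λ m d → con 3 :+ ((con 1 :+ m) :+ (con 1 :+ m) :+ d :+ (con 1 :+ m) :+ d) := con 6 :+ con 3 :* m :+ con 2 :* d) ≡.refl m d)
          (Hom-h (Hom-* (Hom-* f₁ f₁) f₁))))
        (at (solve 2 (λ m d → con 3 :+ (con 3 :+ (m :+ m :+ d :+ m :+ d)) := con 6 :+ con 3 :* m :+ con 2 :* d) ≡.refl m d)
          (Hom-resp (sym (*-assoc h h _)) (Hom-h (Hom-h (Hom-* (Hom-* f₂ f₂) f₂))))))
        (at (solve 2 (λ m d → con 3 :+ ((con 2 :+ m) :+ (con 1 :+ m) :+ d :+ m :+ d) := con 6 :+ con 3 :* m :+ con 2 :* d) ≡.refl m d)
          (Hom-h (Hom-* (Hom-* f₀ f₁) f₂)))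

    nextGraded : Graded (next S) (2 ℕ.+ d)
    nextGraded = record
      { Hom = Hom′
      ; Hom-resp = λ (p , q , r) (f₀ , f₁ , f₂) → Hom-resp p f₀ , Hom-resp q f₁ , Hom-resp r f₂
      ; Hom-zero = λ m → Hom-zero (2 ℕ.+ m) , Hom-zero (1 ℕ.+ m) , Hom-zero m
      ; Hom-+ = λ (f₀ , f₁ , f₂) (g₀ , g₁ , g₂) → Hom-+ f₀ g₀ , Hom-+ f₁ g₁ , Hom-+ f₂ g₂
      ; Hom-p = λ {m} {f} (f₀ , f₁ , f₂) → let (a , b , c) = scale-*³ p f in
          Hom-resp (sym a) (Hom-p f₀) , Hom-resp (sym b) (Hom-p f₁) , Hom-resp (sym c) (Hom-p f₂)
      ; Hom-X = λ {m} {f} (f₀ , f₁ , f₂) → let (a , b , c) = y-* f in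
          Hom-resp (sym a) (Hom-h f₂) , Hom-resp (sym b) f₀ , Hom-resp (sym c) f₁
      ; Hom-* = Hom′-*
      }

-- The projective line in three charts.

module ProjectiveLine where
  open FieldOfFour
  open PowerSeriesRing
  open Evaluation
  open Places
  open Ramification
  open HomogeneousForms

  private module P = F₄-Algebra PS

  1ₚ : PowerSeries
  1ₚ = constₚ 1₄

  -- One factor for each of the expansions at the completely split place
  -- p/q = 0, the bad place q/p = 0 and the totally ramified place p/q = 1.
  base-algebra : F₄-Algebra
  base-algebra = PS ⊗ (PS ⊗ PS)

  private module B = F₄-Algebra base-algebra

  pᴮ qᴮ : B.Carrier
  pᴮ = t , 1ₚ , 1ₚ +ₚ t
  qᴮ = 1ₚ , t , 1ₚ

  open Forms base-algebra pᴮ qᴮ public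

  base : Stage
  base = record { algebra = base-algebra ; p = pᴮ ; X = pᴮ B.+ qᴮ }

  chart₁ chart₂ : Eval base-algebra
  chart₁ = record { ⟦_⟧ = proj₁ ; ⟦⟧-cong = proj₁ ; ⟦⟧-+ = λ _ _ _ → ≡.refl ; ⟦⟧-* = λ _ _ _ → ≡.refl ; ⟦⟧-κ = λ _ _ → ≡.refl }
  chart₂ = record { ⟦_⟧ = proj₁ ∘ proj₂ ; ⟦⟧-cong = proj₁ ∘ proj₂ ; ⟦⟧-+ = λ _ _ _ → ≡.refl ; ⟦⟧-* = λ _ _ _ → ≡.refl ; ⟦⟧-κ = λ _ _ → ≡.refl }

  opaque
    unfolding _*ₚ_

    1+t-const : (1ₚ +ₚ t) 0 ≡ 1₄
    1+t-const = ≡.refl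

    t+1-const : (t +ₚ 1ₚ) 0 ≡ 1₄
    t+1-const = ≡.refl

    c+tf-at-0 : ∀ c f → (constₚ c +ₚ t *ₚ f) 0 ≡ c
    c+tf-at-0 c f = +₄-identityʳ c

    c+tf-at-suc : ∀ c f n → (constₚ c +ₚ t *ₚ f) (suc n) ≡ f n
    c+tf-at-suc c f n = t*≈shift f (suc n)

    c+[1+t]f-at-0 : ∀ c f → (constₚ c +ₚ (1ₚ +ₚ t) *ₚ f) 0 ≡ c +₄ f 0
    c+[1+t]f-at-0 c f = ≡.refl

    c+[1+t]f-at-suc : ∀ c f n → (constₚ c +ₚ (1ₚ +ₚ t) *ₚ f) (suc n) ≡ f (suc n) +₄ f n
    c+[1+t]f-at-suc c f n = ≡.trans (*ₚ-distribʳ f 1ₚ t (suc n)) (cong₂ _+₄_ (*ₚ-identityˡ f (suc n)) (t*≈shift f (suc n)))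

  base-split : SplitPoint base
  base-split = record
    { eval = chart₁
    ; p-const = ≡.refl
    ; X-const = λ eq → contradiction (≡.trans (≡.sym t+1-const) eq) λ ()
    }

  base-unit : UnitPlace base 1
  base-unit = record
    { eval = chart₂
    ; p≈1 = λ _ → ≡.refl
    ; X-const = 1+t-const
    ; X+1-div = Div-resp {1} (P.sym (solve 1 (λ t → (con 1₄ :+ t) :+ con 1₄ := t) P.refl t)) λ where
        zero _ → ≡.refl
        (suc i) (s≤s ())
    }
    where open AlgebraSolver PS

  base-graded : Graded base 0
  base-graded = record
    { Hom = IsForm
    ; Hom-resp = λ {m} {f} {g} → IsForm-resp {m} {f} {g}
    ; Hom-zero = IsForm-zero
    ; Hom-+ = λ {m} {f} {g} → IsForm-+ {m} {f} {g}
    ; Hom-p = λ {m} {f} → IsForm-p {m} {f}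
    ; Hom-X = λ {m} {f} hf → IsForm-resp {suc m} {pᴮ B.* f B.+ qᴮ B.* f} {(pᴮ B.+ qᴮ) B.* f} (B.sym (B.distribʳ f pᴮ qᴮ))
        (IsForm-+ {suc m} {pᴮ B.* f} {qᴮ B.* f} (IsForm-p {m} {f} hf) (IsForm-q {m} {f} hf))
    ; Hom-* = λ {m} {m′} {f} {g} hf hg → subst (λ k → IsForm k (f B.* g)) (≡.sym (ℕ.+-identityʳ (m ℕ.+ m′))) (IsForm-* {m} {m′} {f} {g} hf hg)
    }

  -- Forms expand to polynomials in each chart. The degree bound turns a vanishing condition on them
  -- into a finite one.
  Deg : ℕ → PowerSeries → Set
  Deg d f = ∀ i → d ℕ.< i → f i ≡ 0₄

  opaque
    unfolding _*ₚ_

    Deg-* : ∀ a b {f g} → Deg a f → Deg b g → Deg (a ℕ.+ b) (f *ₚ g)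
    Deg-* zero    b {f} {g} df dg (suc i) b<i = cong₂ _+₄_
      (≡.trans (cong (f 0 *₄_) (dg (suc i) b<i)) (*₄-zeroʳ (f 0))) (zero-*ₚ g (λ n → df (suc n) (s≤s z≤n)) i)
    Deg-* (suc a) b {f} {g} df dg (suc i) (s≤s a+b<i) = cong₂ _+₄_
      (≡.trans (cong (f 0 *₄_) (dg (suc i) (ℕ.≤-trans (s≤s (ℕ.m≤n+m b a)) (ℕ.m≤n⇒m≤1+n a+b<i)))) (*₄-zeroʳ (f 0)))
      (Deg-* a b (λ n a<n → df (suc n) (s≤s a<n)) dg i a+b<i)

    Deg-+ : ∀ {d f g} → Deg d f → Deg d g → Deg d (f +ₚ g)
    Deg-+ df dg i d<i = cong₂ _+₄_ (df i d<i) (dg i d<i)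

  Deg-κ : ∀ d c → Deg d (constₚ c)
  Deg-κ d c (suc i) _ = ≡.refl

  Deg-t : Deg 1 t
  Deg-t (suc (suc i)) _ = ≡.refl
  Deg-t (suc zero) (s≤s ())

  record Chart : Set where
    field
      eval : Eval base-algebra
    open Eval eval public
    field
      p-deg : Deg 1 ⟦ pᴮ ⟧
      q-deg : Deg 1 ⟦ qᴮ ⟧

    q^-deg : ∀ k → Deg k ⟦ q^ k ⟧
    q^-deg zero    i 0<i = ≡.trans (⟦⟧-κ 1₄ i) (Deg-κ 0 1₄ i 0<i)
    q^-deg (suc k) i k<i = ≡.trans (⟦⟧-* qᴮ (q^ k) i) (Deg-* 1 k q-deg (q^-deg k) i k<i)

    form-deg : ∀ {m} (c : Vec F₄ (suc m)) → Deg m ⟦ form c ⟧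
    form-deg {zero}  (c ∷ []) i 0<i = ≡.trans (⟦⟧-κ c i) (Deg-κ 0 c i 0<i)
    form-deg {suc m} (c ∷ cs) i m<i = ≡.trans (⟦⟧-+ _ _ i) (Deg-+ {suc m} {⟦ B.κ c B.* q^ (suc m) ⟧} {⟦ pᴮ B.* form cs ⟧}
      (λ j m<j → ≡.trans (⟦⟧-* _ _ j) (≡.trans (*ₚ-cong {g = ⟦ q^ (suc m) ⟧} (⟦⟧-κ c) (λ _ → ≡.refl) j) (Deg-* 0 (suc m) (Deg-κ 0 c) (q^-deg (suc m)) j m<j)))
      (λ j m<j → ≡.trans (⟦⟧-* pᴮ (form cs) j) (Deg-* 1 m p-deg (form-deg cs) j m<j)) i m<i)

  splitChart badChart ramifiedChart : Chart
  splitChart = record { eval = chart₁ ; p-deg = Deg-t ; q-deg = Deg-κ 1 1₄ }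
  badChart = record { eval = chart₂ ; p-deg = Deg-κ 1 1₄ ; q-deg = Deg-t }
  ramifiedChart = record
    { eval = record { ⟦_⟧ = proj₂ ∘ proj₂ ; ⟦⟧-cong = proj₂ ∘ proj₂ ; ⟦⟧-+ = λ _ _ _ → ≡.refl ; ⟦⟧-* = λ _ _ _ → ≡.refl ; ⟦⟧-κ = λ _ _ → ≡.refl }
    ; p-deg = Deg-+ {1} {1ₚ} {t} (Deg-κ 1 1₄) Deg-t ; q-deg = Deg-κ 1 1₄ }

  open AlgebraSolver PS

  q^₁ : ∀ k → proj₁ (q^ k) ≈ₚ 1ₚ
  q^₁ zero    = P.refl
  q^₁ (suc k) = P.trans (*ₚ-identityˡ (proj₁ (q^ k))) (q^₁ k)

  q^₃ : ∀ k → proj₂ (proj₂ (q^ k)) ≈ₚ 1ₚ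
  q^₃ zero    = P.refl
  q^₃ (suc k) = P.trans (*ₚ-identityˡ (proj₂ (proj₂ (q^ k)))) (q^₃ k)

  q^₂-div : ∀ k → Div k (proj₁ (proj₂ (q^ k)))
  q^₂-div zero    = λ _ ()
  q^₂-div (suc k) = Div-* 1 k {t} (λ { zero _ → ≡.refl ; (suc i) (s≤s ()) }) (q^₂-div k)

  opaque
    unfolding _*ₚ_

    q^₂-top : ∀ k → proj₁ (proj₂ (q^ k)) k ≡ 1₄
    q^₂-top zero    = ≡.refl
    q^₂-top (suc k) = ≡.trans (t*≈shift (proj₁ (proj₂ (q^ k))) (suc k)) (q^₂-top k)

    const-*-at : ∀ c f n → (constₚ c *ₚ f) n ≡ c *₄ f n
    const-*-at c f n = const-*ₚ c f n

  form₁ : ∀ {m} c (cs : Vec F₄ (suc m)) → proj₁ (form (c ∷ cs)) ≈ₚ constₚ c +ₚ t *ₚ proj₁ (form cs)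
  form₁ {m} c cs = P.+-congʳ {t *ₚ proj₁ (form cs)} (P.trans (P.*-congˡ {constₚ c} (q^₁ (suc m))) (P.*-identityʳ (constₚ c)))

  form₃ : ∀ {m} c (cs : Vec F₄ (suc m)) → proj₂ (proj₂ (form (c ∷ cs))) ≈ₚ constₚ c +ₚ (1ₚ +ₚ t) *ₚ proj₂ (proj₂ (form cs))
  form₃ {m} c cs = P.+-congʳ {(1ₚ +ₚ t) *ₚ proj₂ (proj₂ (form cs))} (P.trans (P.*-congˡ {constₚ c} (q^₃ (suc m))) (P.*-identityʳ (constₚ c)))

  form₂-at : ∀ {m} c (cs : Vec F₄ (suc m)) n → proj₁ (proj₂ (form (c ∷ cs))) n ≡ c *₄ proj₁ (proj₂ (q^ (suc m))) n +₄ proj₁ (proj₂ (form cs)) n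
  form₂-at {m} c cs n = ≡.trans (+ₚ-at _ _ n) (cong₂ _+₄_ (const-*-at c (proj₁ (proj₂ (q^ (suc m)))) n) (*ₚ-identityˡ (proj₁ (proj₂ (form cs))) n))

  zeros : ∀ m → Vec F₄ m
  zeros m = Vec.replicate m 0₄

  chart₁-injective : ∀ {m} (c : Vec F₄ (suc m)) → proj₁ (form c) ≈ₚ (λ _ → 0₄) → c ≡ zeros (suc m)
  chart₁-injective {zero}  (c ∷ []) eq = cong (_∷ []) (eq 0)
  chart₁-injective {suc m} (c ∷ cs) eq = cong₂ _∷_
    (≡.trans (≡.sym (c+tf-at-0 c (proj₁ (form cs)))) (≡.trans (≡.sym (form₁ c cs 0)) (eq 0)))
    (chart₁-injective cs λ n → ≡.trans (≡.sym (c+tf-at-suc c (proj₁ (form cs)) n)) (≡.trans (≡.sym (form₁ c cs (suc n))) (eq (suc n))))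

  +₄-zero⇒≡ : ∀ {a b} → a +₄ b ≡ 0₄ → a ≡ b
  +₄-zero⇒≡ {a} {b} eq = ≡.trans (≡.sym (+₄-identityʳ a)) (≡.trans (cong (a +₄_) (≡.sym (+₄-self b)))
    (≡.trans (≡.sym (+₄-assoc a b b)) (cong (_+₄ b) eq)))

  -- In c + (1 + t) f = 0 all coefficients of f agree, so they vanish with the high ones.
  chart₃-injective : ∀ {m} (c : Vec F₄ (suc m)) → proj₂ (proj₂ (form c)) ≈ₚ (λ _ → 0₄) → c ≡ zeros (suc m)
  chart₃-injective {zero}  (c ∷ []) eq = cong (_∷ []) (eq 0)
  chart₃-injective {suc m} (c ∷ cs) eq = cong₂ _∷_
    (≡.trans (+₄-zero⇒≡ (≡.trans (≡.sym (c+[1+t]f-at-0 c f)) (eq′ 0))) (f≈0 0))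
    (chart₃-injective cs f≈0)
    where
    f : PowerSeries
    f = proj₂ (proj₂ (form cs))
    eq′ : ∀ n → (constₚ c +ₚ (1ₚ +ₚ t) *ₚ f) n ≡ 0₄
    eq′ n = ≡.trans (≡.sym (form₃ c cs n)) (eq n)
    const : ∀ n → f n ≡ f 0
    const zero    = ≡.refl
    const (suc n) = ≡.trans (+₄-zero⇒≡ (≡.trans (≡.sym (c+[1+t]f-at-suc c f n)) (eq′ (suc n)))) (const n)
    f≈0 : ∀ n → f n ≡ 0₄
    f≈0 n = ≡.trans (const n) (≡.trans (≡.sym (const (suc m))) (Chart.form-deg ramifiedChart cs (suc m) (ℕ.n<1+n m)))

  -- The chart at p = 0 shows the coefficients from the lowest power of p on, the chart at q = 0
  -- from the highest. Orders a and b delete a of them at one end and b at the other.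
  too-many-zeros : ∀ {m} a b (c : Vec F₄ (suc m)) → m ℕ.< a ℕ.+ b →
    Div a (proj₁ (form c)) → Div b (proj₁ (proj₂ (form c))) → c ≡ zeros (suc m)
  too-many-zeros {zero}  zero    b (c ∷ []) m<b d₁ d₂ = cong (_∷ []) (d₂ 0 m<b)
  too-many-zeros {zero}  (suc a) b (c ∷ []) _   d₁ d₂ = cong (_∷ []) (d₁ 0 (s≤s z≤n))
  too-many-zeros {suc m} (suc a) b (c ∷ cs) (s≤s m<a+b) d₁ d₂ = cong₂ _∷_ c≡0
    (too-many-zeros a b cs m<a+b
      (λ i i<a → ≡.trans (≡.sym (c+tf-at-suc c (proj₁ (form cs)) i)) (≡.trans (≡.sym (form₁ c cs (suc i))) (d₁ (suc i) (s≤s i<a))))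
      (λ i i<b → ≡.trans (≡.sym (cong (λ a → a *₄ proj₁ (proj₂ (q^ (suc m))) i +₄ proj₁ (proj₂ (form cs)) i) c≡0))
        (≡.trans (≡.sym (form₂-at c cs i)) (d₂ i i<b))))
    where
    c≡0 : c ≡ 0₄
    c≡0 = ≡.trans (≡.sym (c+tf-at-0 c (proj₁ (form cs)))) (≡.trans (≡.sym (form₁ c cs 0)) (d₁ 0 (s≤s z≤n)))
  too-many-zeros {suc m} zero    b (c ∷ cs) m<b d₁ d₂ = cong₂ _∷_ c≡0
    (too-many-zeros 0 b cs (ℕ.<-trans (ℕ.n<1+n m) m<b) (λ _ ())
      (λ i i<b → ≡.trans (≡.sym (cong (λ a → a *₄ proj₁ (proj₂ (q^ (suc m))) i +₄ proj₁ (proj₂ (form cs)) i) c≡0))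
        (≡.trans (≡.sym (form₂-at c cs i)) (d₂ i i<b))))
    where
    c≡0 : c ≡ 0₄
    c≡0 = begin
      c                                                        ≡⟨ *₄-comm c 1₄ ⟨
      c *₄ 1₄                                                  ≡⟨ +₄-identityʳ (c *₄ 1₄) ⟨
      c *₄ 1₄ +₄ 0₄                                            ≡⟨ cong₂ (λ a b → c *₄ a +₄ b) (q^₂-top (suc m)) (Chart.form-deg badChart cs (suc m) (ℕ.n<1+n m)) ⟨
      c *₄ proj₁ (proj₂ (q^ (suc m))) (suc m) +₄ proj₁ (proj₂ (form cs)) (suc m)  ≡⟨ form₂-at c cs (suc m) ⟨
      proj₁ (proj₂ (form (c ∷ cs))) (suc m)                    ≡⟨ d₂ (suc m) m<b ⟩
      0₄                                                       ∎
      where open ≡.≡-Reasoning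

  -- The completion at p = q in the chart q = 1, p = 1 + t, where X₀ = p + q is the parameter t.
  third : Stage
  third = record { algebra = PS ; p = 1ₚ +ₚ t ; X = t }

  base-third : StageHom base third
  base-third = record
    { hom = record { ⟦_⟧ = proj₂ ∘ proj₂ ; ⟦⟧-cong = proj₂ ∘ proj₂ ; ⟦⟧-+ = λ _ _ _ → ≡.refl ; ⟦⟧-* = λ _ _ _ → ≡.refl ; ⟦⟧-κ = λ _ _ → ≡.refl }
    ; ⟦p⟧ = λ _ → ≡.refl
    ; ⟦X⟧ = solve 1 (λ t → (con 1₄ :+ t) :+ con 1₄ := t) P.refl t
    }

  opaque
    unfolding _*ₚ_

    v-const : (t *ₚ t +ₚ (1ₚ +ₚ t) *ₚ t +ₚ (1ₚ +ₚ t) *ₚ (1ₚ +ₚ t)) 0 ≡ 1₄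
    v-const = ≡.refl

    t-cancel : ∀ f → t *ₚ f ≈ₚ constₚ 0₄ → f ≈ₚ constₚ 0₄
    t-cancel f tf≈0 n = ≡.trans (≡.sym (t*≈shift f (suc n))) (≡.trans (tf≈0 (suc n)) (≡.sym (P.κ-0 n)))

    t-divide : ∀ f → f 0 ≡ 0₄ → f ≈ₚ t *ₚ (f ∘ suc)
    t-divide f f0≡0 n = ≡.trans (shift-decompose f n) (≡.trans (cong₂ _+₄_ (≡.trans (cong (λ a → constₚ a n) f0≡0) (P.κ-0 n)) ≡.refl)
      (≡.sym (t*≈shift (f ∘ suc) n)))

  third-ramified : Ramified third
  third-ramified = record
    { res = λ f → f 0
    ; res-cong = λ p → p 0
    ; res-+ = λ f g → +ₚ-at f g 0
    ; res-* = *ₚ-0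
    ; res-κ = λ _ → ≡.refl
    ; res-X = ≡.refl
    ; X-cancel = t-cancel
    ; divide = λ f f0≡0 → f ∘ suc , t-divide f f0≡0
    ; separated = λ f deep n → ≡.trans (deep-div (suc n) f (deep (suc n)) n (ℕ.n<1+n n)) (≡.sym (P.κ-0 n))
    ; u⁻¹ = 1ₚ
    ; v⁻¹ = proj₁ (inverseₚ _ v-const)
    ; u-inverse = solve 1 (λ t → (t :+ (con 1₄ :+ t)) :* con 1₄ := con 1₄) P.refl t
    ; v-inverse = proj₂ (inverseₚ _ v-const)
    }
    where
    deep-div : ∀ k f → Deep third k f → Div k f
    deep-div zero    f _ _ ()
    deep-div (suc k) f (g , f≈tg , d) = Div-resp {f = t *ₚ g} (P.sym f≈tg)
      (Div-* 1 k {t} (λ { zero _ → ≡.refl ; (suc i) (s≤s ()) }) (deep-div k g d))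

-- The tower, iterated norms, and the branches of the bad fibre.

module Tower where
  open FieldOfFour
  open PowerSeriesRing
  open CubicExtension
  open Evaluation
  open Places
  open WeightedFiltration
  open HomogeneousForms
  open ProjectiveLine
  open import Data.List.Base as List using (length; map)
  import Data.List.Properties as List
  open import Data.Nat.Base using (_∸_; _^_; pred)
  open import Data.Nat.Solver using (module +-*-Solver)

  private module P = F₄-Algebra PS
  private module B = F₄-Algebra base-algebra
  open +-*-Solver using (solve; _:+_; _:*_; _:=_; con)

  stage : ℕ → Stage
  stage zero    = base
  stage (suc n) = next (stage n)

  Elem : ℕ → Set
  Elem n = Stage.Carrier (stage n)

  stepNorm : ∀ n → Elem (suc n) → Elem n
  stepNorm n = Cubic.norm (Stage.algebra (stage n)) (Stage.h (stage n))

  fullNorm : ∀ n → Elem n → B.Carrier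
  fullNorm zero    f = f
  fullNorm (suc n) f = fullNorm n (stepNorm n f)

  -- The degree 2 n of (X₁ ... Xₙ)², the largest degree of a basis monomial.
  offset : ℕ → ℕ
  offset zero    = 0
  offset (suc n) = 2 ℕ.+ offset n

  graded : ∀ n → Graded (stage n) (offset n)
  graded zero    = base-graded
  graded (suc n) = NextGraded.nextGraded {stage n} {offset n} (graded n)

  HasDegree : ∀ n → ℕ → Elem n → Set
  HasDegree n M f = ∃ λ m → m ℕ.+ offset n ≡ M × Graded.Hom (graded n) m f

  HasDegree-norm : ∀ n {M f} → HasDegree (suc n) M f → HasDegree n (3 ℕ.* M) (stepNorm n f)
  HasDegree-norm n {f = f} (m , ≡.refl , hf) = 6 ℕ.+ 3 ℕ.* m ℕ.+ 2 ℕ.* offset n ,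
    solve 2 (λ m d → con 6 :+ con 3 :* m :+ con 2 :* d :+ d := con 3 :* (m :+ (con 2 :+ d))) ≡.refl m (offset n) ,
    NextGraded.Hom-norm {stage n} {offset n} (graded n) {m} {f} hf

  HasDegree-* : ∀ n {M M′ f g} → HasDegree n M f → HasDegree n M′ g → HasDegree n (M ℕ.+ M′) (Stage._*_ (stage n) f g)
  HasDegree-* n {f = f} {g} (m , ≡.refl , hf) (m′ , ≡.refl , hg) = m ℕ.+ m′ ℕ.+ offset n ,
    solve 3 (λ m m′ d → m :+ m′ :+ d :+ d := m :+ d :+ (m′ :+ d)) ≡.refl m m′ (offset n) , Graded.Hom-* (graded n) {m} {m′} {f} {g} hf hg

  pow-step : ∀ n M → 3 ^ n ℕ.* (3 ℕ.* M) ≡ 3 ^ suc n ℕ.* M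
  pow-step n M = solve 2 (λ a M → a :* (con 3 :* M) := con 3 :* a :* M) ≡.refl (3 ^ n) M

  fullNorm-form : ∀ n {M f} → HasDegree n M f → IsForm (3 ^ n ℕ.* M) (fullNorm n f)
  fullNorm-form zero    {M} {f} (m , ≡.refl , hf) = subst (λ k → IsForm k f) (solve 1 (λ m → m := con 1 :* (m :+ con 0)) ≡.refl m) hf
  fullNorm-form (suc n) {M} {f} hf = subst (λ k → IsForm k (fullNorm (suc n) f)) (pow-step n M)
    (fullNorm-form n {3 ℕ.* M} {stepNorm n f} (HasDegree-norm n {M} {f} hf))

  Point : ℕ → Set
  Point n = Vec (Fin 3) n

  splitStep : ∀ {S} → Fin 3 → SplitPoint S → SplitPoint (next S)
  splitStep {S} zero             z = splitAbove {S} z 1₄ ≡.refl λ ()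
  splitStep {S} (suc zero)       z = splitAbove {S} z ω ≡.refl λ ()
  splitStep {S} (suc (suc zero)) z = splitAbove {S} z ω² ≡.refl λ ()

  splitPoint : ∀ n → Point n → SplitPoint (stage n)
  splitPoint zero    _       = base-split
  splitPoint (suc n) (ζ ∷ z) = splitStep {stage n} ζ (splitPoint n z)

  evalAt : ∀ n → Point n → Elem n → PowerSeries
  evalAt n z = SplitPoint.⟦_⟧ {stage n} (splitPoint n z)

  sumPoints : ∀ n → (Point n → ℕ) → ℕ
  sumPoints zero    o = o []
  sumPoints (suc n) o = sumPoints n λ z → o (zero ∷ z) ℕ.+ o (suc zero ∷ z) ℕ.+ o (suc (suc zero) ∷ z)

  splitPoint-norm : ∀ n z f → evalAt n z (stepNorm n f) ≈ₚ
    evalAt (suc n) (zero ∷ z) f *ₚ evalAt (suc n) (suc zero ∷ z) f *ₚ evalAt (suc n) (suc (suc zero) ∷ z) f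
  splitPoint-norm n z f = split-norm {stage n} (splitPoint n z) f

  Div-triple : ∀ a b c {f g h k} → k ≈ₚ f *ₚ g *ₚ h → Div a f → Div b g → Div c h → Div (a ℕ.+ b ℕ.+ c) k
  Div-triple a b c {f} {g} {h} {k} k≈ df dg dh = Div-resp {f = f *ₚ g *ₚ h} {k} (P.sym {k} {f *ₚ g *ₚ h} k≈) (Div-* (a ℕ.+ b) c {f *ₚ g} {h} (Div-* a b {f} {g} df dg) dh)

  -- At each floor the norm expands as the product over the three points above, so orders add up
  -- along the fibres.
  norm-order : ∀ n (o : Point n → ℕ) f → (∀ z → Div (o z) (evalAt n z f)) → Div (sumPoints n o) (proj₁ (fullNorm n f))
  norm-order zero    o f d = d []
  norm-order (suc n) o f d = norm-order n (λ z → o (zero ∷ z) ℕ.+ o (suc zero ∷ z) ℕ.+ o (suc (suc zero) ∷ z)) (stepNorm n f) λ z →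
    Div-triple (o (zero ∷ z)) (o (suc zero ∷ z)) (o (suc (suc zero) ∷ z))
      {evalAt (suc n) (zero ∷ z) f} {evalAt (suc n) (suc zero ∷ z) f} {evalAt (suc n) (suc (suc zero) ∷ z) f} {evalAt n z (stepNorm n f)}
      (splitPoint-norm n z f) (d (zero ∷ z)) (d (suc zero ∷ z)) (d (suc (suc zero) ∷ z))

  -- The weight of the next generator, one third of 3^r. For r = 0 its order would be fractional,
  -- and the weight is rounded down to 0.
  width : ℕ → ℕ
  width zero    = 0
  width (suc r) = 3 ^ r

  width-pred : ∀ r → 3 ℕ.* width (pred r) ℕ.≤ width r
  width-pred zero          = z≤n
  width-pred (suc zero)    = z≤n
  width-pred (suc (suc r)) = ℕ.≤-refl

  -- A place where Xₖ is a primitive cube root of unity, followed i steps up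
  -- the tower; 3 ^ r is the order of h until it drops to 0.  Imposing
  -- membership in Fil a costs at most 2 * 3 ^ i * a - excess conditions.
  record Branch (S : Stage) : Set₁ where
    open Stage S
    field
      filtration : Filtration S
    open Filtration filtration public
    field
      k i r : ℕ
      h∈ : Fil (3 ℕ.* width r) h
      excess threshold : ℕ
      count : ∀ a → threshold ℕ.≤ a → length (tests a) ℕ.+ excess ℕ.≤ 2 ℕ.* 3 ^ i ℕ.* a
      phase : (r ℕ.+ i ≡ k × 3 ^ (k ℕ.+ i) ℕ.≤ excess ℕ.+ 3 ^ k) ⊎ (r ≡ 0 × 3 ^ (k ℕ.+ i) ℕ.≤ excess ℕ.+ 3 ^ i)

  module _ {S : Stage} (b : Branch S) where
    open Stage S
    open Branch b
    private
      w : ℕ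
      w = width r
      module A = Above filtration w h∈

    branchAbove : Branch (next S)
    branchAbove = record
      { filtration = A.above
      ; k = k ; i = suc i ; r = pred r
      ; h∈ = Filtration.Fil-mono A.above {f = Stage.h (next S)} (width-pred r) A.h∈′
      -- The components are tested at a, a - w and a - 2 w, which saves 2 * 3^i * 3 w bits on top of
      -- three times the old excess.
      ; excess = 3 ℕ.* excess ℕ.+ 6 ℕ.* 3 ^ i ℕ.* w
      -- From here on both truncated subtractions of w are exact and stay above the old threshold.
      ; threshold = threshold ℕ.+ w ℕ.+ w
      ; count = count′
      ; phase = phase′ r ≡.refl phase
      }
      where
      e : ℕ
      e = 3 ℕ.* excess ℕ.+ 6 ℕ.* 3 ^ i ℕ.* w

      length-tests : ∀ a → length (Filtration.tests A.above a) ≡ length (tests a) ℕ.+ (length (tests (a ∸ w)) ℕ.+ length (tests (a ∸ w ∸ w)))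
      length-tests a = ≡.trans (List.length-++ (map (component₀ {algebra} {h}) (tests a)))
        (cong₂ ℕ._+_ (List.length-map (component₀ {algebra} {h}) (tests a)) (≡.trans (List.length-++ (map (component₁ {algebra} {h}) (tests (a ∸ w))))
          (cong₂ ℕ._+_ (List.length-map (component₁ {algebra} {h}) (tests (a ∸ w))) (List.length-map (component₂ {algebra} {h}) (tests (a ∸ w ∸ w))))))

      count′ : ∀ a → threshold ℕ.+ w ℕ.+ w ℕ.≤ a → length (Filtration.tests A.above a) ℕ.+ e ℕ.≤ 2 ℕ.* 3 ^ suc i ℕ.* a
      count′ a L≤a = begin
        length (Filtration.tests A.above a) ℕ.+ e
          ≡⟨ cong (ℕ._+ e) (length-tests a) ⟩
        l₀ ℕ.+ (l₁ ℕ.+ l₂) ℕ.+ e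
          ≡⟨ solve 6 (λ l₀ l₁ l₂ x i w → l₀ :+ (l₁ :+ l₂) :+ (con 3 :* x :+ con 6 :* i :* w) := (l₀ :+ x) :+ ((l₁ :+ x) :+ (l₂ :+ x)) :+ con 6 :* i :* w)
               ≡.refl l₀ l₁ l₂ excess (3 ^ i) w ⟩
        (l₀ ℕ.+ excess) ℕ.+ ((l₁ ℕ.+ excess) ℕ.+ (l₂ ℕ.+ excess)) ℕ.+ 6 ℕ.* 3 ^ i ℕ.* w
          ≤⟨ ℕ.+-monoˡ-≤ (6 ℕ.* 3 ^ i ℕ.* w) (ℕ.+-mono-≤ (count a L≤₀) (ℕ.+-mono-≤ (count (a ∸ w) L≤₁) (count (a ∸ w ∸ w) L≤₂))) ⟩
        2 ℕ.* 3 ^ i ℕ.* a ℕ.+ (2 ℕ.* 3 ^ i ℕ.* (a ∸ w) ℕ.+ 2 ℕ.* 3 ^ i ℕ.* (a ∸ w ∸ w)) ℕ.+ 6 ℕ.* 3 ^ i ℕ.* w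
          ≡⟨ cong₂ (λ x y → 2 ℕ.* 3 ^ i ℕ.* x ℕ.+ (2 ℕ.* 3 ^ i ℕ.* y ℕ.+ 2 ℕ.* 3 ^ i ℕ.* (a ∸ w ∸ w)) ℕ.+ 6 ℕ.* 3 ^ i ℕ.* w) a≡ a∸w≡ ⟩
        2 ℕ.* 3 ^ i ℕ.* (a ∸ w ∸ w ℕ.+ w ℕ.+ w) ℕ.+ (2 ℕ.* 3 ^ i ℕ.* (a ∸ w ∸ w ℕ.+ w) ℕ.+ 2 ℕ.* 3 ^ i ℕ.* (a ∸ w ∸ w)) ℕ.+ 6 ℕ.* 3 ^ i ℕ.* w
          ≤⟨ ℕ.≤-reflexive (solve 3 (λ i b w → con 2 :* i :* (b :+ w :+ w) :+ (con 2 :* i :* (b :+ w) :+ con 2 :* i :* b) :+ con 6 :* i :* w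
               := con 2 :* (con 3 :* i) :* (b :+ w :+ w)) ≡.refl (3 ^ i) (a ∸ w ∸ w) w) ⟩
        2 ℕ.* 3 ^ suc i ℕ.* (a ∸ w ∸ w ℕ.+ w ℕ.+ w)
          ≡⟨ cong (2 ℕ.* 3 ^ suc i ℕ.*_) a≡ ⟨
        2 ℕ.* 3 ^ suc i ℕ.* a ∎
        where
        open ℕ.≤-Reasoning
        l₀ = length (tests a)
        l₁ = length (tests (a ∸ w))
        l₂ = length (tests (a ∸ w ∸ w))
        L≤₂ : threshold ℕ.≤ a ∸ w ∸ w
        L≤₂ = ℕ.m+n≤o⇒m≤o∸n threshold (ℕ.m+n≤o⇒m≤o∸n (threshold ℕ.+ w) L≤a)
        L≤₁ : threshold ℕ.≤ a ∸ w
        L≤₁ = ℕ.≤-trans L≤₂ (ℕ.m∸n≤m (a ∸ w) w)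
        L≤₀ : threshold ℕ.≤ a
        L≤₀ = ℕ.≤-trans L≤₁ (ℕ.m∸n≤m a w)
        w≤a∸w : w ℕ.≤ a ∸ w
        w≤a∸w = ℕ.≤-trans (ℕ.m≤n+m w threshold) (ℕ.m+n≤o⇒m≤o∸n (threshold ℕ.+ w) L≤a)
        w≤a : w ℕ.≤ a
        w≤a = ℕ.≤-trans w≤a∸w (ℕ.m∸n≤m a w)
        a∸w≡ : a ∸ w ≡ a ∸ w ∸ w ℕ.+ w
        a∸w≡ = ≡.sym (ℕ.m∸n+n≡m w≤a∸w)
        a≡ : a ≡ a ∸ w ∸ w ℕ.+ w ℕ.+ w
        a≡ = ≡.trans (≡.sym (ℕ.m∸n+n≡m w≤a)) (cong (ℕ._+ w) a∸w≡)

      3^+ : 3 ^ (k ℕ.+ suc i) ≡ 3 ℕ.* 3 ^ (k ℕ.+ i)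
      3^+ = cong (3 ^_) (ℕ.+-suc k i)

      -- While r > 0, 3 w = 3^r and r + i = k give the recursion e′ = 3 e + 2 * 3^k, with solution
      -- 3^(k + i) - 3^k. Afterwards w = 0, and all terms of the second bound triple.
      phase′ : ∀ s → r ≡ s → (r ℕ.+ i ≡ k × 3 ^ (k ℕ.+ i) ℕ.≤ excess ℕ.+ 3 ^ k) ⊎ (r ≡ 0 × 3 ^ (k ℕ.+ i) ℕ.≤ excess ℕ.+ 3 ^ i) →
        (pred r ℕ.+ suc i ≡ k × 3 ^ (k ℕ.+ suc i) ℕ.≤ e ℕ.+ 3 ^ k) ⊎ (pred r ≡ 0 × 3 ^ (k ℕ.+ suc i) ℕ.≤ e ℕ.+ 3 ^ suc i)
      phase′ (suc s) ≡.refl (inj₁ (≡.refl , bd)) = inj₁ (ℕ.+-suc s i , (begin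
        3 ^ (k ℕ.+ suc i)             ≡⟨ 3^+ ⟩
        3 ℕ.* 3 ^ (k ℕ.+ i)           ≤⟨ ℕ.*-monoʳ-≤ 3 bd ⟩
        3 ℕ.* (excess ℕ.+ 3 ^ k)      ≡⟨ ℕ.*-distribˡ-+ 3 excess (3 ^ k) ⟩
        3 ℕ.* excess ℕ.+ 3 ℕ.* 3 ^ k  ≡⟨ cong (λ x → 3 ℕ.* excess ℕ.+ 3 ℕ.* (3 ℕ.* x)) (ℕ.^-distribˡ-+-* 3 s i) ⟩
        3 ℕ.* excess ℕ.+ 3 ℕ.* (3 ℕ.* (3 ^ s ℕ.* 3 ^ i))
          ≡⟨ solve 3 (λ x s i → con 3 :* x :+ con 3 :* (con 3 :* (s :* i)) := con 3 :* x :+ con 6 :* i :* s :+ con 3 :* (s :* i)) ≡.refl excess (3 ^ s) (3 ^ i) ⟩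
        e ℕ.+ 3 ℕ.* (3 ^ s ℕ.* 3 ^ i) ≡⟨ cong (λ x → e ℕ.+ 3 ℕ.* x) (ℕ.^-distribˡ-+-* 3 s i) ⟨
        e ℕ.+ 3 ^ k                   ∎))
        where open ℕ.≤-Reasoning
      -- Now i = k, where the bounds of the two phases coincide.
      phase′ zero ≡.refl (inj₁ (≡.refl , bd)) = inj₂ (≡.refl , late bd)
        where
        late : 3 ^ (k ℕ.+ i) ℕ.≤ excess ℕ.+ 3 ^ i → 3 ^ (k ℕ.+ suc i) ℕ.≤ e ℕ.+ 3 ^ suc i
        late bd = begin
          3 ^ (k ℕ.+ suc i)             ≡⟨ 3^+ ⟩
          3 ℕ.* 3 ^ (k ℕ.+ i)           ≤⟨ ℕ.*-monoʳ-≤ 3 bd ⟩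
          3 ℕ.* (excess ℕ.+ 3 ^ i)      ≤⟨ ℕ.≤-reflexive (solve 2 (λ x i → con 3 :* (x :+ i) := con 3 :* x :+ con 6 :* i :* con 0 :+ con 3 :* i) ≡.refl excess (3 ^ i)) ⟩
          e ℕ.+ 3 ^ suc i               ∎
          where open ℕ.≤-Reasoning
      phase′ s _ (inj₂ (≡.refl , bd)) = inj₂ (≡.refl , late)
        where
        late : 3 ^ (k ℕ.+ suc i) ℕ.≤ e ℕ.+ 3 ^ suc i
        late = begin
          3 ^ (k ℕ.+ suc i)             ≡⟨ 3^+ ⟩
          3 ℕ.* 3 ^ (k ℕ.+ i)           ≤⟨ ℕ.*-monoʳ-≤ 3 bd ⟩
          3 ℕ.* (excess ℕ.+ 3 ^ i)      ≤⟨ ℕ.≤-reflexive (solve 2 (λ x i → con 3 :* (x :+ i) := con 3 :* x :+ con 6 :* i :* con 0 :+ con 3 :* i) ≡.refl excess (3 ^ i)) ⟩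
          e ℕ.+ 3 ^ suc i               ∎
          where open ℕ.≤-Reasoning

    branchAbove-norm : ∀ T {f} → Filtration.Fil A.above T f → Fil (3 ℕ.* T) (Cubic.norm algebra h f)
    branchAbove-norm T {f} = A.Fil-norm T {f}

-- Counting conditions on the bad fibre, and the bound for zeros.

module ZeroBound where
  open FieldOfFour
  open PowerSeriesRing
  open Evaluation
  open Places
  open Ramification
  open HomogeneousForms
  open ProjectiveLine
  open Tower
  open import Data.List.Base as List using (List; []; _∷_; _++_; length; map; concatMap)
  import Data.List.Properties as List
  open import Data.List.Relation.Unary.All as All using (All; []; _∷_)
  import Data.List.Relation.Unary.All.Properties as All
  open import Data.Nat.Base using (_^_)
  open import Data.Nat.Solver using (module +-*-Solver)

  private module P = F₄-Algebra PS
  private module B = F₄-Algebra base-algebra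
  open +-*-Solver using (solve; _:+_; _:*_; _:=_; con)

  unitPlace : ∀ n → UnitPlace (stage n) (3 ^ n)
  unitPlace zero    = base-unit
  unitPlace (suc n) = unitAbove {stage n} (unitPlace n)

  unitEval : ∀ n → Eval (Stage.algebra (stage n))
  unitEval n = UnitPlace.eval {stage n} {3 ^ n} (unitPlace n)

  -- The equation ζ² + ζ = 1 singles out the primitive cube roots. The excess starts at 0: a single
  -- expansion has 2 a bits below order a.
  newBranch : ∀ n ζ → ζ *₄ ζ *₄ ζ ≡ 1₄ → ζ *₄ ζ +₄ ζ ≡ 1₄ → Branch (stage (suc n))
  newBranch n ζ ζ³≡1 ζ²+ζ≡1 = record
    { filtration = twisted {stage n} (unitPlace n) ζ ζ³≡1
    ; k = suc n ; i = 0 ; r = suc n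
    ; h∈ = twisted-h {stage n} (unitPlace n) ζ ζ³≡1 ζ²+ζ≡1
    ; excess = 0 ; threshold = 0
    ; count = λ a _ → ℕ.≤-reflexive (≡.trans (ℕ.+-identityʳ _) (length-coefficientTests _ a))
    ; phase = inj₁ (ℕ.+-identityʳ (suc n) , ℕ.≤-reflexive (cong (3 ^_) (ℕ.+-identityʳ (suc n))))
    }

  -- Together with the unit place these exhaust the fibre q = 0: for each k from 1 to n there are
  -- the places where Xₖ is ω and those where it is ω².
  branches : ∀ n → List (Branch (stage n))
  branches zero    = []
  branches (suc n) = newBranch n ω ≡.refl ≡.refl ∷ newBranch n ω² ≡.refl ≡.refl ∷ map (branchAbove {stage n}) (branches n)

  -- f / s^T has no pole on the bad fibre.
  Cond : ∀ n → ℕ → Elem n → Set₁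
  Cond n T f = Div T (Eval.⟦_⟧ (unitEval n) f) × All (λ b → Branch.Fil b T f) (branches n)

  -- The unit place below collects the new unit place and the two new branches; each older branch
  -- lies above its former self.
  Cond-norm : ∀ n T f → Cond (suc n) T f → Cond n (3 ℕ.* T) (stepNorm n f)
  Cond-norm n T f (d , dω ∷ dω² ∷ ds) =
      unit-cond-norm {stage n} (unitPlace n) T f d dω dω²
    , All.map (λ {b} → branchAbove-norm {stage n} b T {f}) (All.map⁻ {f = branchAbove {stage n}} ds)

  Cond-+ : ∀ n {T} f g → Cond n T f → Cond n T g → Cond n T (Stage._+_ (stage n) f g)
  Cond-+ n {T} f g (d , ds) (e , es) =
      Filtration.Fil-+ {stage n} (evalFiltration {stage n} (unitEval n)) {T} {f} {g} d e
    , All.zipWith (λ {b} (x , y) → Branch.Fil-+ b {T} {f} {g} x y) (ds , es)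

  Cond-* : ∀ n T T′ f g → Cond n T f → Cond n T′ g → Cond n (T ℕ.+ T′) (Stage._*_ (stage n) f g)
  Cond-* n T T′ f g (d , ds) (e , es) =
      Filtration.Fil-* {stage n} (evalFiltration {stage n} (unitEval n)) T T′ {f} {g} d e
    , All.zipWith (λ {b} (x , y) → Branch.Fil-* b T T′ {f} {g} x y) (ds , es)

  Cond-zero : ∀ n T → Cond n T (Stage.κ (stage n) 0₄)
  Cond-zero n T = Filtration.Fil-zero {stage n} (evalFiltration {stage n} (unitEval n)) T
    , All.universal (λ b → Branch.Fil-zero b T) (branches n)

  fullNorm-div : ∀ n T f → Cond n T f → Div (3 ^ n ℕ.* T) (proj₁ (proj₂ (fullNorm n f)))
  fullNorm-div zero    T f (d , _) = subst (λ k → Div k (proj₁ (proj₂ f))) (≡.sym (ℕ.*-identityˡ T)) d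
  fullNorm-div (suc n) T f c = subst (λ k → Div k (proj₁ (proj₂ (fullNorm (suc n) f)))) (pow-step n T)
    (fullNorm-div n (3 ℕ.* T) (stepNorm n f) (Cond-norm n T f c))

  condTests : ∀ n → ℕ → List (Functional (Stage.algebra (stage n)))
  condTests n T = coefficientTests (unitEval n) T ++ concatMap (λ b → Branch.tests b T) (branches n)

  condTests-sound : ∀ n T {f} → Vanish (condTests n T) f → Cond n T f
  condTests-sound n T {f} vs = let us , ws = All.++⁻ (coefficientTests (unitEval n) T) vs in
    coefficientTests-sound (unitEval n) T us , go (branches n) ws
    where
    go : ∀ bs → Vanish (concatMap (λ b → Branch.tests b T) bs) f → All (λ b → Branch.Fil b T f) bs
    go []       _  = []
    go (b ∷ bs) ws = let u , w = All.++⁻ (Branch.tests b T) ws in Branch.sound b T u ∷ go bs w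

  sumOver : ∀ {ℓ} {A : Set ℓ} → (A → ℕ) → List A → ℕ
  sumOver g []       = 0
  sumOver g (x ∷ xs) = g x ℕ.+ sumOver g xs

  branch-level : ∀ n → All (λ b → Branch.k b ℕ.+ Branch.i b ≡ n) (branches n)
  branch-level zero    = []
  branch-level (suc n) = ℕ.+-identityʳ (suc n) ∷ ℕ.+-identityʳ (suc n) ∷
    All.map⁺ (All.map (λ {b} eq → ≡.trans (ℕ.+-suc (Branch.k b) (Branch.i b)) (cong suc eq)) (branch-level n))

  length-branches : ∀ n → length (branches n) ≡ 2 ℕ.* n
  length-branches zero    = ≡.refl
  length-branches (suc n) = ≡.trans (cong (2 ℕ.+_) (≡.trans (List.length-map (branchAbove {stage n}) (branches n)) (length-branches n)))
    (solve 1 (λ n → con 2 :+ con 2 :* n := con 2 :* (con 1 :+ n)) ≡.refl n)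

  -- The fibre counted with multiplicities: a branch stands for 3^i points and the unit place for
  -- one, out of 3ⁿ in all.
  sum-3^i : ∀ n → sumOver (λ b → 3 ^ Branch.i b) (branches n) ℕ.+ 1 ≡ 3 ^ n
  sum-3^i zero    = ≡.refl
  sum-3^i (suc n) = ≡.trans (cong (λ x → 1 ℕ.+ (1 ℕ.+ x) ℕ.+ 1) (go (branches n)))
    (≡.trans (solve 1 (λ x → con 1 :+ (con 1 :+ con 3 :* x) :+ con 1 := con 3 :* (x :+ con 1)) ≡.refl (sumOver (λ b → 3 ^ Branch.i b) (branches n)))
      (cong (3 ℕ.*_) (sum-3^i n)))
    where
    go : ∀ bs → sumOver (λ b → 3 ^ Branch.i b) (map (branchAbove {stage n}) bs) ≡ 3 ℕ.* sumOver (λ b → 3 ^ Branch.i b) bs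
    go []       = ≡.refl
    go (b ∷ bs) = ≡.trans (cong (3 ℕ.* 3 ^ Branch.i b ℕ.+_) (go bs)) (≡.sym (ℕ.*-distribˡ-+ 3 (3 ^ Branch.i b) _))

  -- A geometric series, as there are two branches for every k from 1 to n.
  sum-3^k : ∀ n → sumOver (λ b → 3 ^ Branch.k b) (branches n) ℕ.+ 3 ≡ 3 ^ suc n
  sum-3^k zero    = ≡.refl
  sum-3^k (suc n) = ≡.trans (cong (λ x → 3 ^ suc n ℕ.+ (3 ^ suc n ℕ.+ x) ℕ.+ 3) (go (branches n)))
    (≡.trans (solve 2 (λ a x → a :+ (a :+ x) :+ con 3 := con 2 :* a :+ (x :+ con 3)) ≡.refl (3 ^ suc n) (sumOver (λ b → 3 ^ Branch.k b) (branches n)))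
      (≡.trans (cong (2 ℕ.* 3 ^ suc n ℕ.+_) (sum-3^k n)) (solve 1 (λ a → con 2 :* a :+ a := con 3 :* a) ≡.refl (3 ^ suc n))))
    where
    go : ∀ bs → sumOver (λ b → 3 ^ Branch.k b) (map (branchAbove {stage n}) bs) ≡ sumOver (λ b → 3 ^ Branch.k b) bs
    go []       = ≡.refl
    go (b ∷ bs) = cong (3 ^ Branch.k b ℕ.+_) (go bs)

  module _ {S : Stage} where

    branch-excess : (b : Branch S) → 3 ^ (Branch.k b ℕ.+ Branch.i b) ℕ.≤ Branch.excess b ℕ.+ (3 ^ Branch.k b ℕ.+ 3 ^ Branch.i b)
    branch-excess b with Branch.phase b
    ... | inj₁ (_ , bd) = ℕ.≤-trans bd (ℕ.+-monoʳ-≤ (Branch.excess b) (ℕ.m≤m+n _ _))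
    ... | inj₂ (_ , bd) = ℕ.≤-trans bd (ℕ.+-monoʳ-≤ (Branch.excess b) (ℕ.m≤n+m _ _))

    tests-bound : ∀ T n (bs : List (Branch S)) → All (λ b → Branch.k b ℕ.+ Branch.i b ≡ n) bs → sumOver Branch.threshold bs ℕ.≤ T →
      length (concatMap (λ b → Branch.tests b T) bs) ℕ.+ length bs ℕ.* 3 ^ n ℕ.≤
        2 ℕ.* T ℕ.* sumOver (λ b → 3 ^ Branch.i b) bs ℕ.+ (sumOver (λ b → 3 ^ Branch.k b) bs ℕ.+ sumOver (λ b → 3 ^ Branch.i b) bs)
    tests-bound T n []       _          _   = z≤n
    tests-bound T n (b ∷ bs) (≡.refl ∷ eqs) thr = begin
      length (tests T ++ rest) ℕ.+ (3 ^ n ℕ.+ length bs ℕ.* 3 ^ n)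
        ≡⟨ cong (ℕ._+ (3 ^ n ℕ.+ length bs ℕ.* 3 ^ n)) (List.length-++ (tests T)) ⟩
      length (tests T) ℕ.+ length rest ℕ.+ (3 ^ n ℕ.+ length bs ℕ.* 3 ^ n)
        ≤⟨ ℕ.+-monoʳ-≤ (length (tests T) ℕ.+ length rest) (ℕ.+-monoˡ-≤ (length bs ℕ.* 3 ^ n) (branch-excess b)) ⟩
      length (tests T) ℕ.+ length rest ℕ.+ (excess ℕ.+ (3 ^ k ℕ.+ 3 ^ i) ℕ.+ length bs ℕ.* 3 ^ n)
        ≡⟨ solve 6 (λ l r e x y m → l :+ r :+ (e :+ (x :+ y) :+ m) := (l :+ e) :+ (r :+ m) :+ (x :+ y)) ≡.refl
             (length (tests T)) (length rest) excess (3 ^ k) (3 ^ i) (length bs ℕ.* 3 ^ n) ⟩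
      (length (tests T) ℕ.+ excess) ℕ.+ (length rest ℕ.+ length bs ℕ.* 3 ^ n) ℕ.+ (3 ^ k ℕ.+ 3 ^ i)
        ≤⟨ ℕ.+-monoˡ-≤ (3 ^ k ℕ.+ 3 ^ i) (ℕ.+-mono-≤ (count T (ℕ.≤-trans (ℕ.m≤m+n _ _) thr))
             (tests-bound T n bs eqs (ℕ.≤-trans (ℕ.m≤n+m _ threshold) thr))) ⟩
      2 ℕ.* 3 ^ i ℕ.* T ℕ.+ (2 ℕ.* T ℕ.* I ℕ.+ (K ℕ.+ I)) ℕ.+ (3 ^ k ℕ.+ 3 ^ i)
        ≡⟨ solve 5 (λ T x y K I → con 2 :* y :* T :+ (con 2 :* T :* I :+ (K :+ I)) :+ (x :+ y) := con 2 :* T :* (y :+ I) :+ ((x :+ K) :+ (y :+ I))) ≡.refl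
             T (3 ^ k) (3 ^ i) K I ⟩
      2 ℕ.* T ℕ.* (3 ^ i ℕ.+ I) ℕ.+ ((3 ^ k ℕ.+ K) ℕ.+ (3 ^ i ℕ.+ I)) ∎
      where
      open ℕ.≤-Reasoning
      open Branch b
      rest = concatMap (λ b → Branch.tests b T) bs
      I = sumOver (λ b → 3 ^ Branch.i b) bs
      K = sumOver (λ b → 3 ^ Branch.k b) bs

  totalThreshold : ℕ → ℕ
  totalThreshold n = sumOver Branch.threshold (branches n)

  -- Order T on the whole fibre naively costs 2 * 3ⁿ T bits. Each of the 2 n branches saves 3ⁿ up to
  -- 3^k + 3^i, and these defects sum to at most 4 * 3ⁿ. The saving of 2 n 3ⁿ is what makes up for
  -- the degrees of the basis monomials.
  condTests-bound : ∀ n T → totalThreshold n ℕ.≤ T →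
    length (condTests n T) ℕ.+ 2 ℕ.* n ℕ.* 3 ^ n ℕ.≤ 2 ℕ.* 3 ^ n ℕ.* (T ℕ.+ 2)
  condTests-bound n T thr = begin
    length (condTests n T) ℕ.+ 2 ℕ.* n ℕ.* 3 ^ n
      ≡⟨ cong₂ (λ x y → x ℕ.+ y ℕ.* 3 ^ n) (≡.trans (List.length-++ (coefficientTests (unitEval n) T))
           (cong (ℕ._+ length rest) (length-coefficientTests (unitEval n) T))) (≡.sym (length-branches n)) ⟩
    2 ℕ.* T ℕ.+ length rest ℕ.+ length (branches n) ℕ.* 3 ^ n
      ≡⟨ ℕ.+-assoc (2 ℕ.* T) (length rest) _ ⟩
    2 ℕ.* T ℕ.+ (length rest ℕ.+ length (branches n) ℕ.* 3 ^ n)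
      ≤⟨ ℕ.+-monoʳ-≤ (2 ℕ.* T) (tests-bound T n (branches n) (branch-level n) thr) ⟩
    2 ℕ.* T ℕ.+ (2 ℕ.* T ℕ.* I ℕ.+ (K ℕ.+ I))
      ≡⟨ solve 3 (λ T I K → con 2 :* T :+ (con 2 :* T :* I :+ (K :+ I)) := con 2 :* T :* (I :+ con 1) :+ (K :+ I)) ≡.refl T I K ⟩
    2 ℕ.* T ℕ.* (I ℕ.+ 1) ℕ.+ (K ℕ.+ I)
      ≤⟨ ℕ.+-monoʳ-≤ (2 ℕ.* T ℕ.* (I ℕ.+ 1)) (ℕ.+-mono-≤ (ℕ.m≤m+n K 3) (ℕ.m≤m+n I 1)) ⟩
    2 ℕ.* T ℕ.* (I ℕ.+ 1) ℕ.+ ((K ℕ.+ 3) ℕ.+ (I ℕ.+ 1))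
      ≡⟨ cong₂ (λ x y → 2 ℕ.* T ℕ.* x ℕ.+ (y ℕ.+ x)) (sum-3^i n) (sum-3^k n) ⟩
    2 ℕ.* T ℕ.* 3 ^ n ℕ.+ (3 ℕ.* 3 ^ n ℕ.+ 3 ^ n)
      ≡⟨ solve 2 (λ T a → con 2 :* T :* a :+ (con 3 :* a :+ a) := con 2 :* a :* (T :+ con 2)) ≡.refl T (3 ^ n) ⟩
    2 ℕ.* 3 ^ n ℕ.* (T ℕ.+ 2) ∎
    where
    open ℕ.≤-Reasoning
    rest = concatMap (λ b → Branch.tests b T) (branches n)
    I = sumOver (λ b → 3 ^ Branch.i b) (branches n)
    K = sumOver (λ b → 3 ^ Branch.k b) (branches n)

  completion : ℕ → Stage
  completion zero    = third
  completion (suc n) = next (completion n)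

  completion-ramified : ∀ n → Ramified (completion n)
  completion-ramified zero    = third-ramified
  completion-ramified (suc n) = NextRamified.nextRamified {completion n} (completion-ramified n)

  complete : ∀ n → StageHom (stage n) (completion n)
  complete zero    = base-third
  complete (suc n) = next-hom {stage n} {completion n} (complete n)

  IsZero : ∀ n → Elem n → Set
  IsZero n f = Stage._≈_ (stage n) f (Stage.κ (stage n) 0₄)

  IsZero³ : ∀ n → Stage.Carrier (completion n) → Set
  IsZero³ n f = Stage._≈_ (completion n) f (Stage.κ (completion n) 0₄)

  -- Homogeneity is essential: the base ring is a product of three charts, and a form, unlike a
  -- general triple, is determined by its last component.
  complete-injective : ∀ n m f → Graded.Hom (graded n) m f → IsZero³ n (StageHom.⟦_⟧ (complete n) f) → IsZero n f
  complete-injective zero m f (c , f≈) f³≈0 = B.trans {f} {form c} {B.κ 0₄} f≈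
    (subst (λ c → form c B.≈ B.κ 0₄) (≡.sym (chart₃-injective c λ n → ≡.trans (≡.sym (proj₂ (proj₂ f≈) n)) (≡.trans (f³≈0 n) (P.κ-0 n)))) (form-zeros m))
  complete-injective (suc n) m (f₀ , f₁ , f₂) (h₀ , h₁ , h₂) (p₀ , p₁ , p₂) =
    complete-injective n (2 ℕ.+ m) f₀ h₀ p₀ , complete-injective n (1 ℕ.+ m) f₁ h₁ p₁ , complete-injective n m f₂ h₂ p₂

  stepNorm-zero : ∀ n {M} f → HasDegree (suc n) M f → IsZero n (stepNorm n f) → IsZero (suc n) f
  stepNorm-zero n f (m , _ , hf) norm≈0 = complete-injective (suc n) m f hf
    (NextRamified.norm-zero {completion n} (completion-ramified n) (StageHom.⟦_⟧ (complete (suc n)) f)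
      (T.trans (T.sym (hom-norm {stage n} {completion n} (complete n) f))
        (T.trans (StageHom.⟦⟧-cong (complete n) norm≈0) (StageHom.⟦⟧-κ (complete n) 0₄))))
    where module T = Stage (completion n)

  fullNorm-zero : ∀ n {M} f → HasDegree n M f → fullNorm n f B.≈ B.κ 0₄ → IsZero n f
  fullNorm-zero zero    f _  eq = eq
  fullNorm-zero (suc n) {M} f hf eq = stepNorm-zero n {M} f hf
    (fullNorm-zero n {3 ℕ.* M} (stepNorm n f) (HasDegree-norm n {M} {f} hf) eq)

  form-decide-zero : ∀ {m f} (c : Vec F₄ (suc m)) → f B.≈ form c → c ≡ zeros (suc m) → f B.≈ B.κ 0₄
  form-decide-zero {m} {f} c f≈ ≡.refl = B.trans {f} {form c} {B.κ 0₄} f≈ (form-zeros m)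

  -- The substitute for counting zeros and poles on the curve. The norm is a form of degree 3ⁿ M
  -- with zeros of order at least `sumPoints n o` at p = 0 and 3ⁿ T at q = 0; if these are too many,
  -- it vanishes.
  zero-bound : ∀ n M T f (o : Point n → ℕ) → HasDegree n M f → Cond n T f → (∀ z → Div (o z) (evalAt n z f)) →
    3 ^ n ℕ.* M ℕ.< sumPoints n o ℕ.+ 3 ^ n ℕ.* T → IsZero n f
  zero-bound n M T f o hf cf d bound = fullNorm-zero n {M} f hf (form-decide-zero c N≈ (too-many-zeros (sumPoints n o) (3 ^ n ℕ.* T) c bound
      (Div-resp {f = proj₁ (fullNorm n f)} {proj₁ (form c)} (proj₁ N≈) (norm-order n o f d))
      (Div-resp {f = proj₁ (proj₂ (fullNorm n f))} {proj₁ (proj₂ (form c))} (proj₁ (proj₂ N≈)) (fullNorm-div n T f cf))))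
    where
    isForm : IsForm (3 ^ n ℕ.* M) (fullNorm n f)
    isForm = fullNorm-form n {M} {f} hf
    c = proj₁ isForm
    N≈ : fullNorm n f B.≈ form c
    N≈ = proj₂ isForm

-- Dimension counts over F₂ and the function space V.

module Subspaces where
  open FieldOfFour
  open PowerSeriesRing
  open CubicExtension
  open Evaluation
  open Places
  open HomogeneousForms
  open ProjectiveLine
  open Tower
  open ZeroBound
  open import Data.List.Base as List using (List; []; _∷_; _++_; length)
  open import Data.List.Relation.Unary.All using ([]; _∷_)
  open import Data.Nat.Base using (_∸_; _^_)
  open import Data.Nat.Solver using (module +-*-Solver)

  private module P = F₄-Algebra PS
  private module B = F₄-Algebra base-algebra

  infixl 6 _⊕_
  _⊕_ : ∀ {k} → Vec Bool k → Vec Bool k → Vec Bool k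
  _⊕_ = Vec.zipWith _xor_

  𝟎 : ∀ {k} → Vec Bool k
  𝟎 = Vec.replicate _ false

  -- A linear parametrisation with trivial kernel, which shows that P contains a k-dimensional space
  -- over F₂ and at once names its elements by bits.
  record Subspace {ℓ} (K : F₄-Algebra) (P : F₄-Algebra.Carrier K → Set ℓ) (k : ℕ) : Set ℓ where
    open F₄-Algebra K
    field
      ι           : Vec Bool k → Carrier
      ι-⊕         : ∀ u v → ι (u ⊕ v) ≈ ι u + ι v
      ι-injective : ∀ v → ι v ≈ κ 0₄ → v ≡ 𝟎
      member      : ∀ v → P (ι v)

  xor-self : ∀ a → a xor a ≡ false
  xor-self false = ≡.refl
  xor-self true  = ≡.refl

  ⊕-self : ∀ {k} (v : Vec Bool k) → v ⊕ v ≡ 𝟎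
  ⊕-self []      = ≡.refl
  ⊕-self (a ∷ v) = cong₂ _∷_ (xor-self a) (⊕-self v)

  ⊕-𝟎ˡ : ∀ {k} (v : Vec Bool k) → 𝟎 ⊕ v ≡ v
  ⊕-𝟎ˡ []      = ≡.refl
  ⊕-𝟎ˡ (a ∷ v) = cong (a ∷_) (⊕-𝟎ˡ v)

  ⊕-𝟎ʳ : ∀ {k} (v : Vec Bool k) → v ⊕ 𝟎 ≡ v
  ⊕-𝟎ʳ []      = ≡.refl
  ⊕-𝟎ʳ (a ∷ v) = cong₂ _∷_ (Bool.xor-identityʳ a) (⊕-𝟎ʳ v)

  Additive : ∀ {k} → (Vec Bool k → Bool) → Set
  Additive ℓ = ∀ u v → ℓ (u ⊕ v) ≡ ℓ u xor ℓ v

  additive-𝟎 : ∀ {k} {ℓ : Vec Bool k → Bool} → Additive ℓ → ℓ 𝟎 ≡ false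
  additive-𝟎 {ℓ = ℓ} add = ≡.trans (cong ℓ (≡.sym (⊕-self 𝟎))) (≡.trans (add 𝟎 𝟎) (xor-self (ℓ 𝟎)))

  additive-∷ : ∀ {k} {ℓ : Vec Bool (suc k) → Bool} → Additive ℓ → ∀ a v → ℓ (a ∷ v) ≡ ℓ (a ∷ 𝟎) xor ℓ (false ∷ v)
  additive-∷ {ℓ = ℓ} add a v = ≡.trans (cong ℓ (cong₂ _∷_ (≡.sym (Bool.xor-identityʳ a)) (≡.sym (⊕-𝟎ˡ v)))) (add (a ∷ 𝟎) (false ∷ v))

  record Hyperplane {k} (ℓ : Vec Bool (suc k) → Bool) : Set where
    field
      j           : Vec Bool k → Vec Bool (suc k)
      j-⊕         : ∀ u v → j (u ⊕ v) ≡ j u ⊕ j v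
      j-injective : ∀ v → j v ≡ 𝟎 → v ≡ 𝟎
      vanishes    : ∀ v → ℓ (j v) ≡ false

  -- One step of Gaussian elimination: if the first coordinate occurs in ℓ, it is solved for;
  -- otherwise it stays free and the remaining coordinates are treated.
  hyperplane : ∀ k {ℓ : Vec Bool (suc k) → Bool} → Additive ℓ → Hyperplane ℓ
  hyperplane k {ℓ} add with ℓ (true ∷ 𝟎) in eq
  ... | true  = record
    { j = λ v → ℓ (false ∷ v) ∷ v
    ; j-⊕ = λ u v → cong (_∷ (u ⊕ v)) (add (false ∷ u) (false ∷ v))
    ; j-injective = λ v jv≡𝟎 → Vec.∷-injectiveʳ jv≡𝟎
    ; vanishes = λ v → ≡.trans (additive-∷ {ℓ = ℓ} add (ℓ (false ∷ v)) v) (pivot (ℓ (false ∷ v)))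
    }
    where
    pivot : ∀ b → ℓ (b ∷ 𝟎) xor b ≡ false
    pivot true  = cong (_xor true) eq
    pivot false = ≡.trans (Bool.xor-identityʳ _) (additive-𝟎 {ℓ = ℓ} add)
  -- No coordinate is left to solve for, and dimension 0 is all that is promised.
  hyperplane zero {ℓ} add | false = record
    { j = λ _ → 𝟎 ; j-⊕ = λ _ _ → ≡.refl ; j-injective = λ { [] _ → ≡.refl } ; vanishes = λ _ → additive-𝟎 {ℓ = ℓ} add }
  hyperplane (suc k) {ℓ} add | false = record
    { j = λ { (a ∷ v) → a ∷ H.j v }
    ; j-⊕ = λ { (a ∷ u) (b ∷ v) → cong ((a xor b) ∷_) (H.j-⊕ u v) }
    ; j-injective = λ { (a ∷ v) eq′ → cong₂ _∷_ (Vec.∷-injectiveˡ eq′) (H.j-injective v (Vec.∷-injectiveʳ eq′)) }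
    ; vanishes = λ { (a ∷ v) → ≡.trans (additive-∷ {ℓ = ℓ} add a (H.j v)) (cong₂ _xor_ (first a) (H.vanishes v)) }
    }
    where
    module H = Hyperplane (hyperplane k {λ v → ℓ (false ∷ v)} (λ u v → add (false ∷ u) (false ∷ v)))
    first : ∀ a → ℓ (a ∷ 𝟎) ≡ false
    first true  = eq
    first false = additive-𝟎 {ℓ = ℓ} add

  module _ {K : F₄-Algebra} where
    open F₄-Algebra K

    cut : ∀ {p} {P : Carrier → Set p} {k} (ℓ : Functional K) → Subspace K P (suc k) → Subspace K (λ f → Functional.fn ℓ f ≡ false × P f) k
    cut {k = k} ℓ V = record
      { ι = ι ∘ j
      ; ι-⊕ = λ u v → trans (reflexive (cong ι (j-⊕ u v))) (ι-⊕ (j u) (j v))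
      ; ι-injective = λ v eq → j-injective v (ι-injective (j v) eq)
      ; member = λ v → vanishes v , member (j v)
      }
      where
      open Subspace V
      open Functional ℓ
      open Hyperplane (hyperplane k {λ v → fn (ι v)} (λ u v → ≡.trans (fn-cong (ι-⊕ u v)) (additive (ι u) (ι v))))

    cutAll : ∀ {p} {P : Carrier → Set p} {k} (ℓs : List (Functional K)) → Subspace K P (length ℓs ℕ.+ k) → Subspace K (λ f → Vanish ℓs f × P f) k
    cutAll []       V = record { ι = ι ; ι-⊕ = ι-⊕ ; ι-injective = ι-injective ; member = λ v → [] , member v }
      where open Subspace V
    cutAll (ℓ ∷ ℓs) V = record { ι = ι ; ι-⊕ = ι-⊕ ; ι-injective = ι-injective
                               ; member = λ v → let (vs , (v₀ , p)) = member v in (v₀ ∷ vs) , p }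
      where open Subspace (cutAll ℓs (cut ℓ V))

    shrink : ∀ {p} {P : Carrier → Set p} a {k} → Subspace K P (a ℕ.+ k) → Subspace K P k
    shrink zero    V = V
    shrink (suc a) V = shrink a record
      { ι = λ v → ι (false ∷ v) ; ι-⊕ = λ u v → ι-⊕ (false ∷ u) (false ∷ v)
      ; ι-injective = λ v eq → Vec.∷-injectiveʳ (ι-injective (false ∷ v) eq) ; member = λ v → member (false ∷ v) }
      where open Subspace V

    imply : ∀ {p q} {P : Carrier → Set p} {Q : Carrier → Set q} {k} → (∀ {f} → P f → Q f) → Subspace K P k → Subspace K Q k
    imply f V = record { ι = ι ; ι-⊕ = ι-⊕ ; ι-injective = ι-injective ; member = λ v → f (member v) }
      where open Subspace V

  𝟎-++ : ∀ a {b} → Vec._++_ (𝟎 {a}) (𝟎 {b}) ≡ 𝟎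
  𝟎-++ zero    = ≡.refl
  𝟎-++ (suc a) = cong (false ∷_) (𝟎-++ a)

  split-𝟎 : ∀ a {b} (v : Vec Bool (a ℕ.+ b)) → Vec.take a v ≡ 𝟎 → Vec.drop a v ≡ 𝟎 → v ≡ 𝟎
  split-𝟎 a v p q = ≡.trans (≡.sym (Vec.take++drop≡id a v)) (≡.trans (cong₂ Vec._++_ p q) (𝟎-++ a))

  sumSpace : (K : F₄-Algebra) (h : F₄-Algebra.Carrier K) {P₀ P₁ P₂ : F₄-Algebra.Carrier K → Set} (a b : ℕ) {c : ℕ} →
    Subspace K P₀ a → Subspace K P₁ b → Subspace K P₂ c →
    Subspace (Cubic.algebra K h) (λ f → P₀ (proj₁ f) × P₁ (proj₁ (proj₂ f)) × P₂ (proj₂ (proj₂ f))) (a ℕ.+ (b ℕ.+ c))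
  sumSpace K h a b U V W = record
    { ι = λ v → U.ι (Vec.take a v) , V.ι (Vec.take b (Vec.drop a v)) , W.ι (Vec.drop b (Vec.drop a v))
    ; ι-⊕ = λ u v →
          trans (reflexive (cong U.ι (Vec.take-zipWith {m = a} _xor_ u v))) (U.ι-⊕ _ _)
        , trans (reflexive (cong V.ι (≡.trans (cong (Vec.take b) (Vec.drop-zipWith {m = a} _xor_ u v)) (Vec.take-zipWith {m = b} _xor_ (Vec.drop a u) (Vec.drop a v))))) (V.ι-⊕ _ _)
        , trans (reflexive (cong W.ι (≡.trans (cong (Vec.drop b) (Vec.drop-zipWith {m = a} _xor_ u v)) (Vec.drop-zipWith {m = b} _xor_ (Vec.drop a u) (Vec.drop a v))))) (W.ι-⊕ _ _)
    ; ι-injective = λ v (p , q , r) → split-𝟎 a v (U.ι-injective _ p) (split-𝟎 b (Vec.drop a v) (V.ι-injective _ q) (W.ι-injective _ r))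
    ; member = λ v → U.member _ , V.member _ , W.member _
    }
    where
    open F₄-Algebra K
    module U = Subspace U
    module V = Subspace V
    module W = Subspace W

  decode : ∀ m → Vec Bool (m ℕ.* 2) → Vec F₄ m
  decode zero    []          = []
  decode (suc m) (a ∷ b ∷ v) = fromBits a b ∷ decode m v

  fromBits-+ : ∀ a b c d → fromBits (a xor c) (b xor d) ≡ fromBits a b +₄ fromBits c d
  fromBits-+ false false c d = ≡.refl
  fromBits-+ true false false false = ≡.refl
  fromBits-+ true false false true = ≡.refl
  fromBits-+ true false true false = ≡.refl
  fromBits-+ true false true true = ≡.refl
  fromBits-+ false true false false = ≡.refl
  fromBits-+ false true false true = ≡.refl
  fromBits-+ false true true false = ≡.refl
  fromBits-+ false true true true = ≡.refl
  fromBits-+ true true false false = ≡.refl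
  fromBits-+ true true false true = ≡.refl
  fromBits-+ true true true false = ≡.refl
  fromBits-+ true true true true = ≡.refl

  decode-⊕ : ∀ m u v → decode m (u ⊕ v) ≡ Vec.zipWith _+₄_ (decode m u) (decode m v)
  decode-⊕ zero    []          []          = ≡.refl
  decode-⊕ (suc m) (a ∷ b ∷ u) (c ∷ d ∷ v) = cong₂ _∷_ (fromBits-+ a b c d) (decode-⊕ m u v)

  decode-injective : ∀ m v → decode m v ≡ zeros m → v ≡ 𝟎
  decode-injective zero    []              _  = ≡.refl
  decode-injective (suc m) (false ∷ false ∷ v) eq = cong (λ v → false ∷ false ∷ v) (decode-injective m v (Vec.∷-injectiveʳ eq))
  decode-injective (suc m) (true ∷ false ∷ v)  eq = contradiction (Vec.∷-injectiveˡ eq) λ ()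
  decode-injective (suc m) (false ∷ true ∷ v)  eq = contradiction (Vec.∷-injectiveˡ eq) λ ()
  decode-injective (suc m) (true ∷ true ∷ v)   eq = contradiction (Vec.∷-injectiveˡ eq) λ ()

  formSize : ℕ → ℕ → ℕ
  formSize zero    m = suc m ℕ.* 2
  formSize (suc n) m = formSize n (2 ℕ.+ m) ℕ.+ (formSize n (1 ℕ.+ m) ℕ.+ formSize n m)

  open +-*-Solver using (solve; _:+_; _:*_; _:=_; con)

  -- In degree m + 2 n a basis monomial of degree e has a coefficient form of degree m + 2 n - e, at
  -- two bits per coefficient. The average of e over the 3ⁿ monomials is n.
  formSize≡ : ∀ n m → formSize n m ≡ 2 ℕ.* 3 ^ n ℕ.* (m ℕ.+ n ℕ.+ 1)
  formSize≡ zero    m = solve 1 (λ m → (con 1 :+ m) :* con 2 := con 2 :* con 1 :* (m :+ con 0 :+ con 1)) ≡.refl m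
  formSize≡ (suc n) m = ≡.trans (cong₂ ℕ._+_ (formSize≡ n (2 ℕ.+ m)) (cong₂ ℕ._+_ (formSize≡ n (1 ℕ.+ m)) (formSize≡ n m)))
    (solve 3 (λ a m n → con 2 :* a :* (con 2 :+ m :+ n :+ con 1) :+ (con 2 :* a :* (con 1 :+ m :+ n :+ con 1) :+ con 2 :* a :* (m :+ n :+ con 1))
      := con 2 :* (con 3 :* a) :* (m :+ (con 1 :+ n) :+ con 1)) ≡.refl (3 ^ n) m n)

  formSpace : ∀ n m → Subspace (Stage.algebra (stage n)) (Graded.Hom (graded n) m) (formSize n m)
  formSpace zero    m = record
    { ι = λ v → form (decode (suc m) v)
    ; ι-⊕ = λ u v → B.trans {form (decode (suc m) (u ⊕ v))} {form (Vec.zipWith _+₄_ (decode (suc m) u) (decode (suc m) v))}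
        {form (decode (suc m) u) B.+ form (decode (suc m) v)}
        (B.reflexive (cong form (decode-⊕ (suc m) u v))) (B.sym {form (decode (suc m) u) B.+ form (decode (suc m) v)} (form-+ (decode (suc m) u) (decode (suc m) v)))
    ; ι-injective = λ v eq → decode-injective (suc m) v (chart₁-injective (decode (suc m) v) (λ i → ≡.trans (proj₁ eq i) (P.κ-0 i)))
    ; member = λ v → decode (suc m) v , B.refl {form (decode (suc m) v)}
    }
  formSpace (suc n) m = sumSpace (Stage.algebra (stage n)) (Stage.h (stage n)) (formSize n (2 ℕ.+ m)) (formSize n (1 ℕ.+ m))
    (formSpace n (2 ℕ.+ m)) (formSpace n (1 ℕ.+ m)) (formSpace n m)

  offset≡ : ∀ n → offset n ≡ 2 ℕ.* n
  offset≡ zero    = ≡.refl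
  offset≡ (suc n) = ≡.trans (cong (2 ℕ.+_) (offset≡ n)) (solve 1 (λ n → con 2 :+ con 2 :* n := con 2 :* (con 1 :+ n)) ≡.refl n)

  -- Any order past the thresholds would do, since it cancels against the degree; adding the offset
  -- makes the index of degree `poleOrder n` + 2 in the grading come out as `totalThreshold n` + 2.
  poleOrder : ℕ → ℕ
  poleOrder n = totalThreshold n ℕ.+ offset n

  -- The analogue of a Riemann-Roch space L(D) with deg D = 2 * 3 ^ n.
  Bounded : ∀ n → Elem n → Set₁
  Bounded n f = HasDegree n (poleOrder n ℕ.+ 2) f × Cond n (poleOrder n) f

  -- Riemann's inequality by counting. With s for `totalThreshold n`, the forms have 2 * 3ⁿ (s + n +
  -- 3) bits and the conditions cost at most 2 * 3ⁿ (s + n + 2).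
  boundedSpace : ∀ n → Subspace (Stage.algebra (stage n)) (Bounded n) (2 ℕ.* 3 ^ n)
  boundedSpace n = imply {Stage.algebra (stage n)}
      (λ {f} (vs , hf) → (m , degree , hf) , condTests-sound n T {f} vs)
      (cutAll {Stage.algebra (stage n)} (condTests n T) (shrink {Stage.algebra (stage n)} (proj₁ room)
        (subst (Subspace (Stage.algebra (stage n)) (Graded.Hom (graded n) m)) (proj₂ room) (formSpace n m))))
    where
    T m : ℕ
    T = poleOrder n
    m = totalThreshold n ℕ.+ 2
    degree : m ℕ.+ offset n ≡ T ℕ.+ 2
    degree = solve 2 (λ t d → t :+ con 2 :+ d := t :+ d :+ con 2) ≡.refl (totalThreshold n) (offset n)
    fits : length (condTests n T) ℕ.+ 2 ℕ.* 3 ^ n ℕ.≤ formSize n m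
    fits = ℕ.+-cancelʳ-≤ (2 ℕ.* n ℕ.* 3 ^ n) _ _ (begin
      length (condTests n T) ℕ.+ 2 ℕ.* 3 ^ n ℕ.+ 2 ℕ.* n ℕ.* 3 ^ n
        ≡⟨ solve 3 (λ l a b → l :+ a :+ b := l :+ b :+ a) ≡.refl (length (condTests n T)) (2 ℕ.* 3 ^ n) (2 ℕ.* n ℕ.* 3 ^ n) ⟩
      length (condTests n T) ℕ.+ 2 ℕ.* n ℕ.* 3 ^ n ℕ.+ 2 ℕ.* 3 ^ n
        ≤⟨ ℕ.+-monoˡ-≤ (2 ℕ.* 3 ^ n) (condTests-bound n T (ℕ.m≤m+n _ _)) ⟩
      2 ℕ.* 3 ^ n ℕ.* (totalThreshold n ℕ.+ offset n ℕ.+ 2) ℕ.+ 2 ℕ.* 3 ^ n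
        ≡⟨ cong (λ d → 2 ℕ.* 3 ^ n ℕ.* (totalThreshold n ℕ.+ d ℕ.+ 2) ℕ.+ 2 ℕ.* 3 ^ n) (offset≡ n) ⟩
      2 ℕ.* 3 ^ n ℕ.* (totalThreshold n ℕ.+ 2 ℕ.* n ℕ.+ 2) ℕ.+ 2 ℕ.* 3 ^ n
        ≡⟨ solve 3 (λ a t n → con 2 :* a :* (t :+ con 2 :* n :+ con 2) :+ con 2 :* a := con 2 :* a :* (t :+ con 2 :+ n :+ con 1) :+ con 2 :* n :* a) ≡.refl (3 ^ n) (totalThreshold n) n ⟩
      2 ℕ.* 3 ^ n ℕ.* (m ℕ.+ n ℕ.+ 1) ℕ.+ 2 ℕ.* n ℕ.* 3 ^ n
        ≡⟨ cong (ℕ._+ 2 ℕ.* n ℕ.* 3 ^ n) (formSize≡ n m) ⟨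
      formSize n m ℕ.+ 2 ℕ.* n ℕ.* 3 ^ n ∎)
      where open ℕ.≤-Reasoning
    room : ∃ λ a → formSize n m ≡ a ℕ.+ (length (condTests n T) ℕ.+ 2 ℕ.* 3 ^ n)
    room = formSize n m ∸ (length (condTests n T) ℕ.+ 2 ℕ.* 3 ^ n) , ≡.sym (ℕ.m∸n+n≡m fits)

-- Codes from jets at the split points.

module EvaluationCodes where
  open FieldOfFour
  open PowerSeriesRing
  open Evaluation
  open Places
  open HomogeneousForms
  open ProjectiveLine
  open Tower
  open ZeroBound
  open Subspaces
  open import Data.Nat.Base using (_^_)
  open import Data.Nat.Solver using (module +-*-Solver)

  private module P = F₄-Algebra PS
  private module B = F₄-Algebra base-algebra
  open +-*-Solver using (solve; _:+_; _:*_; _:=_; con)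

  div? : ℕ → PowerSeries → Bool
  div? zero    f = true
  div? (suc a) f = does (f a ≟₄ 0₄) ∧ div? a f

  div?⇒Div : ∀ a f → div? a f ≡ true → Div a f
  div?⇒Div (suc a) f eq i (s≤s i≤a) with f a ≟₄ 0₄ | ℕ.m≤n⇒m<n∨m≡n i≤a
  ... | yes fa≡0 | inj₁ i<a    = div?⇒Div a f eq i i<a
  ... | yes fa≡0 | inj₂ ≡.refl = fa≡0

  Div⇒div? : ∀ a f → Div a f → div? a f ≡ true
  Div⇒div? zero    f d = ≡.refl
  Div⇒div? (suc a) f d with f a ≟₄ 0₄
  ... | yes _    = Div⇒div? a f λ i i<a → d i (ℕ.m≤n⇒m≤1+n i<a)
  ... | no  fa≢0 = contradiction (d a (ℕ.n<1+n a)) fa≢0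

  indicator : Bool → ℕ
  indicator b = if b then 1 else 0

  countPoints : ∀ n → (Point n → Bool) → ℕ
  countPoints n S = sumPoints n (indicator ∘ S)

  sumPoints-cong : ∀ n {o o′ : Point n → ℕ} → (∀ z → o z ≡ o′ z) → sumPoints n o ≡ sumPoints n o′
  sumPoints-cong zero    eq = eq []
  sumPoints-cong (suc n) eq = sumPoints-cong n λ z → cong₂ ℕ._+_ (cong₂ ℕ._+_ (eq _) (eq _)) (eq _)

  sumPoints-scale : ∀ n c (o : Point n → ℕ) → sumPoints n (λ z → c ℕ.* o z) ≡ c ℕ.* sumPoints n o
  sumPoints-scale zero    c o = ≡.refl
  sumPoints-scale (suc n) c o = ≡.trans (sumPoints-cong n λ z →
      solve 4 (λ c x y w → c :* x :+ c :* y :+ c :* w := c :* (x :+ y :+ w)) ≡.refl c (o (zero ∷ z)) (o (suc zero ∷ z)) (o (suc (suc zero) ∷ z)))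
    (sumPoints-scale n c _)

  sumPoints-const : ∀ n c → sumPoints n (λ _ → c) ≡ 3 ^ n ℕ.* c
  sumPoints-const zero    c = ≡.sym (ℕ.+-identityʳ c)
  sumPoints-const (suc n) c = ≡.trans (sumPoints-const n (c ℕ.+ c ℕ.+ c))
    (solve 2 (λ a c → a :* (c :+ c :+ c) := con 3 :* a :* c) ≡.refl (3 ^ n) c)

  productPoints : ∀ n → (Point n → PowerSeries) → PowerSeries
  productPoints zero    φ = φ []
  productPoints (suc n) φ = productPoints n λ z → φ (zero ∷ z) *ₚ φ (suc zero ∷ z) *ₚ φ (suc (suc zero) ∷ z)

  productPoints-cong : ∀ n {φ ψ} → (∀ z → φ z ≈ₚ ψ z) → productPoints n φ ≈ₚ productPoints n ψ
  productPoints-cong zero    eq = eq []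
  productPoints-cong (suc n) eq = productPoints-cong n λ z → *ₚ-cong (*ₚ-cong (eq _) (eq _)) (eq _)

  productPoints-* : ∀ n φ ψ → productPoints n (λ z → φ z *ₚ ψ z) ≈ₚ productPoints n φ *ₚ productPoints n ψ
  productPoints-* zero    φ ψ _ = ≡.refl
  productPoints-* (suc n) φ ψ = P.trans (productPoints-cong n λ z → rearrange (φ (zero ∷ z)) (ψ (zero ∷ z)) (φ (suc zero ∷ z)) (ψ (suc zero ∷ z))
      (φ (suc (suc zero) ∷ z)) (ψ (suc (suc zero) ∷ z))) (productPoints-* n _ _)
    where
    open AlgebraSolver PS using () renaming (solve to solveₚ; _:*_ to _:*ₚ_; _:=_ to _:=ₚ_)
    rearrange : ∀ a b c d e f → (a *ₚ b) *ₚ (c *ₚ d) *ₚ (e *ₚ f) ≈ₚ (a *ₚ c *ₚ e) *ₚ (b *ₚ d *ₚ f)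
    rearrange = solveₚ 6 (λ a b c d e f → (a :*ₚ b) :*ₚ (c :*ₚ d) :*ₚ (e :*ₚ f) :=ₚ (a :*ₚ c :*ₚ e) :*ₚ (b :*ₚ d :*ₚ f)) P.refl

  productPoints-zero : ∀ n φ → (∀ z → φ z ≈ₚ λ _ → 0₄) → productPoints n φ ≈ₚ λ _ → 0₄
  productPoints-zero zero    φ φ≈0 = φ≈0 []
  productPoints-zero (suc n) φ φ≈0 = productPoints-zero n _ λ z →
    P.trans (*ₚ-cong {g = φ (suc (suc zero) ∷ z)} (zero-*ₚ (φ (suc zero ∷ z)) (φ≈0 (zero ∷ z))) (λ _ → ≡.refl))
      (zero-*ₚ (φ (suc (suc zero) ∷ z)) (λ _ → ≡.refl))

  -- Through this a vanishing product of two functions becomes a vanishing product of two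
  -- polynomials, their norms.
  fullNorm-product : ∀ n f → proj₁ (fullNorm n f) ≈ₚ productPoints n (λ z → evalAt n z f)
  fullNorm-product zero    f _ = ≡.refl
  fullNorm-product (suc n) f = P.trans (fullNorm-product n (stepNorm n f)) (productPoints-cong n λ z → splitPoint-norm n z f)

  opaque
    -- 24 = 4 * 6. Products have degree 4 * 3ⁿ, so a nonzero one has a vanishing jet at no more than
    -- a sixth of the points; the sampling of points may double this to 1/3.
    precision : ℕ
    precision = 24

    precision≡24 : precision ≡ 24
    precision≡24 = ≡.refl

  inner : ∀ {n k d} → (Vec Bool k → Point n → PowerSeries) → Vec (Vec Bool k) d → Vec (Vec Bool k) d → Point n → PowerSeries
  inner ev []       []       z = λ _ → 0₄
  inner ev (x ∷ xs) (y ∷ ys) z = ev x z *ₚ ev y z +ₚ inner ev xs ys z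

  -- All that the communication argument uses of the curve. `gap` is uniform in the number d of
  -- summands because the functions with the poles of a product form a linear space. `integral` is
  -- the absence of zero divisors, stated for jets.
  record EvaluationCode (n k : ℕ) : Set where
    field
      ev   : Vec Bool k → Point n → PowerSeries
      ev-⊕ : ∀ x y z → ev (x ⊕ y) z ≈ₚ ev x z +ₚ ev y z
      gap : ∀ {d} (xs ys : Vec (Vec Bool k) d) → 3 ^ n ℕ.< 6 ℕ.* countPoints n (λ z → div? precision (inner ev xs ys z)) →
        ∀ z → inner ev xs ys z ≈ₚ λ _ → 0₄
      integral : ∀ x y → (∀ z → Div precision (ev x z *ₚ ev y z)) → x ≡ 𝟎 ⊎ y ≡ 𝟎

  module _ (n : ℕ) where
    private
      module S = Stage (stage n)
      module V = Subspace (boundedSpace n)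
      M T : ℕ
      M = poleOrder n ℕ.+ 2
      T = poleOrder n

      evalₙ : Point n → Eval S.algebra
      evalₙ z = SplitPoint.eval {stage n} (splitPoint n z)

      ev : Vec Bool (2 ℕ.* 3 ^ n) → Point n → PowerSeries
      ev x z = evalAt n z (V.ι x)

      dot : ∀ {d} → Vec (Vec Bool (2 ℕ.* 3 ^ n)) d → Vec (Vec Bool (2 ℕ.* 3 ^ n)) d → Elem n
      dot []       []       = S.κ 0₄
      dot (x ∷ xs) (y ∷ ys) = V.ι x S.* V.ι y S.+ dot xs ys

      dot-eval : ∀ {d} (xs ys : Vec (Vec Bool (2 ℕ.* 3 ^ n)) d) z → evalAt n z (dot xs ys) ≈ₚ inner ev xs ys z
      dot-eval []       []       z = P.trans {evalAt n z (S.κ 0₄)} {constₚ 0₄} (Eval.⟦⟧-κ (evalₙ z) 0₄) P.κ-0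
      dot-eval (x ∷ xs) (y ∷ ys) z = P.trans {evalAt n z (V.ι x S.* V.ι y S.+ dot xs ys)} {evalAt n z (V.ι x S.* V.ι y) +ₚ evalAt n z (dot xs ys)}
        (Eval.⟦⟧-+ (evalₙ z) (V.ι x S.* V.ι y) (dot xs ys))
        (+ₚ-cong {evalAt n z (V.ι x S.* V.ι y)} {ev x z *ₚ ev y z} (Eval.⟦⟧-* (evalₙ z) (V.ι x) (V.ι y)) (dot-eval xs ys z))

      HasDegree-+ : ∀ {D f g} → HasDegree n D f → HasDegree n D g → HasDegree n D (f S.+ g)
      HasDegree-+ {D} {f} {g} (m , ≡.refl , hf) (m′ , eq , hg) = m , ≡.refl ,
        Graded.Hom-+ (graded n) {m} {f} {g} hf (subst (λ k → Graded.Hom (graded n) k g) (ℕ.+-cancelʳ-≡ (offset n) m′ m eq) hg)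

      product-bounded : ∀ x y → HasDegree n (M ℕ.+ M) (V.ι x S.* V.ι y) × Cond n (T ℕ.+ T) (V.ι x S.* V.ι y)
      product-bounded x y = HasDegree-* n {M} {M} {V.ι x} {V.ι y} (proj₁ (V.member x)) (proj₁ (V.member y))
        , Cond-* n T T (V.ι x) (V.ι y) (proj₂ (V.member x)) (proj₂ (V.member y))

      zero-degree : HasDegree n (M ℕ.+ M) (S.κ 0₄)
      -- The empty sum still needs an index for its degree, which is taken from a product.
      zero-degree = let (m , eq , _) = proj₁ (product-bounded 𝟎 𝟎) in m , eq , Graded.Hom-zero (graded n) m

      dot-bounded : ∀ {d} (xs ys : Vec (Vec Bool (2 ℕ.* 3 ^ n)) d) → HasDegree n (M ℕ.+ M) (dot xs ys) × Cond n (T ℕ.+ T) (dot xs ys)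
      dot-bounded []       []       = zero-degree , Cond-zero n (T ℕ.+ T)
      dot-bounded (x ∷ xs) (y ∷ ys) =
          HasDegree-+ {M ℕ.+ M} {V.ι x S.* V.ι y} {dot xs ys} (proj₁ (product-bounded x y)) (proj₁ (dot-bounded xs ys))
        , Cond-+ n (V.ι x S.* V.ι y) (dot xs ys) (proj₂ (product-bounded x y)) (proj₂ (dot-bounded xs ys))

      -- deg of a product is 4 * 3 ^ n, and each jet that vanishes counts for 24 zeros.
      many-zeros : ∀ f → HasDegree n (M ℕ.+ M) f → Cond n (T ℕ.+ T) f →
        3 ^ n ℕ.< 6 ℕ.* countPoints n (λ z → div? precision (evalAt n z f)) → IsZero n f
      many-zeros f hf cf big = zero-bound n (M ℕ.+ M) (T ℕ.+ T) f (λ z → precision ℕ.* indicator (div? precision (evalAt n z f))) hf cf orders (begin-strict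
        3 ^ n ℕ.* (M ℕ.+ M)
          ≡⟨ solve 2 (λ a T → a :* (T :+ con 2 :+ (T :+ con 2)) := con 4 :* a :+ a :* (T :+ T)) ≡.refl (3 ^ n) T ⟩
        4 ℕ.* 3 ^ n ℕ.+ 3 ^ n ℕ.* (T ℕ.+ T)
          <⟨ ℕ.+-monoˡ-< (3 ^ n ℕ.* (T ℕ.+ T)) (ℕ.*-monoʳ-< 4 big) ⟩
        4 ℕ.* (6 ℕ.* C) ℕ.+ 3 ^ n ℕ.* (T ℕ.+ T)
          ≡⟨ cong (ℕ._+ 3 ^ n ℕ.* (T ℕ.+ T)) (≡.trans (≡.sym (ℕ.*-assoc 4 6 C)) (≡.trans (cong (ℕ._* C) (≡.sym precision≡24)) (≡.sym (sumPoints-scale n precision _)))) ⟩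
        sumPoints n (λ z → precision ℕ.* indicator (div? precision (evalAt n z f))) ℕ.+ 3 ^ n ℕ.* (T ℕ.+ T) ∎)
        where
        open ℕ.≤-Reasoning
        C : ℕ
        C = countPoints n (λ z → div? precision (evalAt n z f))
        orders : ∀ z → Div (precision ℕ.* indicator (div? precision (evalAt n z f))) (evalAt n z f)
        orders z with div? precision (evalAt n z f) in eq
        ... | true  = subst (λ a → Div a (evalAt n z f)) (≡.sym (ℕ.*-identityʳ precision)) (div?⇒Div precision (evalAt n z f) eq)
        ... | false = subst (λ a → Div a (evalAt n z f)) (≡.sym (ℕ.*-zeroʳ precision)) λ _ ()

      eval-zero : ∀ f → IsZero n f → ∀ z → evalAt n z f ≈ₚ λ _ → 0₄
      eval-zero f f≈0 z = P.trans {evalAt n z f} {evalAt n z (S.κ 0₄)} (Eval.⟦⟧-cong (evalₙ z) f≈0)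
        (P.trans {evalAt n z (S.κ 0₄)} {constₚ 0₄} (Eval.⟦⟧-κ (evalₙ z) 0₄) P.κ-0)

      fullNorm₁-form : ∀ x → IsForm (3 ^ n ℕ.* M) (fullNorm n (V.ι x))
      fullNorm₁-form x = fullNorm-form n {M} {V.ι x} (proj₁ (V.member x))

      norm₁-zero : ∀ x → proj₁ (fullNorm n (V.ι x)) ≈ₚ (λ _ → 0₄) → x ≡ 𝟎
      norm₁-zero x eq = let (c , N≈) = fullNorm₁-form x in
        V.ι-injective x (fullNorm-zero n {M} (V.ι x) (proj₁ (V.member x)) (form-decide-zero c N≈
          (chart₁-injective c λ i → ≡.trans (≡.sym (proj₁ N≈ i)) (eq i))))

    opaque
      evaluationCode : EvaluationCode n (2 ℕ.* 3 ^ n)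
      evaluationCode = record
        { ev = ev
        ; ev-⊕ = λ x y z → P.trans {ev (x ⊕ y) z} {evalAt n z (V.ι x S.+ V.ι y)} (Eval.⟦⟧-cong (evalₙ z) (V.ι-⊕ x y)) (Eval.⟦⟧-+ (evalₙ z) (V.ι x) (V.ι y))
        ; gap = λ xs ys big z → P.trans {inner ev xs ys z} {evalAt n z (dot xs ys)} (P.sym {evalAt n z (dot xs ys)} (dot-eval xs ys z))
            (eval-zero (dot xs ys) (many-zeros (dot xs ys) (proj₁ (dot-bounded xs ys)) (proj₂ (dot-bounded xs ys))
              (subst (λ c → 3 ^ n ℕ.< 6 ℕ.* c) (sumPoints-cong n λ z → cong indicator (div?-cong precision {inner ev xs ys z} {evalAt n z (dot xs ys)}
                (P.sym {evalAt n z (dot xs ys)} (dot-eval xs ys z)))) big)) z)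
        ; integral = integral
        }
        where
        div?-cong : ∀ a {f g} → f ≈ₚ g → div? a f ≡ div? a g
        div?-cong zero    eq = ≡.refl
        div?-cong (suc a) eq = cong₂ (λ b c → does (b ≟₄ 0₄) ∧ c) (eq a) (div?-cong a eq)
        -- If all jets of x y vanish, then so does x y, and with it the product of the two norms. In
        -- the first chart the norms are polynomials, so one of them is zero, and only 0 has norm 0.
        integral : ∀ x y → (∀ z → Div precision (ev x z *ₚ ev y z)) → x ≡ 𝟎 ⊎ y ≡ 𝟎
        integral x y d = Sum.map (norm₁-zero x) (norm₁-zero y)
          (*ₚ-integral (suc (3 ^ n ℕ.* M)) {proj₁ (fullNorm n (V.ι x))} {proj₁ (fullNorm n (V.ι y))}
            (λ i M<i → let (c , N≈) = fullNorm₁-form x in ≡.trans (proj₁ N≈ i) (Chart.form-deg splitChart c i M<i)) Πx*Πy≈0)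
          where
          F : Elem n
          F = V.ι x S.* V.ι y
          F≈ : ∀ z → evalAt n z F ≈ₚ ev x z *ₚ ev y z
          F≈ z = Eval.⟦⟧-* (evalₙ z) (V.ι x) (V.ι y)
          all-zero : countPoints n (λ z → div? precision (evalAt n z F)) ≡ 3 ^ n
          all-zero = ≡.trans (sumPoints-cong n λ z → cong indicator (Div⇒div? precision (evalAt n z F)
            (Div-resp {f = ev x z *ₚ ev y z} {evalAt n z F} (P.sym {evalAt n z F} (F≈ z)) (d z))))
            (≡.trans (sumPoints-const n 1) (ℕ.*-identityʳ (3 ^ n)))
          F≈0 : IsZero n F
          F≈0 = many-zeros F (proj₁ (product-bounded x y)) (proj₂ (product-bounded x y))
            (subst (λ c → 3 ^ n ℕ.< 6 ℕ.* c) (≡.sym all-zero) (subst (ℕ._< 6 ℕ.* 3 ^ n) (ℕ.*-identityˡ (3 ^ n)) (ℕ.*-monoˡ-< (3 ^ n) {{ℕ.m^n≢0 3 n}} (s≤s {1} {5} (s≤s z≤n)))))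
          Πx*Πy≈0 : proj₁ (fullNorm n (V.ι x)) *ₚ proj₁ (fullNorm n (V.ι y)) ≈ₚ λ _ → 0₄
          Πx*Πy≈0 = P.trans (*ₚ-cong (fullNorm-product n (V.ι x)) (fullNorm-product n (V.ι y)))
            (P.trans (P.sym (productPoints-* n (ev x) (ev y))) (productPoints-zero n _ λ z →
              P.trans {ev x z *ₚ ev y z} {evalAt n z F} (P.sym {evalAt n z F} (F≈ z)) (eval-zero F F≈0 z)))

-- Characters of F₂-spaces and nondegenerate forms.

module BooleanSums where
  open Subspaces using (_⊕_; 𝟎; Additive; additive-𝟎; additive-∷; ⊕-self; ⊕-𝟎ˡ; ⊕-𝟎ʳ; split-𝟎)
  open import Defs using (0≤p+q; 0≤1; p≤p+q)
  open import Data.Rational.Base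
  open import Data.Rational.Properties
  open import Data.Rational.Solver using (module +-*-Solver)
  open import Data.Vec.Base using (_++_; take; drop)
  open ≡ using (refl; sym; trans; subst₂; module ≡-Reasoning)

  open +-*-Solver using (solve; _:+_; _:*_; _:=_; con; :-_)

  <⇒≱ : ∀ {p q} → p < q → ¬ (q ≤ p)
  <⇒≱ p<q q≤p = <-irrefl refl (<-≤-trans p<q q≤p)

  ∑ : ∀ a → (Vec Bool a → ℚ) → ℚ
  ∑ zero    f = f []
  ∑ (suc a) f = ∑ a (λ v → f (false ∷ v)) + ∑ a (λ v → f (true ∷ v))

  syntax ∑ a (λ v → e) = ∑[ v ∈ a ] e

  ∑-cong : ∀ a {f g : Vec Bool a → ℚ} → (∀ v → f v ≡ g v) → ∑ a f ≡ ∑ a g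
  ∑-cong zero    eq = eq []
  ∑-cong (suc a) eq = cong₂ _+_ (∑-cong a λ v → eq (false ∷ v)) (∑-cong a λ v → eq (true ∷ v))

  +-interchange : ∀ p q r s → (p + q) + (r + s) ≡ (p + r) + (q + s)
  +-interchange = solve 4 (λ p q r s → (p :+ q) :+ (r :+ s) := (p :+ r) :+ (q :+ s)) refl

  ∑-+ : ∀ a (f g : Vec Bool a → ℚ) → (∑[ v ∈ a ] (f v + g v)) ≡ ∑ a f + ∑ a g
  ∑-+ zero    f g = refl
  ∑-+ (suc a) f g = trans (cong₂ _+_ (∑-+ a (f ∘ (false ∷_)) (g ∘ (false ∷_))) (∑-+ a (f ∘ (true ∷_)) (g ∘ (true ∷_))))
    (+-interchange (∑ a (f ∘ (false ∷_))) (∑ a (g ∘ (false ∷_))) (∑ a (f ∘ (true ∷_))) (∑ a (g ∘ (true ∷_))))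

  ∑-*ˡ : ∀ a c (f : Vec Bool a → ℚ) → (∑[ v ∈ a ] (c * f v)) ≡ c * ∑ a f
  ∑-*ˡ zero    c f = refl
  ∑-*ˡ (suc a) c f = trans (cong₂ _+_ (∑-*ˡ a c (f ∘ (false ∷_))) (∑-*ˡ a c (f ∘ (true ∷_))))
    (sym (*-distribˡ-+ c (∑ a (f ∘ (false ∷_))) (∑ a (f ∘ (true ∷_)))))

  ∑-zero : ∀ a → (∑[ v ∈ a ] 0ℚ) ≡ 0ℚ
  ∑-zero zero    = refl
  ∑-zero (suc a) = cong₂ _+_ (∑-zero a) (∑-zero a)

  ∑-swap : ∀ a b (f : Vec Bool a → Vec Bool b → ℚ) → (∑[ u ∈ a ] ∑[ v ∈ b ] f u v) ≡ (∑[ v ∈ b ] ∑[ u ∈ a ] f u v)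
  ∑-swap zero    b f = refl
  ∑-swap (suc a) b f = trans (cong₂ _+_ (∑-swap a b (f ∘ (false ∷_))) (∑-swap a b (f ∘ (true ∷_))))
    (sym (∑-+ b (λ v → ∑ a (λ u → f (false ∷ u) v)) (λ v → ∑ a (λ u → f (true ∷ u) v))))

  ∑-mono : ∀ a {f g : Vec Bool a → ℚ} → (∀ v → f v ≤ g v) → ∑ a f ≤ ∑ a g
  ∑-mono zero    le = le []
  ∑-mono (suc a) le = +-mono-≤ (∑-mono a λ v → le (false ∷ v)) (∑-mono a λ v → le (true ∷ v))

  ∑-nonneg : ∀ a {f : Vec Bool a → ℚ} → (∀ v → 0ℚ ≤ f v) → 0ℚ ≤ ∑ a f
  ∑-nonneg a {f} nn = subst (_≤ ∑ a f) (∑-zero a) (∑-mono a nn)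

  p≤q+p : ∀ {p q} → 0ℚ ≤ q → p ≤ q + p
  p≤q+p {p} {q} 0≤q = subst (p ≤_) (+-comm p q) (p≤p+q p 0≤q)

  ∑-term : ∀ a {f : Vec Bool a → ℚ} → (∀ v → 0ℚ ≤ f v) → ∀ u → f u ≤ ∑ a f
  ∑-term zero    nn []          = ≤-refl
  ∑-term (suc a) {f} nn (false ∷ u) = ≤-trans (∑-term a (λ v → nn (false ∷ v)) u) (p≤p+q (∑ a (λ v → f (false ∷ v))) (∑-nonneg a λ v → nn (true ∷ v)))
  ∑-term (suc a) nn (true ∷ u)  = ≤-trans (∑-term a (λ v → nn (true ∷ v)) u)
    (p≤q+p (∑-nonneg a λ v → nn (false ∷ v)))

  ∑-two-terms : ∀ a {f : Vec Bool a → ℚ} → (∀ v → 0ℚ ≤ f v) → ∀ u w → u ≢ w → f u + f w ≤ ∑ a f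
  ∑-two-terms zero    nn []          []          u≢w = contradiction refl u≢w
  ∑-two-terms (suc a) {f} nn (false ∷ u) (false ∷ w) u≢w = ≤-trans (∑-two-terms a (λ v → nn (false ∷ v)) u w (u≢w ∘ cong (false ∷_)))
    (p≤p+q (∑ a (λ v → f (false ∷ v))) (∑-nonneg a λ v → nn (true ∷ v)))
  ∑-two-terms (suc a) nn (true ∷ u)  (true ∷ w)  u≢w = ≤-trans (∑-two-terms a (λ v → nn (true ∷ v)) u w (u≢w ∘ cong (true ∷_)))
    (p≤q+p (∑-nonneg a λ v → nn (false ∷ v)))
  ∑-two-terms (suc a) nn (false ∷ u) (true ∷ w)  u≢w = +-mono-≤ (∑-term a (λ v → nn (false ∷ v)) u) (∑-term a (λ v → nn (true ∷ v)) w)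
  ∑-two-terms (suc a) {f} nn (true ∷ u)  (false ∷ w) u≢w = subst (_≤ ∑ (suc a) f) (+-comm (f (false ∷ w)) (f (true ∷ u)))
    (+-mono-≤ (∑-term a (λ v → nn (false ∷ v)) w) (∑-term a (λ v → nn (true ∷ v)) u))

  ∑-pigeonhole : ∀ a {f g : Vec Bool a → ℚ} → ∑ a f < ∑ a g → ∃ λ v → f v < g v
  ∑-pigeonhole zero    lt = [] , lt
  ∑-pigeonhole (suc a) {f} {g} lt with ∑ a (λ v → f (false ∷ v)) <? ∑ a (λ v → g (false ∷ v))
  ... | yes lt₀ = let v , p = ∑-pigeonhole a lt₀ in false ∷ v , p
  ... | no ¬lt₀ = let v , p = ∑-pigeonhole a {λ v → f (true ∷ v)} {λ v → g (true ∷ v)}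
                                (≰⇒> λ le → <⇒≱ lt (+-mono-≤ (≮⇒≥ ¬lt₀) le)) in true ∷ v , p

  pow2 : ℕ → ℚ
  pow2 zero    = 1ℚ
  pow2 (suc a) = pow2 a + pow2 a

  ∑-one : ∀ a → (∑[ v ∈ a ] 1ℚ) ≡ pow2 a
  ∑-one zero    = refl
  ∑-one (suc a) = cong₂ _+_ (∑-one a) (∑-one a)

  ∑-const : ∀ a c → (∑[ v ∈ a ] c) ≡ c * pow2 a
  ∑-const a c = trans (∑-cong a λ _ → sym (*-identityʳ c)) (trans (∑-*ˡ a c _) (cong (c *_) (∑-one a)))

  0≤pow2 : ∀ a → 0ℚ ≤ pow2 a
  0≤pow2 zero    = 0≤1
  0≤pow2 (suc a) = 0≤p+q (0≤pow2 a) (0≤pow2 a)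

  1≤pow2 : ∀ a → 1ℚ ≤ pow2 a
  1≤pow2 zero    = ≤-refl
  1≤pow2 (suc a) = ≤-trans (1≤pow2 a) (p≤p+q (pow2 a) (0≤pow2 a))

  0<pow2 : ∀ a → 0ℚ < pow2 a
  0<pow2 a = <-≤-trans (positive⁻¹ 1ℚ) (1≤pow2 a)

  sign : Bool → ℚ
  sign false = 1ℚ
  sign true  = - 1ℚ

  sign-xor : ∀ a b → sign (a xor b) ≡ sign a * sign b
  sign-xor false false = refl
  sign-xor false true  = refl
  sign-xor true  false = refl
  sign-xor true  true  = refl

  δ : ∀ {a} → Vec Bool a → ℚ
  δ []          = 1ℚ
  δ (true ∷ v)  = 0ℚ
  δ (false ∷ v) = δ v

  δ-𝟎 : ∀ a → δ (𝟎 {a}) ≡ 1ℚ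
  δ-𝟎 zero    = refl
  δ-𝟎 (suc a) = δ-𝟎 a

  δ-cases : ∀ {a} (v : Vec Bool a) → (v ≡ 𝟎 × δ v ≡ 1ℚ) ⊎ (v ≢ 𝟎 × δ v ≡ 0ℚ)
  δ-cases []          = inj₁ (refl , refl)
  δ-cases (true ∷ v)  = inj₂ ((λ ()) , refl)
  δ-cases (false ∷ v) with δ-cases v
  ... | inj₁ (p , q) = inj₁ (cong (false ∷_) p , q)
  ... | inj₂ (p , q) = inj₂ ((λ eq → p (Vec.∷-injectiveʳ eq)) , q)

  ∑-δ : ∀ a → ∑ a δ ≡ 1ℚ
  ∑-δ zero    = refl
  ∑-δ (suc a) = trans (cong₂ _+_ (∑-δ a) (∑-zero a)) (+-identityʳ 1ℚ)

  ⟨_,_⟩ : ∀ {a} → Vec Bool a → Vec Bool a → Bool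
  ⟨ []    , []    ⟩ = false
  ⟨ a ∷ u , b ∷ v ⟩ = (a ∧ b) xor ⟨ u , v ⟩

  xor-interchange : ∀ a b c d → (a xor b) xor (c xor d) ≡ (a xor c) xor (b xor d)
  xor-interchange false b c d = begin
    b xor (c xor d)  ≡⟨ Bool.xor-assoc b c d ⟨
    (b xor c) xor d  ≡⟨ cong (_xor d) (Bool.xor-comm b c) ⟩
    (c xor b) xor d  ≡⟨ Bool.xor-assoc c b d ⟩
    c xor (b xor d)  ∎
    where open ≡-Reasoning
  xor-interchange true b c d = begin
    (true xor b) xor (c xor d)    ≡⟨ Bool.xor-assoc true b (c xor d) ⟩
    true xor (b xor (c xor d))    ≡⟨ cong (true xor_) (xor-interchange false b c d) ⟩
    true xor (c xor (b xor d))    ≡⟨ Bool.xor-assoc true c (b xor d) ⟨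
    (true xor c) xor (b xor d)    ∎
    where open ≡-Reasoning

  pairing-⊕ʳ : ∀ {a} (u : Vec Bool a) → Additive ⟨ u ,_⟩
  pairing-⊕ʳ []      []      []      = refl
  pairing-⊕ʳ (a ∷ u) (b ∷ v) (c ∷ w) = trans (cong₂ _xor_ (Bool.∧-distribˡ-xor a b c) (pairing-⊕ʳ u v w)) (xor-interchange (a ∧ b) (a ∧ c) _ _)

  ∑-pairing : ∀ a (w : Vec Bool a) → (∑[ u ∈ a ] sign ⟨ u , w ⟩) ≡ pow2 a * δ w
  ∑-pairing zero    []          = refl
  ∑-pairing (suc a) (false ∷ w) = trans (cong₂ _+_ (∑-pairing a w) (∑-pairing a w)) (sym (*-distribʳ-+ (δ w) (pow2 a) (pow2 a)))
  ∑-pairing (suc a) (true ∷ w)  = begin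
    ∑ a (λ u → sign ⟨ u , w ⟩) + (∑[ u ∈ a ] sign (true xor ⟨ u , w ⟩))
      ≡⟨ cong (∑ a (λ u → sign ⟨ u , w ⟩) +_) (trans (∑-cong a λ u → sign-xor true ⟨ u , w ⟩) (∑-*ˡ a (- 1ℚ) _)) ⟩
    ∑ a (λ u → sign ⟨ u , w ⟩) + - 1ℚ * ∑ a (λ u → sign ⟨ u , w ⟩)
      ≡⟨ solve 2 (λ s t → s :+ (:- con 1ℚ) :* s := t :* con 0ℚ) refl (∑ a (λ u → sign ⟨ u , w ⟩)) (pow2 a + pow2 a) ⟩
    (pow2 a + pow2 a) * 0ℚ ∎
    where open ≡-Reasoning

  character-sum : ∀ a {ℓ : Vec Bool a → Bool} → Additive ℓ →
    ((∀ v → ℓ v ≡ false) × ∑ a (sign ∘ ℓ) ≡ pow2 a) ⊎ ((∃ λ v → ℓ v ≡ true) × ∑ a (sign ∘ ℓ) ≡ 0ℚ)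
  character-sum zero    {ℓ} add = inj₁ ((λ { [] → additive-𝟎 {ℓ = ℓ} add }) , cong sign (additive-𝟎 {ℓ = ℓ} add))
  character-sum (suc a) {ℓ} add = combine (ℓ (true ∷ 𝟎)) refl (character-sum a {λ v → ℓ (false ∷ v)} (λ u v → add (false ∷ u) (false ∷ v)))
    where
    S : ℚ
    S = ∑ a (λ v → sign (ℓ (false ∷ v)))
    second : ∀ b → ℓ (true ∷ 𝟎) ≡ b → (∑[ v ∈ a ] sign (ℓ (true ∷ v))) ≡ sign b * S
    second b eq = trans (∑-cong a λ v → trans (cong sign (trans (additive-∷ {ℓ = ℓ} add true v) (cong (_xor ℓ (false ∷ v)) eq))) (sign-xor b _))
      (∑-*ˡ a (sign b) _)
    combine : ∀ b → ℓ (true ∷ 𝟎) ≡ b → ((∀ v → ℓ (false ∷ v) ≡ false) × S ≡ pow2 a) ⊎ ((∃ λ v → ℓ (false ∷ v) ≡ true) × S ≡ 0ℚ) →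
      ((∀ v → ℓ v ≡ false) × ∑ (suc a) (sign ∘ ℓ) ≡ pow2 (suc a)) ⊎ ((∃ λ v → ℓ v ≡ true) × ∑ (suc a) (sign ∘ ℓ) ≡ 0ℚ)
    combine true  eq _ = inj₂ ((true ∷ 𝟎 , eq) , trans (cong (S +_) (second true eq)) (solve 1 (λ s → s :+ (:- con 1ℚ) :* s := con 0ℚ) refl S))
    combine false eq (inj₁ (all , S≡)) = inj₁ (
        (λ { (false ∷ v) → all v ; (true ∷ v) → trans (additive-∷ {ℓ = ℓ} add true v) (cong₂ _xor_ eq (all v)) }) ,
        cong₂ _+_ S≡ (trans (second false eq) (trans (*-identityˡ S) S≡)))
    combine false eq (inj₂ ((v , p) , S≡)) = inj₂ ((false ∷ v , p) ,
        cong₂ _+_ S≡ (trans (second false eq) (trans (*-identityˡ S) S≡)))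

  character-sum-nonneg : ∀ a {ℓ : Vec Bool a → Bool} → Additive ℓ → 0ℚ ≤ ∑ a (sign ∘ ℓ)
  character-sum-nonneg a {ℓ} add with character-sum a {ℓ} add
  ... | inj₁ (_ , eq) = subst (0ℚ ≤_) (sym eq) (0≤pow2 a)
  ... | inj₂ (_ , eq) = ≤-reflexive (sym eq)

  record Biadditive {a b c} (μ : Vec Bool a → Vec Bool b → Vec Bool c) : Set where
    field
      additiveˡ : ∀ x x′ y → μ (x ⊕ x′) y ≡ μ x y ⊕ μ x′ y
      additiveʳ : ∀ x y y′ → μ x (y ⊕ y′) ≡ μ x y ⊕ μ x y′

    zeroʳ : ∀ x → μ x 𝟎 ≡ 𝟎
    zeroʳ x = trans (cong (μ x) (sym (⊕-self 𝟎))) (trans (additiveʳ x 𝟎 𝟎) (⊕-self (μ x 𝟎)))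

    zeroˡ : ∀ y → μ 𝟎 y ≡ 𝟎
    zeroˡ y = trans (cong (λ x → μ x y) (sym (⊕-self 𝟎))) (trans (additiveˡ 𝟎 𝟎 y) (⊕-self (μ 𝟎 y)))

    form-additiveʳ : ∀ w x → Additive (λ y → ⟨ w , μ x y ⟩)
    form-additiveʳ w x y y′ = trans (cong ⟨ w ,_⟩ (additiveʳ x y y′)) (pairing-⊕ʳ w (μ x y) (μ x y′))

  -- On average over w the radical of ⟨ w , μ x y ⟩ has fewer than two elements.
  module _ {k K} {μ : Vec Bool k → Vec Bool k → Vec Bool K} (bi : Biadditive μ) (integral : ∀ x y → μ x y ≡ 𝟎 → x ≡ 𝟎 ⊎ y ≡ 𝟎) where
    open Biadditive bi
    private
      row : Vec Bool K → Vec Bool k → ℚ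
      row w x = ∑[ y ∈ k ] sign ⟨ w , μ x y ⟩

      radical : Vec Bool K → ℚ
      radical w = ∑[ x ∈ k ] row w x

      -- Inclusion and exclusion for the condition x = 0 or y = 0, to which μ x y = 0 is equivalent.
      pointwise : ∀ x y → δ (μ x y) + δ x * δ y ≤ δ x + δ y
      pointwise x y with δ-cases (μ x y) | δ-cases x | δ-cases y
      ... | inj₁ (_ , p) | inj₁ (_ , q) | inj₁ (_ , r) rewrite p | q | r = ≤-refl
      ... | inj₁ (_ , p) | inj₁ (_ , q) | inj₂ (_ , r) rewrite p | q | r = ≤-refl
      ... | inj₁ (_ , p) | inj₂ (_ , q) | inj₁ (_ , r) rewrite p | q | r = ≤-refl
      ... | inj₁ (μ≡ , _) | inj₂ (x≢ , _) | inj₂ (y≢ , _) with integral x y μ≡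
      ...   | inj₁ x≡ = contradiction x≡ x≢
      ...   | inj₂ y≡ = contradiction y≡ y≢
      pointwise x y | inj₂ (μ≢ , _) | inj₁ (refl , _) | _ = contradiction (zeroˡ y) μ≢
      pointwise x y | inj₂ (μ≢ , _) | _ | inj₁ (refl , _) = contradiction (zeroʳ x) μ≢
      pointwise x y | inj₂ (_ , p) | inj₂ (_ , q) | inj₂ (_ , r) rewrite p | q | r = ≤-refl

      zeros-bound : (∑[ x ∈ k ] ∑[ y ∈ k ] δ (μ x y)) + 1ℚ ≤ pow2 k + pow2 k
      zeros-bound = begin
        (∑[ x ∈ k ] ∑[ y ∈ k ] δ (μ x y)) + 1ℚ
          ≡⟨ cong ((∑[ x ∈ k ] ∑[ y ∈ k ] δ (μ x y)) +_) (trans (sym (∑-δ k)) (∑-cong k λ x → trans (sym (*-identityʳ (δ x)))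
               (trans (cong (δ x *_) (sym (∑-δ k))) (sym (∑-*ˡ k (δ x) δ))))) ⟩
        (∑[ x ∈ k ] ∑[ y ∈ k ] δ (μ x y)) + (∑[ x ∈ k ] ∑[ y ∈ k ] (δ x * δ y))
          ≡⟨ trans (sym (∑-+ k _ _)) (∑-cong k λ x → sym (∑-+ k _ _)) ⟩
        (∑[ x ∈ k ] ∑[ y ∈ k ] (δ (μ x y) + δ x * δ y))
          ≤⟨ ∑-mono k (λ x → ∑-mono k (λ y → pointwise x y)) ⟩
        (∑[ x ∈ k ] ∑[ y ∈ k ] (δ x + δ y))
          ≡⟨ trans (∑-cong k λ x → trans (∑-+ k _ _) (cong₂ _+_ (∑-const k (δ x)) (∑-δ k))) (∑-+ k _ _) ⟩
        (∑[ x ∈ k ] (δ x * pow2 k)) + (∑[ x ∈ k ] 1ℚ)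
          ≡⟨ cong₂ _+_ (trans (∑-cong k λ x → *-comm (δ x) (pow2 k)) (trans (∑-*ˡ k (pow2 k) δ) (trans (cong (pow2 k *_) (∑-δ k)) (*-identityʳ (pow2 k))))) (∑-one k) ⟩
        pow2 k + pow2 k ∎
        where open ≤-Reasoning

      total : (∑[ w ∈ K ] radical w) ≡ pow2 K * (∑[ x ∈ k ] ∑[ y ∈ k ] δ (μ x y))
      total = begin
        (∑[ w ∈ K ] ∑[ x ∈ k ] row w x)
          ≡⟨ ∑-swap K k row ⟩
        (∑[ x ∈ k ] ∑[ w ∈ K ] row w x)
          ≡⟨ ∑-cong k (λ x → ∑-swap K k (λ w y → sign ⟨ w , μ x y ⟩)) ⟩
        (∑[ x ∈ k ] ∑[ y ∈ k ] ∑[ w ∈ K ] sign ⟨ w , μ x y ⟩)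
          ≡⟨ ∑-cong k (λ x → trans (∑-cong k λ y → ∑-pairing K (μ x y)) (∑-*ˡ k (pow2 K) _)) ⟩
        (∑[ x ∈ k ] (pow2 K * ∑[ y ∈ k ] δ (μ x y)))
          ≡⟨ ∑-*ˡ k (pow2 K) _ ⟩
        pow2 K * (∑[ x ∈ k ] ∑[ y ∈ k ] δ (μ x y)) ∎
        where open ≡-Reasoning

      average : (∑[ w ∈ K ] radical w) < (∑[ w ∈ K ] (pow2 k + pow2 k))
      average = subst₂ _<_ (sym total) (trans (*-comm (pow2 K) (pow2 k + pow2 k)) (sym (∑-const K (pow2 k + pow2 k))))
        (*-monoʳ-<-pos (pow2 K) {{positive (0<pow2 K)}} (<-≤-trans
          (subst (_< N + 1ℚ) (+-identityʳ N) (+-monoʳ-< N (positive⁻¹ 1ℚ))) zeros-bound))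
        where
        N : ℚ
        N = ∑[ x ∈ k ] ∑[ y ∈ k ] δ (μ x y)

    -- Row sums are nonnegative, and a row in the radical, such as that of 0, sums to 2^k. By the
    -- average some w has a total below 2 * 2^k, which leaves no room for a second row of this kind.
    nondegenerate : ∃ λ w → ∀ x → (∀ y → ⟨ w , μ x y ⟩ ≡ false) → x ≡ 𝟎
    nondegenerate = let (w , small) = ∑-pigeonhole K average in w , λ x kills → go w small x kills
      where
      full : ∀ w x → (∀ y → ⟨ w , μ x y ⟩ ≡ false) → row w x ≡ pow2 k
      full w x kills = trans (∑-cong k λ y → cong sign (kills y)) (∑-one k)
      go : ∀ w → radical w < pow2 k + pow2 k → ∀ x → (∀ y → ⟨ w , μ x y ⟩ ≡ false) → x ≡ 𝟎
      go w small x kills with δ-cases x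
      ... | inj₁ (x≡𝟎 , _) = x≡𝟎
      ... | inj₂ (x≢𝟎 , _) = contradiction
        (≤-trans (≤-reflexive (cong₂ _+_ (sym (full w x kills))
            (sym (full w 𝟎 λ y → trans (cong ⟨ w ,_⟩ (zeroˡ y)) (additive-𝟎 {ℓ = ⟨ w ,_⟩} (pairing-⊕ʳ w))))))
          (∑-two-terms k (λ x → character-sum-nonneg k {λ y → ⟨ w , μ x y ⟩} (form-additiveʳ w x)) x 𝟎 x≢𝟎))
        (<⇒≱ small)

  take-++ : ∀ a {b} (u : Vec Bool a) (v : Vec Bool b) → take a (u ++ v) ≡ u
  take-++ zero    []      v = refl
  take-++ (suc a) (x ∷ u) v = cong (x ∷_) (take-++ a u v)

  drop-++ : ∀ a {b} (u : Vec Bool a) (v : Vec Bool b) → drop a (u ++ v) ≡ v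
  drop-++ zero    []      v = refl
  drop-++ (suc a) (x ∷ u) v = drop-++ a u v

  module Power {k K} (μ : Vec Bool k → Vec Bool k → Vec Bool K) (bi : Biadditive μ) where
    open Biadditive bi

    μ^ : ∀ d → Vec Bool (d ℕ.* k) → Vec Bool (d ℕ.* k) → Vec Bool K
    μ^ zero    u v = 𝟎
    μ^ (suc d) u v = μ (take k u) (take k v) ⊕ μ^ d (drop k u) (drop k v)

    ⊕-interchange : ∀ {a} (p q r s : Vec Bool a) → (p ⊕ q) ⊕ (r ⊕ s) ≡ (p ⊕ r) ⊕ (q ⊕ s)
    ⊕-interchange []      []      []      []      = refl
    ⊕-interchange (a ∷ p) (b ∷ q) (c ∷ r) (d ∷ s) = cong₂ _∷_ (xor-interchange a b c d) (⊕-interchange p q r s)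

    biadditive : ∀ d → Biadditive (μ^ d)
    biadditive zero = record { additiveˡ = λ _ _ _ → sym (⊕-self 𝟎) ; additiveʳ = λ _ _ _ → sym (⊕-self 𝟎) }
    biadditive (suc d) = record
      { additiveˡ = λ x x′ y → trans (cong₂ _⊕_
          (trans (cong (λ z → μ z (take k y)) (Vec.take-zipWith {m = k} _xor_ x x′)) (additiveˡ (take k x) (take k x′) (take k y)))
          (trans (cong (λ z → μ^ d z (drop k y)) (Vec.drop-zipWith {m = k} _xor_ x x′)) (D.additiveˡ (drop k x) (drop k x′) (drop k y))))
          (⊕-interchange (μ (take k x) (take k y)) (μ (take k x′) (take k y)) _ _)
      ; additiveʳ = λ x y y′ → trans (cong₂ _⊕_
          (trans (cong (μ (take k x)) (Vec.take-zipWith {m = k} _xor_ y y′)) (additiveʳ (take k x) (take k y) (take k y′)))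
          (trans (cong (μ^ d (drop k x)) (Vec.drop-zipWith {m = k} _xor_ y y′)) (D.additiveʳ (drop k x) (drop k y) (drop k y′))))
          (⊕-interchange (μ (take k x) (take k y)) (μ (take k x) (take k y′)) _ _)
      }
      where module D = Biadditive (biadditive d)

    -- The same functional w serves for sums of d products: vectors v supported in a single block
    -- test one block of u at a time.
    power-nondegenerate : ∀ w → (∀ x → (∀ y → ⟨ w , μ x y ⟩ ≡ false) → x ≡ 𝟎) →
      ∀ d u → (∀ v → ⟨ w , μ^ d u v ⟩ ≡ false) → u ≡ 𝟎
    power-nondegenerate w nd zero    [] _ = refl
    power-nondegenerate w nd (suc d) u kills = split-𝟎 k u
      (nd (take k u) λ y → trans (cong ⟨ w ,_⟩ (sym (begin
        μ (take k u) (take k (y ++ 𝟎)) ⊕ μ^ d (drop k u) (drop k (y ++ 𝟎))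
          ≡⟨ cong₂ (λ a b → μ (take k u) a ⊕ μ^ d (drop k u) b) (take-++ k y 𝟎) (drop-++ k y 𝟎) ⟩
        μ (take k u) y ⊕ μ^ d (drop k u) 𝟎
          ≡⟨ cong (μ (take k u) y ⊕_) (Biadditive.zeroʳ (biadditive d) (drop k u)) ⟩
        μ (take k u) y ⊕ 𝟎
          ≡⟨ ⊕-𝟎ʳ _ ⟩
        μ (take k u) y ∎))) (kills (y ++ 𝟎)))
      (power-nondegenerate w nd d (drop k u) λ v → trans (cong ⟨ w ,_⟩ (sym (begin
        μ (take k u) (take k (𝟎 {k} ++ v)) ⊕ μ^ d (drop k u) (drop k (𝟎 {k} ++ v))
          ≡⟨ cong₂ (λ a b → μ (take k u) a ⊕ μ^ d (drop k u) b) (take-++ k 𝟎 v) (drop-++ k 𝟎 v) ⟩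
        μ (take k u) 𝟎 ⊕ μ^ d (drop k u) v
          ≡⟨ cong (_⊕ μ^ d (drop k u) v) (zeroʳ (take k u)) ⟩
        𝟎 ⊕ μ^ d (drop k u) v
          ≡⟨ ⊕-𝟎ˡ _ ⟩
        μ^ d (drop k u) v ∎))) (kills (𝟎 {k} ++ v)))
      where open ≡-Reasoning

  module Counting {a K} {ν : Vec Bool a → Vec Bool a → Vec Bool K} (bi : Biadditive ν) where
    open Biadditive bi

    -- Detecting zeros by characters writes 2^K times their number as a sum over w of nonnegative
    -- terms, and the term w = 0 alone is 2^(2 a). So zeros make up at least a fraction 2^(-K) of
    -- the entries.
    count-zeros : pow2 a * pow2 a ≤ pow2 K * (∑[ u ∈ a ] ∑[ v ∈ a ] δ (ν u v))
    count-zeros = begin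
      pow2 a * pow2 a
        ≡⟨ trans (sym (∑-const a (pow2 a))) (∑-cong a λ u → trans (sym (∑-one a)) (∑-cong a λ v → cong sign (sym (pairing-𝟎 (ν u v))))) ⟩
      (∑[ u ∈ a ] ∑[ v ∈ a ] sign ⟨ 𝟎 , ν u v ⟩)
        ≤⟨ ∑-term K (λ w → ∑-nonneg a λ u → character-sum-nonneg a {λ v → ⟨ w , ν u v ⟩} (form-additiveʳ w u)) 𝟎 ⟩
      (∑[ w ∈ K ] ∑[ u ∈ a ] ∑[ v ∈ a ] sign ⟨ w , ν u v ⟩)
        ≡⟨ trans (∑-swap K a _) (∑-cong a λ u → ∑-swap K a _) ⟩
      (∑[ u ∈ a ] ∑[ v ∈ a ] ∑[ w ∈ K ] sign ⟨ w , ν u v ⟩)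
        ≡⟨ ∑-cong a (λ u → trans (∑-cong a λ v → ∑-pairing K (ν u v)) (∑-*ˡ a (pow2 K) _)) ⟩
      (∑[ u ∈ a ] (pow2 K * ∑[ v ∈ a ] δ (ν u v)))
        ≡⟨ ∑-*ˡ a (pow2 K) _ ⟩
      pow2 K * (∑[ u ∈ a ] ∑[ v ∈ a ] δ (ν u v)) ∎
      where
      open ≤-Reasoning
      pairing-𝟎 : ∀ {b} (v : Vec Bool b) → ⟨ 𝟎 , v ⟩ ≡ false
      pairing-𝟎 []      = refl
      pairing-𝟎 (_ ∷ v) = pairing-𝟎 v

    module _ (w : Vec Bool K) (nd : ∀ u → (∀ v → ⟨ w , ν u v ⟩ ≡ false) → u ≡ 𝟎) where

      H : Vec Bool a → Vec Bool a → ℚ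
      H u v = sign ⟨ w , ν u v ⟩

      -- Rows of H are characters, and the product of those of u and u′ is that of u ⊕ u′, which is
      -- nontrivial for u ≠ u′ by nondegeneracy.
      H-orthogonal : ∀ u u′ → (∑[ v ∈ a ] (H u v * H u′ v)) ≡ pow2 a * δ (u ⊕ u′)
      H-orthogonal u u′ = trans (∑-cong a λ v → trans (sym (sign-xor ⟨ w , ν u v ⟩ ⟨ w , ν u′ v ⟩))
          (cong sign (trans (sym (pairing-⊕ʳ w (ν u v) (ν u′ v))) (cong ⟨ w ,_⟩ (sym (additiveˡ u u′ v)))))) sum
        where
        sum : (∑[ v ∈ a ] sign ⟨ w , ν (u ⊕ u′) v ⟩) ≡ pow2 a * δ (u ⊕ u′)
        sum with character-sum a {λ v → ⟨ w , ν (u ⊕ u′) v ⟩} (form-additiveʳ w (u ⊕ u′)) | δ-cases (u ⊕ u′)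
        ... | inj₁ (_ , eq)       | inj₁ (_ , q)    = trans eq (sym (trans (cong (pow2 a *_) q) (*-identityʳ (pow2 a))))
        ... | inj₁ (all , _)      | inj₂ (≢ , _)    = contradiction (nd (u ⊕ u′) all) ≢
        ... | inj₂ (_ , eq)       | inj₂ (_ , q)    = trans eq (sym (trans (cong (pow2 a *_) q) (*-zeroʳ (pow2 a))))
        ... | inj₂ ((v , p) , _)  | inj₁ (≡𝟎 , _)   = contradiction
          (trans (sym p) (trans (cong (λ x → ⟨ w , ν x v ⟩) ≡𝟎) (trans (cong ⟨ w ,_⟩ (zeroˡ v)) (additive-𝟎 {ℓ = ⟨ w ,_⟩} (pairing-⊕ʳ w))))) λ ()

      H-on-zeros : ∀ u v → H u v * δ (ν u v) ≡ δ (ν u v)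
      H-on-zeros u v with δ-cases (ν u v)
      ... | inj₁ (ν≡𝟎 , q) = trans (cong (_* δ (ν u v)) (cong sign (trans (cong ⟨ w ,_⟩ ν≡𝟎) (additive-𝟎 {ℓ = ⟨ w ,_⟩} (pairing-⊕ʳ w))))) (*-identityˡ (δ (ν u v)))
      ... | inj₂ (_ , q) = trans (cong (H u v *_) q) (trans (*-zeroʳ (H u v)) (sym q))

-- Lindsey's lemma over the rationals.

module Lindsey where
  open import Defs
  open Subspaces using (_⊕_)
  open BooleanSums
  open import Data.Fin.Base using (_↑ˡ_; _↑ʳ_; splitAt)
  import Data.Fin.Properties as Fin
  open import Data.Rational.Base
  open import Data.Rational.Properties
  open import Data.Rational.Solver using (module +-*-Solver)
  open import Data.Vec.Functional as Vector using (Vector)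
  open ≡ using (refl; sym; trans; subst₂; module ≡-Reasoning)

  open +-*-Solver using (solve; _:+_; _:*_; _:-_; _:=_; :-_)

  isZero : ∀ {a} → Vec Bool a → Bool
  isZero []          = true
  isZero (true ∷ v)  = false
  isZero (false ∷ v) = isZero v

  δ-isZero : ∀ {a} (v : Vec Bool a) → δ v ≡ (if isZero v then 1ℚ else 0ℚ)
  δ-isZero []          = refl
  δ-isZero (true ∷ v)  = refl
  δ-isZero (false ∷ v) = δ-isZero v

  index : ∀ {a} → Vec Bool a → Fin (2 ℕ.^ a)
  index []                  = zero
  index {suc a} (false ∷ v) = index v ↑ˡ (2 ℕ.^ a ℕ.+ 0)
  index {suc a} (true ∷ v)  = 2 ℕ.^ a ↑ʳ (index v ↑ˡ 0)

  digits : ∀ a → Fin (2 ℕ.^ a) → Vec Bool a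
  digits zero    _ = []
  digits (suc a) i with splitAt (2 ℕ.^ a) i
  ... | inj₁ j = false ∷ digits a j
  -- This second split only discards the summand 0 in 2^(a + 1) = 2^a + (2^a + 0).
  ... | inj₂ j with splitAt (2 ℕ.^ a) j
  ...   | inj₁ l = true ∷ digits a l

  digits-index : ∀ {a} (v : Vec Bool a) → digits a (index v) ≡ v
  digits-index []                  = refl
  digits-index {suc a} (false ∷ v) rewrite Fin.splitAt-↑ˡ (2 ℕ.^ a) (index v) (2 ℕ.^ a ℕ.+ 0) = cong (false ∷_) (digits-index v)
  digits-index {suc a} (true ∷ v)  rewrite Fin.splitAt-↑ʳ (2 ℕ.^ a) (2 ℕ.^ a ℕ.+ 0) (index v ↑ˡ 0) | Fin.splitAt-↑ˡ (2 ℕ.^ a) (index v) 0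
    = cong (true ∷_) (digits-index v)

  sumF : ∀ {m} → (Fin m → ℚ) → ℚ
  sumF = Vector.foldr _+_ 0ℚ

  sumF-+ : ∀ {m} (f g : Fin m → ℚ) → sumF (λ l → f l + g l) ≡ sumF f + sumF g
  sumF-+ {zero}  f g = refl
  sumF-+ {suc m} f g = trans (cong ((f zero + g zero) +_) (sumF-+ (f ∘ suc) (g ∘ suc))) (+-interchange (f zero) (g zero) (sumF (f ∘ suc)) (sumF (g ∘ suc)))

  sumF-* : ∀ {m} c (f : Fin m → ℚ) → sumF (λ l → c * f l) ≡ c * sumF f
  sumF-* {zero}  c f = sym (*-zeroʳ c)
  sumF-* {suc m} c f = trans (cong (c * f zero +_) (sumF-* c (f ∘ suc))) (sym (*-distribˡ-+ c (f zero) (sumF (f ∘ suc))))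

  sumF-mono : ∀ {m} {f g : Fin m → ℚ} → (∀ l → f l ≤ g l) → sumF f ≤ sumF g
  sumF-mono {zero}  le = ≤-refl
  sumF-mono {suc m} le = +-mono-≤ (le zero) (sumF-mono (le ∘ suc))

  sumF-cong : ∀ {m} {f g : Fin m → ℚ} → (∀ l → f l ≡ g l) → sumF f ≡ sumF g
  sumF-cong {zero}  eq = refl
  sumF-cong {suc m} eq = cong₂ _+_ (eq zero) (sumF-cong (eq ∘ suc))

  ∑-sumF : ∀ a {m} (f : Vec Bool a → Fin m → ℚ) → (∑[ v ∈ a ] sumF (f v)) ≡ sumF (λ l → ∑[ v ∈ a ] f v l)
  ∑-sumF a {zero}  f = ∑-zero a
  ∑-sumF a {suc m} f = trans (∑-+ a (λ v → f v zero) (λ v → sumF (f v ∘ suc))) (cong ((∑[ v ∈ a ] f v zero) +_) (∑-sumF a (λ v → f v ∘ suc)))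

  ∑-δ-shift : ∀ a (g : Vec Bool a → ℚ) u → (∑[ v ∈ a ] (g v * δ (u ⊕ v))) ≡ g u
  ∑-δ-shift zero    g []          = *-identityʳ (g [])
  ∑-δ-shift (suc a) g (false ∷ u) = trans (cong₂ _+_ (∑-δ-shift a (g ∘ (false ∷_)) u)
    (trans (∑-cong a λ v → *-zeroʳ (g (true ∷ v))) (∑-zero a))) (+-identityʳ _)
  ∑-δ-shift (suc a) g (true ∷ u)  = trans (cong₂ _+_ (trans (∑-cong a λ v → *-zeroʳ (g (false ∷ v))) (∑-zero a))
    (∑-δ-shift a (g ∘ (true ∷_)) u)) (+-identityˡ _)

  0≤p² : ∀ p → 0ℚ ≤ p * p
  0≤p² p with ≤-total 0ℚ p
  ... | inj₁ 0≤p = 0≤p*q 0≤p 0≤p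
  ... | inj₂ p≤0 = subst (0ℚ ≤_) (solve 1 (λ p → (:- p) :* (:- p) := p :* p) refl p) (0≤p*q 0≤-p 0≤-p)
    where
    0≤-p : 0ℚ ≤ - p
    0≤-p = neg-antimono-≤ p≤0

  am-gm : ∀ p q → (p * q) + (p * q) ≤ p * p + q * q
  am-gm p q = subst₂ _≤_ (+-identityˡ _) (solve 2 (λ p q → (p :- q) :* (p :- q) :+ (p :* q :+ p :* q) := p :* p :+ q :* q) refl p q)
    (+-monoˡ-≤ (p * q + p * q) (0≤p² (p - q)))

  module Bilinear (a : ℕ) (H : Vec Bool a → Vec Bool a → ℚ)
    (orthogonal : ∀ u u′ → (∑[ v ∈ a ] (H u v * H u′ v)) ≡ pow2 a * δ (u ⊕ u′)) where

    bilinear : (Vec Bool a → ℚ) → (Vec Bool a → ℚ) → ℚ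
    bilinear f g = ∑[ u ∈ a ] ∑[ v ∈ a ] (H u v * (f u * g v))

    private
      transform : (Vec Bool a → ℚ) → Vec Bool a → ℚ
      transform f v = ∑[ u ∈ a ] (H u v * f u)

      bilinear-transform : ∀ f g → bilinear f g ≡ (∑[ v ∈ a ] (transform f v * g v))
      bilinear-transform f g = trans (∑-swap a a _) (∑-cong a λ v → trans
        (∑-cong a λ u → solve 3 (λ h f g → h :* (f :* g) := g :* (h :* f)) refl (H u v) (f u) (g v))
        (trans (∑-*ˡ a (g v) _) (*-comm (g v) (transform f v))))

      parseval : ∀ f → (∑[ v ∈ a ] (transform f v * transform f v)) ≡ pow2 a * (∑[ u ∈ a ] (f u * f u))
      parseval f = begin
        (∑[ v ∈ a ] (transform f v * transform f v))
          ≡⟨ sym (bilinear-transform f (transform f)) ⟩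
        (∑[ u ∈ a ] ∑[ v ∈ a ] (H u v * (f u * transform f v)))
          ≡⟨ ∑-cong a (λ u → trans
               (∑-cong a λ v → trans (trans (solve 3 (λ h f t → h :* (f :* t) := (h :* f) :* t) refl (H u v) (f u) (transform f v)) (sym (∑-*ˡ a (H u v * f u) _)))
                 (∑-cong a λ u′ → solve 4 (λ h f h′ f′ → (h :* f) :* (h′ :* f′) := (f :* f′) :* (h :* h′)) refl (H u v) (f u) (H u′ v) (f u′)))
               (∑-swap a a _)) ⟩
        (∑[ u ∈ a ] ∑[ u′ ∈ a ] ∑[ v ∈ a ] ((f u * f u′) * (H u v * H u′ v)))
          ≡⟨ ∑-cong a (λ u → ∑-cong a λ u′ → trans (∑-*ˡ a (f u * f u′) _) (cong ((f u * f u′) *_) (orthogonal u u′))) ⟩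
        (∑[ u ∈ a ] ∑[ u′ ∈ a ] ((f u * f u′) * (pow2 a * δ (u ⊕ u′))))
          ≡⟨ ∑-cong a (λ u → trans (∑-cong a λ u′ → solve 4 (λ f g p d → (f :* g) :* (p :* d) := (p :* f) :* (g :* d)) refl (f u) (f u′) (pow2 a) (δ (u ⊕ u′)))
               (trans (∑-*ˡ a (pow2 a * f u) _) (cong ((pow2 a * f u) *_) (∑-δ-shift a f u)))) ⟩
        (∑[ u ∈ a ] ((pow2 a * f u) * f u))
          ≡⟨ trans (∑-cong a λ u → *-assoc (pow2 a) (f u) (f u)) (∑-*ˡ a (pow2 a) _) ⟩
        pow2 a * (∑[ u ∈ a ] (f u * f u)) ∎
        where open ≡-Reasoning

    -- Cauchy-Schwarz and Parseval without square roots: the inequality of the two means is applied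
    -- with weights α and β still to be chosen.
    bilinear-bound : ∀ α β f g → (α * β) * bilinear f g + (α * β) * bilinear f g ≤
      (α * α) * (pow2 a * (∑[ u ∈ a ] (f u * f u))) + (β * β) * (∑[ v ∈ a ] (g v * g v))
    bilinear-bound α β f g = begin
      (α * β) * bilinear f g + (α * β) * bilinear f g
        ≡⟨ cong (λ x → (α * β) * x + (α * β) * x) (bilinear-transform f g) ⟩
      (α * β) * (∑[ v ∈ a ] (P v * g v)) + (α * β) * (∑[ v ∈ a ] (P v * g v))
        ≡⟨ cong (λ x → x + x) (trans (sym (∑-*ˡ a (α * β) _)) (∑-cong a λ v → solve 4 (λ α β p g → (α :* β) :* (p :* g) := (α :* p) :* (β :* g)) refl α β (P v) (g v))) ⟩
      (∑[ v ∈ a ] ((α * P v) * (β * g v))) + (∑[ v ∈ a ] ((α * P v) * (β * g v)))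
        ≡⟨ sym (∑-+ a _ _) ⟩
      (∑[ v ∈ a ] ((α * P v) * (β * g v) + (α * P v) * (β * g v)))
        ≤⟨ ∑-mono a (λ v → am-gm (α * P v) (β * g v)) ⟩
      (∑[ v ∈ a ] ((α * P v) * (α * P v) + (β * g v) * (β * g v)))
        ≡⟨ trans (∑-+ a _ _) (cong₂ _+_
             (trans (∑-cong a λ v → solve 2 (λ α p → (α :* p) :* (α :* p) := (α :* α) :* (p :* p)) refl α (P v)) (trans (∑-*ˡ a (α * α) _) (cong ((α * α) *_) (parseval f))))
             (trans (∑-cong a λ v → solve 2 (λ α p → (α :* p) :* (α :* p) := (α :* α) :* (p :* p)) refl β (g v)) (∑-*ˡ a (β * β) _))) ⟩
      (α * α) * (pow2 a * (∑[ u ∈ a ] (f u * f u))) + (β * β) * (∑[ v ∈ a ] (g v * g v)) ∎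
      where
      open ≤-Reasoning
      P : Vec Bool a → ℚ
      P = transform f

    -- The entries Σₗ (Aᵤₗ Cᵥₗ - Bᵤₗ Dᵥₗ) are the real parts of those of a complex matrix product.
    module Correlation {m} (A B C D : Vec Bool a → Fin m → ℚ) (h R Q : ℚ) (h² : h * h ≡ pow2 a) (0<h : 0ℚ < h) (0<R : 0ℚ < R) (0<Q : 0ℚ < Q)
      (rows : ∀ u → sumF (λ l → A u l * A u l + B u l * B u l) ≤ R * R)
      (columns : ∀ v → sumF (λ l → C v l * C v l + D v l * D v l) ≤ Q * Q) where

      correlation : ℚ
      correlation = ∑[ u ∈ a ] ∑[ v ∈ a ] (H u v * sumF (λ l → A u l * C v l - B u l * D v l))

      private
        α β : ℚ
        -- This choice and β = h R balance the two squares: both are then bounded by h⁴ R² Q².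
        α = Q
        β = h * R

        coordinate : Fin m → ℚ
        coordinate l = bilinear (λ u → A u l) (λ v → C v l) + bilinear (λ u → - B u l) (λ v → D v l)

        correlation≡ : correlation ≡ sumF coordinate
        correlation≡ = begin
          correlation
            ≡⟨ ∑-cong a (λ u → trans (∑-cong a λ v → sym (sumF-* {m} (H u v) (λ l → A u l * C v l - B u l * D v l)))
                 (∑-sumF a {m} (λ v l → H u v * (A u l * C v l - B u l * D v l)))) ⟩
          (∑[ u ∈ a ] sumF (λ l → ∑[ v ∈ a ] (H u v * (A u l * C v l - B u l * D v l))))
            ≡⟨ ∑-sumF a {m} (λ u l → ∑[ v ∈ a ] (H u v * (A u l * C v l - B u l * D v l))) ⟩
          sumF (λ l → ∑[ u ∈ a ] ∑[ v ∈ a ] (H u v * (A u l * C v l - B u l * D v l)))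
            ≡⟨ sumF-cong {m} (λ l → trans (∑-cong a λ u → trans
                 (∑-cong a λ v → solve 5 (λ h a c b d → h :* (a :* c :- b :* d) := h :* (a :* c) :+ h :* ((:- b) :* d)) refl (H u v) (A u l) (C v l) (B u l) (D v l))
                 (∑-+ a _ _)) (∑-+ a _ _)) ⟩
          sumF coordinate ∎
          where open ≡-Reasoning

        Sq : (Vec Bool a → Fin m → ℚ) → Fin m → ℚ
        Sq F l = ∑[ u ∈ a ] (F u l * F u l)

        coordinate-bound : ∀ l → (α * β) * coordinate l + (α * β) * coordinate l ≤
          (α * α) * (pow2 a * (Sq A l + Sq B l)) + (β * β) * (Sq C l + Sq D l)
        coordinate-bound l = begin
          (α * β) * coordinate l + (α * β) * coordinate l
            ≡⟨ solve 3 (λ x p q → x :* (p :+ q) :+ x :* (p :+ q) := (x :* p :+ x :* p) :+ (x :* q :+ x :* q)) refl (α * β) X Y ⟩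
          ((α * β) * X + (α * β) * X) + ((α * β) * Y + (α * β) * Y)
            ≤⟨ +-mono-≤ (bilinear-bound α β (λ u → A u l) (λ v → C v l)) (bilinear-bound α β (λ u → - B u l) (λ v → D v l)) ⟩
          ((α * α) * (pow2 a * Sq A l) + (β * β) * Sq C l) + ((α * α) * (pow2 a * (∑[ u ∈ a ] (- B u l * - B u l))) + (β * β) * Sq D l)
            ≡⟨ cong (λ x → ((α * α) * (pow2 a * Sq A l) + (β * β) * Sq C l) + ((α * α) * (pow2 a * x) + (β * β) * Sq D l))
                 (∑-cong a λ u → solve 1 (λ b → (:- b) :* (:- b) := b :* b) refl (B u l)) ⟩
          ((α * α) * (pow2 a * Sq A l) + (β * β) * Sq C l) + ((α * α) * (pow2 a * Sq B l) + (β * β) * Sq D l)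
            ≡⟨ solve 7 (λ x y n a b c d → (x :* (n :* a) :+ y :* c) :+ (x :* (n :* b) :+ y :* d) := x :* (n :* (a :+ b)) :+ y :* (c :+ d)) refl
                 (α * α) (β * β) (pow2 a) (Sq A l) (Sq B l) (Sq C l) (Sq D l) ⟩
          (α * α) * (pow2 a * (Sq A l + Sq B l)) + (β * β) * (Sq C l + Sq D l) ∎
          where
          open ≤-Reasoning
          X Y : ℚ
          X = bilinear (λ u → A u l) (λ v → C v l)
          Y = bilinear (λ u → - B u l) (λ v → D v l)

        total : ∀ (F G : Vec Bool a → Fin m → ℚ) r → (∀ u → sumF (λ l → F u l * F u l + G u l * G u l) ≤ r) →
          sumF (λ l → Sq F l + Sq G l) ≤ r * pow2 a
        total F G r le = begin
          sumF (λ l → Sq F l + Sq G l)  ≡⟨ sumF-cong {m} (λ l → sym (∑-+ a (λ u → F u l * F u l) (λ u → G u l * G u l))) ⟩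
          sumF (λ l → ∑[ u ∈ a ] (F u l * F u l + G u l * G u l))  ≡⟨ sym (∑-sumF a {m} (λ u l → F u l * F u l + G u l * G u l)) ⟩
          (∑[ u ∈ a ] sumF (λ l → F u l * F u l + G u l * G u l))  ≤⟨ ∑-mono a le ⟩
          (∑[ u ∈ a ] r)  ≡⟨ ∑-const a r ⟩
          r * pow2 a ∎
          where open ≤-Reasoning

        0<αβ : 0ℚ < α * β
        0<αβ = positive⁻¹ (α * β) {{pos*pos⇒pos α {{positive 0<Q}} β {{positive (positive⁻¹ β {{pos*pos⇒pos h {{positive 0<h}} R {{positive 0<R}}}})}}}}

        0≤pow : 0ℚ ≤ pow2 a
        0≤pow = 0≤pow2 a

        doubled : (α * β) * correlation + (α * β) * correlation ≤ (α * β) * (h * h * h * (R * Q)) + (α * β) * (h * h * h * (R * Q))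
        doubled = begin
          (α * β) * correlation + (α * β) * correlation
            ≡⟨ cong (λ x → (α * β) * x + (α * β) * x) correlation≡ ⟩
          (α * β) * sumF coordinate + (α * β) * sumF coordinate
            ≡⟨ trans (cong (λ x → x + x) (sym (sumF-* {m} (α * β) coordinate))) (sym (sumF-+ {m} (λ l → (α * β) * coordinate l) (λ l → (α * β) * coordinate l))) ⟩
          sumF (λ l → (α * β) * coordinate l + (α * β) * coordinate l)
            ≤⟨ sumF-mono {m} coordinate-bound ⟩
          sumF (λ l → (α * α) * (pow2 a * (Sq A l + Sq B l)) + (β * β) * (Sq C l + Sq D l))
            ≡⟨ trans (sumF-+ {m} (λ l → (α * α) * (pow2 a * (Sq A l + Sq B l))) (λ l → (β * β) * (Sq C l + Sq D l)))
                 (cong₂ _+_ (trans (sumF-* {m} (α * α) (λ l → pow2 a * (Sq A l + Sq B l))) (cong ((α * α) *_) (sumF-* {m} (pow2 a) (λ l → Sq A l + Sq B l))))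
                   (sumF-* {m} (β * β) (λ l → Sq C l + Sq D l))) ⟩
          (α * α) * (pow2 a * sumF (λ l → Sq A l + Sq B l)) + (β * β) * sumF (λ l → Sq C l + Sq D l)
            ≤⟨ +-mono-≤
                 (*-monoˡ-≤-nonNeg (α * α) {{nonNegative (0≤p² α)}} (*-monoˡ-≤-nonNeg (pow2 a) {{nonNegative 0≤pow}} (total A B (R * R) rows)))
                 (*-monoˡ-≤-nonNeg (β * β) {{nonNegative (0≤p² β)}} (total C D (Q * Q) columns)) ⟩
          (α * α) * (pow2 a * (R * R * pow2 a)) + (β * β) * (Q * Q * pow2 a)
            ≡⟨ cong (λ n → (α * α) * (n * (R * R * n)) + (β * β) * (Q * Q * n)) (sym h²) ⟩
          (α * α) * ((h * h) * (R * R * (h * h))) + (β * β) * (Q * Q * (h * h))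
            ≡⟨ solve 3 (λ h r q → (q :* q) :* ((h :* h) :* (r :* r :* (h :* h))) :+ ((h :* r) :* (h :* r)) :* (q :* q :* (h :* h))
                 := (q :* (h :* r)) :* (h :* h :* h :* (r :* q)) :+ (q :* (h :* r)) :* (h :* h :* h :* (r :* q))) refl h R Q ⟩
          (α * β) * (h * h * h * (R * Q)) + (α * β) * (h * h * h * (R * Q)) ∎
          where open ≤-Reasoning

      correlation-bound : correlation ≤ h * h * h * (R * Q)
      correlation-bound = *-cancelˡ-≤-pos (α * β) {{positive 0<αβ}} (≮⇒≥ λ lt → <⇒≱ (+-mono-< lt lt) doubled)

-- The lower bound for factorizations with real approximations.

module FactorizationBound where
  open import Defs
  open Subspaces using (𝟎)
  open BooleanSums
  open Lindsey
  open import Data.Rational.Base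
  open import Data.Rational.Properties
  open import Data.Rational.Solver using (module +-*-Solver)
  open import Data.Vec.Functional as Vector using (Vector)
  open ≡ using (refl; sym; trans; subst₂; module ≡-Reasoning)

  open +-*-Solver using (solve; _:+_; _:*_; _:-_; _:=_; con; :-_)

  -- An inequality of reals is, up to a positive error, an inequality of almost all rational
  -- approximations, so the argument is run at a late index k.
  Eventually : (ℕ → Set) → Set
  Eventually P = ∃ λ N → ∀ k → N ℕ.≤ k → P k

  eventually-× : ∀ {P Q} → Eventually P → Eventually Q → Eventually (λ k → P k × Q k)
  eventually-× (N , p) (N′ , q) = N ℕ.⊔ N′ , λ k le → p k (≤⊔ˡ {N} le) , q k (≤⊔ʳ {N} le)

  eventually-map : ∀ {P Q : ℕ → Set} → (∀ k → P k → Q k) → Eventually P → Eventually Q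
  eventually-map f (N , p) = N , λ k le → f k (p k le)

  eventually-all : ∀ {n} {P : Fin n → ℕ → Set} → (∀ i → Eventually (P i)) → Eventually (λ k → ∀ i → P i k)
  eventually-all {zero}  _ = 0 , λ _ _ ()
  eventually-all {suc n} {P} ev = eventually-map {λ k → P zero k × (∀ i → P (suc i) k)}
    (λ { k (p , q) zero → p ; k (p , q) (suc i) → q i })
    (eventually-× (ev zero) (eventually-all (ev ∘ suc)))

  approx-sum : ∀ {m} (x : Fin m → ℝ) k → approx (Vector.foldr _+ʳ_ 0ʳ x) k ≡ sumF (λ l → approx (x l) k)
  approx-sum {zero}  x k = refl
  approx-sum {suc m} x k = cong (approx (x zero) k +_) (approx-sum (x ∘ suc) k)

  approx-re-sum : ∀ {m} (x : Fin m → ℂ) k → approx (re (Vector.foldr _+ᶜ_ 0ᶜ x)) k ≡ sumF (λ l → approx (re (x l)) k)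
  approx-re-sum {zero}  x k = refl
  approx-re-sum {suc m} x k = cong (approx (re (x zero)) k +_) (approx-re-sum (x ∘ suc) k)

  approx-max : ∀ {m} (x : Fin m → ℝ) k i → approx (x i) k ≤ approx (Vector.foldr _⊔ʳ_ 0ʳ x) k
  approx-max x k zero    = p≤p⊔q (approx (x zero) k) _
  approx-max x k (suc i) = ≤-trans (approx-max (x ∘ suc) k i) (p≤q⊔p (approx (x zero) k) _)

  approx-max-nonneg : ∀ {m} (x : Fin m → ℝ) k → 0ℚ ≤ approx (Vector.foldr _⊔ʳ_ 0ʳ x) k
  approx-max-nonneg {zero}  x k = ≤-refl
  approx-max-nonneg {suc m} x k = ≤-trans (approx-max-nonneg (x ∘ suc) k) (p≤q⊔p (approx (x zero) k) _)

  -- The k-th approximation of a square root is rounded down to a multiple of 1 / (k + 1), so this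
  -- much has to be added before squaring.
  norm-bound : ∀ {m} (v : Vector ℂ m) k R → approx ‖ v ‖₂ k ≤ R →
    sumF (λ l → approx (re (v l)) k * approx (re (v l)) k + approx (im (v l)) k * approx (im (v l)) k) ≤ (R + 1/suc k) * (R + 1/suc k)
  norm-bound v k R le = begin
    sumF (λ l → approx (re (v l)) k * approx (re (v l)) k + approx (im (v l)) k * approx (im (v l)) k)
      ≡⟨ approx-sum (λ l → ∣ v l ∣²) k ⟨
    s
      ≤⟨ <⇒≤ (root-upper 2 s k) ⟩
    (root 2 s k + 1/suc k) * ((root 2 s k + 1/suc k) * 1ℚ)
      ≡⟨ cong ((root 2 s k + 1/suc k) *_) (*-identityʳ (root 2 s k + 1/suc k)) ⟩
    (root 2 s k + 1/suc k) * (root 2 s k + 1/suc k)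
      ≤⟨ *-mono-≤ nn (+-monoˡ-≤ (1/suc k) le) nn (+-monoˡ-≤ (1/suc k) le) ⟩
    (R + 1/suc k) * (R + 1/suc k) ∎
    where
    open ≤-Reasoning
    s : ℚ
    s = approx (Vector.foldr _+ʳ_ 0ʳ (λ l → ∣ v l ∣²)) k
    nn : 0ℚ ≤ root 2 s k + 1/suc k
    nn = 0≤p+q (0≤root 2 s k) (0≤frac 1 k)

  pow2-+ : ∀ m n → pow2 (m ℕ.+ n) ≡ pow2 m * pow2 n
  pow2-+ zero    n = sym (*-identityˡ (pow2 n))
  pow2-+ (suc m) n = trans (cong (λ x → x + x) (pow2-+ m n)) (sym (*-distribʳ-+ (pow2 n) (pow2 m) (pow2 m)))

  approx-toℂ : ∀ {m n} (M : Matrix Bool m n) i j k → approx (re (toℂ M i j)) k ≡ (if M i j then 1ℚ else 0ℚ)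
  approx-toℂ M i j k with M i j
  ... | true  = refl
  ... | false = refl

  sign-≤ : ∀ b {x y η} → x ≤ y + η → y ≤ x + η → sign b * x ≤ sign b * y + η
  sign-≤ false {x} {y} {η} p _ = subst₂ (λ s t → s ≤ t + η) (sym (*-identityˡ x)) (sym (*-identityˡ y)) p
  sign-≤ true  {x} {y} {η} _ q = subst₂ _≤_
    (solve 3 (λ x y e → y :+ (:- x :- y) := (:- con 1ℚ) :* x) refl x y η)
    (solve 3 (λ x y e → (x :+ e) :+ (:- x :- y) := (:- con 1ℚ) :* y :+ e) refl x y η)
    (+-monoˡ-≤ (- x - y) q)

  -- For n = 2^a with a even, √n = 2^hh is rational. The bound to be proved for the factorizations
  -- is 2^c = √n / 2^K.
  module _ (a hh K c : ℕ) (a≡ : a ≡ hh ℕ.+ hh) (hh≡ : hh ≡ c ℕ.+ K) (ν : Vec Bool a → Vec Bool a → Vec Bool K) (bi : Biadditive ν)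
    (w : Vec Bool K) (nd : ∀ u → (∀ v → ⟨ w , ν u v ⟩ ≡ false) → u ≡ 𝟎) where

    private
      open module Cnt = Counting bi using (count-zeros; H; H-on-zeros; H-orthogonal)
      h g N : ℚ
      h = pow2 hh
      g = pow2 c
      N = ∑[ u ∈ a ] ∑[ v ∈ a ] δ (ν u v)

    zeroMatrix : Matrix Bool (2 ℕ.^ a) (2 ℕ.^ a)
    zeroMatrix i j = isZero (ν (digits a i) (digits a j))

    zeroMatrix-index : ∀ u v → (if zeroMatrix (index u) (index v) then 1ℚ else 0ℚ) ≡ δ (ν u v)
    zeroMatrix-index u v = trans (cong₂ (λ x y → if isZero (ν x y) then 1ℚ else 0ℚ) (digits-index u) (digits-index v)) (sym (δ-isZero (ν u v)))

    private
      h²≡ : h * h ≡ pow2 a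
      h²≡ = trans (sym (pow2-+ hh hh)) (cong pow2 (sym a≡))

      0<h : 0ℚ < h
      0<h = 0<pow2 hh

      instance
        h-pos : Positive h
        h-pos = positive 0<h
        h³-pos : Positive (h * h * h)
        h³-pos = pos*pos⇒pos (h * h) {{pos*pos⇒pos h h}} h
        K-pos : Positive (pow2 K)
        K-pos = positive (0<pow2 K)

      -- Because h⁴ = 2^(2 a) ≤ 2^K N and h = g 2^K.
      many : h * h * h * g ≤ N
      many = *-cancelˡ-≤-pos (pow2 K) (≤-trans (≤-reflexive (begin
        pow2 K * (h * h * h * g)
          ≡⟨ solve 3 (λ k h g → k :* (h :* h :* h :* g) := h :* h :* (h :* (g :* k))) refl (pow2 K) h g ⟩
        h * h * (h * (g * pow2 K))
          ≡⟨ cong (λ x → h * h * (h * x)) (trans (sym (pow2-+ c K)) (cong pow2 (sym hh≡))) ⟩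
        h * h * (h * h)
          ≡⟨ cong₂ _*_ h²≡ h²≡ ⟩
        pow2 a * pow2 a ∎)) count-zeros)
        where open ≡-Reasoning

    module _ {m} (U : Matrix ℂ (2 ℕ.^ a) m) (V : Matrix ℂ m (2 ℕ.^ a)) (factors : ∀ i j → toℂ zeroMatrix i j ≈ᶜ (U · V) i j) where

      private
        Close : ℚ → ℕ → Set
        Close η k = ∀ i j → approx (re (toℂ zeroMatrix i j)) k ≤ approx (re ((U · V) i j)) k + η ×
                            approx (re ((U · V) i j)) k ≤ approx (re (toℂ zeroMatrix i j)) k + η

        eventually-close : ∀ η → 0ℚ < η → Eventually (Close η)
        eventually-close η 0<η = eventually-all λ i → eventually-all λ j →
          eventually-× (proj₁ (proj₁ (factors i j)) η 0<η) (proj₂ (proj₁ (factors i j)) η 0<η)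

        R Q : ℕ → ℚ
        R = approx ‖ U ‖row
        Q = approx ‖ V ‖col

        -- H is paired with the real parts of the approximate entries. An error η in each of the h⁴
        -- entries adds up to η h⁴, of which h η remains after division by h³.
        at-stage : ∀ η k → Close η k → g ≤ (R k + 1/suc k) * (Q k + 1/suc k) + h * η
        at-stage η k close = *-cancelˡ-≤-pos (h * h * h) (begin
          h * h * h * g
            ≤⟨ many ⟩
          N
            ≡⟨ ∑-cong a (λ u → ∑-cong a λ v → sym (H-on-zeros w nd u v)) ⟩
          (∑[ u ∈ a ] ∑[ v ∈ a ] (H w nd u v * δ (ν u v)))
            ≤⟨ ∑-mono a (λ u → ∑-mono a λ v → entry u v) ⟩
          (∑[ u ∈ a ] ∑[ v ∈ a ] (H w nd u v * sumF (λ l → A u l * C v l - B u l * D v l) + η))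
            ≡⟨ trans (∑-cong a λ u → trans (∑-+ a (λ v → e u v) (λ _ → η)) (cong ((∑[ v ∈ a ] e u v) +_) (∑-const a η)))
                 (trans (∑-+ a (λ u → ∑[ v ∈ a ] e u v) (λ _ → η * pow2 a)) (cong ((∑[ u ∈ a ] ∑[ v ∈ a ] e u v) +_) (∑-const a (η * pow2 a)))) ⟩
          correlation + η * pow2 a * pow2 a
            ≤⟨ +-monoˡ-≤ (η * pow2 a * pow2 a) correlation-bound ⟩
          h * h * h * (r * q) + η * pow2 a * pow2 a
            ≡⟨ cong (λ n → h * h * h * (r * q) + η * n * n) (sym h²≡) ⟩
          h * h * h * (r * q) + η * (h * h) * (h * h)
            ≡⟨ solve 3 (λ h x e → h :* h :* h :* x :+ e :* (h :* h) :* (h :* h) := h :* h :* h :* (x :+ h :* e)) refl h (r * q) η ⟩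
          h * h * h * (r * q + h * η) ∎)
          where
          open ≤-Reasoning
          r q : ℚ
          r = R k + 1/suc k
          q = Q k + 1/suc k
          A B C D : Vec Bool a → Fin m → ℚ
          A u l = approx (re (U (index u) l)) k
          B u l = approx (im (U (index u) l)) k
          C v l = approx (re (V l (index v))) k
          D v l = approx (im (V l (index v))) k
          e : Vec Bool a → Vec Bool a → ℚ
          e u v = H w nd u v * sumF (λ l → A u l * C v l - B u l * D v l)
          0<ι : ∀ {p} → 0ℚ ≤ p → 0ℚ < p + 1/suc k
          0<ι {p} 0≤p = <-≤-trans (0<frac 0 k) (p≤q+p 0≤p)
          open Bilinear a (H w nd) (H-orthogonal w nd)
          open Correlation A B C D h r q h²≡ 0<h
            (0<ι (approx-max-nonneg (λ i → ‖ U i ‖₂) k)) (0<ι (approx-max-nonneg (λ j → ‖ (λ i → V i j) ‖₂) k))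
            (λ u → norm-bound (U (index u)) k (R k) (approx-max (λ i → ‖ U i ‖₂) k (index u)))
            (λ v → norm-bound (λ l → V l (index v)) k (Q k) (approx-max (λ j → ‖ (λ i → V i j) ‖₂) k (index v)))
          product-entry : ∀ u v → approx (re ((U · V) (index u) (index v))) k ≡ sumF (λ l → A u l * C v l - B u l * D v l)
          product-entry u v = approx-re-sum (λ l → U (index u) l *ᶜ V l (index v)) k
          matrix-entry : ∀ u v → approx (re (toℂ zeroMatrix (index u) (index v))) k ≡ δ (ν u v)
          matrix-entry u v = trans (approx-toℂ zeroMatrix (index u) (index v) k) (zeroMatrix-index u v)
          entry : ∀ u v → H w nd u v * δ (ν u v) ≤ H w nd u v * sumF (λ l → A u l * C v l - B u l * D v l) + η
          entry u v = let (p , q) = close (index u) (index v) in sign-≤ ⟨ w , ν u v ⟩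
            (subst₂ (λ x y → x ≤ y + η) (matrix-entry u v) (product-entry u v) p)
            (subst₂ (λ x y → x ≤ y + η) (product-entry u v) (matrix-entry u v) q)

      factorization-bound : ∀ ε → 0ℚ < ε → Eventually (λ k → g ≤ approx (‖ U ‖row *ʳ ‖ V ‖col) k + ε)
      factorization-bound ε 0<ε =
        let (B₁ , N₁ , b₁) = eventually-bounded ‖ U ‖row
            (B₂ , N₂ , b₂) = eventually-bounded ‖ V ‖col
            -- Half of ε pays for the entrywise error 1 / (K₀ + 1), multiplied by h; the other half
            -- for the rounding of the square roots, where B₁ + B₂ + 1 bounds R + Q + 1 / (k + 1).
            (K₀ , small₀)  = archimedean h (0<half 0<ε)
            (K₁ , small₁)  = archimedean (B₁ + B₂ + 1ℚ) (0<half 0<ε)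
        in eventually-map (λ k (close , (r≤ , q≤) , K₁≤k) → finish B₁ B₂ K₀ K₁ k small₀ small₁ close (≤-trans (p≤∣p∣ (R k)) r≤) (≤-trans (p≤∣p∣ (Q k)) q≤) K₁≤k)
             (eventually-× (eventually-close (1/suc K₀) (0<frac 0 K₀)) (eventually-× (eventually-× (N₁ , b₁) (N₂ , b₂)) (K₁ , λ _ le → le)))
        where
        finish : ∀ B₁ B₂ K₀ K₁ k → h * 1/suc K₀ ≤ half ε → (B₁ + B₂ + 1ℚ) * 1/suc K₁ ≤ half ε → Close (1/suc K₀) k →
          R k ≤ B₁ → Q k ≤ B₂ → K₁ ℕ.≤ k → g ≤ R k * Q k + ε
        finish B₁ B₂ K₀ K₁ k small₀ small₁ close r≤ q≤ K₁≤k = begin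
          g
            ≤⟨ at-stage (1/suc K₀) k close ⟩
          (R k + ι) * (Q k + ι) + h * 1/suc K₀
            ≡⟨ solve 4 (λ r q i e → (r :+ i) :* (q :+ i) :+ e := r :* q :+ ((r :+ q :+ i) :* i :+ e)) refl (R k) (Q k) ι (h * 1/suc K₀) ⟩
          R k * Q k + ((R k + Q k + ι) * ι + h * 1/suc K₀)
            ≤⟨ +-monoʳ-≤ (R k * Q k) (+-mono-≤ (≤-trans (*-mono-≤ nn (+-mono-≤ (+-mono-≤ r≤ q≤) ι≤1) (0≤frac 1 k) (1/-antimono K₁≤k)) small₁) small₀) ⟩
          R k * Q k + (half ε + half ε)
            ≡⟨ cong (R k * Q k +_) (half+half ε) ⟩
          R k * Q k + ε ∎
          where
          open ≤-Reasoning
          ι : ℚ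
          ι = 1/suc k
          ι≤1 : ι ≤ 1ℚ
          ι≤1 = subst (ι ≤_) fromℕ-1 (1/-antimono {0} {k} z≤n)
          nn : 0ℚ ≤ R k + Q k + ι
          nn = 0≤p+q (0≤p+q (approx-max-nonneg (λ i → ‖ U i ‖₂) k) (approx-max-nonneg (λ j → ‖ (λ i → V i j) ‖₂) k)) (0≤frac 1 k)

-- Powers of n = 2^b with real exponents.

module RealPowers where
  open import Defs
  open BooleanSums using (pow2; 0≤pow2; 1≤pow2)
  open FactorizationBound using (pow2-+)
  open import Data.Integer.Base as ℤ using (ℤ; +_; -[1+_])
  import Data.Integer.Properties as ℤ
  open import Data.Rational.Base
  open import Data.Rational.Properties
  import Data.Rational.Unnormalised.Properties as ℚᵘ
  open import Data.Rational.Solver using (module +-*-Solver)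
  open ≡ using (refl; sym; trans; subst₂)
  open import Algebra.Definitions.RawSemiring +-*-rawSemiring using (_^_)

  open +-*-Solver using (solve; _:+_; _:*_; _:-_; _:=_; con)

  fromℕ-2^ : ∀ a → fromℕ (2 ℕ.^ a) ≡ pow2 a
  fromℕ-2^ zero    = fromℕ-1
  fromℕ-2^ (suc a) = trans (cong (λ n → fromℕ (2 ℕ.^ a ℕ.+ n)) (ℕ.+-identityʳ (2 ℕ.^ a)))
    (trans (fromℕ-+ (2 ℕ.^ a) (2 ℕ.^ a)) (cong (λ x → x + x) (fromℕ-2^ a)))

  pow2-^ : ∀ c q → pow2 c ^ q ≡ pow2 (q ℕ.* c)
  pow2-^ c zero    = refl
  pow2-^ c (suc q) = trans (cong (pow2 c *_) (pow2-^ c q)) (sym (pow2-+ c (q ℕ.* c)))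

  pow2-mono : ∀ {m n} → m ℕ.≤ n → pow2 m ≤ pow2 n
  pow2-mono {m} {n} m≤n = subst (pow2 m ≤_) (trans (sym (pow2-+ m (n ℕ.∸ m))) (cong pow2 (ℕ.m+[n∸m]≡n m≤n)))
    (subst (_≤ pow2 m * pow2 (n ℕ.∸ m)) (*-identityʳ (pow2 m)) (*-monoˡ-≤-nonNeg (pow2 m) {{nonNegative (0≤pow2 m)}} (1≤pow2 (n ℕ.∸ m))))

  ^≤1 : ∀ {p} q → 0ℚ ≤ p → p ≤ 1ℚ → p ^ q ≤ 1ℚ
  ^≤1 {p} q 0≤p p≤1 = subst (p ^ q ≤_) (1^ q) (^-mono-≤ q 0≤p p≤1)

  ^ᶻ-bound : ∀ n .{{_ : ℕ.NonZero n}} b c i q → fromℕ n ≡ pow2 b → i ℤ.* + b ℤ.≤ + c ℤ.* + q → n ^ᶻ i ≤ pow2 c ^ q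
  ^ᶻ-bound n b c (+ p) q n≡ le = begin
    (+ n / 1) ^ p          ≡⟨ cong (_^ p) (trans (sym (frac-def n 0)) n≡) ⟩
    pow2 b ^ p             ≡⟨ pow2-^ b p ⟩
    pow2 (p ℕ.* b)         ≤⟨ pow2-mono (subst (p ℕ.* b ℕ.≤_) (ℕ.*-comm c q) (ℤ.drop‿+≤+ (subst₂ ℤ._≤_ (sym (ℤ.pos-* p b)) (sym (ℤ.pos-* c q)) le))) ⟩
    pow2 (q ℕ.* c)         ≡⟨ pow2-^ c q ⟨
    pow2 c ^ q             ∎
    where open ≤-Reasoning
  ^ᶻ-bound (suc n) b c -[1+ p ] q n≡ le = ≤-trans (^≤1 (suc p) (subst (0ℚ ≤_) (frac-def 1 n) (0≤frac 1 n))
    (subst₂ _≤_ (frac-def 1 n) fromℕ-1 (1/-antimono {0} {n} z≤n))) (1≤^ q (1≤pow2 c))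

  -- Approximate roots are rounded down, so the bound of the exact power holds for each
  -- approximation without an error term.
  powApprox-bound : ∀ n .{{_ : ℕ.NonZero n}} b c a k → fromℕ n ≡ pow2 b → ↥ a ℤ.* + b ℤ.≤ + c ℤ.* ↧ a → powApprox n a k ≤ pow2 c
  powApprox-bound n b c a@record{} k n≡ le with root-lower (↧ₙ a) (n ^ᶻ (↥ a)) k
  ... | inj₁ eq = subst (_≤ pow2 c) (sym eq) (0≤pow2 c)
  ... | inj₂ s^q≤ = ^-cancel-≤ (↧ₙ a) (0≤pow2 c) (≤-trans s^q≤ (^ᶻ-bound n b c (↥ a) (↧ₙ a) n≡ le))

  -- The right side is 1/2 - 1 / (2 (D + 1)), so half of the permitted loss is given away.
  half-minus : ∀ D → ½ - 1/suc D ≤ frac D (suc (D ℕ.+ D))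
  half-minus D = *-cancelʳ-≤-pos m {{positive (0<frac (suc (D ℕ.+ D)) 0)}} (begin
    (½ - x) * m            ≡⟨ cong ((½ - x) *_) m≡ ⟩
    (½ - x) * (s + s)      ≡⟨ solve 2 (λ s x → (con ½ :- x) :* (s :+ s) := s :- (s :* x :+ s :* x)) refl s x ⟩
    s - (s * x + s * x)    ≡⟨ cong (λ y → s - (y + y)) (suc*1/suc D) ⟩
    s - (1ℚ + 1ℚ)          ≡⟨ cong (_- (1ℚ + 1ℚ)) (trans (fromℕ-+ 1 D) (cong (_+ fromℕ D) fromℕ-1)) ⟩
    (1ℚ + fromℕ D) - (1ℚ + 1ℚ)  ≡⟨ solve 1 (λ d → (con 1ℚ :+ d) :- (con 1ℚ :+ con 1ℚ) := d :- con 1ℚ) refl (fromℕ D) ⟩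
    fromℕ D - 1ℚ           ≤⟨ p≤q+r⇒p-q≤r {fromℕ D} {1ℚ} {fromℕ D} (subst (fromℕ D ≤_) (+-comm (fromℕ D) 1ℚ) (p≤p+q (fromℕ D) 0≤1)) ⟩
    fromℕ D                ≡⟨ sym (*-identityʳ (fromℕ D)) ⟩
    fromℕ D * 1ℚ           ≡⟨ cong (fromℕ D *_) (sym (trans (*-comm z m) (suc*1/suc (suc (D ℕ.+ D))))) ⟩
    fromℕ D * (z * m)      ≡⟨ sym (*-assoc (fromℕ D) z m) ⟩
    fromℕ D * z * m        ≡⟨ cong (_* m) (sym (frac≡* D (suc (D ℕ.+ D)))) ⟩
    frac D (suc (D ℕ.+ D)) * m ∎)
    where
    open ≤-Reasoning
    m s x z : ℚ
    m = fromℕ (suc (suc (D ℕ.+ D)))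
    s = fromℕ (suc D)
    x = 1/suc D
    z = 1/suc (suc (D ℕ.+ D))
    m≡ : m ≡ s + s
    m≡ = trans (cong fromℕ (cong suc (sym (ℕ.+-suc D D)))) (fromℕ-+ (suc D) (suc D))

  -- Denominators are cleared: for n = 2^(2 (D + 1) e) an exponent a ≤ D / (2 D + 2) gives at most
  -- 2^(D e).
  exponent : ∀ D e a → a ≤ frac D (suc (D ℕ.+ D)) → ↥ a ℤ.* + ((suc D ℕ.+ suc D) ℕ.* e) ℤ.≤ + (D ℕ.* e) ℤ.* ↧ a
  exponent D e a@record{} le = subst₂ ℤ._≤_
    (trans (ℤ.*-assoc (↥ a) (+ suc (suc (D ℕ.+ D))) (+ e)) (cong (↥ a ℤ.*_) (trans (sym (ℤ.pos-* (suc (suc (D ℕ.+ D))) e)) (cong (λ x → + (suc x ℕ.* e)) (sym (ℕ.+-suc D D))))))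
    (trans (ℤ.*-assoc (+ D) (↧ a) (+ e)) (trans (cong (+ D ℤ.*_) (ℤ.*-comm (↧ a) (+ e))) (trans (sym (ℤ.*-assoc (+ D) (+ e) (↧ a))) (cong (ℤ._* ↧ a) (sym (ℤ.pos-* D e))))))
    (ℤ.*-monoʳ-≤-nonNeg (+ e) (ℚᵘ.drop-*≤* (ℚᵘ.≤-respʳ-≃ (frac-toℚᵘ D (suc (D ℕ.+ D))) (toℚᵘ-mono-≤ le))))

-- One-way protocols, events of finitely many coins, and sampling a point.

module Protocols where
  open import Defs
  open Tower using (Point; sumPoints)
  open EvaluationCodes using (indicator; countPoints)
  open import Data.Integer.Base as ℤ using (+_)
  open import Data.List.Base using (List; []; _∷_; applyUpTo)
  open import Data.Nat.DivMod using (m≡m%n+[m/n]*n; m%n<n)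
  open import Data.Nat.Solver using () renaming (module +-*-Solver to ℕ-Solver)
  open import Data.Rational.Base
  open import Data.Rational.Properties
  open import Data.Rational.Solver using (module +-*-Solver)
  open import Data.Vec.Base using (head; tail)
  open ≡ using (refl; sym; trans; subst₂)
  import Data.Rational.Unnormalised.Base as ℚᵘ
  import Data.Rational.Unnormalised.Properties as ℚᵘ
  import Data.Integer.Properties as ℤ

  module _ {X Y : Set} where

    send : ∀ {L} → (X → Vec Bool L) → (Vec Bool L → Protocol X Y) → Protocol X Y
    send {zero}  f π = π []
    send {suc L} f π = alice (head ∘ f) λ b → send (tail ∘ f) λ v → π (b ∷ v)

    run-send : ∀ {L} (f : X → Vec Bool L) π x y → run (send f π) x y ≡ run (π (f x)) x y
    run-send {zero}  f π x y with f x
    ... | [] = refl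
    run-send {suc L} f π x y = trans (run-send (tail ∘ f) (λ v → π (head (f x) ∷ v)) x y) (cong (λ v → run (π v) x y) (head∷tail (f x)))
      where
      head∷tail : (v : Vec Bool (suc L)) → head v ∷ tail v ≡ v
      head∷tail (_ ∷ _) = refl

    bits-send : ∀ {L} (f : X → Vec Bool L) π B x y → (∀ v → bits (π v) x y ≡ B) → bits (send f π) x y ≡ L ℕ.+ B
    bits-send {zero}  f π B x y h = h []
    bits-send {suc L} f π B x y h = cong suc (bits-send (tail ∘ f) (λ v → π (head (f x) ∷ v)) B x y (λ v → h (head (f x) ∷ v)))

    reply : ∀ {L} → (X → Vec Bool L) → (Vec Bool L → Y → Bool) → Protocol X Y
    reply f g = send f λ v → bob (g v) output

    run-reply : ∀ {L} (f : X → Vec Bool L) g x y → run (reply f g) x y ≡ g (f x) y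
    run-reply f g x y = run-send f (λ v → bob (g v) output) x y

    bits-reply : ∀ {L} (f : X → Vec Bool L) g x y → bits (reply f g) x y ≡ L ℕ.+ 1
    bits-reply f g x y = bits-send f (λ v → bob (g v) output) 1 x y (λ _ → refl)

  prefix : ∀ b → Coins → Vec Bool b
  prefix zero    r = []
  prefix (suc b) r = r 0 ∷ prefix b (r ∘ suc)

  -- An event of the first b coins is clopen. As the tree of a closed set it must accept all shorter
  -- words, which are still undecided.
  cylinder : ∀ b → (Vec Bool b → Bool) → List Bool → Bool
  cylinder zero    E _        = E []
  cylinder (suc b) E []       = true
  cylinder (suc b) E (c ∷ ws) = cylinder b (E ∘ (c ∷_)) ws

  cylinder-prefix : ∀ b E r → cylinder b E (applyUpTo r b) ≡ E (prefix b r)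
  cylinder-prefix zero    E r = refl
  cylinder-prefix (suc b) E r = cylinder-prefix b (E ∘ (r 0 ∷_)) (r ∘ suc)

  ∑ℕ : ∀ b → (Vec Bool b → ℕ) → ℕ
  ∑ℕ zero    f = f []
  ∑ℕ (suc b) f = ∑ℕ b (f ∘ (false ∷_)) ℕ.+ ∑ℕ b (f ∘ (true ∷_))

  countWords : ∀ b → (Vec Bool b → Bool) → ℕ
  countWords b E = ∑ℕ b (indicator ∘ E)

  ∑ℕ-cong : ∀ b {f g : Vec Bool b → ℕ} → (∀ w → f w ≡ g w) → ∑ℕ b f ≡ ∑ℕ b g
  ∑ℕ-cong zero    eq = eq []
  ∑ℕ-cong (suc b) eq = cong₂ ℕ._+_ (∑ℕ-cong b (λ w → eq (false ∷ w))) (∑ℕ-cong b (λ w → eq (true ∷ w)))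

  2^suc : ∀ b → 2 ℕ.^ suc b ≡ 2 ℕ.^ b ℕ.+ 2 ℕ.^ b
  2^suc b = cong (2 ℕ.^ b ℕ.+_) (ℕ.+-identityʳ (2 ℕ.^ b))

  open ℕ-Solver using () renaming (solve to solveℕ; _:+_ to _:+ⁿ_; _:*_ to _:*ⁿ_; _:=_ to _:=ⁿ_; con to conⁿ)

  countWords-complement : ∀ b E → countWords b E ℕ.+ countWords b (not ∘ E) ≡ 2 ℕ.^ b
  countWords-complement zero    E with E []
  ... | true  = refl
  ... | false = refl
  countWords-complement (suc b) E = trans
    (solveℕ 4 (λ a b c d → (a :+ⁿ b) :+ⁿ (c :+ⁿ d) :=ⁿ (a :+ⁿ c) :+ⁿ (b :+ⁿ d)) refl
      (countWords b (E ∘ (false ∷_))) (countWords b (E ∘ (true ∷_))) (countWords b (not ∘ E ∘ (false ∷_))) (countWords b (not ∘ E ∘ (true ∷_))))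
    (trans (cong₂ ℕ._+_ (countWords-complement b (E ∘ (false ∷_))) (countWords-complement b (E ∘ (true ∷_)))) (sym (2^suc b)))

  countWords-≤ : ∀ b E → countWords b E ℕ.≤ 2 ℕ.^ b
  countWords-≤ b E = subst (countWords b E ℕ.≤_) (countWords-complement b E) (ℕ.m≤m+n _ _)

  count-const : ∀ c k → count (λ _ → c) k ≡ indicator c ℕ.* 2 ℕ.^ k
  count-const false zero    = refl
  count-const true  zero    = refl
  count-const false (suc k) = refl
  count-const true  (suc k) = trans (cong₂ ℕ._+_ (count-const true k) (count-const true k))
    (solveℕ 1 (λ x → conⁿ 1 :*ⁿ x :+ⁿ conⁿ 1 :*ⁿ x :=ⁿ conⁿ 1 :*ⁿ (conⁿ 2 :*ⁿ x)) refl (2 ℕ.^ k))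

  -- From k = b on the density is the probability itself, and before that it is 1.
  count-cylinder : ∀ b E k → countWords b E ℕ.* 2 ℕ.^ k ℕ.≤ count (cylinder b E) k ℕ.* 2 ℕ.^ b
  count-cylinder zero    E k       = ℕ.≤-reflexive (trans (sym (count-const (E []) k)) (sym (ℕ.*-identityʳ _)))
  count-cylinder (suc b) E zero    = subst₂ ℕ._≤_ (sym (ℕ.*-identityʳ _)) (sym (ℕ.*-identityˡ _)) (countWords-≤ (suc b) E)
  count-cylinder (suc b) E (suc k) = begin
    (E₀ ℕ.+ E₁) ℕ.* 2 ℕ.^ suc k
      ≡⟨ solveℕ 3 (λ x y z → (x :+ⁿ y) :*ⁿ (conⁿ 2 :*ⁿ z) :=ⁿ conⁿ 2 :*ⁿ (x :*ⁿ z :+ⁿ y :*ⁿ z)) refl E₀ E₁ (2 ℕ.^ k) ⟩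
    2 ℕ.* (E₀ ℕ.* 2 ℕ.^ k ℕ.+ E₁ ℕ.* 2 ℕ.^ k)
      ≤⟨ ℕ.*-monoʳ-≤ 2 (ℕ.+-mono-≤ (count-cylinder b (E ∘ (false ∷_)) k) (count-cylinder b (E ∘ (true ∷_)) k)) ⟩
    2 ℕ.* (C₀ ℕ.* 2 ℕ.^ b ℕ.+ C₁ ℕ.* 2 ℕ.^ b)
      ≡⟨ solveℕ 3 (λ x y z → conⁿ 2 :*ⁿ (x :*ⁿ z :+ⁿ y :*ⁿ z) :=ⁿ (x :+ⁿ y) :*ⁿ (conⁿ 2 :*ⁿ z)) refl C₀ C₁ (2 ℕ.^ b) ⟩
    (C₀ ℕ.+ C₁) ℕ.* 2 ℕ.^ suc b ∎
    where
    open ℕ.≤-Reasoning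
    E₀ = countWords b (E ∘ (false ∷_))
    E₁ = countWords b (E ∘ (true ∷_))
    C₀ = count (cylinder b (E ∘ (false ∷_))) k
    C₁ = count (cylinder b (E ∘ (true ∷_))) k

  /-mono : ∀ m m′ n n′ .{{_ : ℕ.NonZero n}} .{{_ : ℕ.NonZero n′}} → m ℕ.* n′ ℕ.≤ m′ ℕ.* n → + m / n ≤ + m′ / n′
  /-mono m m′ (suc n) (suc n′) le = subst₂ _≤_ (frac-def m n) (frac-def m′ n′) (toℚᵘ-cancel-≤
    (ℚᵘ.≤-respˡ-≃ (ℚᵘ.≃-sym (frac-toℚᵘ m n)) (ℚᵘ.≤-respʳ-≃ (ℚᵘ.≃-sym (frac-toℚᵘ m′ n′))
      (ℚᵘ.*≤* (subst₂ ℤ._≤_ (ℤ.pos-* m (suc n′)) (ℤ.pos-* m′ (suc n)) (ℤ.+≤+ le))))))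

  /-* : ∀ m n .{{_ : ℕ.NonZero n}} → (+ m / n) * fromℕ n ≡ fromℕ m
  /-* m (suc n) = trans (cong (_* fromℕ (suc n)) (trans (sym (frac-def m n)) (frac≡* m n)))
    (trans (*-assoc (fromℕ m) (1/suc n) (fromℕ (suc n))) (trans (cong (fromℕ m *_) (trans (*-comm (1/suc n) (fromℕ (suc n))) (suc*1/suc n))) (*-identityʳ (fromℕ m))))

  /-complement : ∀ m m′ n .{{_ : ℕ.NonZero n}} → m ℕ.+ m′ ≡ n → + m / n + + m′ / n ≡ 1ℚ
  /-complement m m′ n@(suc n-1) eq = *-cancelʳ-≡ (trans (*-distribʳ-+ (fromℕ n) (+ m / n) (+ m′ / n))
      (trans (cong₂ _+_ (/-* m n) (/-* m′ n)) (trans (sym (fromℕ-+ m m′)) (trans (cong fromℕ eq) (sym (*-identityˡ (fromℕ n)))))))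
    where
    *-cancelʳ-≡ : ∀ {p q} → p * fromℕ n ≡ q * fromℕ n → p ≡ q
    *-cancelʳ-≡ {p} {q} eq = ≤-antisym (*-cancelʳ-≤-pos (fromℕ n) {{positive (0<frac n-1 0)}} (≤-reflexive eq))
      (*-cancelʳ-≤-pos (fromℕ n) {{positive (0<frac n-1 0)}} (≤-reflexive (sym eq)))

  probability : ∀ b → (Vec Bool b → Bool) → ℚ
  probability b E = _/_ (+ countWords b E) (2 ℕ.^ b) {{ℕ.m^n≢0 2 b}}

  density-bound : ∀ b E δ → 0ʳ <ʳ δ → ∀ p → (∀ k → approx p k ≡ probability b E) → ∀ k → p -ʳ δ ≤ʳ density (cylinder b E) k
  density-bound b E δ (δ₀ , 0<δ₀ , N , h) p p≡ k η 0<η = N , λ m N≤m → begin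
    approx p m - approx δ m                          ≤⟨ p≤q+r⇒p-q≤r {approx p m} {approx δ m} {approx p m} (subst (approx p m ≤_) (+-comm (approx p m) (approx δ m))
                                                          (p≤p+q (approx p m) (≤-trans (<⇒≤ 0<δ₀) (subst (_≤ approx δ m) (+-identityˡ δ₀) (h m N≤m))))) ⟩
    approx p m                                       ≡⟨ p≡ m ⟩
    probability b E                                  ≤⟨ /-mono (countWords b E) (count (cylinder b E) k) (2 ℕ.^ b) (2 ℕ.^ k) {{ℕ.m^n≢0 2 b}} {{ℕ.m^n≢0 2 k}} (count-cylinder b E k) ⟩
    D                                                ≤⟨ p≤p+q D (<⇒≤ 0<η) ⟩
    D + η                                            ∎
    where
    open ≤-Reasoning
    D : ℚ
    D = _/_ (+ count (cylinder b E) k) (2 ℕ.^ k) {{ℕ.m^n≢0 2 k}}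

  -- The event and its complement are both closed, so each is its own approximation from within.
  hasProbability : ∀ b E {P : Coins → Set} → (∀ r → E (prefix b r) ≡ true → P r) → (∀ r → E (prefix b r) ≡ false → ¬ P r) →
    HasProbability P (fromℚ (probability b E))
  hasProbability b E {P} holds fails δ 0<δ = cylinder b E , cylinder b (not ∘ E) ,
    (λ r closed → holds r (trans (sym (cylinder-prefix b E r)) (closed b))) ,
    (λ r closed → fails r (not-true (trans (sym (cylinder-prefix b (not ∘ E) r)) (closed b)))) ,
    density-bound b E δ 0<δ (fromℚ (probability b E)) (λ _ → refl) ,
    density-bound b (not ∘ E) δ 0<δ (1ʳ -ʳ fromℚ (probability b E)) (λ _ → complement)
    where
    not-true : ∀ {x} → not x ≡ true → x ≡ false
    not-true {false} _ = refl
    complement : 1ℚ - probability b E ≡ probability b (not ∘ E)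
    complement = trans (cong (_- probability b E) (sym (/-complement (countWords b E) (countWords b (not ∘ E)) (2 ℕ.^ b) {{ℕ.m^n≢0 2 b}} (countWords-complement b E))))
      (solve 2 (λ p q → (p :+ q) :- p := q) refl (probability b E) (probability b (not ∘ E)))
      where open +-*-Solver

  split3 : ℕ → ℕ × Fin 3
  split3 0 = 0 , zero
  split3 1 = 0 , suc zero
  split3 2 = 0 , suc (suc zero)
  split3 (suc (suc (suc i))) = map₁ suc (split3 i)

  pointOf : ∀ n → ℕ → Point n
  pointOf zero    _ = []
  pointOf (suc n) i = proj₂ (split3 i) ∷ pointOf n (proj₁ (split3 i))

  ∑< : ℕ → (ℕ → ℕ) → ℕ
  ∑< zero    F = 0
  ∑< (suc L) F = F 0 ℕ.+ ∑< L (F ∘ suc)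

  ∑<-cong : ∀ L {F G} → (∀ i → F i ≡ G i) → ∑< L F ≡ ∑< L G
  ∑<-cong zero    eq = refl
  ∑<-cong (suc L) eq = cong₂ ℕ._+_ (eq 0) (∑<-cong L (eq ∘ suc))

  ∑<-mono : ∀ {L L′} F → L ℕ.≤ L′ → ∑< L F ℕ.≤ ∑< L′ F
  ∑<-mono F z≤n     = z≤n
  ∑<-mono F (s≤s p) = ℕ.+-monoʳ-≤ (F 0) (∑<-mono (F ∘ suc) p)

  ∑<-+ : ∀ L L′ F → ∑< (L ℕ.+ L′) F ≡ ∑< L F ℕ.+ ∑< L′ (λ i → F (L ℕ.+ i))
  ∑<-+ zero    L′ F = refl
  ∑<-+ (suc L) L′ F = trans (cong (F 0 ℕ.+_) (∑<-+ L L′ (F ∘ suc))) (sym (ℕ.+-assoc (F 0) _ _))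

  ∑<-split3 : ∀ L (F : ℕ × Fin 3 → ℕ) → ∑< (L ℕ.* 3) (F ∘ split3) ≡ ∑< L (λ j → F (j , zero) ℕ.+ F (j , suc zero) ℕ.+ F (j , suc (suc zero)))
  ∑<-split3 zero    F = refl
  ∑<-split3 (suc L) F = trans (cong (λ s → F (0 , zero) ℕ.+ (F (0 , suc zero) ℕ.+ (F (0 , suc (suc zero)) ℕ.+ s))) (∑<-split3 L (F ∘ map₁ suc)))
    (solveℕ 4 (λ a b c s → a :+ⁿ (b :+ⁿ (c :+ⁿ s)) :=ⁿ (a :+ⁿ b :+ⁿ c) :+ⁿ s) refl (F (0 , zero)) (F (0 , suc zero)) (F (0 , suc (suc zero))) _)

  -- m * 3ⁿ, bracketed so that each base 3 digit takes off one factor 3.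
  blocks : ℕ → ℕ → ℕ
  blocks zero    m = m
  blocks (suc n) m = blocks n m ℕ.* 3

  blocks≡ : ∀ n m → blocks n m ≡ m ℕ.* 3 ℕ.^ n
  blocks≡ zero    m = sym (ℕ.*-identityʳ m)
  blocks≡ (suc n) m = trans (cong (ℕ._* 3) (blocks≡ n m)) (solveℕ 2 (λ m a → m :*ⁿ a :*ⁿ conⁿ 3 :=ⁿ m :*ⁿ (conⁿ 3 :*ⁿ a)) refl m (3 ℕ.^ n))

  ∑<-const : ∀ L c → ∑< L (λ _ → c) ≡ L ℕ.* c
  ∑<-const zero    c = refl
  ∑<-const (suc L) c = cong (c ℕ.+_) (∑<-const L c)

  ∑<-points : ∀ n m (F : Point n → ℕ) → ∑< (blocks n m) (F ∘ pointOf n) ≡ m ℕ.* sumPoints n F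
  ∑<-points zero    m F = ∑<-const m (F [])
  ∑<-points (suc n) m F = trans (∑<-split3 (blocks n m) (λ (j , r) → F (r ∷ pointOf n j)))
    (∑<-points n m (λ z → F (zero ∷ z) ℕ.+ F (suc zero ∷ z) ℕ.+ F (suc (suc zero) ∷ z)))

  value : ∀ {b} → Vec Bool b → ℕ
  value []                  = 0
  value (false ∷ w)         = value w
  value {suc b} (true ∷ w)  = 2 ℕ.^ b ℕ.+ value w

  ∑ℕ-value : ∀ b F → ∑ℕ b (F ∘ value) ≡ ∑< (2 ℕ.^ b) F
  ∑ℕ-value zero    F = sym (ℕ.+-identityʳ (F 0))
  ∑ℕ-value (suc b) F = trans (cong₂ ℕ._+_ (∑ℕ-value b F) (∑ℕ-value b (λ i → F (2 ℕ.^ b ℕ.+ i))))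
    (trans (sym (∑<-+ (2 ℕ.^ b) (2 ℕ.^ b) F)) (cong (λ L → ∑< L F) (sym (2^suc b))))

  coinCount : ℕ → ℕ
  coinCount n = 2 ℕ.* n

  3^≤2^ : ∀ n → 3 ℕ.^ n ℕ.≤ 2 ℕ.^ coinCount n
  3^≤2^ n = subst (3 ℕ.^ n ℕ.≤_) (ℕ.^-*-assoc 2 2 n) (ℕ.^-monoˡ-≤ n (s≤s (s≤s (s≤s z≤n))))

  -- The base 3 digits of a random number of 2 n bits are within a factor 2 of uniform.
  samplePoint : ∀ n → Vec Bool (coinCount n) → Point n
  samplePoint n w = pointOf n (value w)

  -- The words of b = 2 n bits fit into m = q + 1 periods of length 3ⁿ, where q is the quotient of
  -- 2^b by 3ⁿ. Since 3ⁿ ≤ 2^b, m 3ⁿ is at most twice 2^b, and a sixth of the points becomes at most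
  -- a third of the words.
  sample-bound : ∀ n (S : Point n → Bool) → 6 ℕ.* countPoints n S ℕ.≤ 3 ℕ.^ n →
    3 ℕ.* countWords (coinCount n) (S ∘ samplePoint n) ℕ.≤ 2 ℕ.^ coinCount n
  sample-bound n S le = ℕ.*-cancelˡ-≤ 2 (begin
    2 ℕ.* (3 ℕ.* countWords b (S ∘ samplePoint n))
      ≡⟨ cong (λ x → 2 ℕ.* (3 ℕ.* x)) (∑ℕ-value b (indicator ∘ S ∘ pointOf n)) ⟩
    2 ℕ.* (3 ℕ.* ∑< (2 ℕ.^ b) (indicator ∘ S ∘ pointOf n))
      ≤⟨ ℕ.*-monoʳ-≤ 2 (ℕ.*-monoʳ-≤ 3 (∑<-mono (indicator ∘ S ∘ pointOf n) covers)) ⟩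
    2 ℕ.* (3 ℕ.* ∑< (blocks n m) (indicator ∘ S ∘ pointOf n))
      ≡⟨ cong (λ x → 2 ℕ.* (3 ℕ.* x)) (∑<-points n m (indicator ∘ S)) ⟩
    2 ℕ.* (3 ℕ.* (m ℕ.* countPoints n S))
      ≡⟨ solveℕ 2 (λ m c → conⁿ 2 :*ⁿ (conⁿ 3 :*ⁿ (m :*ⁿ c)) :=ⁿ m :*ⁿ (conⁿ 6 :*ⁿ c)) refl m (countPoints n S) ⟩
    m ℕ.* (6 ℕ.* countPoints n S)
      ≤⟨ ℕ.*-monoʳ-≤ m le ⟩
    m ℕ.* 3 ℕ.^ n
      ≤⟨ ℕ.+-mono-≤ (3^≤2^ n) (subst (q ℕ.* 3 ℕ.^ n ℕ.≤_) (sym division) (ℕ.m≤n+m _ _)) ⟩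
    2 ℕ.^ b ℕ.+ 2 ℕ.^ b
      ≡⟨ sym (2^suc b) ⟩
    2 ℕ.* 2 ℕ.^ b ∎)
    where
    open ℕ.≤-Reasoning
    instance
      3^≢0 : ℕ.NonZero (3 ℕ.^ n)
      3^≢0 = ℕ.m^n≢0 3 n
    b q m : ℕ
    b = coinCount n
    q = 2 ℕ.^ b ℕ./ 3 ℕ.^ n
    m = suc q
    division : 2 ℕ.^ b ≡ 2 ℕ.^ b ℕ.% 3 ℕ.^ n ℕ.+ q ℕ.* 3 ℕ.^ n
    division = m≡m%n+[m/n]*n (2 ℕ.^ b) (3 ℕ.^ n)
    covers : 2 ℕ.^ b ℕ.≤ blocks n m
    covers = subst₂ ℕ._≤_ (sym division) (sym (blocks≡ n m)) (ℕ.+-monoˡ-≤ (q ℕ.* 3 ℕ.^ n) (ℕ.<⇒≤ (m%n<n (2 ℕ.^ b) (3 ℕ.^ n))))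

-- Jets as bit vectors, the matrix with its protocol, and the choice of parameters.

open import Defs
open FieldOfFour
open PowerSeriesRing
open Tower using (Point)
open Subspaces using (_⊕_; 𝟎; 𝟎-++)
open EvaluationCodes
open BooleanSums using (⟨_,_⟩; Biadditive; nondegenerate; pow2; take-++; drop-++; module Power)
open Lindsey using (isZero; digits)
open FactorizationBound using (eventually-×; eventually-map; factorization-bound)
open RealPowers
open Protocols
open import Data.Integer.Base as ℤ using (+_)
open import Data.Nat.Base using (NonZero; _<_)
open import Data.Nat.Solver using () renaming (module +-*-Solver to ℕ-Solver)
open import Data.Rational.Base using (ℚ; ½; _-_; ↥_; ↧_) renaming (_≤_ to _≤ℚ_; _+_ to _+ℚ_)
import Data.Rational.Properties as ℚ
open import Data.Vec.Base using (_++_; take; drop)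
open ≡ using (refl; sym; trans)

open ℕ-Solver using (solve; _:+_; _:*_; _:=_; con)

isZero⇒𝟎 : ∀ {a} (v : Vec Bool a) → isZero v ≡ true → v ≡ 𝟎
isZero⇒𝟎 []          _  = refl
isZero⇒𝟎 (false ∷ v) eq = cong (false ∷_) (isZero⇒𝟎 v eq)

isZero-𝟎 : ∀ a → isZero (𝟎 {a}) ≡ true
isZero-𝟎 zero    = refl
isZero-𝟎 (suc a) = isZero-𝟎 a

encode : ∀ a → PowerSeries → Vec Bool (a ℕ.* 2)
encode zero    f = []
encode (suc a) f = lo (f 0) ∷ hi (f 0) ∷ encode a (f ∘ suc)

decode : ∀ a → Vec Bool (a ℕ.* 2) → PowerSeries
decode zero    _           _       = 0₄
decode (suc a) (x ∷ y ∷ v) zero    = fromBits x y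
decode (suc a) (x ∷ y ∷ v) (suc n) = decode a v n

decode-encode : ∀ a f i → i ℕ.< a → decode a (encode a f) i ≡ f i
decode-encode (suc a) f zero    _         = fromBits-lo-hi (f 0)
decode-encode (suc a) f (suc i) (s≤s i<a) = decode-encode a (f ∘ suc) i i<a

encode-cong : ∀ a {f g} → f ≈ₚ g → encode a f ≡ encode a g
encode-cong zero    eq = refl
encode-cong (suc a) eq = cong₂ _∷_ (cong lo (eq 0)) (cong₂ _∷_ (cong hi (eq 0)) (encode-cong a (eq ∘ suc)))

encode-pointwise : ∀ a f g → encode a (λ n → f n +₄ g n) ≡ encode a f ⊕ encode a g
encode-pointwise zero    f g = refl
encode-pointwise (suc a) f g = cong₂ _∷_ (lo-+ (f 0) (g 0)) (cong₂ _∷_ (hi-+ (f 0) (g 0)) (encode-pointwise a (f ∘ suc) (g ∘ suc)))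

encode-+ : ∀ a f g → encode a (f +ₚ g) ≡ encode a f ⊕ encode a g
encode-+ a f g = trans (encode-cong a (+ₚ-at f g)) (encode-pointwise a f g)

encode-zero : ∀ a f → Div a f → encode a f ≡ 𝟎
encode-zero zero    f d = refl
encode-zero (suc a) f d = cong₂ _∷_ (cong lo (d 0 (s≤s z≤n))) (cong₂ _∷_ (cong hi (d 0 (s≤s z≤n))) (encode-zero a (f ∘ suc) (λ i i<a → d (suc i) (s≤s i<a))))

encode-zero⇒Div : ∀ a f → encode a f ≡ 𝟎 → Div a f
encode-zero⇒Div (suc a) f eq zero    _         = lo-hi-injective (Vec.∷-injectiveˡ eq) (Vec.∷-injectiveˡ (Vec.∷-injectiveʳ eq))
encode-zero⇒Div (suc a) f eq (suc i) (s≤s i<a) = encode-zero⇒Div a (f ∘ suc) (Vec.∷-injectiveʳ (Vec.∷-injectiveʳ eq)) i i<a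

div?-local : ∀ a {f g} → (∀ i → i ℕ.< a → f i ≡ g i) → div? a f ≡ div? a g
div?-local zero    eq = refl
div?-local (suc a) eq = cong₂ (λ x y → does (x ≟₄ 0₄) ∧ y) (eq a (ℕ.n<1+n a)) (div?-local a λ i i<a → eq i (ℕ.m≤n⇒m≤1+n i<a))

flatSize : ℕ → ℕ → ℕ
flatSize zero    c = c
flatSize (suc n) c = flatSize n (c ℕ.+ (c ℕ.+ c))

flatSize≡ : ∀ n c → flatSize n c ≡ 3 ℕ.^ n ℕ.* c
flatSize≡ zero    c = sym (ℕ.+-identityʳ c)
flatSize≡ (suc n) c = trans (flatSize≡ n (c ℕ.+ (c ℕ.+ c))) (solve 2 (λ a c → a :* (c :+ (c :+ c)) := con 3 :* a :* c) refl (3 ℕ.^ n) c)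

flat : ∀ n {c} → (Point n → Vec Bool c) → Vec Bool (flatSize n c)
flat zero    φ = φ []
flat (suc n) φ = flat n λ z → φ (zero ∷ z) ++ (φ (suc zero ∷ z) ++ φ (suc (suc zero) ∷ z))

flat-cong : ∀ n {c} {φ ψ : Point n → Vec Bool c} → (∀ z → φ z ≡ ψ z) → flat n φ ≡ flat n ψ
flat-cong zero    eq = eq []
flat-cong (suc n) eq = flat-cong n λ z → cong₂ _++_ (eq _) (cong₂ _++_ (eq _) (eq _))

++-⊕ : ∀ {a b} (u u′ : Vec Bool a) (v v′ : Vec Bool b) → (u ++ v) ⊕ (u′ ++ v′) ≡ (u ⊕ u′) ++ (v ⊕ v′)
++-⊕ []      []        v v′ = refl
++-⊕ (x ∷ u) (y ∷ u′) v v′ = cong (_ ∷_) (++-⊕ u u′ v v′)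

++³-⊕ : ∀ {c} (u v w u′ v′ w′ : Vec Bool c) → (u ++ (v ++ w)) ⊕ (u′ ++ (v′ ++ w′)) ≡ (u ⊕ u′) ++ ((v ⊕ v′) ++ (w ⊕ w′))
++³-⊕ u v w u′ v′ w′ = trans (++-⊕ u u′ (v ++ w) (v′ ++ w′)) (cong ((u ⊕ u′) ++_) (++-⊕ v v′ w w′))

triple : ∀ {n c} → (Point (suc n) → Vec Bool c) → Point n → Vec Bool (c ℕ.+ (c ℕ.+ c))
triple φ z = φ (zero ∷ z) ++ (φ (suc zero ∷ z) ++ φ (suc (suc zero) ∷ z))

flat-⊕ : ∀ n {c} (φ ψ : Point n → Vec Bool c) → flat n (λ z → φ z ⊕ ψ z) ≡ flat n φ ⊕ flat n ψ
flat-⊕ zero    φ ψ = refl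
flat-⊕ (suc n) φ ψ = trans (flat-cong n λ z → sym (++³-⊕ (φ (zero ∷ z)) (φ (suc zero ∷ z)) (φ (suc (suc zero) ∷ z))
  (ψ (zero ∷ z)) (ψ (suc zero ∷ z)) (ψ (suc (suc zero) ∷ z)))) (flat-⊕ n (triple φ) (triple ψ))

flat-𝟎 : ∀ n {c} → flat n (λ _ → 𝟎 {c}) ≡ 𝟎
flat-𝟎 zero        = refl
flat-𝟎 (suc n) {c} = trans (flat-cong n λ _ → trans (cong (𝟎 {c} ++_) (𝟎-++ c)) (𝟎-++ c)) (flat-𝟎 n)

++-𝟎 : ∀ {a b} (u : Vec Bool a) (v : Vec Bool b) → u ++ v ≡ 𝟎 → u ≡ 𝟎 × v ≡ 𝟎
++-𝟎 []      v eq = refl , eq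
++-𝟎 (x ∷ u) v eq = let (p , q) = ++-𝟎 u v (Vec.∷-injectiveʳ eq) in cong₂ _∷_ (Vec.∷-injectiveˡ eq) p , q

flat-zero : ∀ n {c} (φ : Point n → Vec Bool c) → flat n φ ≡ 𝟎 → ∀ z → φ z ≡ 𝟎
flat-zero zero    φ eq []      = eq
flat-zero (suc n) φ eq (ζ ∷ z) = pick ζ
  where
  at : φ (zero ∷ z) ≡ 𝟎 × φ (suc zero ∷ z) ++ φ (suc (suc zero) ∷ z) ≡ 𝟎
  at = ++-𝟎 (φ (zero ∷ z)) (φ (suc zero ∷ z) ++ φ (suc (suc zero) ∷ z)) (flat-zero n (triple φ) eq z)
  pick : ∀ ζ → φ (ζ ∷ z) ≡ 𝟎
  pick zero             = proj₁ at
  pick (suc zero)       = proj₁ (++-𝟎 (φ (suc zero ∷ z)) (φ (suc (suc zero) ∷ z)) (proj₂ at))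
  pick (suc (suc zero)) = proj₂ (++-𝟎 (φ (suc zero ∷ z)) (φ (suc (suc zero) ∷ z)) (proj₂ at))

module Construction (n d : ℕ) where
  k : ℕ
  k = 2 ℕ.* 3 ℕ.^ n

  code : EvaluationCode n k
  code = evaluationCode n
  open EvaluationCode code

  jetSize : ℕ
  jetSize = precision ℕ.* 2

  K : ℕ
  K = flatSize n jetSize

  -- The product of two functions, recorded by its jets at all split points. These are 48 * 3ⁿ bits
  -- whatever d is, while the indices of the matrix have 2 d 3ⁿ bits.
  μ : Vec Bool k → Vec Bool k → Vec Bool K
  μ x y = flat n λ z → encode precision (ev x z *ₚ ev y z)

  private
    module P = F₄-Algebra PS

  μ-biadditive : Biadditive μ
  μ-biadditive = record
    { additiveˡ = λ x x′ y → trans (flat-cong n λ z → trans (encode-cong precision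
          (P.trans {ev (x ⊕ x′) z *ₚ ev y z} {(ev x z +ₚ ev x′ z) *ₚ ev y z} (*ₚ-cong {g = ev y z} (ev-⊕ x x′ z) (λ _ → refl)) (*ₚ-distribʳ (ev y z) (ev x z) (ev x′ z))))
        (encode-+ precision (ev x z *ₚ ev y z) (ev x′ z *ₚ ev y z))) (flat-⊕ n _ _)
    ; additiveʳ = λ x y y′ → trans (flat-cong n λ z → trans (encode-cong precision
          (P.trans {ev x z *ₚ ev (y ⊕ y′) z} {ev x z *ₚ (ev y z +ₚ ev y′ z)} (*ₚ-cong {ev x z} (λ _ → refl) (ev-⊕ y y′ z)) (P.distribˡ (ev x z) (ev y z) (ev y′ z))))
        (encode-+ precision (ev x z *ₚ ev y z) (ev x z *ₚ ev y′ z))) (flat-⊕ n _ _)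
    }

  μ-integral : ∀ x y → μ x y ≡ 𝟎 → x ≡ 𝟎 ⊎ y ≡ 𝟎
  μ-integral x y eq = integral x y λ z → encode-zero⇒Div precision (ev x z *ₚ ev y z) (flat-zero n _ eq z)

  open Power μ μ-biadditive

  a : ℕ
  a = d ℕ.* k

  ν : Vec Bool a → Vec Bool a → Vec Bool K
  ν = μ^ d

  chunks : ∀ d → Vec Bool (d ℕ.* k) → Vec (Vec Bool k) d
  chunks zero    u = []
  chunks (suc d) u = take k u ∷ chunks d (drop k u)

  power-flat : ∀ d u v → μ^ d u v ≡ flat n (λ z → encode precision (inner ev (chunks d u) (chunks d v) z))
  power-flat zero    u v = trans (sym (flat-𝟎 n)) (flat-cong n λ z → sym (encode-zero precision (λ _ → 0₄) (λ _ _ → refl)))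
  power-flat (suc d) u v = trans (cong (μ (take k u) (take k v) ⊕_) (power-flat d (drop k u) (drop k v)))
    (trans (sym (flat-⊕ n _ _)) (flat-cong n λ z → sym (encode-+ precision (ev (take k u) z *ₚ ev (take k v) z) _)))

  message : ∀ d → Point n → Vec Bool (d ℕ.* k) → Vec Bool (d ℕ.* jetSize)
  message zero    z u = []
  message (suc d) z u = encode precision (ev (take k u) z) ++ message d z (drop k u)

  answer : ∀ d → Point n → Vec Bool (d ℕ.* jetSize) → Vec Bool (d ℕ.* k) → PowerSeries
  answer zero    z m v = λ _ → 0₄
  answer (suc d) z m v = decode precision (take jetSize m) *ₚ ev (take k v) z +ₚ answer d z (drop jetSize m) (drop k v)

  -- Coefficient i of a product depends only on coefficients up to i of the factors, so Bob may
  -- multiply the jets he receives, padded with zeros, by his full expansions.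
  answer-correct : ∀ d z u v i → i ℕ.< precision → answer d z (message d z u) v i ≡ inner ev (chunks d u) (chunks d v) z i
  answer-correct zero    z u v i _   = refl
  answer-correct (suc d) z u v i i<e = trans (+ₚ-at (decode precision (take jetSize (message (suc d) z u)) *ₚ ev (take k v) z) _ i) (trans (cong₂ _+₄_
      (trans (cong (λ m → (decode precision m *ₚ ev (take k v) z) i) (take-++ jetSize (encode precision (ev (take k u) z)) (message d z (drop k u))))
        (*ₚ-causal i {g = ev (take k v) z} (λ j j≤i → decode-encode precision (ev (take k u) z) j (ℕ.≤-<-trans j≤i i<e)) (λ _ _ → refl)))
      (trans (cong (λ m → answer d z m (drop k v) i) (drop-++ jetSize (encode precision (ev (take k u) z)) (message d z (drop k u))))
        (answer-correct d z (drop k u) (drop k v) i i<e)))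
    (sym (+ₚ-at (ev (take k u) z *ₚ ev (take k v) z) (inner ev (chunks d (drop k u)) (chunks d (drop k v)) z) i)))

  accept : Vec Bool a → Vec Bool a → Point n → Bool
  accept u v z = div? precision (inner ev (chunks d u) (chunks d v) z)

  matrix : Matrix Bool (2 ℕ.^ a) (2 ℕ.^ a)
  matrix i j = isZero (ν (digits a i) (digits a j))

  accept-zero : ∀ u v → isZero (ν u v) ≡ true → ∀ z → accept u v z ≡ true
  accept-zero u v eq z = Div⇒div? precision _ (encode-zero⇒Div precision _
    (flat-zero n _ (trans (sym (power-flat d u v)) (isZero⇒𝟎 (ν u v) eq)) z))

  -- By contraposition: a sum of products with vanishing jets at more than a sixth of the points
  -- vanishes at all of them, and then the entry would be 1.
  accept-few : ∀ u v → isZero (ν u v) ≡ false → 6 ℕ.* countPoints n (accept u v) ℕ.≤ 3 ℕ.^ n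
  accept-few u v eq = ℕ.≮⇒≥ λ big → contradiction (trans (sym eq) (trans (cong isZero (trans (power-flat d u v)
    (trans (flat-cong n λ z → encode-zero precision _ (λ i _ → gap (chunks d u) (chunks d v) big z i)) (flat-𝟎 n)))) (isZero-𝟎 K))) λ ()

  b : ℕ
  b = coinCount n

  protocol : Coins → Protocol (Fin (2 ℕ.^ a)) (Fin (2 ℕ.^ a))
  protocol r = reply (λ i → message d z (digits a i)) (λ m j → div? precision (answer d z m (digits a j)))
    where
    z : Point n
    z = samplePoint n (prefix b r)

  run-protocol : ∀ r i j → run (protocol r) i j ≡ accept (digits a i) (digits a j) (samplePoint n (prefix b r))
  run-protocol r i j = trans (run-reply (λ i → message d z (digits a i)) (λ m j → div? precision (answer d z m (digits a j))) i j)
    (div?-local precision (answer-correct d z (digits a i) (digits a j)))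
    where
    z : Point n
    z = samplePoint n (prefix b r)

  module _ (i j : Fin (2 ℕ.^ a)) where
    private
      S : Point n → Bool
      S = accept (digits a i) (digits a j)

    correct : Vec Bool b → Bool
    correct w = not (S (samplePoint n w) xor matrix i j)

    -- The error is one-sided: a one of the matrix is always accepted, a zero with probability at
    -- most 1/3.
    correct-count : 2 ℕ.* 2 ℕ.^ b ℕ.≤ countWords b correct ℕ.* 3
    correct-count with matrix i j in eq
    ... | true  = subst (2 ℕ.* 2 ℕ.^ b ℕ.≤_) (cong (ℕ._* 3) (sym all)) (subst (2 ℕ.* 2 ℕ.^ b ℕ.≤_) (ℕ.*-comm 3 (2 ℕ.^ b)) (ℕ.*-monoˡ-≤ (2 ℕ.^ b) (s≤s (s≤s (z≤n {1})))))
      where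
      ∑ℕ-one : ∀ b → ∑ℕ b (λ _ → 1) ≡ 2 ℕ.^ b
      ∑ℕ-one zero    = refl
      ∑ℕ-one (suc b) = trans (cong₂ ℕ._+_ (∑ℕ-one b) (∑ℕ-one b)) (sym (2^suc b))
      all : countWords b (λ w → not (S (samplePoint n w) xor true)) ≡ 2 ℕ.^ b
      all = trans (∑ℕ-cong b λ w → cong (λ x → indicator (not (x xor true))) (accept-zero (digits a i) (digits a j) eq (samplePoint n w))) (∑ℕ-one b)
    ... | false = ℕ.+-cancelʳ-≤ (3 ℕ.* A) (2 ℕ.* 2 ℕ.^ b) (C ℕ.* 3) (begin
      2 ℕ.* 2 ℕ.^ b ℕ.+ 3 ℕ.* A        ≤⟨ ℕ.+-monoʳ-≤ (2 ℕ.* 2 ℕ.^ b) (sample-bound n S (accept-few (digits a i) (digits a j) eq)) ⟩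
      2 ℕ.* 2 ℕ.^ b ℕ.+ 2 ℕ.^ b        ≡⟨ solve 1 (λ x → con 2 :* x :+ x := con 3 :* x) refl (2 ℕ.^ b) ⟩
      3 ℕ.* 2 ℕ.^ b                    ≡⟨ cong (3 ℕ.*_) (countWords-complement b (S ∘ samplePoint n)) ⟨
      3 ℕ.* (A ℕ.+ C′)                 ≡⟨ cong (λ x → 3 ℕ.* (A ℕ.+ x)) (∑ℕ-cong b λ w → cong (λ x → indicator (not x)) (sym (Bool.xor-identityʳ (S (samplePoint n w))))) ⟩
      3 ℕ.* (A ℕ.+ C)                  ≡⟨ solve 2 (λ a c → con 3 :* (a :+ c) := c :* con 3 :+ con 3 :* a) refl A C ⟩
      C ℕ.* 3 ℕ.+ 3 ℕ.* A              ∎)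
      where
      open ℕ.≤-Reasoning
      A C C′ : ℕ
      A = countWords b (S ∘ samplePoint n)
      C = countWords b (λ w → not (S (samplePoint n w) xor false))
      C′ = countWords b (not ∘ S ∘ samplePoint n)

    correct-event : ∀ r → correct (prefix b r) ≡ true → run (protocol r) i j ≡ matrix i j
    correct-event r eq = trans (run-protocol r i j) (agree (S (samplePoint n (prefix b r))) (matrix i j) eq)
      where
      agree : ∀ x y → not (x xor y) ≡ true → x ≡ y
      agree true  true  _ = refl
      agree false false _ = refl

    incorrect-event : ∀ r → correct (prefix b r) ≡ false → ¬ run (protocol r) i j ≡ matrix i j
    incorrect-event r eq agree = differ (S (samplePoint n (prefix b r))) (matrix i j) eq (trans (sym (run-protocol r i j)) agree)
      where
      differ : ∀ x y → not (x xor y) ≡ false → ¬ x ≡ y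
      differ true  true  () _
      differ false false () _

  cost : R matrix ≤ᴿ (d ℕ.* jetSize ℕ.+ 1)
  cost = protocol ,
    (λ r i j → ℕ.≤-reflexive (bits-reply (λ i → message d (samplePoint n (prefix b r)) (digits a i))
      (λ m j → div? precision (answer d (samplePoint n (prefix b r)) m (digits a j))) i j)) ,
    λ i j → fromℚ (probability b (correct i j)) ,
      (λ δ 0<δ → 0 , λ _ _ → ℚ.≤-trans (/-mono 2 (countWords b (correct i j)) 3 (2 ℕ.^ b) {{_}} {{ℕ.m^n≢0 2 b}} (correct-count i j))
        (p≤p+q (probability b (correct i j)) (ℚ.<⇒≤ 0<δ))) ,
      hasProbability b (correct i j) (correct-event i j) (incorrect-event i j)

  ν-biadditive : Biadditive ν
  ν-biadditive = biadditive d

  ν-nondegenerate : ∃ λ w → ∀ u → (∀ v → ⟨ w , ν u v ⟩ ≡ false) → u ≡ 𝟎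
  ν-nondegenerate = let (w , nd) = nondegenerate μ-biadditive μ-integral in w , power-nondegenerate w nd d

n<2^n : ∀ n → n ℕ.< 2 ℕ.^ n
n<2^n zero    = s≤s z≤n
n<2^n (suc n) = subst (suc (suc n) ℕ.≤_) (sym (2^suc n)) (ℕ.+-mono-≤ (ℕ.m^n>0 2 n) (n<2^n n))

corollary6p2 : ∀ (ε : ℝ) → 0ʳ <ʳ ε →
    ∃ λ (C : ℕ) →
    ∀ (N : ℕ) →
    ∃ λ (n : ℕ) → Σ (NonZero n) λ n≢0 → N < n ×
    ∃ λ (M : Matrix Bool n n) →
    R M ≤ᴿ C  ×  (_^ʳ_ n {{n≢0}} (fromℚ ½ -ʳ ε)) ≤γ₂ toℂ M
corollary6p2 ε (ε₀ , 0<ε₀ , N₀ , above) = d ℕ.* (precision ℕ.* 2) ℕ.+ 1 , λ N →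
  -- N is also the floor of the tower that is used; the cost involves d alone and thus depends only
  -- on ε.
  2 ℕ.^ size N , ℕ.m^n≢0 2 (size N) , large N , Construction.matrix N d , Construction.cost N d , lower N
  where
  D d : ℕ
  -- Here ε₀ > 0 is a rational lower bound for almost all approximations of ε, and 1 / (D + 1) ≤ ε₀.
  D = proj₁ (eventually-1/≤ 0<ε₀)
  -- A jet has 48 bits. With K = 48 * 3^N an index has 2 (D + 1) K bits, so the division of √n by
  -- 2^K costs 1 / (2 (D + 1)) in the exponent.
  d = 48 ℕ.* suc D

  small : 1/suc D ≤ℚ ε₀
  small = proj₂ (eventually-1/≤ 0<ε₀) D ℕ.≤-refl

  size scale : ℕ → ℕ
  size N = d ℕ.* (2 ℕ.* 3 ℕ.^ N)
  scale N = 48 ℕ.* 3 ℕ.^ N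

  large : ∀ N → N < 2 ℕ.^ size N
  large N = ℕ.<-≤-trans (n<2^n N) (ℕ.^-monoʳ-≤ 2 (begin
    N                         ≤⟨ ℕ.<⇒≤ (n<2^n N) ⟩
    2 ℕ.^ N                   ≤⟨ ℕ.^-monoˡ-≤ N (s≤s (s≤s z≤n)) ⟩
    3 ℕ.^ N                   ≤⟨ ℕ.m≤m+n _ _ ⟩
    2 ℕ.* 3 ℕ.^ N             ≤⟨ ℕ.m≤m+n _ _ ⟩
    size N                    ∎))
    where open ℕ.≤-Reasoning

  size≡ : ∀ N → size N ≡ (suc D ℕ.+ suc D) ℕ.* scale N
  size≡ N = solve 2 (λ D a → con 48 :* D :* (con 2 :* a) := (D :+ D) :* (con 48 :* a)) refl (suc D) (3 ℕ.^ N)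

  exponent-bound : ∀ k → N₀ ℕ.≤ k → ½ - approx ε k ≤ℚ frac D (suc (D ℕ.+ D))
  exponent-bound k N₀≤k = ℚ.≤-trans (ℚ.+-monoʳ-≤ ½ (ℚ.neg-antimono-≤ (ℚ.≤-trans small (subst (_≤ℚ approx ε k) (ℚ.+-identityˡ ε₀) (above k N₀≤k))))) (half-minus D)

  lower : ∀ N → (_^ʳ_ (2 ℕ.^ size N) {{ℕ.m^n≢0 2 (size N)}} (fromℚ ½ -ʳ ε)) ≤γ₂ toℂ (Construction.matrix N d)
  lower N m U V factors δ 0<δ = eventually-map {λ k → pow2 c ≤ℚ approx (‖ U ‖row *ʳ ‖ V ‖col) k +ℚ δ × N₀ ℕ.≤ k}
      (λ k (bound , N₀≤k) → ℚ.≤-trans (powApprox-bound (2 ℕ.^ size N) {{ℕ.m^n≢0 2 (size N)}} (size N) c (½ - approx ε k) k (fromℕ-2^ (size N))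
        (subst (λ b → ↥ (½ - approx ε k) ℤ.* + b ℤ.≤ + c ℤ.* ↧ (½ - approx ε k)) (sym (size≡ N)) (exponent D (scale N) (½ - approx ε k) (exponent-bound k N₀≤k)))) bound)
      (eventually-× (factorization-bound (size N) (suc D ℕ.* scale N) X.K c (trans (size≡ N) (ℕ.*-distribʳ-+ (scale N) (suc D) (suc D)))
        (trans (ℕ.+-comm (scale N) c) (cong (c ℕ.+_) (trans (ℕ.*-comm 48 (3 ℕ.^ N)) (trans (cong (λ e → 3 ℕ.^ N ℕ.* (e ℕ.* 2)) (sym precision≡24)) (sym (flatSize≡ N (precision ℕ.* 2)))))))
        X.ν X.ν-biadditive (proj₁ X.ν-nondegenerate) (proj₂ X.ν-nondegenerate) U V factors δ 0<δ) (N₀ , λ _ le → le))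
    where
    module X = Construction N d
    c : ℕ
    -- Half of `size N` is (D + 1) * `scale N`, and the K bits of a value of ν are `scale N`.
    c = D ℕ.* scale N
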